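{- Let $w\in S_n$ be a cograssmannian permutation with unique right ascent $s_z$, and let $A_w$, $|t|$ and $x(t)$ (for $t\in A_w$) be as defined in the context. Then, in the Hecke algebra of $S_n$, \[ C'_w = q^{ -\frac{1}{2}\ell(w)} \sum_{t\in A_w} q^{\,|t|+\frac{1}{2}\ell(x(t))}\, B'_{x(t)}. \]
   Context: $S_n$ is the Coxeter group generated by adjacent transpositions $s_1,\ldots,s_{n-1}$; $s_i$ is a right ascent of $w$ if $\ell(ws_i)>\ell(w)$ and a right descent otherwise. $w$ is cograssmannian if it has at most one right ascent; here we assume it has exactly one, $s_z$. Hecke algebra $\mathcal{H}$: the $\mathbb{Z}[q^{1/2},q^{ -1/2}]$-algebra with basis $\{T_x\}$, relations $T_sT_x=T_{sx}$ if $\ell(sx)>\ell(x)$, $T_sT_x=(q-1)T_x+qT_{sx}$ otherwise. The Kazhdan–Lusztig basis element is $C'_w=q^{ -\frac12\ell(w)}\sum_{x\le w}P_{x,w}(q)T_x$ (the unique bar-invariant element of this form with $P_{w,w}=1$ and $\deg P_{x,w}\le (\ell(w)-\ell(x)-1)/2$ for $x<w$, bar involution $\overline{q^{1/2}}=q^{ -1/2}$, $\overline{T_x}=T_{x^{ -1}}^{ -1}$), and $B'_x=q^{ -\frac12\ell(x)}\sum_{y\le x}T_y$ (Bruhat order). Construction. Let $J=\{s_1,\ldots,s_{n-1}\}\setminus\{s_z\}$, $w_0^J$ the longest element of the parabolic subgroup $W_J$, and write $w=vw_0^J$ with $v$ the minimal-length representative of $wW_J$ ($v$ has unique right descent $s_z$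 and is fully commutative). Fix the reduced word $\mathsf{w}=\mathsf{w}_1\cdots\mathsf{w}_\ell$ consisting of a reduced word for $v$ followed by $(s_1s_2\cdots s_{z-1})(s_1\cdots s_{z-2})\cdots(s_1)$ and $(s_{n-1}s_{n-2}\cdots s_{z+1})(s_{n-1}\cdots s_{z+2})\cdots(s_{n-1})$. The heap of $\mathsf{w}$ is the poset on positions $\{1,\ldots,\ell\}$ given by the transitive closure of $i\prec j$ whenever $i>j$ and $\mathsf{w}_i,\mathsf{w}_j$ do not commute; position $i$ lies in column $k$ if $\mathsf{w}_i=s_k$, and "above" means greater in this poset. The columns containing entries of (the positions of) $v$ form an interval; in each such column take the maximal $v$-entry. For each pair of consecutive such columns $k,k+1$ the two maximal entries are comparable; record "(" if the one in column $k$ is above the one in column $k+1$ and ")" otherwise, reading $k$ from left to right. Build a rooted tree $T(w)$: its non-root vertices are the matched pairs "$(\cdots)$" of this parenthesis string, one vertex a descendant of another iff its pair is enclosed by the other's, plus a root adjacent to all maximal such vertices. The leaves are the pairs of consecutive symbols "()", called valleys; the valley column is the column $k$ such that "(" is recorded between columns $k-1,k$ and ")" between $k,k+1$. The capacity of a valley is the number of entries of $v$ in its column. $A_w$ is the set of labelings of the edges of $T(w)$ by nonnegative integers that weakly increase along every path from the root to a leaf and such that the label of each edge incident to a leaf does not exceed that leaf's capacity; $|t|$ is the sum of the labels of $t$. For $t\in A_w$, start with the all-ones mask on $\mathsf{w}$; for each valley column with leaf-edge label $m$, set to $0$ the top $m$ entries of that column together with all heap entries above them; $x(t)$ is the product,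 in order, of the $\mathsf{w}_i$ whose mask value is $1$. -}

module Defs where

open import Data.Bool using (Bool; true; false; _∧_; _∨_; not; if_then_else_)
open import Data.Nat using (ℕ; zero; suc; _+_; _*_; _∸_; _<_; _≤_; _≡ᵇ_; _<ᵇ_; _≤ᵇ_)
open import Data.Integer using (ℤ; +_; -_; 0ℤ; 1ℤ) renaming (_+_ to _+ℤ_; _*_ to _*ℤ_)
import Data.Integer.Properties as ℤP
open import Data.Product using (_×_; _,_; proj₁; proj₂)
open import Data.List using (List; []; _∷_; _++_; map; foldr; foldl; concatMap; length; upTo; zip; take; reverse)
open import Data.Nat.ListAction using (sum)
open import Data.List.Relation.Binary.Permutation.Propositional using (_↭_)
open import Relation.Nullary using (does; ¬_)
open import Relation.Binary.PropositionalEquality using (_≡_)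

filterᵇ : {A : Set} → (A → Bool) → List A → List A
filterᵇ p [] = []
filterᵇ p (x ∷ xs) = if p x then x ∷ filterᵇ p xs else filterᵇ p xs

anyᵇ : {A : Set} → (A → Bool) → List A → Bool
anyᵇ p [] = false
anyᵇ p (x ∷ xs) = p x ∨ anyᵇ p xs

allᵇ : {A : Set} → (A → Bool) → List A → Bool
allᵇ p [] = true
allᵇ p (x ∷ xs) = p x ∧ allᵇ p xs

at : List ℕ → ℕ → ℕ
at [] j = 0
at (x ∷ xs) zero = x
at (x ∷ xs) (suc j) = at xs j

eqL : List ℕ → List ℕ → Bool
eqL [] [] = true
eqL (x ∷ xs) (y ∷ ys) = (x ≡ᵇ y) ∧ eqL xs ys
eqL _ _ = false

indexed : {A : Set} → List A → List (ℕ × A)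
indexed xs = zip (upTo (length xs)) xs

countᵇ : ℕ → List ℕ → ℕ
countᵇ k xs = length (filterᵇ (λ y → y ≡ᵇ k) xs)

-- Permutations of {0,…,n-1} in one-line notation  x = [x(0), …, x(n-1)].
-- Composition (u·v)(j) = u(v(j)).  The generator s_i (1 ≤ i ≤ n-1) is the
-- transposition of i-1 and i; right multiplication x·s_i swaps the
-- positions i-1,i, left multiplication s_i·x swaps the values i-1,i.

Perm : Set
Perm = List ℕ

IsPerm : ℕ → Perm → Set
IsPerm n x = x ↭ upTo n

idP : ℕ → Perm
idP n = upTo n

tr : ℕ → ℕ → ℕ → ℕ
tr a b j = if j ≡ᵇ a then b else (if j ≡ᵇ b then a else j)

compose : Perm → Perm → Perm
compose u v = map (at u) v

swapPos : ℕ → ℕ → Perm → Perm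
swapPos a b x = map (λ j → at x (tr a b j)) (upTo (length x))

rmul : Perm → ℕ → Perm
rmul x i = swapPos (i ∸ 1) i x

lmul : ℕ → Perm → Perm
lmul i x = map (tr (i ∸ 1) i) x

evalWord : ℕ → List ℕ → Perm
evalWord n ws = foldl rmul (idP n) ws

-- Coxeter length ℓ(x) = number of inversions
len : Perm → ℕ
len [] = 0
len (a ∷ as) = length (filterᵇ (λ b → b <ᵇ a) as) + len as

ReducedWordOf : ℕ → List ℕ → Perm → Set
ReducedWordOf n ws x =
  (allᵇ (λ i → (1 ≤ᵇ i) ∧ (i <ᵇ n)) ws ≡ true) × (evalWord n ws ≡ x × length ws ≡ len x)

-- Bruhat order: y ≤ x iff there is a chain y = u₀, u₁, …, u_k = x with
-- u_{j+1} = u_j t_j for transpositions t_j and ℓ(u_j) < ℓ(u_{j+1}).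
-- Computed downward from x; the fuel ℓ(x)+1 is always sufficient.

transpositions : ℕ → List (ℕ × ℕ)
transpositions m = concatMap (λ b → map (λ a → (a , b)) (upTo b)) (upTo m)

bruhatF : ℕ → Perm → Perm → Bool
bruhatF zero y x = eqL y x
bruhatF (suc f) y x =
  eqL y x ∨ anyᵇ (λ ab → let x' = swapPos (proj₁ ab) (proj₂ ab) x in
                          (len x' <ᵇ len x) ∧ bruhatF f y x')
                 (transpositions (length x))

bruhat : Perm → Perm → Bool
bruhat y x = bruhatF (suc (len x)) y x

-- Laurent polynomials in q^{1/2} with integer coefficients:
-- a list of (e , c) stands for Σ c · q^{e/2}.

LP : Set
LP = List (ℤ × ℤ)

coefL : LP → ℤ → ℤ
coefL [] e = 0ℤ
coefL ((e' , c) ∷ p) e = if does (e ℤP.≟ e') then c +ℤ coefL p e else coefL p e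

monoL : ℤ → LP
monoL e = (e , 1ℤ) ∷ []

oneL : LP
oneL = monoL 0ℤ

mulL : LP → LP → LP
mulL p r = concatMap (λ ec → map (λ ec' → (proj₁ ec +ℤ proj₁ ec' , proj₂ ec *ℤ proj₂ ec')) r) p

barL : LP → LP
barL = map (λ ec → (- proj₁ ec , proj₂ ec))

-- Hecke algebra of S_n: an element Σ_x a_x T_x is the coefficient
-- function x ↦ a_x (only permutations x matter).

Hk : Set
Hk = Perm → LP

HEq : ℕ → Hk → Hk → Set
HEq n h h' = ∀ x → IsPerm n x → ∀ e → coefL (h x) e ≡ coefL (h' x) e

addH : Hk → Hk → Hk
addH h h' x = h x ++ h' x

sumH : List Hk → Hk
sumH hs x = concatMap (λ h → h x) hs

scaleH : LP → Hk → Hk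
scaleH c h x = mulL c (h x)

Te : ℕ → Hk
Te n x = if eqL x (idP n) then oneL else []

-- left multiplication by T_{s_i}, from the defining relations
--   T_s T_y = T_{sy}                 if ℓ(sy) > ℓ(y)
--   T_s T_y = (q-1) T_y + q T_{sy}   otherwise
tmul : ℕ → Hk → Hk
tmul i h x =
  let sx = lmul i x in
  if len sx <ᵇ len x
    then h sx ++ mulL ((+ 2 , 1ℤ) ∷ (0ℤ , - 1ℤ) ∷ []) (h x)
    else mulL (monoL (+ 2)) (h sx)

-- left multiplication by T_{s_i}^{-1} = q^{-1} T_{s_i} + (q^{-1} - 1) T_e
tinv : ℕ → Hk → Hk
tinv i h = addH (scaleH (monoL (- (+ 2))) (tmul i h))
                (scaleH ((- (+ 2) , 1ℤ) ∷ (0ℤ , - 1ℤ) ∷ []) h)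

firstDescent : Perm → List ℕ
firstDescent x = take 1 (filterᵇ (λ i → at x i <ᵇ at x (i ∸ 1))
                                 (map suc (upTo (length x ∸ 1))))

redWordF : ℕ → Perm → List ℕ
redWordF zero x = []
redWordF (suc f) x with firstDescent x
... | [] = []
... | (i ∷ _) = redWordF f (rmul x i) ++ (i ∷ [])

redWord : Perm → List ℕ
redWord x = redWordF (len x) x

-- \bar{T_x} = T_{x^{-1}}^{-1} = T_{s_{a1}}^{-1} ⋯ T_{s_{ak}}^{-1}  for x = s_{a1}⋯s_{ak} reduced
barT : ℕ → Perm → Hk
barT n x = foldr tinv (Te n) (redWord x)

insertAll : ℕ → List ℕ → List (List ℕ)
insertAll a [] = (a ∷ []) ∷ []
insertAll a (b ∷ bs) = (a ∷ b ∷ bs) ∷ map (b ∷_) (insertAll a bs)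

permsOf : List ℕ → List (List ℕ)
permsOf [] = [] ∷ []
permsOf (a ∷ as) = concatMap (insertAll a) (permsOf as)

perms : ℕ → List Perm
perms n = permsOf (upTo n)

barH : ℕ → Hk → Hk
barH n h y = concatMap (λ x → mulL (barL (h x)) (barT n x y)) (perms n)

-- Kazhdan–Lusztig data.  Polynomials in q: coefficient lists (c₀ c₁ …).

coefP : List ℤ → ℕ → ℤ
coefP [] i = 0ℤ
coefP (c ∷ cs) zero = c
coefP (c ∷ cs) (suc i) = coefP cs i

Cform : Perm → (Perm → List ℤ) → Hk
Cform w P x =
  if bruhat x w
    then map (λ ic → ((+ (2 * proj₁ ic)) +ℤ (- (+ len w)) , proj₂ ic)) (indexed (P x))
    else []

-- P is the family of Kazhdan–Lusztig polynomials P_{x,w}, i.e. Cform w P is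
-- C'_w: bar-invariant, P_{w,w} = 1 and deg P_{x,w} ≤ (ℓ(w)-ℓ(x)-1)/2 for x < w.
IsKL : ℕ → Perm → (Perm → List ℤ) → Set
IsKL n w P =
  (∀ i → coefP (P w) i ≡ (if i ≡ᵇ 0 then 1ℤ else 0ℤ)) ×
  ((∀ x → bruhat x w ≡ true → ¬ (x ≡ w) →
      ∀ i → len w < 2 * i + 1 + len x → coefP (P x) i ≡ 0ℤ) ×
   HEq n (barH n (Cform w P)) (Cform w P))

Bprime : Perm → Hk
Bprime x y = if bruhat y x then monoL (- (+ len x)) else []

RightAscent : Perm → ℕ → Set
RightAscent w i = len w < len (rmul w i)

Cograssmannian : ℕ → Perm → ℕ → Set
Cograssmannian n w z =
  1 ≤ z × (z < n × (RightAscent w z ×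
   (∀ i → 1 ≤ i → i < n → ¬ (i ≡ z) → ¬ RightAscent w i)))

-- reduced word of w₀^J:  (s_1⋯s_{z-1})(s_1⋯s_{z-2})⋯(s_1)
--                        (s_{n-1}⋯s_{z+1})(s_{n-1}⋯s_{z+2})⋯(s_{n-1})
wordJ : ℕ → ℕ → List ℕ
wordJ n z =
  concatMap (λ k → map suc (upTo k)) (reverse (upTo z)) ++
  concatMap (λ k → reverse (map (λ j → k + j) (upTo (n ∸ k))))
            (map (λ j → (z + 1) + j) (upTo (n ∸ (z + 1))))

w0J : ℕ → ℕ → Perm
w0J n z = evalWord n (wordJ n z)

-- minimal coset representative v with w = v w₀^J (w₀^J is an involution)
vOf : ℕ → ℕ → Perm → Perm
vOf n z w = compose w (w0J n z)

-- Heap of the word 𝗐 (positions 0-based).  i ≺ j when i > j and 𝗐_i, 𝗐_j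
-- do not commute (equal letters included), transitively closed.

noncomm : ℕ → ℕ → Bool
noncomm a b = (a ≤ᵇ suc b) ∧ (b ≤ᵇ suc a)

upSetGo : List ℕ → ℕ → List ℕ → List ℕ
upSetGo W zero acc = acc
upSetGo W (suc p) acc =
  upSetGo W p (if anyᵇ (λ q → noncomm (at W p) (at W q)) acc then p ∷ acc else acc)

upSet : List ℕ → ℕ → List ℕ
upSet W r = upSetGo W r (r ∷ [])

minL : List ℕ → ℕ
minL [] = 0
minL (x ∷ xs) = foldr (λ a b → if a <ᵇ b then a else b) x xs

maxL : List ℕ → ℕ
maxL [] = 0
maxL (x ∷ xs) = foldr (λ a b → if b <ᵇ a then a else b) x xs

-- position of the first (= topmost in the heap) occurrence of k
firstIdx : ℕ → List ℕ → ℕ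
firstIdx k [] = 0
firstIdx k (x ∷ xs) = if x ≡ᵇ k then 0 else suc (firstIdx k xs)

-- positions of occurrences of k in W, from the top down
occurrences : ℕ → List ℕ → List ℕ
occurrences k W = map proj₁ (filterᵇ (λ p → proj₂ p ≡ᵇ k) (indexed W))

-- parenthesis string for a reduced word vw of v: true = "(" , false = ")"
-- symbol number j concerns the columns a+j, a+j+1 (a = leftmost column of v)
parens : List ℕ → List Bool
parens vw =
  map (λ k → firstIdx k vw <ᵇ firstIdx (suc k) vw)
      (map (λ j → minL vw + j) (upTo (maxL vw ∸ minL vw)))

matchGo : ℕ → List ℕ → List Bool → List (ℕ × ℕ)
matchGo i st [] = []
matchGo i st (true ∷ bs) = matchGo (suc i) (i ∷ st) bs
matchGo i [] (false ∷ bs) = matchGo (suc i) [] bs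
matchGo i (j ∷ st) (false ∷ bs) = (j , i) ∷ matchGo (suc i) st bs

-- the non-root vertices of T(w)
pairsT : List ℕ → List (ℕ × ℕ)
pairsT vw = matchGo 0 [] (parens vw)

-- p' is a (proper) descendant of p
encloses : ℕ × ℕ → ℕ × ℕ → Bool
encloses p p' = (proj₁ p <ᵇ proj₁ p') ∧ (proj₂ p' <ᵇ proj₂ p)

-- leaves = valleys "()"
isValley : ℕ × ℕ → Bool
isValley p = proj₂ p ≡ᵇ suc (proj₁ p)

valleyCol : List ℕ → ℕ × ℕ → ℕ
valleyCol vw p = minL vw + suc (proj₁ p)

capacity : List ℕ → ℕ × ℕ → ℕ
capacity vw p = countᵇ (valleyCol vw p) vw

-- an edge labeling = a label for each non-root vertex (its parent edge)
validLab : List ℕ → List ℕ → Bool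
validLab vw t =
  let pt = zip (pairsT vw) t in
  (length t ≡ᵇ length (pairsT vw)) ∧
  (allᵇ (λ pm → allᵇ (λ pm' → not (encloses (proj₁ pm) (proj₁ pm'))
                               ∨ (proj₂ pm ≤ᵇ proj₂ pm')) pt) pt ∧
   allᵇ (λ pm → not (isValley (proj₁ pm)) ∨ (proj₂ pm ≤ᵇ capacity vw (proj₁ pm))) pt)

labelings : ℕ → ℕ → List (List ℕ)
labelings zero B = [] ∷ []
labelings (suc k) B = concatMap (λ m → map (m ∷_) (labelings k B)) (upTo (suc B))

-- A_w (every label is ≤ some capacity ≤ length vw, so the bound is harmless)
Aw : List ℕ → List (List ℕ)
Aw vw = filterᵇ (validLab vw) (labelings (length (pairsT vw)) (length vw))

fullWord : ℕ → ℕ → List ℕ → List ℕ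
fullWord n z vw = vw ++ wordJ n z

xOf : ℕ → ℕ → List ℕ → List ℕ → Perm
xOf n z vw t =
  let W = fullWord n z vw
      killed : ℕ → Bool
      killed p = anyᵇ (λ pm → isValley (proj₁ pm) ∧
                        anyᵇ (λ r → anyᵇ (λ u → u ≡ᵇ p) (upSet W r))
                             (take (proj₂ pm) (occurrences (valleyCol vw (proj₁ pm)) W)))
                      (zip (pairsT vw) t)
  in evalWord n (map proj₂ (filterᵇ (λ pw → not (killed (proj₁ pw))) (indexed W)))

rhs : ℕ → ℕ → Perm → List ℕ → Hk
rhs n z w vw =
  scaleH (monoL (- (+ len w)))
    (sumH (map (λ t → scaleH (monoL (+ (2 * sum t + len (xOf n z vw t))))
                             (Bprime (xOf n z vw t)))
               (Aw vw)))

{-# OPTIONS --safe #-}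
module Submission where

-- On the Hecke module of functions on cosets y·W_J, written as lattice paths, q^{-1/2} T_s − q^{1/2} is the Temperley–Lieb
-- generator cup∘cap of the tensor power of the two-dimensional representation.  Let w be the longest element of its coset, with
-- path λ.  Since its right descents act on C'_w by q, the element C'_w is such a function.  Contracting it at two neighbouring
-- steps of the path is again bar-invariant in a smaller tensor power, and the degree bounds show that the result vanishes unless
-- λ has a valley "()" there, in which case it is the Kazhdan–Lusztig vector of λ with that valley deleted.  The generating function
-- of admissible labelings of T(λ) satisfies the same recursion: comparing a path with a valley and the path with a peak at a leaf
-- of T(λ), only the labelings giving that leaf its maximal label survive, and these are the labelings of the tree without the leaf.
-- As a vector killed by all contractions is determined by its coefficient at the highest path, C'_w equals this generating
-- function.  Finally, a coset lies below x(t) in Bruhat order iff its path lies below λ and, at each valley, the number of boxes between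
-- both is at least the label of t there.

-- Coefficients at a coset are rescaled by q^(ℓ/2), where ℓ is the length of its longest element.
-- Bar invariance then makes an extremal coefficient symmetric under e ↦ -e, and the Kazhdan-Lusztig
-- bound leaves only negative exponents besides the 1 at `w`. Uniqueness is always the same remark:
-- a symmetric Laurent polynomial with only negative exponents is zero. The obstacle is that a
-- contracted vector lives in a tensor power that does not belong to the given symmetric group, so
-- it has no bar involution of its own. Its invariance therefore means invariance after cups are put
-- back at the left end, and the zigzag relation carries a cup created elsewhere to that end. Braid
-- relations are avoided: that the bar image of T_x does not depend on the reduced word follows from
-- the commutation of left and right multiplication. The generating function tests labels against
-- the gap between two paths at all enclosed points, whereas x(t) only sees valleys. Both tests
-- agree because the gap cannot grow on a "(" of λ nor shrink on a ")", so inside a matched pair it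
-- is smallest at a leaf.

open import Defs
open import Data.Bool using (Bool; true; false; if_then_else_; not; _∧_; _∨_)
import Data.Bool.Properties as BP
open import Data.Bool.Properties using (T-≡)
open import Data.Empty using (⊥-elim; ⊥)
open import Data.Integer using (ℤ)
import Data.Integer.Properties as ℤP
open import Data.List using (List; []; _∷_; _++_; map; foldr; concatMap; length; upTo; applyUpTo; take; drop; foldl; reverse; zip; replicate; _∷ʳ_; downFrom)
open import Data.List.Membership.Propositional using (_∈_; _∉_)
open import Data.List.Membership.Propositional.Properties using (∈-upTo⁺; ∈-upTo⁻; ∈-map⁺; ∈-map⁻; ∈-∃++; ∈-++⁻; ∈-++⁺ˡ; ∈-++⁺ʳ)
import Data.List.Properties as LP
import Data.List.Relation.Binary.Permutation.Propositional.Properties as PP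
import Data.List.Relation.Binary.Permutation.Setoid.Properties as PS
open import Data.List.Relation.Unary.All as All using (All; []; _∷_)
import Data.List.Relation.Unary.All.Properties as AllP
open import Data.List.Relation.Unary.AllPairs using ([]; _∷_; AllPairs)
import Data.List.Relation.Unary.AllPairs.Properties as APP
open import Data.List.Relation.Unary.Any using (here; there)
open import Data.List.Relation.Unary.Unique.Propositional using (Unique)
import Data.List.Relation.Unary.Unique.Propositional.Properties as UP
open import Data.Nat using (ℕ)
import Data.Nat.Properties as ℕP
open import Data.Product using (_×_; _,_; proj₁; proj₂; ∃; ∃₂)
open import Data.Sum using (_⊎_; inj₁; inj₂)
open import Function.Base using (_∘_; id)
open import Function.Bundles using (Equivalence)
open import Relation.Binary.PropositionalEquality hiding ([_])
open import Relation.Nullary using (does; yes; no; Dec; ¬_)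
open import Relation.Nullary.Decidable using (_×-dec_; ¬?)

-- Coefficients of Laurent polynomials as linear functionals

module LaurentCoefficients where
  open import Data.Nat as ℕ using (suc)
  open import Data.Integer using (-_; 0ℤ; 1ℤ; _+_; _*_; _-_)
  open import Data.Integer.Solver using (module +-*-Solver)

  open +-*-Solver

  sumZ : {A : Set} → (A → ℤ) → List A → ℤ
  sumZ φ [] = 0ℤ
  sumZ φ (x ∷ xs) = φ x + sumZ φ xs

  -- The linear functional sending q^(k/2) to `F k`. Products and the bar become substitutions in
  -- `F`, and a coefficient is the pairing with `δ e`, so lists with repeated exponents never need a
  -- normal form.
  pairing : LP → (ℤ → ℤ) → ℤ
  pairing p F = sumZ (λ ec → proj₂ ec * F (proj₁ ec)) p

  δ : ℤ → ℤ → ℤ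
  δ a b = if does (a ℤP.≟ b) then 1ℤ else 0ℤ

  sumZ-cong : {A : Set} {φ ψ : A → ℤ} → (∀ x → φ x ≡ ψ x) → ∀ xs → sumZ φ xs ≡ sumZ ψ xs
  sumZ-cong eq [] = refl
  sumZ-cong eq (x ∷ xs) = cong₂ _+_ (eq x) (sumZ-cong eq xs)

  sumZ-++ : {A : Set} (φ : A → ℤ) → ∀ xs ys → sumZ φ (xs ++ ys) ≡ sumZ φ xs + sumZ φ ys
  sumZ-++ φ [] ys = sym (ℤP.+-identityˡ _)
  sumZ-++ φ (x ∷ xs) ys = trans (cong (φ x +_) (sumZ-++ φ xs ys)) (sym (ℤP.+-assoc (φ x) _ _))

  sumZ-- : {A : Set} (φ ψ : A → ℤ) → ∀ xs → sumZ (λ x → φ x - ψ x) xs ≡ sumZ φ xs - sumZ ψ xs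
  sumZ-- φ ψ [] = refl
  sumZ-- φ ψ (x ∷ xs) = trans (cong ((φ x - ψ x) +_) (sumZ-- φ ψ xs))
    (solve 4 (λ a b c d → (a :- b) :+ (c :- d) := (a :+ c) :- (b :+ d)) refl (φ x) (ψ x) (sumZ φ xs) (sumZ ψ xs))

  sumZ-0 : {A : Set} {φ : A → ℤ} → (∀ x → φ x ≡ 0ℤ) → ∀ xs → sumZ φ xs ≡ 0ℤ
  sumZ-0 eq [] = refl
  sumZ-0 eq (x ∷ xs) rewrite eq x | sumZ-0 eq xs = refl

  sumZ-map : {A B : Set} (φ : B → ℤ) (f : A → B) → ∀ xs → sumZ φ (map f xs) ≡ sumZ (λ x → φ (f x)) xs
  sumZ-map φ f [] = refl
  sumZ-map φ f (x ∷ xs) = cong (φ (f x) +_) (sumZ-map φ f xs)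

  sumZ-concatMap : {A B : Set} (φ : B → ℤ) (f : A → List B) → ∀ xs →
    sumZ φ (concatMap f xs) ≡ sumZ (λ x → sumZ φ (f x)) xs
  sumZ-concatMap φ f [] = refl
  sumZ-concatMap φ f (x ∷ xs) = trans (sumZ-++ φ (f x) _) (cong (sumZ φ (f x) +_) (sumZ-concatMap φ f xs))

  sumZ-* : {A : Set} (c : ℤ) (φ : A → ℤ) → ∀ xs → sumZ (λ x → c * φ x) xs ≡ c * sumZ φ xs
  sumZ-* c φ [] = sym (ℤP.*-zeroʳ c)
  sumZ-* c φ (x ∷ xs) = trans (cong (c * φ x +_) (sumZ-* c φ xs)) (sym (ℤP.*-distribˡ-+ c (φ x) _))

  coefL-pairing : ∀ p e → coefL p e ≡ pairing p (δ e)
  coefL-pairing [] e = refl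
  coefL-pairing ((e' , c) ∷ p) e with does (e ℤP.≟ e')
  ... | true = cong₂ _+_ (sym (ℤP.*-identityʳ c)) (coefL-pairing p e)
  ... | false = trans (coefL-pairing p e) (trans (sym (ℤP.+-identityˡ _)) (cong (_+ pairing p (δ e)) (sym (ℤP.*-zeroʳ c))))

  pairing-cong : ∀ p {F G : ℤ → ℤ} → (∀ k → F k ≡ G k) → pairing p F ≡ pairing p G
  pairing-cong p eq = sumZ-cong (λ ec → cong (proj₂ ec *_) (eq (proj₁ ec))) p

  pairing-mulL : ∀ p r F → pairing (mulL p r) F ≡ pairing p (λ k → pairing r (λ l → F (k + l)))
  pairing-mulL p r F = trans (sumZ-concatMap _ _ p) (sumZ-cong (λ ec →
    trans (sumZ-map _ _ r) (trans (sumZ-cong (λ ec' → ℤP.*-assoc (proj₂ ec) (proj₂ ec') _) r)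
      (sumZ-* (proj₂ ec) _ r))) p)

  δ-refl : ∀ a → δ a a ≡ 1ℤ
  δ-refl a with a ℤP.≟ a
  ... | yes _ = refl
  ... | no ne = ⊥-elim (ne refl)

  δ-ne : ∀ {a b} → a ≢ b → δ a b ≡ 0ℤ
  δ-ne {a} {b} ne with a ℤP.≟ b
  ... | yes p = ⊥-elim (ne p)
  ... | no _ = refl

  δ-inj : ∀ {a b c d} → (a ≡ b → c ≡ d) → (c ≡ d → a ≡ b) → δ a b ≡ δ c d
  δ-inj {a} {b} {c} {d} f g with a ℤP.≟ b
  ... | yes p rewrite f p = sym (δ-refl d)
  ... | no ne = sym (δ-ne (λ q → ne (g q)))

  δ-shift : ∀ e k l → δ e (k + l) ≡ δ (e - k) l
  δ-shift e k l = δ-inj {e} {k + l} {e - k} {l}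
    (λ { refl → solve 2 (λ k l → (k :+ l) :- k := l) refl k l })
    (λ { refl → solve 2 (λ e k → e := k :+ (e :- k)) refl e k })

  coefL-mulL : ∀ p r e → coefL (mulL p r) e ≡ pairing p (λ k → coefL r (e - k))
  coefL-mulL p r e = trans (coefL-pairing (mulL p r) e) (trans (pairing-mulL p r (δ e))
    (pairing-cong p (λ k → trans (pairing-cong r (δ-shift e k)) (sym (coefL-pairing r (e - k))))))

  coefL-++ : ∀ p r e → coefL (p ++ r) e ≡ coefL p e + coefL r e
  coefL-++ p r e = trans (coefL-pairing (p ++ r) e) (trans (sumZ-++ _ p r)
    (cong₂ _+_ (sym (coefL-pairing p e)) (sym (coefL-pairing r e))))

  pairing-barL : ∀ p F → pairing (barL p) F ≡ pairing p (λ k → F (- k))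
  pairing-barL p F = sumZ-map _ _ p

  pairing-mono : ∀ k F → pairing (monoL k) F ≡ F k
  pairing-mono k F = trans (ℤP.+-identityʳ _) (ℤP.*-identityˡ (F k))

  coefL-mono* : ∀ k r e → coefL (mulL (monoL k) r) e ≡ coefL r (e - k)
  coefL-mono* k r e = trans (coefL-mulL (monoL k) r e) (pairing-mono k (λ k → coefL r (e - k)))

  coefL-concatMap : {A : Set} (f : A → LP) → ∀ xs e → coefL (concatMap f xs) e ≡ sumZ (λ x → coefL (f x) e) xs
  coefL-concatMap f [] e = refl
  coefL-concatMap f (x ∷ xs) e = trans (coefL-++ (f x) _ e) (cong (coefL (f x) e +_) (coefL-concatMap f xs e))

  -- Deleting all terms of one exponent makes "all coefficients vanish ⇒ every pairing vanishes" an induction on the number of terms.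
  private
    remove : ℤ → LP → LP
    remove e [] = []
    remove e ((e' , c) ∷ p) = if does (e ℤP.≟ e') then remove e p else (e' , c) ∷ remove e p

    remove-≤ : ∀ e p → length (remove e p) ℕ.≤ length p
    remove-≤ e [] = ℕ.z≤n
    remove-≤ e ((e' , c) ∷ p) with does (e ℤP.≟ e')
    ... | true = ℕP.m≤n⇒m≤1+n (remove-≤ e p)
    ... | false = ℕ.s≤s (remove-≤ e p)

    remove-pairing : ∀ e p F → pairing p F ≡ coefL p e * F e + pairing (remove e p) F
    remove-pairing e [] F = refl
    remove-pairing e ((e' , c) ∷ p) F with e ℤP.≟ e'
    ... | yes refl = trans (cong (c * F e +_) (remove-pairing e p F))
          (solve 4 (λ c f k r → c :* f :+ (k :* f :+ r) := (c :+ k) :* f :+ r) refl c (F e) (coefL p e) (pairing (remove e p) F))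
    ... | no _ = trans (cong (c * F e' +_) (remove-pairing e p F))
          (solve 3 (λ a b r → a :+ (b :+ r) := b :+ (a :+ r)) refl (c * F e') (coefL p e * F e) (pairing (remove e p) F))

    remove-coef : ∀ e p e₁ → (∀ e₂ → coefL p e₂ ≡ 0ℤ) → coefL (remove e p) e₁ ≡ 0ℤ
    remove-coef e p e₁ z = begin
      coefL (remove e p) e₁                                   ≡⟨ coefL-pairing (remove e p) e₁ ⟩
      pairing (remove e p) (δ e₁)                             ≡⟨ ℤP.+-identityˡ _ ⟨
      0ℤ * δ e₁ e + pairing (remove e p) (δ e₁)               ≡⟨ cong (λ c → c * δ e₁ e + pairing (remove e p) (δ e₁)) (z e) ⟨
      coefL p e * δ e₁ e + pairing (remove e p) (δ e₁)        ≡⟨ remove-pairing e p (δ e₁) ⟨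
      pairing p (δ e₁)                                        ≡⟨ coefL-pairing p e₁ ⟨
      coefL p e₁                                              ≡⟨ z e₁ ⟩
      0ℤ ∎ where open ≡-Reasoning

    pairing-0-fuel : ∀ n p F → length p ℕ.≤ n → (∀ e → coefL p e ≡ 0ℤ) → pairing p F ≡ 0ℤ
    pairing-0-fuel n [] F le z = refl
    pairing-0-fuel (suc n) ((e , c) ∷ p) F (ℕ.s≤s le) z =
      trans (remove-pairing e ((e , c) ∷ p) F)
        (trans (cong₂ (λ a b → a * F e + b) (z e)
           (pairing-0-fuel n (remove e ((e , c) ∷ p)) F short (λ e₁ → remove-coef e ((e , c) ∷ p) e₁ z)))
         refl)
      where
      short : length (remove e ((e , c) ∷ p)) ℕ.≤ n
      short with e ℤP.≟ e
      ... | yes _ = ℕP.≤-trans (remove-≤ e p) le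
      ... | no ne = ⊥-elim (ne refl)

  pairing-0 : ∀ p F → (∀ e → coefL p e ≡ 0ℤ) → pairing p F ≡ 0ℤ
  pairing-0 p F = pairing-0-fuel (length p) p F ℕP.≤-refl

-- Lengths and descents of permutations in one-line notation

module Permutations where
  open import Data.Nat
  open import Data.Nat.Solver using (module +-*-Solver)
  open import Data.List.Relation.Binary.Permutation.Propositional using (_↭_; refl; prep; swap; ↭-sym; ↭-trans; ↭⇒↭ₛ)
  import Data.List.Relation.Binary.Permutation.Propositional as Permutation

  ≡ᵇ-refl : ∀ a → (a ≡ᵇ a) ≡ true
  ≡ᵇ-refl zero = refl
  ≡ᵇ-refl (suc a) = ≡ᵇ-refl a

  ≡ᵇ-ne : ∀ {a b} → a ≢ b → (a ≡ᵇ b) ≡ false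
  ≡ᵇ-ne {zero} {zero} ne = ⊥-elim (ne refl)
  ≡ᵇ-ne {zero} {suc b} ne = refl
  ≡ᵇ-ne {suc a} {zero} ne = refl
  ≡ᵇ-ne {suc a} {suc b} ne = ≡ᵇ-ne (λ p → ne (cong suc p))

  ≡ᵇ-true : ∀ a b → (a ≡ᵇ b) ≡ true → a ≡ b
  ≡ᵇ-true zero zero p = refl
  ≡ᵇ-true (suc a) (suc b) p = cong suc (≡ᵇ-true a b p)

  <ᵇ-t : ∀ {a b} → a < b → (a <ᵇ b) ≡ true
  <ᵇ-t p = Equivalence.to T-≡ (ℕP.<⇒<ᵇ p)

  <ᵇ-true : ∀ a b → (a <ᵇ b) ≡ true → a < b
  <ᵇ-true a b p = ℕP.<ᵇ⇒< a b (Equivalence.from T-≡ p)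

  <ᵇ-f : ∀ {a b} → b ≤ a → (a <ᵇ b) ≡ false
  <ᵇ-f {a} {b} p with a <ᵇ b in eq
  ... | false = refl
  ... | true = ⊥-elim (ℕP.<⇒≱ (<ᵇ-true a b eq) p)

  <ᵇ-false : ∀ a b → (a <ᵇ b) ≡ false → b ≤ a
  <ᵇ-false a b p with b ≤? a
  ... | yes q = q
  ... | no q with () ← trans (sym p) (<ᵇ-t (ℕP.≰⇒> q))

  t≢f : true ≢ false
  t≢f ()

  ≤ᵇ-t : ∀ {a b} → a ≤ b → (a ≤ᵇ b) ≡ true
  ≤ᵇ-t {zero} _ = refl
  ≤ᵇ-t {suc a} lt = <ᵇ-t lt

  ≤ᵇ-true : ∀ a b → (a ≤ᵇ b) ≡ true → a ≤ b
  ≤ᵇ-true zero b e = z≤n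
  ≤ᵇ-true (suc a) b e = <ᵇ-true a b e

  iff-Bool : ∀ {a b : Bool} → (a ≡ true → b ≡ true) → (b ≡ true → a ≡ true) → a ≡ b
  iff-Bool {true} f g = sym (f refl)
  iff-Bool {false} {true} f g = g refl
  iff-Bool {false} {false} f g = refl

  tr-l : ∀ a b → tr a b a ≡ b
  tr-l a b rewrite ≡ᵇ-refl a = refl

  tr-r : ∀ a b → tr a b b ≡ a
  tr-r a b with b ≡ᵇ a in eq
  ... | true = ≡ᵇ-true b a eq
  ... | false rewrite ≡ᵇ-refl b = refl

  tr-o : ∀ {a b} k → k ≢ a → k ≢ b → tr a b k ≡ k
  tr-o k p q rewrite ≡ᵇ-ne p | ≡ᵇ-ne q = refl

  tr-invol : ∀ a b k → tr a b (tr a b k) ≡ k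
  tr-invol a b k with k ≟ a | k ≟ b
  ... | yes refl | _ = trans (cong (tr a b) (tr-l a b)) (tr-r a b)
  ... | no _ | yes refl = trans (cong (tr a b) (tr-r a b)) (tr-l a b)
  ... | no p | no q = trans (cong (tr a b) (tr-o k p q)) (tr-o k p q)

  tr-suc : ∀ a b k → tr (suc a) (suc b) (suc k) ≡ suc (tr a b k)
  tr-suc a b k with k ≡ᵇ a | k ≡ᵇ b
  ... | true | _ = refl
  ... | false | true = refl
  ... | false | false = refl

  tr-< : ∀ {n} j k → suc j < n → k < n → tr j (suc j) k < n
  tr-< j k jn kn with k ≟ j | k ≟ suc j
  ... | yes refl | _ = subst (_< _) (sym (tr-l j (suc j))) jn
  ... | no _ | yes refl = subst (_< _) (sym (tr-r j (suc j))) (ℕP.<-trans (ℕP.n<1+n j) jn)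
  ... | no p | no q = subst (_< _) (sym (tr-o k p q)) kn

  -- Exchanging the values `j` and `suc j` reverses the order of this one pair only. Keeping `j`
  -- away from both arguments already excludes the pair; `tr-<ᵇ′` keeps `suc j` away instead.
  tr-<ᵇ : ∀ j u v → u ≢ j → v ≢ j → (tr j (suc j) u <ᵇ tr j (suc j) v) ≡ (u <ᵇ v)
  tr-<ᵇ j u v p q with u ≟ suc j | v ≟ suc j
  ... | yes refl | yes refl = trans (<ᵇ-f (ℕP.≤-refl {tr j (suc j) (suc j)})) (sym (<ᵇ-f (ℕP.≤-refl {suc j})))
  ... | yes refl | no q' rewrite tr-r j (suc j) | tr-o v q q' =
    iff-Bool (λ e → <ᵇ-t (ℕP.≤∧≢⇒< (<ᵇ-true j v e) (λ e' → q' (sym e'))))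
             (λ e → <ᵇ-t (ℕP.<-trans (ℕP.n<1+n j) (<ᵇ-true (suc j) v e)))
  ... | no p' | yes refl rewrite tr-r j (suc j) | tr-o u p p' =
    iff-Bool (λ e → <ᵇ-t (ℕP.m<n⇒m<1+n (<ᵇ-true u j e)))
             (λ e → <ᵇ-t (ℕP.≤∧≢⇒< (ℕP.≤-pred (<ᵇ-true u (suc j) e)) p))
  ... | no p' | no q' rewrite tr-o u p p' | tr-o v q q' = refl

  tr-<ᵇ′ : ∀ j u v → u ≢ suc j → v ≢ suc j → (tr j (suc j) u <ᵇ tr j (suc j) v) ≡ (u <ᵇ v)
  tr-<ᵇ′ j u v p q with u ≟ j | v ≟ j
  ... | yes refl | yes refl = trans (<ᵇ-f (ℕP.≤-refl {tr j (suc j) j})) (sym (<ᵇ-f (ℕP.≤-refl {j})))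
  ... | yes refl | no q' rewrite tr-l j (suc j) | tr-o v q' q =
    iff-Bool (λ e → <ᵇ-t (ℕP.<-trans (ℕP.n<1+n j) (<ᵇ-true (suc j) v e)))
             (λ e → <ᵇ-t (ℕP.≤∧≢⇒< (<ᵇ-true j v e) (λ e' → q (sym e'))))
  ... | no p' | yes refl rewrite tr-l j (suc j) | tr-o u p' p =
    iff-Bool (λ e → <ᵇ-t (ℕP.≤∧≢⇒< (ℕP.≤-pred (<ᵇ-true u (suc j) e)) p'))
             (λ e → <ᵇ-t (ℕP.m<n⇒m<1+n (<ᵇ-true u j e)))
  ... | no p' | no q' rewrite tr-o u p' p | tr-o v q' q = refl

  at-map : ∀ (f : ℕ → ℕ) xs i → i < length xs → at (map f xs) i ≡ f (at xs i)
  at-map f (x ∷ xs) zero lt = refl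
  at-map f (x ∷ xs) (suc i) (s≤s lt) = at-map f xs i lt

  at-applyUpTo : ∀ (f : ℕ → ℕ) n i → i < n → at (applyUpTo f n) i ≡ f i
  at-applyUpTo f (suc n) zero lt = refl
  at-applyUpTo f (suc n) (suc i) (s≤s lt) = at-applyUpTo (λ k → f (suc k)) n i lt

  at-upTo : ∀ n i → i < n → at (upTo n) i ≡ i
  at-upTo = at-applyUpTo id

  at-ext : ∀ xs ys → length xs ≡ length ys → (∀ i → i < length xs → at xs i ≡ at ys i) → xs ≡ ys
  at-ext [] [] _ _ = refl
  at-ext (x ∷ xs) (y ∷ ys) le eq =
    cong₂ _∷_ (eq 0 z<s) (at-ext xs ys (ℕP.suc-injective le) (λ i lt → eq (suc i) (s<s lt)))

  at-∈ : ∀ xs i → i < length xs → at xs i ∈ xs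
  at-∈ (x ∷ xs) zero lt = here refl
  at-∈ (x ∷ xs) (suc i) (s≤s lt) = there (at-∈ xs i lt)

  at-inj : ∀ xs → Unique xs → ∀ i j → i < length xs → j < length xs → at xs i ≡ at xs j → i ≡ j
  at-inj (x ∷ xs) (px ∷ u) zero zero _ _ _ = refl
  at-inj (x ∷ xs) (px ∷ u) zero (suc j) _ (s≤s l) eq = ⊥-elim (All.lookup px (at-∈ xs j l) eq)
  at-inj (x ∷ xs) (px ∷ u) (suc i) zero (s≤s l) _ eq = ⊥-elim (All.lookup px (at-∈ xs i l) (sym eq))
  at-inj (x ∷ xs) (px ∷ u) (suc i) (suc j) (s≤s l) (s≤s l') eq = cong suc (at-inj xs u i j l l' eq)

  -- A structurally recursive form of right multiplication by a generator, so that inversions can be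
  -- counted by induction. Applied to a lattice path it becomes left multiplication (`path-lmul`).
  adj : {A : Set} → ℕ → List A → List A
  adj zero (a ∷ b ∷ r) = b ∷ a ∷ r
  adj zero xs = xs
  adj (suc j) (x ∷ r) = x ∷ adj j r
  adj (suc j) [] = []

  map-adj : {A B : Set} (f : A → B) → ∀ j xs → map f (adj j xs) ≡ adj j (map f xs)
  map-adj f zero [] = refl
  map-adj f zero (a ∷ []) = refl
  map-adj f zero (a ∷ b ∷ r) = refl
  map-adj f (suc j) [] = refl
  map-adj f (suc j) (x ∷ r) = cong (f x ∷_) (map-adj f j r)

  adj-↭ : {A : Set} → ∀ j (xs : List A) → adj j xs ↭ xs
  adj-↭ zero [] = refl
  adj-↭ zero (a ∷ []) = refl
  adj-↭ zero (a ∷ b ∷ r) = swap b a refl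
  adj-↭ (suc j) [] = refl
  adj-↭ (suc j) (x ∷ r) = prep x (adj-↭ j r)

  adj-invol : {A : Set} → ∀ j (xs : List A) → adj j (adj j xs) ≡ xs
  adj-invol zero [] = refl
  adj-invol zero (a ∷ []) = refl
  adj-invol zero (a ∷ b ∷ r) = refl
  adj-invol (suc j) [] = refl
  adj-invol (suc j) (x ∷ r) = cong (x ∷_) (adj-invol j r)

  adj-split : {A : Set} → ∀ (p : List A) a b r → adj (length p) (p ++ a ∷ b ∷ r) ≡ p ++ b ∷ a ∷ r
  adj-split [] a b r = refl
  adj-split (x ∷ p) a b r = cong (x ∷_) (adj-split p a b r)

  length-adj : {A : Set} → ∀ j (xs : List A) → length (adj j xs) ≡ length xs
  length-adj j xs = PP.↭-length (adj-↭ j xs)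

  at-adj : ∀ j xs i → suc j < length xs → i < length xs → at (adj j xs) i ≡ at xs (tr j (suc j) i)
  at-adj zero (_ ∷ []) _ (s≤s ()) _
  at-adj zero (a ∷ b ∷ r) zero _ _ = refl
  at-adj zero (a ∷ b ∷ r) (suc zero) _ _ = refl
  at-adj zero (a ∷ b ∷ r) (suc (suc i)) _ _ = refl
  at-adj (suc j) (x ∷ r) zero _ _ = refl
  at-adj (suc j) (x ∷ r) (suc i) (s≤s jl) (s≤s il) =
    trans (at-adj j r i jl il) (cong (at (x ∷ r)) (sym (tr-suc j (suc j) i)))

  swapPos-adj : ∀ j x → suc j < length x → swapPos j (suc j) x ≡ adj j x
  swapPos-adj j x jl = at-ext _ _
    (trans (LP.length-map _ (upTo (length x))) (trans (LP.length-upTo _) (sym (length-adj j x))))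
    (λ i lt → let il = subst (i <_) (trans (LP.length-map _ (upTo (length x))) (LP.length-upTo (length x))) lt in
      trans (at-map _ (upTo (length x)) i (subst (i <_) (sym (LP.length-upTo (length x))) il))
      (trans (cong (λ k → at x (tr j (suc j) k)) (at-upTo (length x) i il))
             (sym (at-adj j x i jl il))))

  map-tr-upTo : ∀ j n → suc j < n → map (tr j (suc j)) (upTo n) ≡ adj j (upTo n)
  map-tr-upTo j n jn = at-ext _ _
    (trans (LP.length-map _ (upTo n)) (sym (length-adj j (upTo n))))
    (λ i lt → let il = subst (i <_) (LP.length-map _ (upTo n)) lt
                  il' = subst (i <_) (LP.length-upTo n) il in
      trans (at-map _ (upTo n) i il) (trans (cong (tr j (suc j)) (at-upTo n i il'))
        (sym (trans (at-adj j (upTo n) i (subst (suc j <_) (sym (LP.length-upTo n)) jn) il)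
          (at-upTo n _ (tr-< j i jn il'))))))

  rmul-adj : ∀ {n} x j → length x ≡ n → suc j < n → rmul x (suc j) ≡ adj j x
  rmul-adj x j refl jn = swapPos-adj j x jn

  perm-length : ∀ {n x} → IsPerm n x → length x ≡ n
  perm-length {n} p = trans (PP.↭-length p) (LP.length-upTo n)

  perm-unique : ∀ {n x} → IsPerm n x → Unique x
  perm-unique {n} p = PS.Unique-resp-↭ (setoid ℕ) (↭⇒↭ₛ (↭-sym p)) (UP.upTo⁺ n)

  perm-∈ : ∀ {n x k} → IsPerm n x → k < n → k ∈ x
  perm-∈ p lt = PP.∈-resp-↭ (↭-sym p) (∈-upTo⁺ lt)

  perm-< : ∀ {n x k} → IsPerm n x → k ∈ x → k < n
  perm-< p m = ∈-upTo⁻ (PP.∈-resp-↭ p m)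

  perm-id : ∀ n → IsPerm n (idP n)
  perm-id n = refl

  lmul-perm : ∀ {n x} j → IsPerm n x → suc j < n → IsPerm n (lmul (suc j) x)
  lmul-perm {n} {x} j p jn = ↭-trans (PP.map⁺ _ p) (subst (_↭ upTo n) (sym (map-tr-upTo j n jn)) (adj-↭ j (upTo n)))

  rmul-perm : ∀ {n x} j → IsPerm n x → suc j < n → IsPerm n (rmul x (suc j))
  rmul-perm {n} {x} j p jn = subst (IsPerm n) (sym (rmul-adj x j (perm-length p) jn)) (↭-trans (adj-↭ j x) p)

  lmul-invol : ∀ i x → lmul i (lmul i x) ≡ x
  lmul-invol i x = trans (sym (LP.map-∘ x)) (trans (LP.map-cong (tr-invol (i ∸ 1) i) x) (LP.map-id x))

  rmul-invol : ∀ {n x} j → length x ≡ n → suc j < n → rmul (rmul x (suc j)) (suc j) ≡ x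
  rmul-invol {n} {x} j lx jn = trans (cong (λ y → rmul y (suc j)) (rmul-adj x j lx jn))
    (trans (rmul-adj (adj j x) j (trans (length-adj j x) lx) jn) (adj-invol j x))

  lmul-rmul : ∀ {n x} i j → length x ≡ n → suc j < n → lmul i (rmul x (suc j)) ≡ rmul (lmul i x) (suc j)
  lmul-rmul {n} {x} i j lx jn = trans (cong (lmul i) (rmul-adj x j lx jn))
    (trans (map-adj _ j x) (sym (rmul-adj (lmul i x) j (trans (LP.length-map _ x) lx) jn)))

  cnt : {A : Set} → (A → Bool) → List A → ℕ
  cnt p xs = length (filterᵇ p xs)

  cnt-∷ : {A : Set} (p : A → Bool) → ∀ x xs → cnt p (x ∷ xs) ≡ (if p x then 1 else 0) + cnt p xs
  cnt-∷ p x xs with p x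
  ... | true = refl
  ... | false = refl

  cnt-cong : {A : Set} (p q : A → Bool) → ∀ xs → (∀ x → x ∈ xs → p x ≡ q x) → cnt p xs ≡ cnt q xs
  cnt-cong p q [] eq = refl
  cnt-cong p q (x ∷ xs) eq rewrite cnt-∷ p x xs | cnt-∷ q x xs | eq x (here refl) =
    cong ((if q x then 1 else 0) +_) (cnt-cong p q xs (λ y m → eq y (there m)))

  cnt-map : {A B : Set} (p : B → Bool) (f : A → B) → ∀ xs → cnt p (map f xs) ≡ cnt (p ∘ f) xs
  cnt-map p f [] = refl
  cnt-map p f (x ∷ xs) with p (f x)
  ... | true = cong suc (cnt-map p f xs)
  ... | false = cnt-map p f xs

  cnt-↭ : {A : Set} (p : A → Bool) → ∀ {xs ys} → xs ↭ ys → cnt p xs ≡ cnt p ys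
  cnt-↭ p refl = refl
  cnt-↭ p (prep {xs} {ys} x r) rewrite cnt-∷ p x xs | cnt-∷ p x ys = cong ((if p x then 1 else 0) +_) (cnt-↭ p r)
  cnt-↭ p (swap x y r) with p x | p y
  ... | true | true = cong (2 +_) (cnt-↭ p r)
  ... | true | false = cong suc (cnt-↭ p r)
  ... | false | true = cong suc (cnt-↭ p r)
  ... | false | false = cnt-↭ p r
  cnt-↭ p (Permutation.trans r s) = trans (cnt-↭ p r) (cnt-↭ p s)

  len-adj : ∀ j x → suc j < length x → at x j < at x (suc j) → len (adj j x) ≡ suc (len x)
  len-adj zero (u ∷ v ∷ r) _ lt rewrite <ᵇ-t lt | <ᵇ-f {v} {u} (ℕP.<⇒≤ lt) =
    cong suc (solve 3 (λ a b c → a :+ (b :+ c) := b :+ (a :+ c)) refl (cnt (_<ᵇ v) r) (cnt (_<ᵇ u) r) (len r))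
    where open +-*-Solver
  len-adj (suc j) (x ∷ r) (s≤s jl) lt = trans
    (cong₂ _+_ (cnt-↭ (_<ᵇ x) (adj-↭ j r)) (len-adj j r jl lt)) (ℕP.+-suc _ _)

  len-adj↓ : ∀ j x → suc j < length x → at x (suc j) < at x j → suc (len (adj j x)) ≡ len x
  len-adj↓ j x jl lt = trans (sym (len-adj j (adj j x) (subst (suc j <_) (sym (length-adj j x)) jl)
      (subst₂ _<_ (sym (trans (at-adj j x j jl (ℕP.<-trans (ℕP.n<1+n j) jl)) (cong (at x) (tr-l j (suc j)))))
                  (sym (trans (at-adj j x (suc j) jl jl) (cong (at x) (tr-r j (suc j))))) lt)))
    (cong len (adj-invol j x))

  -- The test for left descents: multiplying `x` on the left by the generator `suc j` shortens it
  -- exactly when the value `suc j` stands to the left of `j`, that is, when `before (suc j) j x`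
  -- holds.
  before : ℕ → ℕ → List ℕ → Bool
  before u v [] = false
  before u v (x ∷ xs) = if x ≡ᵇ u then true else (if x ≡ᵇ v then false else before u v xs)

  before-swap : ∀ u v x → u ≢ v → u ∈ x → before v u x ≡ not (before u v x)
  before-swap u v (c ∷ xs) ne m with c ≟ u
  ... | yes refl rewrite ≡ᵇ-refl c | ≡ᵇ-ne ne = refl
  ... | no p with c ≟ v
  ...   | yes refl rewrite ≡ᵇ-refl c | ≡ᵇ-ne p = refl
  ...   | no q with m
  ...     | here e = ⊥-elim (p (sym e))
  ...     | there m' rewrite ≡ᵇ-ne p | ≡ᵇ-ne q = before-swap u v xs ne m'

  before-map-tr : ∀ j x → before (suc j) j (map (tr j (suc j)) x) ≡ before j (suc j) x
  before-map-tr j [] = refl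
  before-map-tr j (c ∷ xs) with c ≟ j
  ... | yes refl rewrite tr-l j (suc j) | ≡ᵇ-refl j = refl
  ... | no p with c ≟ suc j
  ...   | yes refl rewrite tr-r j (suc j) | ≡ᵇ-refl j | ≡ᵇ-ne {j} {suc j} (ℕP.<⇒≢ (ℕP.n<1+n j)) | ≡ᵇ-ne p = refl
  ...   | no q rewrite tr-o c p q | ≡ᵇ-ne p | ≡ᵇ-ne q = before-map-tr j xs

  len-map-mono : ∀ f x → (∀ u v → u ∈ x → v ∈ x → (f u <ᵇ f v) ≡ (u <ᵇ v)) → len (map f x) ≡ len x
  len-map-mono f [] h = refl
  len-map-mono f (a ∷ x) h = cong₂ _+_
    (trans (cnt-map (_<ᵇ f a) f x) (cnt-cong _ _ x (λ b m → h b a (there m) (here refl))))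
    (len-map-mono f x (λ u v p q → h u v (there p) (there q)))

  private
    ∉-∷ : ∀ {k c : ℕ} {xs} → k ∉ (c ∷ xs) → k ∉ xs
    ∉-∷ ne m = ne (there m)

    ∈-ne : ∀ {k c : ℕ} {xs} → k ∈ xs → c ∉ xs → k ≢ c
    ∈-ne m ne refl = ne m

  All-∉ : ∀ {c : ℕ} {xs} → All (c ≢_) xs → c ∉ xs
  All-∉ px m = All.lookup px m refl

  private
    -- Here `xs` stands to the right of the value `j`, which turns into `suc j`. The single new
    -- inversion is with the entry that was `suc j` and is now `j`.
    cnt-tr : ∀ j xs → Unique xs → j ∉ xs → suc j ∈ xs →
      cnt (λ y → tr j (suc j) y <ᵇ suc j) xs ≡ suc (cnt (_<ᵇ j) xs)
    cnt-tr j (c ∷ xs) (px ∷ u) nj m with c ≟ suc j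
    ... | yes refl rewrite tr-r j (suc j) | <ᵇ-t (ℕP.n<1+n j) | <ᵇ-f {suc j} {j} (ℕP.n≤1+n j) =
      cong suc (cnt-cong _ _ xs (λ y my →
        let y≢j = ∈-ne my (∉-∷ nj) ; y≢sj = ∈-ne my (All-∉ px) in
        trans (cong (_<ᵇ suc j) (tr-o y y≢j y≢sj))
          (iff-Bool (λ e → <ᵇ-t (ℕP.≤∧≢⇒< (ℕP.≤-pred (<ᵇ-true y (suc j) e)) y≢j))
                    (λ e → <ᵇ-t (ℕP.m<n⇒m<1+n (<ᵇ-true y j e))))))
    ... | no q with m
    ...   | here e = ⊥-elim (q (sym e))
    ...   | there m' = begin
        cnt P (c ∷ xs)                                   ≡⟨ cnt-∷ P c xs ⟩
        (if P c then 1 else 0) + cnt P xs                ≡⟨ cong₂ _+_ (cong (if_then 1 else 0) Pc) (cnt-tr j xs u (∉-∷ nj) m') ⟩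
        (if c <ᵇ j then 1 else 0) + suc (cnt (_<ᵇ j) xs) ≡⟨ ℕP.+-suc _ _ ⟩
        suc ((if c <ᵇ j then 1 else 0) + cnt (_<ᵇ j) xs) ≡⟨ cong suc (cnt-∷ (_<ᵇ j) c xs) ⟨
        suc (cnt (_<ᵇ j) (c ∷ xs)) ∎
      where
      open ≡-Reasoning
      P : ℕ → Bool
      P y = tr j (suc j) y <ᵇ suc j
      c≢j : c ≢ j
      c≢j e = nj (here (sym e))
      Pc : P c ≡ (c <ᵇ j)
      Pc = trans (cong (_<ᵇ suc j) (tr-o c c≢j q))
          (iff-Bool (λ e → <ᵇ-t (ℕP.≤∧≢⇒< (ℕP.≤-pred (<ᵇ-true c (suc j) e)) c≢j))
                    (λ e → <ᵇ-t (ℕP.m<n⇒m<1+n (<ᵇ-true c j e))))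

    tr-<ᵇ-other : ∀ j c y → c ≢ j → c ≢ suc j → (tr j (suc j) y <ᵇ c) ≡ (y <ᵇ c)
    tr-<ᵇ-other j c y p q with y ≟ j
    ... | no y≢j = trans (cong (tr j (suc j) y <ᵇ_) (sym (tr-o c p q))) (tr-<ᵇ j y c y≢j p)
    ... | yes refl = trans (cong (tr j (suc j) y <ᵇ_) (sym (tr-o c p q)))
                       (tr-<ᵇ′ j y c (ℕP.<⇒≢ (ℕP.n<1+n j)) q)

  len-lmul-up : ∀ j x → Unique x → j ∈ x → suc j ∈ x → before (suc j) j x ≡ false →
    len (lmul (suc j) x) ≡ suc (len x)
  len-lmul-up j (c ∷ xs) (px ∷ u) mj msj bf with c ≟ suc j
  ... | yes refl rewrite ≡ᵇ-refl j with () ← bf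
  ... | no q with c ≟ j
  len-lmul-up j (.j ∷ xs) (px ∷ u) mj (here e) bf | no q | yes refl = ⊥-elim (q (sym e))
  len-lmul-up j (.j ∷ xs) (px ∷ u) mj (there m) bf | no q | yes refl rewrite tr-l j (suc j) =
    cong₂ _+_ (trans (cnt-map _ _ xs) (cnt-tr j xs u (All-∉ px) m))
      (len-map-mono _ xs (λ a b ma mb → tr-<ᵇ j a b (∈-ne ma (All-∉ px)) (∈-ne mb (All-∉ px))))
  len-lmul-up j (c ∷ xs) (px ∷ u) (here e) msj bf | no q | no p = ⊥-elim (p (sym e))
  len-lmul-up j (c ∷ xs) (px ∷ u) (there mj) (here e) bf | no q | no p = ⊥-elim (q (sym e))
  len-lmul-up j (c ∷ xs) (px ∷ u) (there mj) (there msj) bf | no q | no p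
    rewrite tr-o c p q | ≡ᵇ-ne p | ≡ᵇ-ne q =
    trans (cong₂ _+_ (trans (cnt-map _ _ xs) (cnt-cong _ _ xs (λ y _ → tr-<ᵇ-other j c y p q)))
      (len-lmul-up j xs u mj msj bf)) (ℕP.+-suc _ _)

  lmul-up : ∀ {n x} j → IsPerm n x → suc j < n → before (suc j) j x ≡ false → len (lmul (suc j) x) ≡ suc (len x)
  lmul-up {n} {x} j p jn = len-lmul-up j x (perm-unique p) (perm-∈ p (ℕP.<-trans (ℕP.n<1+n j) jn)) (perm-∈ p jn)

  lmul-down : ∀ {n x} j → IsPerm n x → suc j < n → before (suc j) j x ≡ true → len x ≡ suc (len (lmul (suc j) x))
  lmul-down {n} {x} j p jn bt = trans (cong len (sym (lmul-invol (suc j) x)))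
    (lmul-up j (lmul-perm j p jn) jn (trans (before-map-tr j x)
      (trans (before-swap (suc j) j x (λ e → ℕP.<⇒≢ (ℕP.n<1+n j) (sym e)) (perm-∈ p jn)) (cong not bt))))

  dl : ℕ → Perm → Bool
  dl i x = len (lmul i x) <ᵇ len x

  dr : ℕ → Perm → Bool
  dr i x = len (rmul x i) <ᵇ len x

  dl-before : ∀ {n x} j → IsPerm n x → suc j < n → dl (suc j) x ≡ before (suc j) j x
  dl-before {n} {x} j p jn with before (suc j) j x in eq
  ... | true = trans (cong (len (lmul (suc j) x) <ᵇ_) (lmul-down j p jn eq)) (<ᵇ-t (ℕP.n<1+n (len (lmul (suc j) x))))
  ... | false = trans (cong (_<ᵇ len x) (lmul-up j p jn eq)) (<ᵇ-f (ℕP.n≤1+n (len x)))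

  rmul-up : ∀ {n x} j → IsPerm n x → suc j < n → at x j < at x (suc j) → len (rmul x (suc j)) ≡ suc (len x)
  rmul-up {n} {x} j p jn lt = trans (cong len (rmul-adj x j (perm-length p) jn))
    (len-adj j x (subst (suc j <_) (sym (perm-length p)) jn) lt)

  rmul-down : ∀ {n x} j → IsPerm n x → suc j < n → at x (suc j) < at x j → len x ≡ suc (len (rmul x (suc j)))
  rmul-down {n} {x} j p jn lt = sym (trans (cong (suc ∘ len) (rmul-adj x j (perm-length p) jn))
    (len-adj↓ j x (subst (suc j <_) (sym (perm-length p)) jn) lt))

  at-≢ : ∀ {n x} j → IsPerm n x → suc j < n → at x j ≢ at x (suc j)
  at-≢ {n} {x} j p jn e = ℕP.<⇒≢ (ℕP.n<1+n j) (at-inj x (perm-unique p) j (suc j)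
    (subst (j <_) (sym (perm-length p)) (ℕP.<-trans (ℕP.n<1+n j) jn)) (subst (suc j <_) (sym (perm-length p)) jn) e)

  dr-at : ∀ {n x} j → IsPerm n x → suc j < n → dr (suc j) x ≡ (at x (suc j) <ᵇ at x j)
  dr-at {n} {x} j p jn with at x (suc j) <ᵇ at x j in eq
  ... | true = trans (cong (len (rmul x (suc j)) <ᵇ_) (rmul-down j p jn (<ᵇ-true _ _ eq))) (<ᵇ-t (ℕP.n<1+n (len (rmul x (suc j)))))
  ... | false = trans (cong (_<ᵇ len x) (rmul-up j p jn (ℕP.≤∧≢⇒< (<ᵇ-false (at x (suc j)) _ eq) (at-≢ j p jn)))) (<ᵇ-f (ℕP.n≤1+n (len x)))

-- Reduced words and sums over the symmetric group

module Words where
  open import Data.Nat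
  open import Data.Integer using (0ℤ)
  import Data.Integer as ℤ
  open import Data.List.Relation.Unary.Linked using (Linked; []; [-]; _∷_)
  open import Data.List.Relation.Unary.Linked.Properties using (Linked⇒AllPairs)
  open import Data.List.Relation.Binary.Permutation.Propositional using (_↭_; refl; prep; swap; ↭-sym; ↭-trans; ↭⇒↭ₛ)
  import Data.List.Relation.Binary.Permutation.Propositional as Permutation
  open LaurentCoefficients
  open Permutations

  before-adj : ∀ j k x → suc k < length x →
    ¬ (at x k ≡ j × at x (suc k) ≡ suc j) → ¬ (at x k ≡ suc j × at x (suc k) ≡ j) →
    before (suc j) j (adj k x) ≡ before (suc j) j x
  before-adj j zero (u ∷ []) (s≤s ()) p q
  before-adj j zero (u ∷ v ∷ r) _ p q with u ≟ suc j | v ≟ suc j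
  ... | yes refl | yes refl = refl
  ... | yes refl | no b rewrite ≡ᵇ-refl j | ≡ᵇ-ne b | ≡ᵇ-ne {v} {j} (λ e → q (refl , e)) = refl
  ... | no a | yes refl rewrite ≡ᵇ-refl j | ≡ᵇ-ne a | ≡ᵇ-ne {u} {j} (λ e → p (e , refl)) = refl
  ... | no a | no b rewrite ≡ᵇ-ne a | ≡ᵇ-ne b with u ≡ᵇ j | v ≡ᵇ j
  ...   | true | true = refl
  ...   | true | false = refl
  ...   | false | true = refl
  ...   | false | false = refl
  before-adj j (suc k) (x ∷ r) (s≤s l) p q with x ≡ᵇ suc j | x ≡ᵇ j
  ... | true | _ = refl
  ... | false | true = refl
  ... | false | false = before-adj j k r l p q

  module _ {n : ℕ} {x : Perm} {j k : ℕ} (px : IsPerm n x) (jn : suc j < n) (kn : suc k < n) where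
    private
      kl : suc k < length x
      kl = subst (suc k <_) (sym (perm-length px)) kn
      kl′ : k < length x
      kl′ = ℕP.<-trans (ℕP.n<1+n k) kl

      lmul≡adj : tr j (suc j) (at x k) ≡ at x (suc k) → tr j (suc j) (at x (suc k)) ≡ at x k →
        (at x k ≡ j × at x (suc k) ≡ suc j) ⊎ (at x k ≡ suc j × at x (suc k) ≡ j) →
        lmul (suc j) x ≡ rmul x (suc k)
      lmul≡adj e₁ e₂ c = trans (at-ext _ _ (trans (LP.length-map _ x) (sym (length-adj k x))) pt)
          (sym (rmul-adj x k (perm-length px) kn))
        where
        other : ∀ i → i < length x → i ≢ k → i ≢ suc k → tr j (suc j) (at x i) ≡ at x i
        other i il a b = go c
          where
          inj = at-inj x (perm-unique px)
          go : (at x k ≡ j × at x (suc k) ≡ suc j) ⊎ (at x k ≡ suc j × at x (suc k) ≡ j) → tr j (suc j) (at x i) ≡ at x i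
          go (inj₁ (p , q)) = tr-o _ (λ e → a (inj i k il kl′ (trans e (sym p)))) (λ e → b (inj i (suc k) il kl (trans e (sym q))))
          go (inj₂ (p , q)) = tr-o _ (λ e → b (inj i (suc k) il kl (trans e (sym q)))) (λ e → a (inj i k il kl′ (trans e (sym p))))
        pt : ∀ i → i < length (lmul (suc j) x) → at (lmul (suc j) x) i ≡ at (adj k x) i
        pt i il′ with il ← subst (i <_) (LP.length-map _ x) il′ | i ≟ k | i ≟ suc k
        ... | yes refl | _ = trans (at-map _ x i il) (trans e₁ (sym (trans (at-adj i x i kl il) (cong (at x) (tr-l i (suc i))))))
        ... | no _ | yes refl = trans (at-map _ x i il) (trans e₂ (sym (trans (at-adj k x i kl il) (cong (at x) (tr-r k i)))))
        ... | no a | no b = trans (at-map _ x i il) (trans (other i il a b) (sym (trans (at-adj k x i kl il) (cong (at x) (tr-o i a b)))))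

      descents : ¬ (at x k ≡ j × at x (suc k) ≡ suc j) → ¬ (at x k ≡ suc j × at x (suc k) ≡ j) →
        (dl (suc j) (rmul x (suc k)) ≡ dl (suc j) x) × (dr (suc k) (lmul (suc j) x) ≡ dr (suc k) x)
      descents p q =
        trans (dl-before j (rmul-perm k px kn) jn) (trans (cong (before (suc j) j) (rmul-adj x k (perm-length px) kn))
          (trans (before-adj j k x kl p q) (sym (dl-before j px jn)))) ,
        trans (dr-at k (lmul-perm j px jn) kn) (trans (cong₂ _<ᵇ_ (at-map _ x (suc k) kl) (at-map _ x k kl′))
          (trans ord (sym (dr-at k px kn))))
        where
        u = at x k
        v = at x (suc k)
        ord : (tr j (suc j) v <ᵇ tr j (suc j) u) ≡ (v <ᵇ u)
        ord with u ≟ j | v ≟ j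
        ... | no a | no b = tr-<ᵇ j v u b a
        ... | yes a | _ = tr-<ᵇ′ j v u (λ e → p (a , e)) (λ e → ℕP.<⇒≢ (ℕP.n<1+n j) (trans (sym a) e))
        ... | no a | yes b = tr-<ᵇ′ j v u (λ e → ℕP.<⇒≢ (ℕP.n<1+n j) (trans (sym b) e)) (λ e → q (e , b))

    -- Either the entries at places `k`, `suc k` are the values `j`, `suc j` in some order, and both
    -- multiplications exchange them, or neither multiplication affects the comparison that decides
    -- the descent of the other. This is the case distinction behind the commutation of left and
    -- right multiplication in the Hecke algebra.
    lmul-rmul-dichotomy : (lmul (suc j) x ≡ rmul x (suc k)) ⊎
      ((dl (suc j) (rmul x (suc k)) ≡ dl (suc j) x) × (dr (suc k) (lmul (suc j) x) ≡ dr (suc k) x))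
    lmul-rmul-dichotomy with at x k ≟ j | at x (suc k) ≟ suc j | at x k ≟ suc j | at x (suc k) ≟ j
    ... | yes a | yes b | _ | _ = inj₁ (lmul≡adj
          (trans (cong (tr j (suc j)) a) (trans (tr-l j (suc j)) (sym b)))
          (trans (cong (tr j (suc j)) b) (trans (tr-r j (suc j)) (sym a))) (inj₁ (a , b)))
    ... | _ | _ | yes a | yes b = inj₁ (lmul≡adj
          (trans (cong (tr j (suc j)) a) (trans (tr-r j (suc j)) (sym b)))
          (trans (cong (tr j (suc j)) b) (trans (tr-l j (suc j)) (sym a))) (inj₂ (a , b)))
    ... | no a | _ | no b | _ = inj₂ (descents (a ∘ proj₁) (b ∘ proj₁))
    ... | no a | _ | yes _ | no b = inj₂ (descents (a ∘ proj₁) (b ∘ proj₂))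
    ... | yes _ | no a | no b | _ = inj₂ (descents (a ∘ proj₂) (b ∘ proj₁))
    ... | yes _ | no a | yes _ | no b = inj₂ (descents (a ∘ proj₂) (b ∘ proj₂))

  sorted-unique : ∀ {xs ys} → AllPairs _<_ xs → AllPairs _<_ ys →
    (∀ {k} → k ∈ xs → k ∈ ys) → (∀ {k} → k ∈ ys → k ∈ xs) → xs ≡ ys
  sorted-unique {[]} {[]} _ _ _ _ = refl
  sorted-unique {[]} {y ∷ ys} _ _ f g with () ← g (here refl)
  sorted-unique {x ∷ xs} {[]} _ _ f g with () ← f (here refl)
  sorted-unique {x ∷ xs} {y ∷ ys} (px ∷ sx) (py ∷ sy) f g = cong₂ _∷_ x≡y (sorted-unique sx sy f′ g′)
    where
    x≡y : x ≡ y
    x≡y with f (here refl) | g (here refl)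
    ... | here e | _ = e
    ... | there _ | here e = sym e
    ... | there p | there q = ⊥-elim (ℕP.<-asym (All.lookup py p) (All.lookup px q))
    f′ : ∀ {k} → k ∈ xs → k ∈ ys
    f′ m with f (there m)
    ... | there q = q
    ... | here e = ⊥-elim (ℕP.<⇒≢ (All.lookup px m) (trans x≡y (sym e)))
    g′ : ∀ {k} → k ∈ ys → k ∈ xs
    g′ m with g (there m)
    ... | there q = q
    ... | here e = ⊥-elim (ℕP.<⇒≢ (All.lookup py m) (trans (sym x≡y) (sym e)))

  linked-at : ∀ x → (∀ i → suc i < length x → at x i < at x (suc i)) → Linked _<_ x
  linked-at [] h = []
  linked-at (a ∷ []) h = [-]
  linked-at (a ∷ b ∷ x) h = h 0 (s≤s z<s) ∷ linked-at (b ∷ x) (λ i l → h (suc i) (s≤s l))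

  increasing-at : ∀ x → (∀ i → suc i < length x → at x i < at x (suc i)) → AllPairs _<_ x
  increasing-at x h = Linked⇒AllPairs ℕP.<-trans (linked-at x h)

  upTo-increasing : ∀ n → AllPairs _<_ (upTo n)
  upTo-increasing n = increasing-at (upTo n) (λ i l → let l′ = subst (suc i <_) (LP.length-upTo n) l in
    subst₂ _<_ (sym (at-upTo n i (ℕP.<-trans (ℕP.n<1+n i) l′))) (sym (at-upTo n (suc i) l′)) (ℕP.n<1+n i))

  no-descent⇒id : ∀ {n x} → IsPerm n x → (∀ j → suc j < n → (at x (suc j) <ᵇ at x j) ≡ false) → x ≡ idP n
  no-descent⇒id {n} {x} p h = sorted-unique
    (increasing-at x (λ i l → let l′ = subst (suc i <_) (perm-length p) l in
       ℕP.≤∧≢⇒< (<ᵇ-false (at x (suc i)) _ (h i l′)) (at-≢ i p l′)))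
    (upTo-increasing n) (PP.∈-resp-↭ p) (PP.∈-resp-↭ (↭-sym p))

  anyᵇ-true : {A : Set} (p : A → Bool) → ∀ xs → anyᵇ p xs ≡ true → ∃ λ x → x ∈ xs × p x ≡ true
  anyᵇ-true p (x ∷ xs) e with p x in q
  ... | true = x , here refl , q
  ... | false with y , m , r ← anyᵇ-true p xs e = y , there m , r

  anyᵇ-∈ : {A : Set} (p : A → Bool) → ∀ xs {x} → x ∈ xs → p x ≡ true → anyᵇ p xs ≡ true
  anyᵇ-∈ p (x ∷ xs) (here refl) e rewrite e = refl
  anyᵇ-∈ p (x ∷ xs) (there m) e with p x
  ... | true = refl
  ... | false = anyᵇ-∈ p xs m e

  ∧-true : ∀ a b → a ∧ b ≡ true → a ≡ true × b ≡ true
  ∧-true true b e = refl , e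

  filterᵇ-∈ : {A : Set} (p : A → Bool) → ∀ xs {y} → y ∈ filterᵇ p xs → y ∈ xs × p y ≡ true
  filterᵇ-∈ p (x ∷ xs) m with p x in eq
  filterᵇ-∈ p (x ∷ xs) (here refl) | true = here refl , eq
  filterᵇ-∈ p (x ∷ xs) (there m) | true with a , b ← filterᵇ-∈ p xs m = there a , b
  ... | false with a , b ← filterᵇ-∈ p xs m = there a , b

  filterᵇ-∈⁺ : {A : Set} (p : A → Bool) → ∀ xs {y} → y ∈ xs → p y ≡ true → y ∈ filterᵇ p xs
  filterᵇ-∈⁺ p (x ∷ xs) (here refl) e rewrite e = here refl
  filterᵇ-∈⁺ p (x ∷ xs) (there m) e with p x
  ... | true = there (filterᵇ-∈⁺ p xs m e)
  ... | false = filterᵇ-∈⁺ p xs m e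

  Letter : ℕ → ℕ → Set
  Letter n i = 1 ≤ i × i < n

  Valid : ℕ → List ℕ → Set
  Valid n = All (Letter n)

  private
    isDescent : Perm → ℕ → Bool
    isDescent x i = at x i <ᵇ at x (i ∸ 1)

    candidates : Perm → List ℕ
    candidates x = map suc (upTo (length x ∸ 1))

    take1-[] : ∀ {A : Set} (xs : List A) → take 1 xs ≡ [] → xs ≡ []
    take1-[] [] e = refl

    take1-∈ : ∀ {A : Set} (xs : List A) {y ys} → take 1 xs ≡ y ∷ ys → y ∈ xs
    take1-∈ (x ∷ xs) refl = here refl

  firstDescent-[] : ∀ {n x} → IsPerm n x → firstDescent x ≡ [] → x ≡ idP n
  firstDescent-[] {n} {x} p e = no-descent⇒id p h
    where
    h : ∀ j → suc j < n → (at x (suc j) <ᵇ at x j) ≡ false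
    h j jn with at x (suc j) <ᵇ at x j in eq
    ... | false = refl
    ... | true with () ← subst (suc j ∈_) (take1-[] _ e) (filterᵇ-∈⁺ (isDescent x) (candidates x)
          (∈-map⁺ suc (∈-upTo⁺ (subst (j <_) (cong (_∸ 1) (sym (perm-length p))) (ℕP.∸-monoˡ-≤ 1 jn)))) eq)

  firstDescent-∷ : ∀ {n x i is} → IsPerm n x → firstDescent x ≡ i ∷ is →
    ∃ λ j → i ≡ suc j × suc j < n × at x (suc j) < at x j
  firstDescent-∷ {n} {x} p e with m , b ← filterᵇ-∈ (isDescent x) (candidates x) (take1-∈ _ e)
    with j , mj , refl ← ∈-map⁻ suc m = j , refl ,
      lt (subst (λ l → j < l ∸ 1) (perm-length p) (∈-upTo⁻ mj)) , <ᵇ-true _ _ b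
    where
    lt : ∀ {n} → j < n ∸ 1 → suc j < n
    lt {suc n} q = s≤s q

  eval-snoc : ∀ n ws i → evalWord n (ws ++ i ∷ []) ≡ rmul (evalWord n ws) i
  eval-snoc n ws i = LP.foldl-++ rmul (idP n) ws (i ∷ [])

  foldl-perm : ∀ {n x} ws → Valid n ws → IsPerm n x → IsPerm n (foldl rmul x ws)
  foldl-perm [] [] p = p
  foldl-perm (suc j ∷ ws) ((s≤s _ , jn) ∷ v) p = foldl-perm ws v (rmul-perm j p jn)

  eval-perm : ∀ n ws → Valid n ws → IsPerm n (evalWord n ws)
  eval-perm n ws v = foldl-perm ws v (perm-id n)

  foldl-lmul : ∀ {n x} a ws → Valid n ws → IsPerm n x → foldl rmul (lmul a x) ws ≡ lmul a (foldl rmul x ws)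
  foldl-lmul a [] [] p = refl
  foldl-lmul {n} {x} a (suc j ∷ ws) ((s≤s _ , jn) ∷ v) p =
    trans (cong (λ y → foldl rmul y ws) (sym (lmul-rmul {n} {x} a j (perm-length p) jn)))
          (foldl-lmul a ws v (rmul-perm j p jn))

  rmul-id : ∀ {n} j → suc j < n → rmul (idP n) (suc j) ≡ lmul (suc j) (idP n)
  rmul-id {n} j jn = trans (rmul-adj (upTo n) j (LP.length-upTo n) jn) (sym (map-tr-upTo j n jn))

  eval-cons : ∀ n i ws → Valid n (i ∷ ws) → evalWord n (i ∷ ws) ≡ lmul i (evalWord n ws)
  eval-cons n (suc j) ws ((s≤s _ , jn) ∷ v) =
    trans (cong (λ y → foldl rmul y ws) (rmul-id j jn)) (foldl-lmul (suc j) ws v (perm-id n))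

  eval-++ : ∀ n u w → Valid n u → Valid n w → evalWord n (u ++ w) ≡ foldr lmul (evalWord n w) u
  eval-++ n [] w _ _ = refl
  eval-++ n (i ∷ u) w (l ∷ vu) vw = trans (eval-cons n i (u ++ w) (l ∷ AllP.++⁺ vu vw))
    (cong (lmul i) (eval-++ n u w vu vw))

  valid-reverse : ∀ {n} ws → Valid n ws → Valid n (reverse ws)
  valid-reverse ws v = PP.All-resp-↭ (↭-sym (PP.↭-reverse ws)) v

  foldl-cancel : ∀ {n x} ws → Valid n ws → IsPerm n x → foldl rmul (foldl rmul x ws) (reverse ws) ≡ x
  foldl-cancel [] [] p = refl
  foldl-cancel {n} {x} (suc j ∷ ws) ((s≤s _ , jn) ∷ v) p = begin
    foldl rmul y (reverse (suc j ∷ ws))                  ≡⟨ cong (foldl rmul y) (LP.unfold-reverse (suc j) ws) ⟩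
    foldl rmul y (reverse ws ++ suc j ∷ [])              ≡⟨ LP.foldl-++ rmul y (reverse ws) (suc j ∷ []) ⟩
    rmul (foldl rmul y (reverse ws)) (suc j)             ≡⟨ cong (λ y → rmul y (suc j)) (foldl-cancel ws v (rmul-perm j p jn)) ⟩
    rmul (rmul x (suc j)) (suc j)                        ≡⟨ rmul-invol j (perm-length p) jn ⟩
    x ∎
    where
    open ≡-Reasoning
    y = foldl rmul (rmul x (suc j)) ws

  -- The word `reverse a ++ a ++ reverse a′` can be cancelled at either end. This takes the place of
  -- an inverse operation on one-line notation.
  eval-reverse : ∀ n a a′ → Valid n a → Valid n a′ → evalWord n a ≡ evalWord n a′ →
    evalWord n (reverse a) ≡ evalWord n (reverse a′)
  eval-reverse n a a′ va va′ e = trans (sym left) right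
    where
    open ≡-Reasoning
    ra = valid-reverse a va
    ra′ = valid-reverse a′ va′
    left : evalWord n (reverse a ++ (a ++ reverse a′)) ≡ evalWord n (reverse a)
    left = begin
      evalWord n (reverse a ++ (a ++ reverse a′))               ≡⟨ eval-++ n (reverse a) _ ra (AllP.++⁺ va ra′) ⟩
      foldr lmul (evalWord n (a ++ reverse a′)) (reverse a)     ≡⟨ cong (λ y → foldr lmul y (reverse a)) (begin
          evalWord n (a ++ reverse a′)                          ≡⟨ LP.foldl-++ rmul (idP n) a (reverse a′) ⟩
          foldl rmul (evalWord n a) (reverse a′)                ≡⟨ cong (λ y → foldl rmul y (reverse a′)) e ⟩
          foldl rmul (evalWord n a′) (reverse a′)               ≡⟨ foldl-cancel a′ va′ (perm-id n) ⟩
          evalWord n [] ∎) ⟩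
      foldr lmul (evalWord n []) (reverse a)                    ≡⟨ eval-++ n (reverse a) [] ra [] ⟨
      evalWord n (reverse a ++ [])                              ≡⟨ cong (evalWord n) (LP.++-identityʳ (reverse a)) ⟩
      evalWord n (reverse a) ∎
    right : evalWord n (reverse a ++ (a ++ reverse a′)) ≡ evalWord n (reverse a′)
    right = begin
      evalWord n (reverse a ++ (a ++ reverse a′))                 ≡⟨ LP.foldl-++ rmul (idP n) (reverse a) _ ⟩
      foldl rmul (evalWord n (reverse a)) (a ++ reverse a′)       ≡⟨ LP.foldl-++ rmul _ a (reverse a′) ⟩
      foldl rmul (foldl rmul (evalWord n (reverse a)) a) (reverse a′)
        ≡⟨ cong (λ b → foldl rmul (foldl rmul (evalWord n (reverse a)) b) (reverse a′)) (LP.reverse-involutive a) ⟨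
      foldl rmul (foldl rmul (evalWord n (reverse a)) (reverse (reverse a))) (reverse a′)
        ≡⟨ cong (λ y → foldl rmul y (reverse a′)) (foldl-cancel (reverse a) ra (perm-id n)) ⟩
      evalWord n (reverse a′) ∎

  len-increasing : ∀ {xs} → AllPairs _<_ xs → len xs ≡ 0
  len-increasing [] = refl
  len-increasing {x ∷ xs} (px ∷ s) = cong₂ _+_ (none xs px) (len-increasing s)
    where
    none : ∀ ys → All (x <_) ys → cnt (_<ᵇ x) ys ≡ 0
    none [] [] = refl
    none (y ∷ ys) (py ∷ pys) rewrite <ᵇ-f {y} {x} (ℕP.<⇒≤ py) = none ys pys

  len-id : ∀ n → len (idP n) ≡ 0
  len-id n = len-increasing (upTo-increasing n)

  redWordF-correct : ∀ {n} f x → IsPerm n x → len x ≡ f →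
    evalWord n (redWordF f x) ≡ x × length (redWordF f x) ≡ f × Valid n (redWordF f x)
  redWordF-correct {n} zero x p e = sym (no-descent⇒id p h) , refl , []
    where
    h : ∀ j → suc j < n → (at x (suc j) <ᵇ at x j) ≡ false
    h j jn with at x (suc j) <ᵇ at x j in eq
    ... | false = refl
    ... | true with () ← trans (sym e) (rmul-down j p jn (<ᵇ-true _ _ eq))
  redWordF-correct {n} (suc f) x p e with firstDescent x in eq
  ... | [] with () ← trans (sym e) (trans (cong len (firstDescent-[] p eq)) (len-id n))
  ... | i ∷ is with j , refl , jn , lt ← firstDescent-∷ p eq
    with a , b , c ← redWordF-correct f (rmul x (suc j)) (rmul-perm j p jn)
           (ℕP.suc-injective (trans (sym (rmul-down j p jn lt)) e)) =
    trans (eval-snoc n (redWordF f (rmul x (suc j))) (suc j)) (trans (cong (λ y → rmul y (suc j)) a) (rmul-invol j (perm-length p) jn)) ,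
    trans (LP.length-++ (redWordF f (rmul x (suc j)))) (trans (ℕP.+-comm _ 1) (cong suc b)) ,
    AllP.++⁺ c ((s≤s z≤n , jn) ∷ [])

  Reduced : ℕ → List ℕ → Set
  Reduced n u = Valid n u × len (evalWord n u) ≡ length u

  redWord-eval : ∀ {n x} → IsPerm n x → evalWord n (redWord x) ≡ x
  redWord-eval {n} {x} p = proj₁ (redWordF-correct (len x) x p refl)

  redWord-reduced : ∀ {n x} → IsPerm n x → Reduced n (redWord x)
  redWord-reduced {n} {x} p with a , b , c ← redWordF-correct (len x) x p refl = c , trans (cong len a) (sym b)

  dl-dec : ∀ {n x} j → IsPerm n x → suc j < n →
    (dl (suc j) x ≡ true × len x ≡ suc (len (lmul (suc j) x))) ⊎
    (dl (suc j) x ≡ false × len (lmul (suc j) x) ≡ suc (len x))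
  dl-dec {n} {x} j p jn with before (suc j) j x in eq
  ... | true = inj₁ (trans (dl-before j p jn) eq , lmul-down j p jn eq)
  ... | false = inj₂ (trans (dl-before j p jn) eq , lmul-up j p jn eq)

  dr-dec : ∀ {n x} j → IsPerm n x → suc j < n →
    (dr (suc j) x ≡ true × len x ≡ suc (len (rmul x (suc j)))) ⊎
    (dr (suc j) x ≡ false × len (rmul x (suc j)) ≡ suc (len x))
  dr-dec {n} {x} j p jn with at x (suc j) <ᵇ at x j in eq
  ... | true = inj₁ (trans (dr-at j p jn) eq , rmul-down j p jn (<ᵇ-true _ _ eq))
  ... | false = inj₂ (trans (dr-at j p jn) eq ,
        rmul-up j p jn (ℕP.≤∧≢⇒< (<ᵇ-false (at x (suc j)) _ eq) (at-≢ j p jn)))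

  lmul-len-≤ : ∀ {n x} j → IsPerm n x → suc j < n → len (lmul (suc j) x) ≤ suc (len x)
  lmul-len-≤ j p jn with dl-dec j p jn
  ... | inj₁ (_ , e) = ℕP.≤-trans (ℕP.n≤1+n _) (ℕP.≤-trans (ℕP.≤-reflexive (sym e)) (ℕP.n≤1+n _))
  ... | inj₂ (_ , e) = ℕP.≤-reflexive e

  len-eval-≤ : ∀ n u → Valid n u → len (evalWord n u) ≤ length u
  len-eval-≤ n [] [] = ℕP.≤-reflexive (len-id n)
  len-eval-≤ n (suc j ∷ u) v@((s≤s _ , jn) ∷ vu) = subst (λ y → len y ≤ suc (length u)) (sym (eval-cons n (suc j) u v))
    (ℕP.≤-trans (lmul-len-≤ j (eval-perm n u vu) jn) (s≤s (len-eval-≤ n u vu)))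

  reduced-tail : ∀ n i u → Reduced n (i ∷ u) → Reduced n u × dl i (evalWord n u) ≡ false
  reduced-tail n (suc j) u (v@((s≤s _ , jn) ∷ vu) , e) with dl-dec j (eval-perm n u vu) jn | len-eval-≤ n u vu
  ... | inj₁ (_ , e′) | le = ⊥-elim (ℕP.<-irrefl refl (ℕP.≤-trans
        (ℕP.≤-reflexive (trans (cong suc (sym (trans (sym (cong len (eval-cons n (suc j) u v))) e))) (sym e′)))
        (ℕP.≤-trans le (ℕP.n≤1+n _))))
  ... | inj₂ (d , e′) | le = (vu , ℕP.suc-injective (trans (sym e′) (trans (sym (cong len (eval-cons n (suc j) u v))) e))) , d

  -- One inequality is general. For the other, take a reduced word `b` of the reversed product:
  -- `reverse b` evaluates to the same element as `a`, so `b` cannot be shorter than the reduced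
  -- word `a`.
  reduced-reverse : ∀ n a → Reduced n a → Reduced n (reverse a)
  reduced-reverse n a (va , ea) = ra , ℕP.≤-antisym (len-eval-≤ n (reverse a) ra)
    (begin
      length (reverse a)                 ≡⟨ LP.length-reverse a ⟩
      length a                           ≡⟨ ea ⟨
      len (evalWord n a)                 ≡⟨ cong (len ∘ evalWord n) (LP.reverse-involutive a) ⟨
      len (evalWord n (reverse (reverse a)))
        ≡⟨ cong len (eval-reverse n (reverse a) b ra vb (sym (redWord-eval py))) ⟩
      len (evalWord n (reverse b))       ≤⟨ len-eval-≤ n (reverse b) (valid-reverse b vb) ⟩
      length (reverse b)                 ≡⟨ LP.length-reverse b ⟩
      length b                           ≡⟨ eb ⟨
      len (evalWord n b)                 ≡⟨ cong len (redWord-eval py) ⟩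
      len y ∎)
    where
    open ℕP.≤-Reasoning
    ra = valid-reverse a va
    y = evalWord n (reverse a)
    py = eval-perm n (reverse a) ra
    b = redWord y
    vb = proj₁ (redWord-reduced py)
    eb = proj₂ (redWord-reduced py)

  unique-↭ : {A : Set} {xs ys : List A} → Unique xs → Unique ys →
    (∀ {x} → x ∈ xs → x ∈ ys) → (∀ {x} → x ∈ ys → x ∈ xs) → xs ↭ ys
  unique-↭ {xs = []} {[]} _ _ f g = refl
  unique-↭ {xs = []} {y ∷ ys} _ _ f g with () ← g (here refl)
  unique-↭ {A} {x ∷ xs} {ys} (px ∷ ux) uy f g with ps , qs , refl ← ∈-∃++ (f (here refl)) = 
    ↭-trans (prep x (unique-↭ ux uy″ f′ g′)) (↭-sym (PP.shift x ps qs))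
    where
    uy′ : Unique (x ∷ ps ++ qs)
    uy′ = PS.Unique-resp-↭ (setoid A) (↭⇒↭ₛ (PP.shift x ps qs)) uy
    uy″ : Unique (ps ++ qs)
    uy″ with _ ∷ u ← uy′ = u
    x∉ : x ∉ ps ++ qs
    x∉ with p ∷ _ ← uy′ = λ m → All.lookup p m refl
    f′ : ∀ {z} → z ∈ xs → z ∈ ps ++ qs
    f′ m with PP.∈-resp-↭ (PP.shift x ps qs) (f (there m))
    ... | here e = ⊥-elim (All.lookup px m (sym e))
    ... | there q = q
    g′ : ∀ {z} → z ∈ ps ++ qs → z ∈ xs
    g′ m with g (PP.∈-resp-↭ (↭-sym (PP.shift x ps qs)) (there m))
    ... | here refl = ⊥-elim (x∉ m)
    ... | there q = q

  ∈-concatMap-intro : {A B : Set} (f : A → List B) → ∀ xs {x y} → x ∈ xs → y ∈ f x → y ∈ concatMap f xs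
  ∈-concatMap-intro f (x ∷ xs) (here refl) m = ∈-++⁺ˡ m
  ∈-concatMap-intro f (x ∷ xs) (there p) m = ∈-++⁺ʳ (f x) (∈-concatMap-intro f xs p m)

  ∈-concatMap-elim : {A B : Set} (f : A → List B) → ∀ xs {y} → y ∈ concatMap f xs → ∃ λ x → x ∈ xs × y ∈ f x
  ∈-concatMap-elim f (x ∷ xs) m with ∈-++⁻ (f x) m
  ... | inj₁ p = x , here refl , p
  ... | inj₂ p with z , a , b ← ∈-concatMap-elim f xs p = z , there a , b

  private
    delete : ℕ → List ℕ → List ℕ
    delete a [] = []
    delete a (b ∷ bs) = if b ≡ᵇ a then bs else b ∷ delete a bs

    insertAll-delete : ∀ a ys → a ∉ ys → ∀ {y} → y ∈ insertAll a ys → delete a y ≡ ys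
    insertAll-delete a [] ne (here refl) rewrite ≡ᵇ-refl a = refl
    insertAll-delete a (b ∷ bs) ne (here refl) rewrite ≡ᵇ-refl a = refl
    insertAll-delete a (b ∷ bs) ne (there m) with z , mz , refl ← ∈-map⁻ (b ∷_) m
      rewrite ≡ᵇ-ne {b} {a} (λ e → ne (here (sym e))) = cong (b ∷_) (insertAll-delete a bs (ne ∘ there) mz)

    insertAll-unique : ∀ a ys → a ∉ ys → Unique (insertAll a ys)
    insertAll-unique a [] ne = [] ∷ []
    insertAll-unique a (b ∷ bs) ne =
      All.tabulate (λ {y} m e → let z , mz , e′ = ∈-map⁻ (b ∷_) m in ne (here (LP.∷-injectiveˡ (trans e e′))))
      ∷ UP.map⁺ (λ e → LP.∷-injectiveʳ e) (insertAll-unique a bs (ne ∘ there))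

    insertAll-↭ : ∀ a ys {y} → y ∈ insertAll a ys → y ↭ a ∷ ys
    insertAll-↭ a [] (here refl) = refl
    insertAll-↭ a (b ∷ bs) (here refl) = refl
    insertAll-↭ a (b ∷ bs) (there m) with z , mz , refl ← ∈-map⁻ (b ∷_) m =
      ↭-trans (prep b (insertAll-↭ a bs mz)) (swap b a refl)

    ∈-insertAll : ∀ a ps qs → ps ++ a ∷ qs ∈ insertAll a (ps ++ qs)
    ∈-insertAll a [] [] = here refl
    ∈-insertAll a [] (b ∷ qs) = here refl
    ∈-insertAll a (p ∷ ps) qs = there (∈-map⁺ (p ∷_) (∈-insertAll a ps qs))

    -- The map `g` recovers `x` from every member of `f x`, which makes the lists for distinct `x`
    -- disjoint.
    concatMap-unique : {A B : Set} (f : A → List B) (g : B → A) → ∀ xs →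
      (∀ {x y} → x ∈ xs → y ∈ f x → g y ≡ x) → (∀ {x} → x ∈ xs → Unique (f x)) → Unique xs → Unique (concatMap f xs)
    concatMap-unique f g [] h k [] = []
    concatMap-unique f g (x ∷ xs) h k (px ∷ u) = UP.++⁺ (k (here refl))
      (concatMap-unique f g xs (h ∘ there) (k ∘ there) u)
      (λ (a , b) → let z , mz , mb = ∈-concatMap-elim f xs b in
         All.lookup px mz (trans (sym (h (here refl) a)) (h (there mz) mb)))

    permsOf-↭ : ∀ xs {y} → y ∈ permsOf xs → y ↭ xs
    permsOf-↭ [] (here refl) = refl
    permsOf-↭ (a ∷ xs) m with z , mz , my ← ∈-concatMap-elim (insertAll a) (permsOf xs) m =
      ↭-trans (insertAll-↭ a z my) (prep a (permsOf-↭ xs mz))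

    ∈-permsOf : ∀ xs {y} → y ↭ xs → y ∈ permsOf xs
    ∈-permsOf [] p rewrite PP.↭-empty-inv p = here refl
    ∈-permsOf (a ∷ xs) p with ps , qs , refl ← ∈-∃++ (PP.∈-resp-↭ (↭-sym p) (here refl)) =
      ∈-concatMap-intro (insertAll a) (permsOf xs)
        (∈-permsOf xs (PP.drop-∷ (↭-trans (↭-sym (PP.shift a ps qs)) p))) (∈-insertAll a ps qs)

    permsOf-unique : ∀ xs → Unique xs → Unique (permsOf xs)
    permsOf-unique [] _ = [] ∷ []
    permsOf-unique (a ∷ xs) (pa ∷ u) = concatMap-unique (insertAll a) (delete a) (permsOf xs)
        (λ mx my → insertAll-delete a _ (a∉ mx) my) (λ mx → insertAll-unique a _ (a∉ mx)) (permsOf-unique xs u)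
      where
      a∉ : ∀ {x} → x ∈ permsOf xs → a ∉ x
      a∉ mx ma = All-∉ pa (PP.∈-resp-↭ (permsOf-↭ xs mx) ma)

  ∈-perms : ∀ {n x} → IsPerm n x → x ∈ perms n
  ∈-perms {n} = ∈-permsOf (upTo n)

  perms-IsPerm : ∀ {n x} → x ∈ perms n → IsPerm n x
  perms-IsPerm {n} = permsOf-↭ (upTo n)

  perms-unique : ∀ n → Unique (perms n)
  perms-unique n = permsOf-unique (upTo n) (UP.upTo⁺ n)

  sumZ-∈-cong : {A : Set} {φ ψ : A → ℤ} → ∀ xs → (∀ x → x ∈ xs → φ x ≡ ψ x) → sumZ φ xs ≡ sumZ ψ xs
  sumZ-∈-cong [] eq = refl
  sumZ-∈-cong (x ∷ xs) eq = cong₂ ℤ._+_ (eq x (here refl)) (sumZ-∈-cong xs (λ y m → eq y (there m)))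

  sumZ-↭ : {A : Set} (φ : A → ℤ) {xs ys : List A} → xs ↭ ys → sumZ φ xs ≡ sumZ φ ys
  sumZ-↭ φ refl = refl
  sumZ-↭ φ (prep x p) = cong (λ k → φ x ℤ.+ k) (sumZ-↭ φ p)
  sumZ-↭ φ (swap {xs} {ys} x y p) = trans (cong (λ k → φ x ℤ.+ (φ y ℤ.+ k)) (sumZ-↭ φ p))
    (trans (sym (ℤP.+-assoc (φ x) (φ y) _)) (trans (cong (λ k → k ℤ.+ sumZ φ ys) (ℤP.+-comm (φ x) (φ y))) (ℤP.+-assoc (φ y) (φ x) _)))
  sumZ-↭ φ (Permutation.trans p q) = trans (sumZ-↭ φ p) (sumZ-↭ φ q)

  sumZ-perms-cong : ∀ {n} {φ ψ : Perm → ℤ} → (∀ x → IsPerm n x → φ x ≡ ψ x) → sumZ φ (perms n) ≡ sumZ ψ (perms n)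
  sumZ-perms-cong {n} h = sumZ-∈-cong (perms n) (λ x m → h x (perms-IsPerm m))

  sumZ-perms-involution : ∀ {n} (σ : Perm → Perm) → (∀ {x} → IsPerm n x → IsPerm n (σ x)) →
    (∀ {x} → IsPerm n x → σ (σ x) ≡ x) → ∀ φ → sumZ φ (perms n) ≡ sumZ (φ ∘ σ) (perms n)
  sumZ-perms-involution {n} σ cl inv φ = trans (sumZ-↭ φ (unique-↭ (perms-unique n) um to from)) (sumZ-map φ σ (perms n))
    where
    uniqueMap : ∀ xs → (∀ {x} → x ∈ xs → IsPerm n x) → Unique xs → Unique (map σ xs)
    uniqueMap [] h [] = []
    uniqueMap (x ∷ xs) h (px ∷ u) = All.tabulate (λ m e → let z , mz , e′ = ∈-map⁻ σ m in
        All.lookup px mz (trans (sym (inv (h (here refl)))) (trans (cong σ (trans e e′)) (inv (h (there mz))))))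
      ∷ uniqueMap xs (h ∘ there) u
    um = uniqueMap (perms n) perms-IsPerm (perms-unique n)
    to : ∀ {x} → x ∈ perms n → x ∈ map σ (perms n)
    to m = subst (_∈ map σ (perms n)) (inv (perms-IsPerm m)) (∈-map⁺ σ (∈-perms (cl (perms-IsPerm m))))
    from : ∀ {x} → x ∈ map σ (perms n) → x ∈ perms n
    from m with z , mz , refl ← ∈-map⁻ σ m = ∈-perms (cl (perms-IsPerm mz))

  sumZ-single : {A : Set} (φ : A → ℤ) → ∀ xs {x} → Unique xs → x ∈ xs → (∀ y → y ∈ xs → y ≢ x → φ y ≡ 0ℤ) → sumZ φ xs ≡ φ x
  sumZ-single φ (x ∷ xs) (px ∷ u) (here refl) h =
    trans (cong (λ k → φ x ℤ.+ k) (trans (sumZ-∈-cong xs (λ y m → h y (there m) (λ e → All.lookup px m (sym e))))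
       (sumZ-0 (λ _ → refl) xs))) (ℤP.+-identityʳ (φ x))
  sumZ-single φ (x ∷ xs) (px ∷ u) (there m) h = trans (cong (λ k → k ℤ.+ sumZ φ xs) (h x (here refl) (λ e → All.lookup px m e)))
    (trans (ℤP.+-identityˡ _) (sumZ-single φ xs u m (λ y m′ → h y (there m′))))

-- Generators acting on coefficient functions, and the bar images of the T_x

module HeckeOperators where
  open import Data.Nat as ℕ using (suc; z≤n)
  open import Data.Integer using (+_; -_; 0ℤ; 1ℤ; _+_; _-_; -1ℤ)
  open import Data.Integer.Solver using (module +-*-Solver)
  open LaurentCoefficients
  open Permutations
  open Words

  open +-*-Solver

  private
    +2-2 : ∀ e → (e + + 2) - + 2 ≡ e
    +2-2 = solve 1 (λ e → (e :+ con (+ 2)) :- con (+ 2) := e) refl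

    -2+2 : ∀ e → (e - + 2) + + 2 ≡ e
    -2+2 = solve 1 (λ e → (e :- con (+ 2)) :+ con (+ 2) := e) refl

  Fn : Set
  Fn = Perm → ℤ → ℤ

  coefs : Hk → Fn
  coefs h x e = coefL (h x) e

  desc : (Perm → Perm) → Perm → Bool
  desc σ x = len (σ x) ℕ.<ᵇ len x

  -- The action of a simple reflection (σ is left or right multiplication by it) on coefficient functions, q being a shift of exponents by 2.
  Act : (Perm → Perm) → Fn → Fn
  Act σ g x e = if desc σ x then g (σ x) e + (g x (e - + 2) - g x e) else g (σ x) (e - + 2)

  ActI : (Perm → Perm) → Fn → Fn
  ActI σ g x e = if desc σ x then g (σ x) (e + + 2) else g (σ x) e + (g x (e + + 2) - g x e)

  -- Left and right multiplication by a generator share these properties, so every argument about a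
  -- single generator is given once for both sides.
  record IsReflection (n : ℕ) (σ : Perm → Perm) : Set where
    field
      closed : ∀ {x} → IsPerm n x → IsPerm n (σ x)
      invol : ∀ {x} → IsPerm n x → σ (σ x) ≡ x
      cases : ∀ {x} → IsPerm n x → (desc σ x ≡ true × len x ≡ suc (len (σ x))) ⊎ (desc σ x ≡ false × len (σ x) ≡ suc (len x))

    flip : ∀ {x} → IsPerm n x → desc σ (σ x) ≡ not (desc σ x)
    flip {x} p with cases p
    ... | inj₁ (d , e) rewrite d | invol p | e = <ᵇ-f {suc (len (σ x))} {len (σ x)} (ℕP.n≤1+n _)
    ... | inj₂ (d , e) rewrite d | invol p | e = <ᵇ-t {len x} {suc (len x)} (ℕP.n<1+n _)

    flip-t : ∀ {x} → IsPerm n x → desc σ x ≡ true → desc σ (σ x) ≡ false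
    flip-t p d = trans (flip p) (cong not d)

    flip-f : ∀ {x} → IsPerm n x → desc σ x ≡ false → desc σ (σ x) ≡ true
    flip-f p d = trans (flip p) (cong not d)

    len-t : ∀ {x} → IsPerm n x → desc σ x ≡ true → len x ≡ suc (len (σ x))
    len-t p d with cases p
    ... | inj₁ (_ , e) = e
    ... | inj₂ (d′ , _) with () ← trans (sym d) d′

    len-f : ∀ {x} → IsPerm n x → desc σ x ≡ false → len (σ x) ≡ suc (len x)
    len-f p d with cases p
    ... | inj₁ (d′ , _) with () ← trans (sym d) d′
    ... | inj₂ (_ , e) = e

  open IsReflection

  rmulʳ : ℕ → Perm → Perm
  rmulʳ i x = rmul x i

  lmul-reflection : ∀ {n i} → Letter n i → IsReflection n (lmul i)
  lmul-reflection {n} {suc j} (_ , jn) = record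
    { closed = λ p → lmul-perm j p jn ; invol = λ {x} _ → lmul-invol (suc j) x ; cases = λ p → dl-dec j p jn }

  rmul-reflection : ∀ {n i} → Letter n i → IsReflection n (rmulʳ i)
  rmul-reflection {n} {suc j} (_ , jn) = record
    { closed = λ p → rmul-perm j p jn ; invol = λ p → rmul-invol j (perm-length p) jn ; cases = λ p → dr-dec j p jn }

  infix 4 _≈[_]_
  _≈[_]_ : Fn → ℕ → Fn → Set
  g ≈[ n ] g′ = ∀ x → IsPerm n x → ∀ e → g x e ≡ g′ x e

  ≈-sym : ∀ {n g g′} → g ≈[ n ] g′ → g′ ≈[ n ] g
  ≈-sym h x p e = sym (h x p e)

  ≈-trans : ∀ {n g g′ g″} → g ≈[ n ] g′ → g′ ≈[ n ] g″ → g ≈[ n ] g″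
  ≈-trans h k x p e = trans (h x p e) (k x p e)

  Act-cong : ∀ {n σ g g′} → IsReflection n σ → g ≈[ n ] g′ → Act σ g ≈[ n ] Act σ g′
  Act-cong {σ = σ} I h x p e rewrite h (σ x) (closed I p) e | h x p (e - + 2) | h x p e | h (σ x) (closed I p) (e - + 2) = refl

  ActI-cong : ∀ {n σ g g′} → IsReflection n σ → g ≈[ n ] g′ → ActI σ g ≈[ n ] ActI σ g′
  ActI-cong {σ = σ} I h x p e rewrite h (σ x) (closed I p) e | h x p (e + + 2) | h x p e | h (σ x) (closed I p) (e + + 2) = refl

  ActI-Act : ∀ {n σ} → IsReflection n σ → ∀ g → ActI σ (Act σ g) ≈[ n ] g
  ActI-Act {n} {σ} I g x p e with desc σ x in eq
  ... | true rewrite flip-t I p eq | invol I p | +2-2 e = refl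
  ... | false rewrite flip-f I p eq | invol I p | +2-2 e =
    solve 4 (λ a b c d → (a :+ (b :- c)) :+ (c :- b) := a) refl (g x e) (g (σ x) (e - + 2)) (g (σ x) e) 0ℤ

  Act-ActI : ∀ {n σ} → IsReflection n σ → ∀ g → Act σ (ActI σ g) ≈[ n ] g
  Act-ActI {n} {σ} I g x p e with desc σ x in eq
  ... | true rewrite flip-t I p eq | invol I p | -2+2 e =
    solve 3 (λ a b c → (a :+ (b :- c)) :+ (c :- b) := a) refl (g x e) (g (σ x) (e + + 2)) (g (σ x) e)
  ... | false rewrite flip-f I p eq | invol I p | -2+2 e = refl

  record Commuting (n : ℕ) (σ τ : Perm → Perm) : Set where
    field
      commute : ∀ {x} → IsPerm n x → σ (τ x) ≡ τ (σ x)
      dichotomy : ∀ {x} → IsPerm n x → (σ x ≡ τ x) ⊎ ((desc σ (τ x) ≡ desc σ x) × (desc τ (σ x) ≡ desc τ x))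

  lmul-rmul-commuting : ∀ {n i j} → Letter n i → Letter n j → Commuting n (lmul i) (rmulʳ j)
  lmul-rmul-commuting {n} {suc i} {suc j} (_ , il) (_ , jl) = record
    { commute = λ {x} p → lmul-rmul {n} {x} (suc i) j (perm-length p) jl
    ; dichotomy = λ p → lmul-rmul-dichotomy p il jl }

  Act-t : ∀ σ g x e → desc σ x ≡ true → Act σ g x e ≡ g (σ x) e + (g x (e - + 2) - g x e)
  Act-t σ g x e d rewrite d = refl

  Act-f : ∀ σ g x e → desc σ x ≡ false → Act σ g x e ≡ g (σ x) (e - + 2)
  Act-f σ g x e d rewrite d = refl

  private
    -- The double action in the case σ x = τ x. Only `x` and its common image occur, and the formula
    -- is the same whichever operator acts first.
    Act-both : Bool → Fn → Perm → Perm → ℤ → ℤ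
    Act-both b g x y e = if b
      then g x (e - + 2) + ((g y (e - + 2) + (g x (e - + 2 - + 2) - g x (e - + 2))) - (g y e + (g x (e - + 2) - g x e)))
      else g x (e - + 2) + (g y (e - + 2 - + 2) - g y (e - + 2))

    Act-Act-same : ∀ {n σ τ x} → IsReflection n τ → IsPerm n x → σ x ≡ τ x →
      ∀ g e → Act σ (Act τ g) x e ≡ Act-both (desc τ x) g x (τ x) e
    Act-Act-same {n} {σ} {τ} {x} J p eq g e = go (desc τ x) refl
      where
      go : ∀ b → desc τ x ≡ b → Act σ (Act τ g) x e ≡ Act-both b g x (τ x) e
      go true d = trans (Act-t σ (Act τ g) x e (trans (cong (λ y → len y ℕ.<ᵇ len x) eq) d))
          (cong₂ _+_ (trans (cong (λ y → Act τ g y e) eq) (trans (Act-f τ g (τ x) e (flip-t J p d)) (cong (λ y → g y (e - + 2)) (invol J p))))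
            (cong₂ _-_ (Act-t τ g x (e - + 2) d) (Act-t τ g x e d)))
      go false d = trans (Act-f σ (Act τ g) x e (trans (cong (λ y → len y ℕ.<ᵇ len x) eq) d))
          (trans (cong (λ y → Act τ g y (e - + 2)) eq) (trans (Act-t τ g (τ x) (e - + 2) (flip-f J p d))
            (cong (λ y → g y (e - + 2) + (g (τ x) (e - + 2 - + 2) - g (τ x) (e - + 2))) (invol J p))))

  -- Associativity of the Hecke algebra on generators. If σ x = τ x, both sides are `Act-both`;
  -- otherwise neither multiplication changes the descent status of the other, and each of the four
  -- cases expands to the same terms.
  Act-comm : ∀ {n σ τ} → IsReflection n σ → IsReflection n τ → Commuting n σ τ →
    ∀ g → Act σ (Act τ g) ≈[ n ] Act τ (Act σ g)
  Act-comm {n} {σ} {τ} I J C g x p e with Commuting.commute C p | Commuting.dichotomy C p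
  ... | cm | inj₁ eq = trans (Act-Act-same {σ = σ} {τ = τ} J p eq g e) (trans
      (cong (λ y → Act-both (len y ℕ.<ᵇ len x) g x y e) (sym eq)) (sym (Act-Act-same {σ = τ} {τ = σ} I p (sym eq) g e)))
  ... | cm | inj₂ (dστ , dτσ) with desc σ x | desc τ x
  ... | true | true rewrite dστ | dτσ | cm =
    solve 8 (λ a b c d f k l m → (a :+ (b :- c)) :+ ((d :+ (f :- k)) :- (l :+ (k :- m))) :=
                                 (a :+ (d :- l)) :+ ((b :+ (f :- k)) :- (c :+ (k :- m)))) refl
       (g (τ (σ x)) e) (g (σ x) (e - + 2)) (g (σ x) e) (g (τ x) (e - + 2)) (g x (e - + 2 - + 2)) (g x (e - + 2)) (g (τ x) e) (g x e)
  ... | true | false rewrite dστ | dτσ | cm = refl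
  ... | false | true rewrite dστ | dτσ | cm = refl
  ... | false | false rewrite dστ | dτσ | cm = refl

  -- Conjugating a commutation relation by the inverse of one of the operators.
  private
    conj : ∀ {n σ} {A : Fn → Fn} → IsReflection n σ → (∀ {g g′} → g ≈[ n ] g′ → A g ≈[ n ] A g′) →
      (∀ g → A (Act σ g) ≈[ n ] Act σ (A g)) → ∀ g → A (ActI σ g) ≈[ n ] ActI σ (A g)
    conj {A = A} I cg c g = ≈-trans (≈-sym (ActI-Act I (A (ActI _ g))))
      (ActI-cong I (≈-trans (≈-sym (c (ActI _ g))) (cg (Act-ActI I g))))

  Act-ActI-comm : ∀ {n σ τ} → IsReflection n σ → IsReflection n τ → Commuting n σ τ →
    ∀ g → Act σ (ActI τ g) ≈[ n ] ActI τ (Act σ g)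
  Act-ActI-comm {σ = σ} {τ = τ} I J C = conj {A = Act σ} J (Act-cong I) (Act-comm I J C)

  ActI-comm : ∀ {n σ τ} → IsReflection n σ → IsReflection n τ → Commuting n σ τ →
    ∀ g → ActI σ (ActI τ g) ≈[ n ] ActI τ (ActI σ g)
  ActI-comm {σ = σ} {τ = τ} I J C g = ≈-sym (conj {A = ActI τ} I (ActI-cong J) (λ g → ≈-sym (Act-ActI-comm I J C g)) g)

  eqL-true : ∀ x y → eqL x y ≡ true → x ≡ y
  eqL-true [] [] e = refl
  eqL-true (a ∷ x) (b ∷ y) e with a ℕ.≡ᵇ b in q
  ... | true = cong₂ _∷_ (≡ᵇ-true a b q) (eqL-true x y e)

  eqL-refl : ∀ x → eqL x x ≡ true
  eqL-refl [] = refl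
  eqL-refl (a ∷ x) rewrite ≡ᵇ-refl a = eqL-refl x

  eqL-ne : ∀ {x y} → x ≢ y → eqL x y ≡ false
  eqL-ne {x} {y} ne with eqL x y in e
  ... | true = ⊥-elim (ne (eqL-true x y e))
  ... | false = refl

  basis : Perm → Fn
  basis y x e = if eqL x y then δ e 0ℤ else 0ℤ

  basis-self : ∀ y e → basis y y e ≡ δ e 0ℤ
  basis-self y e rewrite eqL-refl y = refl

  basis-ne : ∀ {x y} → x ≢ y → ∀ e → basis y x e ≡ 0ℤ
  basis-ne ne e rewrite eqL-ne ne = refl

  Te-coefs : ∀ n → coefs (Te n) ≈[ n ] basis (idP n)
  Te-coefs n x p e with eqL x (idP n)
  ... | true = trans (coefL-pairing oneL e) (pairing-mono 0ℤ (δ e))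
  ... | false = refl

  basis-reflect : ∀ {n σ x y} → IsReflection n σ → IsPerm n x → IsPerm n y → ∀ e → basis y (σ x) e ≡ basis (σ y) x e
  basis-reflect {n} {σ} {x} {y} I px py e = cong (λ b → if b then δ e 0ℤ else 0ℤ)
    (iff-Bool (λ t → trans (cong (λ z → eqL z (σ y)) (trans (sym (invol I px)) (cong σ (eqL-true _ _ t)))) (eqL-refl (σ y)))
              (λ t → trans (cong (eqL (σ x)) (trans (sym (invol I py)) (cong σ (sym (eqL-true _ _ t))))) (eqL-refl (σ x))))

  Act-basis : ∀ {n σ y} → IsReflection n σ → IsPerm n y → desc σ y ≡ false → Act σ (basis y) ≈[ n ] basis (σ y)
  Act-basis {n} {σ} {y} I py d x px e with desc σ x in dx
  ... | true = trans (cong₂ (λ a b → a + b) (basis-reflect I px py e)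
        (cong₂ _-_ (basis-ne x≢y (e - + 2)) (basis-ne x≢y e))) (ℤP.+-identityʳ _)
    where
    x≢y : x ≢ y
    x≢y refl = t≢f (trans (sym dx) d)
  ... | false = trans (basis-reflect I px py (e - + 2)) (trans (basis-ne x≢σy (e - + 2)) (sym (basis-ne x≢σy e)))
    where
    x≢σy : x ≢ σ y
    x≢σy refl = t≢f (trans (sym (flip-f I py d)) dx)

  LAct LActI RActI : List ℕ → Fn → Fn
  LAct u g = foldr (λ i → Act (lmul i)) g u
  LActI u g = foldr (λ i → ActI (lmul i)) g u
  RActI u g = foldr (λ i → ActI (rmulʳ i)) g u

  LAct-cong : ∀ {n g g′} u → Valid n u → g ≈[ n ] g′ → LAct u g ≈[ n ] LAct u g′
  LAct-cong [] [] h = h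
  LAct-cong (i ∷ u) (l ∷ v) h = Act-cong (lmul-reflection l) (LAct-cong u v h)

  LActI-cong : ∀ {n g g′} u → Valid n u → g ≈[ n ] g′ → LActI u g ≈[ n ] LActI u g′
  LActI-cong [] [] h = h
  LActI-cong (i ∷ u) (l ∷ v) h = ActI-cong (lmul-reflection l) (LActI-cong u v h)

  RActI-cong : ∀ {n g g′} u → Valid n u → g ≈[ n ] g′ → RActI u g ≈[ n ] RActI u g′
  RActI-cong [] [] h = h
  RActI-cong (i ∷ u) (l ∷ v) h = ActI-cong (rmul-reflection l) (RActI-cong u v h)

  ActI-RActI : ∀ {n i} u → Letter n i → Valid n u → ∀ g → ActI (lmul i) (RActI u g) ≈[ n ] RActI u (ActI (lmul i) g)
  ActI-RActI [] l [] g x p e = refl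
  ActI-RActI (j ∷ u) l (k ∷ v) g = ≈-trans (ActI-comm (lmul-reflection l) (rmul-reflection k) (lmul-rmul-commuting l k) (RActI u g))
    (ActI-cong (rmul-reflection k) (ActI-RActI u l v g))

  Act-RActI : ∀ {n i} u → Letter n i → Valid n u → ∀ g → Act (lmul i) (RActI u g) ≈[ n ] RActI u (Act (lmul i) g)
  Act-RActI [] l [] g x p e = refl
  Act-RActI (j ∷ u) l (k ∷ v) g = ≈-trans (Act-ActI-comm (lmul-reflection l) (rmul-reflection k) (lmul-rmul-commuting l k) (RActI u g))
    (ActI-cong (rmul-reflection k) (Act-RActI u l v g))

  LAct-RActI : ∀ {n} b c → Valid n b → Valid n c → ∀ g → LAct b (RActI c g) ≈[ n ] RActI c (LAct b g)
  LAct-RActI [] c [] vc g x p e = refl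
  LAct-RActI (i ∷ b) c (l ∷ vb) vc g = ≈-trans (Act-cong (lmul-reflection l) (LAct-RActI b c vb vc g)) (Act-RActI c l vc (LAct b g))

  LActI-ActI : ∀ {n i} u → Letter n i → Valid n u → ∀ g → LActI u (ActI (rmulʳ i) g) ≈[ n ] ActI (rmulʳ i) (LActI u g)
  LActI-ActI [] l [] g x p e = refl
  LActI-ActI (j ∷ u) l (k ∷ v) g = ≈-trans (ActI-cong (lmul-reflection k) (LActI-ActI u l v g))
    (ActI-comm (lmul-reflection k) (rmul-reflection l) (lmul-rmul-commuting k l) (LActI u g))

  -- T⁻¹ = q⁻¹ T + (q⁻¹ − 1)
  ActI-Act-formula : ∀ σ g x e → ActI σ g x e ≡ Act σ g x (e + + 2) + (g x (e + + 2) - g x e)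
  ActI-Act-formula σ g x e with desc σ x
  ... | true rewrite +2-2 e = solve 3 (λ a b c → a := (a :+ (b :- c)) :+ (c :- b)) refl (g (σ x) (e + + 2)) (g x e) (g x (e + + 2))
  ... | false rewrite +2-2 e = refl

  desc-id : ∀ n σ → desc σ (idP n) ≡ false
  desc-id n σ = trans (cong (len (σ (idP n)) ℕ.<ᵇ_) (len-id n)) (<ᵇ-f {len (σ (idP n))} z≤n)

  -- On T_e left and right multiplication by a generator agree. This one equality converts a left
  -- product of inverses into the right product over the reversed word.
  ActI-id : ∀ {n i} → Letter n i → ActI (lmul i) (basis (idP n)) ≈[ n ] ActI (rmulʳ i) (basis (idP n))
  ActI-id {n} {i@(suc j)} l@(_ , jn) x p e = trans (ActI-Act-formula (lmul i) (basis (idP n)) x e)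
    (trans (cong (_+ (basis (idP n) x (e + + 2) - basis (idP n) x e)) (begin
       Act (lmul i) (basis (idP n)) x (e + + 2)   ≡⟨ Act-basis (lmul-reflection l) (perm-id n) (desc-id n (lmul i)) x p (e + + 2) ⟩
       basis (lmul i (idP n)) x (e + + 2)         ≡⟨ cong (λ y → basis y x (e + + 2)) (rmul-id j jn) ⟨
       basis (rmulʳ i (idP n)) x (e + + 2)        ≡⟨ Act-basis (rmul-reflection l) (perm-id n) (desc-id n (rmulʳ i)) x p (e + + 2) ⟨
       Act (rmulʳ i) (basis (idP n)) x (e + + 2)  ∎))
     (sym (ActI-Act-formula (rmulʳ i) (basis (idP n)) x e)))
    where open ≡-Reasoning

  LActI-id≈RActI-id : ∀ {n} u → Valid n u → LActI u (basis (idP n)) ≈[ n ] RActI (reverse u) (basis (idP n))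
  LActI-id≈RActI-id [] [] x p e = refl
  LActI-id≈RActI-id {n} (i ∷ u) (l ∷ v) = ≈-trans (ActI-cong (lmul-reflection l) (LActI-id≈RActI-id u v))
    (≈-trans (ActI-RActI (reverse u) l (valid-reverse u v) (basis (idP n)))
    (≈-trans (RActI-cong (reverse u) (valid-reverse u v) (ActI-id l))
     (λ x p e → cong (λ f → f x e) (sym (trans (cong (λ w → RActI w (basis (idP n))) (LP.unfold-reverse i u))
        (LP.foldr-++ (λ i → ActI (rmulʳ i)) (basis (idP n)) (reverse u) (i ∷ [])))))))

  LAct-id : ∀ {n} b → Reduced n b → LAct b (basis (idP n)) ≈[ n ] basis (evalWord n b)
  LAct-id [] r x p e = refl
  LAct-id {n} (i ∷ b) r@((l ∷ v) , _) with r′ , d ← reduced-tail n i b r =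
    ≈-trans (Act-cong (lmul-reflection l) (LAct-id b r′))
    (≈-trans (Act-basis (lmul-reflection l) (eval-perm n b v) d)
      (λ x p e → cong (λ y → basis y x e) (sym (eval-cons n i b (l ∷ v)))))

  LAct-snoc : ∀ u i g → LAct (reverse (i ∷ u)) g ≡ LAct (reverse u) (Act (lmul i) g)
  LAct-snoc u i g = trans (cong (λ w → LAct w g) (LP.unfold-reverse i u)) (LP.foldr-++ (λ i → Act (lmul i)) g (reverse u) (i ∷ []))

  LAct-LActI : ∀ {n} u → Valid n u → ∀ g → LAct (reverse u) (LActI u g) ≈[ n ] g
  LAct-LActI [] [] g x p e = refl
  LAct-LActI {n} (i ∷ u) (l ∷ v) g = ≈-trans (λ x p e → cong (λ f → f x e) (LAct-snoc u i (LActI (i ∷ u) g)))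
    (≈-trans (LAct-cong (reverse u) (valid-reverse u v) (Act-ActI (lmul-reflection l) (LActI u g))) (LAct-LActI u v g))

  LActI-LAct : ∀ {n} u → Valid n u → ∀ g → LActI u (LAct (reverse u) g) ≈[ n ] g
  LActI-LAct [] [] g x p e = refl
  LActI-LAct {n} (i ∷ u) (l ∷ v) g = ≈-trans (λ x p e → cong (λ f → ActI (lmul i) (LActI u f) x e) (LAct-snoc u i g))
    (≈-trans (ActI-cong (lmul-reflection l) (LActI-LAct u v (Act (lmul i) g))) (ActI-Act (lmul-reflection l) g))

  -- Both sides are right multiples of T_e, and left multiplication by T_{x⁻¹} does not depend on the reduced word.
  LActI-word : ∀ {n} a a′ → Reduced n a → Reduced n a′ → evalWord n a ≡ evalWord n a′ →
    LActI a (basis (idP n)) ≈[ n ] LActI a′ (basis (idP n))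
  LActI-word {n} a a′ ra@(va , _) ra′@(va′ , _) eq =
    ≈-trans (LActI-cong a va (≈-sym chain)) (LActI-LAct a va G′)
    where
    T = basis (idP n)
    G′ = LActI a′ T
    vr = valid-reverse a va
    vr′ = valid-reverse a′ va′
    step : ∀ b → Valid n b → LAct b G′ ≈[ n ] RActI (reverse a′) (LAct b T)
    step b vb = ≈-trans (LAct-cong b vb (LActI-id≈RActI-id a′ va′)) (LAct-RActI b (reverse a′) vb vr′ T)
    chain : LAct (reverse a) G′ ≈[ n ] T
    chain = ≈-trans (step (reverse a) vr) (≈-trans (RActI-cong (reverse a′) vr′
       (≈-trans (LAct-id (reverse a) (reduced-reverse n a ra))
       (≈-trans (λ x p e → cong (λ y → basis y x e) (eval-reverse n a a′ va va′ eq))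
         (≈-sym (LAct-id (reverse a′) (reduced-reverse n a′ ra′))))))
      (≈-trans (≈-sym (step (reverse a′) vr′)) (LAct-LActI a′ va′ T)))

  tmul-coefs : ∀ i h x e → coefL (tmul i h x) e ≡ Act (lmul i) (coefs h) x e
  tmul-coefs i h x e with desc (lmul i) x
  ... | true = trans (coefL-++ (h (lmul i x)) _ e) (cong (λ z → coefL (h (lmul i x)) e + z)
        (trans (coefL-mulL ((+ 2 , 1ℤ) ∷ (0ℤ , - 1ℤ) ∷ []) (h x) e)
         (trans (solve 2 (λ a b → con 1ℤ :* a :+ (con -1ℤ :* b :+ con 0ℤ) := a :- b) refl (coefL (h x) (e - + 2)) (coefL (h x) (e - 0ℤ)))
           (cong (λ k → coefL (h x) (e - + 2) - coefL (h x) k) (ℤP.+-identityʳ e)))))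
  ... | false = coefL-mono* (+ 2) (h (lmul i x)) e

  tinv-coefs : ∀ i h x e → coefL (tinv i h x) e ≡ ActI (lmul i) (coefs h) x e
  tinv-coefs i h x e = trans (coefL-++ (scaleH (monoL (- (+ 2))) (tmul i h) x) _ e) (trans
    (cong₂ _+_ (trans (coefL-mono* (- (+ 2)) (tmul i h x) e) (tmul-coefs i h x (e + + 2)))
       (trans (coefL-mulL ((- (+ 2) , 1ℤ) ∷ (0ℤ , - 1ℤ) ∷ []) (h x) e)
         (trans (solve 2 (λ a b → con 1ℤ :* a :+ (con -1ℤ :* b :+ con 0ℤ) := a :- b) refl (coefL (h x) (e + + 2)) (coefL (h x) (e - 0ℤ)))
           (cong (λ k → coefL (h x) (e + + 2) - coefL (h x) k) (ℤP.+-identityʳ e)))))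
    (sym (ActI-Act-formula (lmul i) (coefs h) x e)))

  foldr-tinv : ∀ {n} u → Valid n u → coefs (foldr tinv (Te n) u) ≈[ n ] LActI u (basis (idP n))
  foldr-tinv {n} [] [] = Te-coefs n
  foldr-tinv (i ∷ u) (l ∷ v) = ≈-trans (λ x p e → tinv-coefs i (foldr tinv (Te _) u) x e) (ActI-cong (lmul-reflection l) (foldr-tinv u v))

  Bar : ℕ → Perm → Fn
  Bar n x = coefs (barT n x)

  Bar-word : ∀ {n x} a → IsPerm n x → Reduced n a → evalWord n a ≡ x → Bar n x ≈[ n ] LActI a (basis (idP n))
  Bar-word {n} {x} a p ra eq = ≈-trans (foldr-tinv (redWord x) (proj₁ (redWord-reduced p)))
    (LActI-word (redWord x) a (redWord-reduced p) ra (trans (redWord-eval p) (sym eq)))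

  Bar-lmul : ∀ {n i x} → Letter n i → IsPerm n x → desc (lmul i) x ≡ false → Bar n (lmul i x) ≈[ n ] ActI (lmul i) (Bar n x)
  Bar-lmul {n} {i} {x} l p d = ≈-trans
    (Bar-word (i ∷ redWord x) (closed I p) ((l ∷ v) , trans (cong len ev) (trans (len-f I p d) (cong suc e))) ev)
    (ActI-cong I (≈-sym (Bar-word (redWord x) p (redWord-reduced p) (redWord-eval p))))
    where
    I = lmul-reflection l
    v = proj₁ (redWord-reduced p)
    ev = trans (eval-cons n i (redWord x) (l ∷ v)) (cong (lmul i) (redWord-eval p))
    e : len x ≡ length (redWord x)
    e = trans (sym (cong len (redWord-eval p))) (proj₂ (redWord-reduced p))

  Bar-rmul : ∀ {n i x} → Letter n i → IsPerm n x → desc (rmulʳ i) x ≡ false → Bar n (rmul x i) ≈[ n ] ActI (rmulʳ i) (Bar n x)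
  Bar-rmul {n} {i} {x} l p d = ≈-trans
    (Bar-word (u ++ i ∷ []) (closed I p) (AllP.++⁺ v (l ∷ []) , trans (cong len ev) (trans (len-f I p d)
       (trans (cong suc e) (sym (trans (LP.length-++ u) (ℕP.+-comm _ 1)))))) ev)
    (≈-trans (λ y q k → cong (λ f → f y k) (LP.foldr-++ (λ i → ActI (lmul i)) (basis (idP n)) u (i ∷ [])))
    (≈-trans (LActI-cong u v (ActI-id l)) (≈-trans (LActI-ActI u l v (basis (idP n)))
    (ActI-cong I (≈-sym (Bar-word u p (redWord-reduced p) (redWord-eval p)))))))
    where
    I = rmul-reflection l
    u = redWord x
    v = proj₁ (redWord-reduced p)
    ev : evalWord n (u ++ i ∷ []) ≡ rmul x i
    ev = trans (eval-snoc n u i) (cong (λ y → rmul y i) (redWord-eval p))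
    e : len x ≡ length u
    e = trans (sym (cong len (redWord-eval p))) (proj₂ (redWord-reduced p))

  private
    -- Each letter contributes q^(-1) to the leading coefficient, which counts 2 in exponents of
    -- q^(1/2). If the letter raises `y`, then `y` and its image are both longer than the remaining
    -- word and give nothing. Triangularity with respect to length is enough; Bruhat order does not
    -- enter.
    LActI-tri : ∀ {n} a → Reduced n a → ∀ y → IsPerm n y → length a ℕ.≤ len y →
      ∀ e → LActI a (basis (idP n)) y e ≡ (if eqL y (evalWord n a) then δ (e + + (length a ℕ.+ length a)) 0ℤ else 0ℤ)
    LActI-tri [] r y p le e = cong (λ k → if eqL y _ then δ k 0ℤ else 0ℤ) (sym (ℤP.+-identityʳ e))
    LActI-tri {n} (i ∷ u) r@((l ∷ v) , _) y p le e with r′ , d ← reduced-tail n i u r | desc (lmul i) y in dy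
    ... | true = trans (LActI-tri u r′ (lmul i y) (closed I p)
            (ℕP.≤-pred (ℕP.≤-trans le (ℕP.≤-reflexive (len-t I p dy)))) (e + + 2))
          (cong₂ (λ b k → if b then δ k 0ℤ else 0ℤ) same
            (trans (ℤP.+-assoc e (+ 2) _) (cong (λ k → e + + k) (cong suc (sym (ℕP.+-suc (length u) (length u)))))))
      where
      I = lmul-reflection l
      pe = eval-perm n u v
      same : eqL (lmul i y) (evalWord n u) ≡ eqL y (evalWord n (i ∷ u))
      same = trans (iff-Bool (λ t → trans (cong (λ z → eqL z (lmul i (evalWord n u))) (trans (sym (invol I p)) (cong (lmul i) (eqL-true _ _ t)))) (eqL-refl (lmul i (evalWord n u))))
              (λ t → trans (cong (eqL (lmul i y)) (trans (sym (invol I pe)) (cong (lmul i) (sym (eqL-true _ _ t))))) (eqL-refl (lmul i y))))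
              (cong (eqL y) (sym (eval-cons n i u (l ∷ v))))
    ... | false = trans (cong₂ _+_ (zero′ (lmul i y) (closed I p) lt′ e)
            (cong₂ _-_ (zero′ y p le (e + + 2)) (zero′ y p le e)))
          (sym (cong (λ b → if b then δ (e + + (suc (length u) ℕ.+ suc (length u))) 0ℤ else 0ℤ) (eqL-ne ne)))
      where
      I = lmul-reflection l
      lt′ : suc (length u) ℕ.≤ len (lmul i y)
      lt′ = ℕP.≤-trans le (ℕP.≤-trans (ℕP.n≤1+n _) (ℕP.≤-reflexive (sym (len-f I p dy))))
      zero′ : ∀ y → IsPerm n y → suc (length u) ℕ.≤ len y → ∀ e → LActI u (basis (idP n)) y e ≡ 0ℤ
      zero′ y p lt e = trans (LActI-tri u r′ y p (ℕP.<⇒≤ lt) e)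
        (cong (λ b → if b then δ (e + + (length u ℕ.+ length u)) 0ℤ else 0ℤ)
          (eqL-ne {y} {evalWord n u} (λ { refl → ℕP.<-irrefl (sym (proj₂ r′)) lt })))
      ne : y ≢ evalWord n (i ∷ u)
      ne refl = t≢f (trans (sym (flip-f I (eval-perm n u v) d)) (trans (cong (desc (lmul i)) (sym (eval-cons n i u (l ∷ v)))) dy))

  Bar-triangular : ∀ {n x y} → IsPerm n x → IsPerm n y → len x ℕ.≤ len y → ∀ e →
    Bar n x y e ≡ (if eqL y x then δ (e + + (len x ℕ.+ len x)) 0ℤ else 0ℤ)
  Bar-triangular {n} {x} {y} p q le e = trans (Bar-word (redWord x) p r (redWord-eval p) y q e)
    (trans (LActI-tri (redWord x) r y q (subst (ℕ._≤ len y) eq le) e)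
      (cong₂ (λ b k → if b then δ (e + + (k ℕ.+ k)) 0ℤ else 0ℤ) (cong (eqL y) (redWord-eval p)) (sym eq)))
    where
    r = redWord-reduced p
    eq : len x ≡ length (redWord x)
    eq = trans (sym (cong len (redWord-eval p))) (proj₂ r)

-- Bar-invariant elements and the operator q^(-1/2) T_s - q^(1/2)

module BarInvolution where
  open import Data.Nat as ℕ using ()
  open import Data.Integer using (+_; -_; 0ℤ; 1ℤ; _+_; _*_; _-_; -1ℤ)
  open import Data.Integer.Solver using (module +-*-Solver)
  open LaurentCoefficients
  open Permutations
  open Words
  open HeckeOperators

  open +-*-Solver
  open IsReflection

  -- q^{-1/2} T_s − q^{1/2}: a bar-invariant element annihilating the q-eigenspace of T_s.
  E[_] : (Perm → Perm) → Hk → Hk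
  E[ σ ] h x = mulL (monoL -1ℤ)
      (if desc σ x then h (σ x) ++ mulL ((+ 2 , 1ℤ) ∷ (0ℤ , - 1ℤ) ∷ []) (h x) else mulL (monoL (+ 2)) (h (σ x)))
    ++ mulL ((1ℤ , -1ℤ) ∷ []) (h x)

  EF : (Perm → Perm) → Fn → Fn
  EF σ g x e = if desc σ x then g (σ x) (e + 1ℤ) - g x (e + 1ℤ) else g (σ x) (e - 1ℤ) - g x (e - 1ℤ)

  shift : Bool → ℤ → ℤ
  shift b e = if b then e - 1ℤ else e + 1ℤ

  -- The q^(1/2) terms cancel at a descent, so the value at `x` is h(σ x) - h(x) times q^(-1/2) at a
  -- descent and times q^(1/2) at an ascent. Hence the operator kills `h` exactly when `h` is
  -- constant on the pairs x, σ x.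
  pairing-E : ∀ σ h x F → pairing (E[ σ ] h x) F ≡
    pairing (h (σ x)) (F ∘ shift (desc σ x)) - pairing (h x) (F ∘ shift (desc σ x))
  pairing-E σ h x F with desc σ x
  ... | true = trans (sumZ-++ _ (mulL (monoL -1ℤ) (h (σ x) ++ mulL ((+ 2 , 1ℤ) ∷ (0ℤ , - 1ℤ) ∷ []) (h x))) _)
     (trans (cong₂ _+_
       (trans (pairing-mulL (monoL -1ℤ) (h (σ x) ++ mulL ((+ 2 , 1ℤ) ∷ (0ℤ , - 1ℤ) ∷ []) (h x)) F)
       (trans (pairing-mono -1ℤ (λ k → pairing (h (σ x) ++ mulL ((+ 2 , 1ℤ) ∷ (0ℤ , - 1ℤ) ∷ []) (h x)) (λ l → F (k + l))))
       (trans (sumZ-++ _ (h (σ x)) _) (cong₂ _+_ (pairing-cong (h (σ x)) (λ k → cong F (ℤP.+-comm -1ℤ k)))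
        (trans (pairing-mulL ((+ 2 , 1ℤ) ∷ (0ℤ , - 1ℤ) ∷ []) (h x) (λ l → F (-1ℤ + l)))
          (cong₂ (λ a b → 1ℤ * a + (- 1ℤ * b + 0ℤ))
            (pairing-cong (h x) (λ k → cong F (solve 1 (λ k → con -1ℤ :+ (con (+ 2) :+ k) := con 1ℤ :+ k) refl k)))
            (pairing-cong (h x) (λ k → cong F (solve 1 (λ k → con -1ℤ :+ (con 0ℤ :+ k) := k :+ con -1ℤ) refl k)))))))))
       (pairing-mulL ((1ℤ , -1ℤ) ∷ []) (h x) F))
     (solve 3 (λ a b c → (a :+ (con 1ℤ :* c :+ (con -1ℤ :* b :+ con 0ℤ))) :+ (con -1ℤ :* c :+ con 0ℤ) := a :- b) refl
       (pairing (h (σ x)) (λ k → F (k - 1ℤ))) (pairing (h x) (λ k → F (k - 1ℤ))) (pairing (h x) (λ k → F (1ℤ + k)))))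
  ... | false = trans (sumZ-++ _ (mulL (monoL -1ℤ) (mulL (monoL (+ 2)) (h (σ x)))) _)
     (trans (cong₂ _+_
       (trans (pairing-mulL (monoL -1ℤ) (mulL (monoL (+ 2)) (h (σ x))) F)
       (trans (pairing-mono -1ℤ (λ k → pairing (mulL (monoL (+ 2)) (h (σ x))) (λ l → F (k + l))))
       (trans (pairing-mulL (monoL (+ 2)) (h (σ x)) (λ l → F (-1ℤ + l)))
       (trans (pairing-mono (+ 2) (λ k → pairing (h (σ x)) (λ l → F (-1ℤ + (k + l)))))
         (pairing-cong (h (σ x)) (λ k → cong F (solve 1 (λ k → con -1ℤ :+ (con (+ 2) :+ k) := k :+ con 1ℤ) refl k)))))))
       (trans (pairing-mulL ((1ℤ , -1ℤ) ∷ []) (h x) F) (cong (λ a → -1ℤ * a + 0ℤ) (pairing-cong (h x) (λ k → cong F (ℤP.+-comm 1ℤ k))))))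
     (solve 2 (λ a b → a :+ (con -1ℤ :* b :+ con 0ℤ) := a :- b) refl (pairing (h (σ x)) (λ k → F (k + 1ℤ))) (pairing (h x) (λ k → F (k + 1ℤ)))))

  E-coefs : ∀ σ h x e → coefL (E[ σ ] h x) e ≡ EF σ (coefs h) x e
  E-coefs σ h x e = trans (coefL-pairing (E[ σ ] h x) e) (trans (pairing-E σ h x (δ e)) go)
    where
    shift-coef : ∀ p d d′ → (∀ k → (k + d ≡ e → e + d′ ≡ k) × (e + d′ ≡ k → k + d ≡ e)) → pairing p (λ k → δ e (k + d)) ≡ coefL p (e + d′)
    shift-coef p d d′ h = trans (pairing-cong p (λ k → δ-inj {e} {k + d} {e + d′} {k} (λ q → proj₁ (h k) (sym q)) (λ q → sym (proj₂ (h k) q))))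
      (sym (coefL-pairing p (e + d′)))
    up : ∀ p → pairing p (λ k → δ e (k - 1ℤ)) ≡ coefL p (e + 1ℤ)
    up p = shift-coef p -1ℤ 1ℤ (λ k → (λ { refl → solve 1 (λ k → (k :+ con -1ℤ) :+ con 1ℤ := k) refl k }) ,
                                      (λ { refl → solve 1 (λ k → (k :+ con 1ℤ) :+ con -1ℤ := k) refl e }))
    down : ∀ p → pairing p (λ k → δ e (k + 1ℤ)) ≡ coefL p (e - 1ℤ)
    down p = shift-coef p 1ℤ -1ℤ (λ k → (λ { refl → solve 1 (λ k → (k :+ con 1ℤ) :+ con -1ℤ := k) refl k }) ,
                                      (λ { refl → solve 1 (λ k → (k :+ con -1ℤ) :+ con 1ℤ := k) refl e }))
    go : pairing (h (σ x)) (δ e ∘ shift (desc σ x)) - pairing (h x) (δ e ∘ shift (desc σ x)) ≡ EF σ (coefs h) x e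
    go with desc σ x
    ... | true = cong₂ _-_ (up (h (σ x))) (up (h x))
    ... | false = cong₂ _-_ (down (h (σ x))) (down (h x))

  BarInv : ℕ → Hk → Set
  BarInv n h = HEq n (barH n h) h

  conv : ℕ → Hk → Fn
  conv n h y e = sumZ (λ x → pairing (h x) (λ k → Bar n x y (e + k))) (perms n)

  barH-coefs : ∀ n h y e → coefL (barH n h y) e ≡ conv n h y e
  barH-coefs n h y e = trans (coefL-concatMap _ (perms n) e) (sumZ-cong (λ x →
    trans (coefL-mulL (barL (h x)) (barT n x y) e) (trans (pairing-barL (h x) (λ k → coefL (barT n x y) (e - k)))
      (pairing-cong (h x) (λ k → cong (λ l → Bar n x y (e + l)) (ℤP.neg-involutive k))))) (perms n))

  BarInv-conv : ∀ {n} h → BarInv n h → conv n h ≈[ n ] coefs h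
  BarInv-conv {n} h b y p e = trans (sym (barH-coefs n h y e)) (b y p e)

  -- Multiplicativity of the bar for one generator. It holds on both sides (`Bar-lmul`, `Bar-rmul`),
  -- so bar invariance can be transported by left and by right multiplication.
  StarAt : ℕ → (Perm → Perm) → Set
  StarAt n σ = ∀ {x} → IsPerm n x → desc σ x ≡ false → Bar n (σ x) ≈[ n ] ActI σ (Bar n x)

  ActI-t : ∀ σ g x e → desc σ x ≡ true → ActI σ g x e ≡ g (σ x) (e + + 2)
  ActI-t σ g x e d rewrite d = refl

  ActI-f : ∀ σ g x e → desc σ x ≡ false → ActI σ g x e ≡ g (σ x) e + (g x (e + + 2) - g x e)
  ActI-f σ g x e d rewrite d = refl

  private
    -- Bar invariance of the operator in matrix form: its transpose in the summation index `x`, with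
    -- inverted powers of q^(1/2), equals its action in the index `y` of the bar matrix. If σ raises
    -- `x` this unfolds `StarAt` at `x`, otherwise at σ x.
    swapped : ∀ {n σ} → IsReflection n σ → StarAt n σ → ∀ x y e → IsPerm n x → IsPerm n y →
      (if desc σ x then Bar n (σ x) y (e + 1ℤ) - Bar n x y (e - 1ℤ) else Bar n (σ x) y (e - 1ℤ) - Bar n x y (e + 1ℤ)) ≡
      EF σ (Bar n x) y e
    swapped {n} {σ} I star x y e p q = go (desc σ x) (desc σ y) refl refl
      where
      B = Bar n
      s1 : (e - 1ℤ) + + 2 ≡ e + 1ℤ
      s1 = solve 1 (λ e → (e :- con 1ℤ) :+ con (+ 2) := e :+ con 1ℤ) refl e
      go : ∀ b c → desc σ x ≡ b → desc σ y ≡ c →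
        (if b then B (σ x) y (e + 1ℤ) - B x y (e - 1ℤ) else B (σ x) y (e - 1ℤ) - B x y (e + 1ℤ)) ≡
        (if c then B x (σ y) (e + 1ℤ) - B x y (e + 1ℤ) else B x (σ y) (e - 1ℤ) - B x y (e - 1ℤ))
      go false true dx dy = cong (_- B x y (e + 1ℤ)) (trans (star p dx y q (e - 1ℤ)) (trans (ActI-t σ (B x) y (e - 1ℤ) dy) (cong (B x (σ y)) s1)))
      go false false dx dy = trans (cong (_- B x y (e + 1ℤ)) (trans (star p dx y q (e - 1ℤ)) (trans (ActI-f σ (B x) y (e - 1ℤ) dy)
          (cong (λ k → B x (σ y) (e - 1ℤ) + (B x y k - B x y (e - 1ℤ))) s1))))
        (solve 3 (λ a b c → (a :+ (b :- c)) :- b := a :- c) refl (B x (σ y) (e - 1ℤ)) (B x y (e + 1ℤ)) (B x y (e - 1ℤ)))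
      go true c dx dy = go′ c dy
        where
        g = B (σ x)
        Bx : ∀ y → IsPerm n y → ∀ e → B x y e ≡ ActI σ g y e
        Bx y q e = trans (cong (λ z → B z y e) (sym (invol I p))) (star (closed I p) (flip-t I p dx) y q e)
        go′ : ∀ c → desc σ y ≡ c → g y (e + 1ℤ) - B x y (e - 1ℤ) ≡
          (if c then B x (σ y) (e + 1ℤ) - B x y (e + 1ℤ) else B x (σ y) (e - 1ℤ) - B x y (e - 1ℤ))
        go′ true dy = trans (cong (λ z → g y (e + 1ℤ) - z) (trans (Bx y q (e - 1ℤ)) (trans (ActI-t σ g y (e - 1ℤ) dy) (cong (g (σ y)) s1))))
          (trans (solve 3 (λ a b c → a :- b := (a :+ (c :- b)) :- c) refl (g y (e + 1ℤ)) (g (σ y) (e + 1ℤ)) (g (σ y) (e + 1ℤ + + 2)))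
          (sym (cong₂ _-_ (trans (Bx (σ y) (closed I q) (e + 1ℤ)) (trans (ActI-f σ g (σ y) (e + 1ℤ) (flip-t I q dy))
              (cong (λ z → g z (e + 1ℤ) + (g (σ y) (e + 1ℤ + + 2) - g (σ y) (e + 1ℤ))) (invol I q))))
            (trans (Bx y q (e + 1ℤ)) (ActI-t σ g y (e + 1ℤ) dy)))))
        go′ false dy = cong (_- B x y (e - 1ℤ)) (sym (trans (Bx (σ y) (closed I q) (e - 1ℤ))
          (trans (ActI-t σ g (σ y) (e - 1ℤ) (flip-f I q dy)) (cong₂ g (invol I q) s1))))

  -- The half of the sum that carries `h (σ x)` is reindexed by the involution σ. Both halves then
  -- carry `h x`, and `swapped` turns their difference into the operator acting in `y`.
  conv-E : ∀ {n σ} → IsReflection n σ → StarAt n σ → ∀ h → conv n (E[ σ ] h) ≈[ n ] EF σ (conv n h)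
  conv-E {n} {σ} I star h y q e = begin
    conv n (E[ σ ] h) y e
      ≡⟨ sumZ-cong (λ x → pairing-E σ h x (λ k → Bar n x y (e + k))) (perms n) ⟩
    sumZ (λ x → P (σ x) x - P x x) (perms n)
      ≡⟨ sumZ-- (λ x → P (σ x) x) (λ x → P x x) (perms n) ⟩
    sumZ (λ x → P (σ x) x) (perms n) - sumZ (λ x → P x x) (perms n)
      ≡⟨ cong (_- sumZ (λ x → P x x) (perms n)) (sumZ-perms-involution σ (closed I) (invol I) (λ x → P (σ x) x)) ⟩
    sumZ (λ x → P (σ (σ x)) (σ x)) (perms n) - sumZ (λ x → P x x) (perms n)
      ≡⟨ sumZ-- (λ x → P (σ (σ x)) (σ x)) (λ x → P x x) (perms n) ⟨
    sumZ (λ x → P (σ (σ x)) (σ x) - P x x) (perms n)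
      ≡⟨ sumZ-perms-cong (λ x p → trans (cong (λ z → P z (σ x) - P x x) (invol I p)) (per x p)) ⟩
    sumZ (λ x → pairing (h x) (λ k → EF σ (Bar n x) y (e + k))) (perms n)
      ≡⟨ final ⟩
    EF σ (conv n h) y e ∎
    where
    open ≡-Reasoning
    P : Perm → Perm → ℤ
    P z x = pairing (h z) (λ k → Bar n x y (e + shift (desc σ x) k))
    pairing-- : ∀ p F G → pairing p F - pairing p G ≡ pairing p (λ k → F k - G k)
    pairing-- p F G = trans (sym (sumZ-- _ _ p)) (sumZ-cong (λ ec →
      solve 3 (λ c a b → c :* a :- c :* b := c :* (a :- b)) refl (proj₂ ec) (F (proj₁ ec)) (G (proj₁ ec))) p)
    per : ∀ x → IsPerm n x → P x (σ x) - P x x ≡ pairing (h x) (λ k → EF σ (Bar n x) y (e + k))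
    per x p = trans (pairing-- (h x) _ _) (pairing-cong (h x) (λ k → trans (pt k) (swapped I star x y (e + k) p q)))
      where
      pt : ∀ k → Bar n (σ x) y (e + shift (desc σ (σ x)) k) - Bar n x y (e + shift (desc σ x) k) ≡
        (if desc σ x then Bar n (σ x) y (e + k + 1ℤ) - Bar n x y (e + k - 1ℤ) else Bar n (σ x) y (e + k - 1ℤ) - Bar n x y (e + k + 1ℤ))
      pt k rewrite flip I p with desc σ x
      ... | true = cong₂ (λ a b → Bar n (σ x) y a - Bar n x y b) (sym (ℤP.+-assoc e k 1ℤ)) (sym (ℤP.+-assoc e k -1ℤ))
      ... | false = cong₂ (λ a b → Bar n (σ x) y a - Bar n x y b) (sym (ℤP.+-assoc e k -1ℤ)) (sym (ℤP.+-assoc e k 1ℤ))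
    assocs : ∀ d k → (e + k) + d ≡ (e + d) + k
    assocs d k = solve 3 (λ e k d → (e :+ k) :+ d := (e :+ d) :+ k) refl e k d
    final : sumZ (λ x → pairing (h x) (λ k → EF σ (Bar n x) y (e + k))) (perms n) ≡ EF σ (conv n h) y e
    final with desc σ y
    ... | true = trans (sumZ-cong (λ x → trans (pairing-cong (h x) (λ k → cong₂ (λ a b → Bar n x (σ y) a - Bar n x y b) (assocs 1ℤ k) (assocs 1ℤ k)))
            (sym (pairing-- (h x) _ _))) (perms n)) (sumZ-- _ _ (perms n))
    ... | false = trans (sumZ-cong (λ x → trans (pairing-cong (h x) (λ k → cong₂ (λ a b → Bar n x (σ y) a - Bar n x y b) (assocs -1ℤ k) (assocs -1ℤ k)))
            (sym (pairing-- (h x) _ _))) (perms n)) (sumZ-- _ _ (perms n))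

  EF-cong : ∀ {n σ g g′} → IsReflection n σ → g ≈[ n ] g′ → EF σ g ≈[ n ] EF σ g′
  EF-cong {σ = σ} I h x p e rewrite h (σ x) (closed I p) (e + 1ℤ) | h x p (e + 1ℤ) | h (σ x) (closed I p) (e - 1ℤ) | h x p (e - 1ℤ) = refl

  BarInv-E : ∀ {n σ} h → IsReflection n σ → StarAt n σ → BarInv n h → BarInv n (E[ σ ] h)
  BarInv-E {n} {σ} h I star b y p e = trans (barH-coefs n (E[ σ ] h) y e)
    (trans (conv-E I star h y p e) (trans (EF-cong I (BarInv-conv h b) y p e) (sym (E-coefs σ h y e))))

  BarInv-lmul : ∀ {n i} h → Letter n i → BarInv n h → BarInv n (E[ lmul i ] h)
  BarInv-lmul h l = BarInv-E h (lmul-reflection l) (Bar-lmul l)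

  -- In the bar sum at `x` only the diagonal term survives: shorter and equally long indices drop
  -- out by `Bar-triangular`, longer ones by hypothesis. The diagonal entry q^(-ℓ(x)) fixes the
  -- centre of the symmetry.
  BarInv-symmetric : ∀ {n x} h → BarInv n h → IsPerm n x →
    (∀ y → IsPerm n y → len x ℕ.< len y → ∀ e → coefL (h y) e ≡ 0ℤ) →
    ∀ e → coefL (h x) e ≡ coefL (h x) (- (e + + (len x ℕ.+ len x)))
  BarInv-symmetric {n} {x} h b p top e = begin
    coefL (h x) e                                                  ≡⟨ BarInv-conv h b x p e ⟨
    conv n h x e                                                   ≡⟨ sumZ-single _ (perms n) (perms-unique n) (∈-perms p) others ⟩
    pairing (h x) (λ k → Bar n x x (e + k))                        ≡⟨ pairing-cong (h x) self ⟩
    pairing (h x) (δ (- (e + + (len x ℕ.+ len x))))                ≡⟨ coefL-pairing (h x) _ ⟨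
    coefL (h x) (- (e + + (len x ℕ.+ len x))) ∎
    where
    open ≡-Reasoning
    L = + (len x ℕ.+ len x)
    self : ∀ k → Bar n x x (e + k) ≡ δ (- (e + L)) k
    self k = trans (Bar-triangular p p ℕP.≤-refl (e + k)) (trans (cong (λ b → if b then δ (e + k + L) 0ℤ else 0ℤ) (eqL-refl x))
      (δ-inj {e + k + L} {0ℤ} { - (e + L) } {k}
        (λ q → trans (solve 3 (λ e k l → :- (e :+ l) := k :- (e :+ k :+ l)) refl e k L) (trans (cong (λ z → k - z) q) (ℤP.+-identityʳ k)))
        (λ { refl → solve 2 (λ e l → e :+ (:- (e :+ l)) :+ l := con 0ℤ) refl e L })))
    others : ∀ z → _ → z ≢ x → pairing (h z) (λ k → Bar n z x (e + k)) ≡ 0ℤ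
    others z m ne with len z ℕ.≤? len x
    ... | yes le = trans (pairing-cong (h z) (λ k → trans (Bar-triangular (perms-IsPerm m) p le (e + k))
            (cong (λ b → if b then δ (e + k + + (len z ℕ.+ len z)) 0ℤ else 0ℤ) (eqL-ne {x} {z} (λ q → ne (sym q))))))
          (sumZ-0 (λ ec → ℤP.*-zeroʳ (proj₂ ec)) (h z))
    ... | no nle = pairing-0 (h z) _ (top z (perms-IsPerm m) (ℕP.≰⇒> nle))

-- Degree bounds and the invariance of C'_w under its descents

module KazhdanLusztig where
  open import Data.Nat as ℕ using (zero; suc; z≤n; s≤s)
  open import Data.Integer using (+_; -_; 0ℤ; 1ℤ; _+_; _*_; _-_; _≤_; _<_; +<+)
  open import Data.Integer.Solver using (module +-*-Solver)
  open LaurentCoefficients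
  open Permutations
  open Words
  open HeckeOperators
  open BarInvolution

  open +-*-Solver
  open IsReflection

  -- C, rescaled by the lengths, is T_w plus terms with strictly negative exponents.
  Bounded : ℕ → Perm → Hk → Set
  Bounded n w C = ∀ x → IsPerm n x → ∀ e → 0ℤ ≤ e + + len x → coefL (C x) e ≡ basis w x (e + + len x)

  private
    series : (ℕ → ℕ) → ℤ → List ℤ → LP
    series f L cs = map (λ ic → ((+ (2 ℕ.* proj₁ ic)) + L , proj₂ ic)) (zip (applyUpTo f (length cs)) cs)

    series-0 : ∀ f L cs e → (∀ i → e ≡ + (2 ℕ.* f i) + L → coefP cs i ≡ 0ℤ) → coefL (series f L cs) e ≡ 0ℤ
    series-0 f L [] e h = refl
    series-0 f L (c ∷ cs) e h with e ℤP.≟ + (2 ℕ.* f 0) + L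
    ... | yes q = cong₂ _+_ (h 0 q) (series-0 (f ∘ suc) L cs e (h ∘ suc))
    ... | no _ = series-0 (f ∘ suc) L cs e (h ∘ suc)

  bruhat-refl : ∀ x → bruhat x x ≡ true
  bruhat-refl x rewrite eqL-refl x = refl

  -- The coefficient of q^i in P_(x,w) sits at exponent 2i - ℓ(w). If this is nonnegative after
  -- adding ℓ(x), then `i` already exceeds the degree bound, so the coefficient is zero unless x =
  -- w.
  Cform-bounded : ∀ {n w P} → IsPerm n w → IsKL n w P → Bounded n w (Cform w P)
  Cform-bounded {n} {w} {P} pw (Pw , deg , _) x px e pos = go (bruhat x w) refl (LP.≡-dec ℕ._≟_ x w)
    where
    L = - (+ len w)
    Cform-t : bruhat x w ≡ true → Cform w P x ≡ series id L (P x)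
    Cform-t b rewrite b = refl
    Cform-f : bruhat x w ≡ false → Cform w P x ≡ []
    Cform-f b rewrite b = refl
    top : ∀ cs → (∀ i → coefP cs i ≡ (if i ℕ.≡ᵇ 0 then 1ℤ else 0ℤ)) → coefL (series id L cs) e ≡ δ (e + + len w) 0ℤ
    top [] h with () ← h 0
    top (c ∷ cs) h with e ℤP.≟ + 0 + L
    ... | yes refl = trans (cong₂ _+_ (h 0) (series-0 suc L cs e (λ i _ → h (suc i))))
          (sym (trans (cong (λ k → δ k 0ℤ) (solve 1 (λ l → con 0ℤ :+ :- l :+ l := con 0ℤ) refl (+ len w))) (δ-refl 0ℤ)))
    ... | no ne = trans (series-0 suc L cs e (λ i _ → h (suc i)))
          (sym (δ-ne {e + + len w} {0ℤ} (λ q → ne (trans (solve 2 (λ e l → e := (e :+ l) :+ :- l) refl e (+ len w)) (cong (_+ L) q)))))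
    go : ∀ b → bruhat x w ≡ b → Dec (x ≡ w) → coefL (Cform w P x) e ≡ basis w x (e + + len x)
    go b bxw (yes refl) = trans (cong (λ p → coefL p e) (Cform-t (bruhat-refl x))) (trans (top (P x) Pw) (sym (basis-self x (e + + len x))))
    go false bxw (no ne) = trans (cong (λ p → coefL p e) (Cform-f bxw)) (sym (basis-ne ne (e + + len x)))
    go true bxw (no ne) = trans (cong (λ p → coefL p e) (Cform-t bxw))
        (trans (series-0 id L (P x) e (λ i q → deg x bxw ne i (lt i q))) (sym (basis-ne ne (e + + len x))))
      where
      lt : ∀ i → e ≡ + (2 ℕ.* i) + L → len w ℕ.< 2 ℕ.* i ℕ.+ 1 ℕ.+ len x
      lt i q = ℕP.≤-<-trans (ℤP.drop‿+≤+ (subst₂ _≤_ (ℤP.+-identityˡ _) eq (ℤP.+-monoˡ-≤ (+ len w) pos)))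
         (ℕP.≤-reflexive (trans (sym (ℕP.+-suc (2 ℕ.* i) (len x))) (sym (ℕP.+-assoc (2 ℕ.* i) 1 (len x)))))
        where
        eq : e + + len x + + len w ≡ + (2 ℕ.* i ℕ.+ len x)
        eq = trans (cong (λ e → e + + len x + + len w) q)
          (trans (solve 3 (λ a b c → (a :+ :- c) :+ b :+ c := a :+ b) refl (+ (2 ℕ.* i)) (+ len x) (+ len w)) (sym (ℤP.pos-+ (2 ℕ.* i) (len x))))

  cnt-≤-length : {A : Set} (p : A → Bool) → ∀ xs → cnt p xs ℕ.≤ length xs
  cnt-≤-length p [] = z≤n
  cnt-≤-length p (x ∷ xs) with p x
  ... | true = s≤s (cnt-≤-length p xs)
  ... | false = ℕP.m≤n⇒m≤1+n (cnt-≤-length p xs)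

  len-≤-square : ∀ x → len x ℕ.≤ length x ℕ.* length x
  len-≤-square [] = z≤n
  len-≤-square (a ∷ x) = ℕP.≤-trans (ℕP.+-mono-≤ (cnt-≤-length _ x) (len-≤-square x))
    (ℕP.≤-trans (ℕP.+-monoʳ-≤ (length x) (ℕP.*-monoʳ-≤ (length x) (ℕP.n≤1+n (length x)))) (ℕP.n≤1+n _))

  -- Induction from long permutations to short ones. It is well-founded because lengths are bounded
  -- by n².
  len-induction : ∀ {n} (Q : Perm → Set) →
    (∀ x → IsPerm n x → (∀ y → IsPerm n y → len x ℕ.< len y → Q y) → Q x) → ∀ x → IsPerm n x → Q x
  len-induction {n} Q step x p = go (suc (n ℕ.* n)) x p (ℕP.m≤n⇒m≤o+n (len x) ℕP.≤-refl)
    where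
    go : ∀ k x → IsPerm n x → n ℕ.* n ℕ.< len x ℕ.+ k → Q x
    go zero x p lt = ⊥-elim (ℕP.<⇒≱ (subst (n ℕ.* n ℕ.<_) (ℕP.+-identityʳ (len x)) lt)
      (subst (λ l → len x ℕ.≤ l ℕ.* l) (perm-length p) (len-≤-square x)))
    go (suc k) x p lt = step x p (λ y q l → go k y q (ℕP.≤-trans lt (subst (ℕ._≤ len y ℕ.+ k) (sym (ℕP.+-suc (len x) k)) (ℕP.+-monoˡ-≤ k l))))

  symmetric-vanish : ∀ (f : ℤ → ℤ) (L : ℕ) → (∀ e → f e ≡ f (- (e + + (L ℕ.+ L)))) →
    (∀ e → 0ℤ ≤ e + + L → f e ≡ 0ℤ) → ∀ e → f e ≡ 0ℤ
  symmetric-vanish f L s z e with 0ℤ ℤP.≤? e + + L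
  ... | yes p = z e p
  ... | no np = trans (s e) (z _ (subst (0ℤ ≤_) eq (ℤP.neg-mono-≤ (ℤP.<⇒≤ (ℤP.≰⇒> np)))))
    where
    eq : - (e + + L) ≡ - (e + + (L ℕ.+ L)) + + L
    eq = trans (solve 2 (λ e l → :- (e :+ l) := :- (e :+ (l :+ l)) :+ l) refl e (+ L))
      (cong (λ k → - (e + k) + + L) (sym (ℤP.pos-+ L L)))

  private
    +1-1 : ∀ e → (e + 1ℤ) - 1ℤ ≡ e
    +1-1 = solve 1 (λ e → (e :+ con 1ℤ) :- con 1ℤ := e) refl

    -1+1 : ∀ e → (e - 1ℤ) + 1ℤ ≡ e
    -1+1 = solve 1 (λ e → (e :- con 1ℤ) :+ con 1ℤ := e) refl

  EF-t : ∀ σ g x e → desc σ x ≡ true → EF σ g x e ≡ g (σ x) (e + 1ℤ) - g x (e + 1ℤ)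
  EF-t σ g x e d rewrite d = refl

  EF-f : ∀ σ g x e → desc σ x ≡ false → EF σ g x e ≡ g (σ x) (e - 1ℤ) - g x (e - 1ℤ)
  EF-f σ g x e d rewrite d = refl

  module _ {n : ℕ} {w : Perm} {C : Hk} {σ : Perm → Perm} (I : IsReflection n σ) (star : StarAt n σ) (binv : BarInv n C) (bound : Bounded n w C)
           (pw : IsPerm n w) (dw : desc σ w ≡ true) where

    private
      D : Hk
      D = E[ σ ] C

      -- At a descent, bar invariance makes the coefficient symmetric and the degree bounds remove
      -- all exponents on one side of the centre. At an ascent the coefficient is, up to sign and a
      -- power of q, the one at the longer σ x.
      D-vanish : ∀ x → IsPerm n x → ∀ e → coefL (D x) e ≡ 0ℤ
      D-vanish = len-induction (λ x → ∀ e → coefL (D x) e ≡ 0ℤ) step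
        where
        step : ∀ x → IsPerm n x → (∀ y → IsPerm n y → len x ℕ.< len y → ∀ e → coefL (D y) e ≡ 0ℤ) → ∀ e → coefL (D x) e ≡ 0ℤ
        step x p ih = go (desc σ x) refl
          where
          go : ∀ b → desc σ x ≡ b → ∀ e → coefL (D x) e ≡ 0ℤ
          go false d e = begin
              coefL (D x) e                                           ≡⟨ trans (E-coefs σ C x e) (EF-f σ (coefs C) x e d) ⟩
              coefL (C (σ x)) (e - 1ℤ) - coefL (C x) (e - 1ℤ)         ≡⟨ solve 2 (λ a b → a :- b := :- (b :- a)) refl (coefL (C (σ x)) (e - 1ℤ)) (coefL (C x) (e - 1ℤ)) ⟩
              - (coefL (C x) (e - 1ℤ) - coefL (C (σ x)) (e - 1ℤ))     ≡⟨ cong -_ other ⟩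
              0ℤ ∎
            where
            open ≡-Reasoning
            -- At σ x the power of q^(1/2) is the opposite one, so the same difference is found two
            -- exponents lower.
            e′ = e - + 2
            ee : e′ + 1ℤ ≡ e - 1ℤ
            ee = solve 1 (λ e → (e :- con (+ 2)) :+ con 1ℤ := e :- con 1ℤ) refl e
            other : coefL (C x) (e - 1ℤ) - coefL (C (σ x)) (e - 1ℤ) ≡ 0ℤ
            other = trans (sym (trans (E-coefs σ C (σ x) e′) (trans (EF-t σ (coefs C) (σ x) e′ (flip-f I p d))
                (cong₂ _-_ (cong₂ (coefs C) (invol I p) ee) (cong (coefL (C (σ x))) ee)))))
              (ih (σ x) (closed I p) (ℕP.≤-reflexive (sym (len-f I p d))) e′)
          go true d = symmetric-vanish (coefL (D x)) (len x)
              (BarInv-symmetric D (BarInv-E C I star binv) p ih)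
              (λ e pos → trans (E-coefs σ C x e) (trans (EF-t σ (coefs C) x e d) (cong₂ _-_ (lower e pos) (upper e pos))))
            where
            -- `w` has the descent σ and σ x has not, so the leading term of `Bounded` cannot occur
            -- at σ x.
            σx≢w : σ x ≢ w
            σx≢w refl = t≢f (trans (sym dw) (flip-t I p d))
            lower : ∀ e → 0ℤ ≤ e + + len x → coefL (C (σ x)) (e + 1ℤ) ≡ 0ℤ
            lower e pos = trans (bound (σ x) (closed I p) (e + 1ℤ) (subst (0ℤ ≤_) eq pos)) (basis-ne σx≢w (e + 1ℤ + + len (σ x)))
              where
              eq : e + + len x ≡ e + 1ℤ + + len (σ x)
              eq = trans (cong (λ l → e + + l) (len-t I p d)) (sym (ℤP.+-assoc e 1ℤ (+ len (σ x))))
            upper : ∀ e → 0ℤ ≤ e + + len x → coefL (C x) (e + 1ℤ) ≡ 0ℤ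
            upper e pos = trans (bound x p (e + 1ℤ) (ℤP.<⇒≤ pos′)) (zero′ (eqL x w))
              where
              eq : 1ℤ + (e + + len x) ≡ e + 1ℤ + + len x
              eq = solve 2 (λ e l → con 1ℤ :+ (e :+ l) := e :+ con 1ℤ :+ l) refl e (+ len x)
              pos′ : 0ℤ < e + 1ℤ + + len x
              pos′ = subst (0ℤ <_) eq (ℤP.≤-<-trans pos (subst (_< 1ℤ + (e + + len x)) (ℤP.+-identityˡ _) (ℤP.+-monoˡ-< (e + + len x) (+<+ (s≤s z≤n)))))
              zero′ : ∀ b → (if b then δ (e + 1ℤ + + len x) 0ℤ else 0ℤ) ≡ 0ℤ
              zero′ false = refl
              zero′ true = δ-ne (λ q → ℤP.<⇒≢ pos′ (sym q))

    descent-invariant : ∀ x → IsPerm n x → ∀ e → coefL (C (σ x)) e ≡ coefL (C x) e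
    descent-invariant x p e = go (desc σ x) refl
      where
      finish : ∀ {a b : ℤ} → a - b ≡ 0ℤ → a ≡ b
      finish {a} {b} h = ℤP.i-j≡0⇒i≡j a b h
      go : ∀ b → desc σ x ≡ b → coefL (C (σ x)) e ≡ coefL (C x) e
      go true d = finish (trans (sym (trans (E-coefs σ C x (e - 1ℤ)) (trans (EF-t σ (coefs C) x (e - 1ℤ) d)
        (cong (λ k → coefL (C (σ x)) k - coefL (C x) k) (-1+1 e))))) (D-vanish x p (e - 1ℤ)))
      go false d = finish (trans (sym (trans (E-coefs σ C x (e + 1ℤ)) (trans (EF-f σ (coefs C) x (e + 1ℤ) d)
        (cong (λ k → coefL (C (σ x)) k - coefL (C x) k) (+1-1 e))))) (D-vanish x p (e + 1ℤ)))

  Cform-rmul : ∀ {n w P i} → IsPerm n w → IsKL n w P → Letter n i → desc (rmulʳ i) w ≡ true →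
    ∀ x → IsPerm n x → ∀ e → coefL (Cform w P (rmul x i)) e ≡ coefL (Cform w P x) e
  Cform-rmul {w = w} {P} pw kl l d = descent-invariant {C = Cform w P} (rmul-reflection l) (Bar-rmul l)
    (proj₂ (proj₂ kl)) (Cform-bounded {P = P} pw kl) pw d

-- Caps, cups and the generating function of labelings

module TensorPowers where
  open import Data.Nat as ℕ using (zero; suc; z≤n; s≤s; _⊓_)
  open import Data.Integer using (+_; -_; 0ℤ; 1ℤ; _+_; _*_; _-_; -1ℤ; _≤_; _<_)
  open import Data.Integer.Solver using (module +-*-Solver)
  open LaurentCoefficients

  open +-*-Solver

  Word : Set
  Word = List Bool

  SF : Set
  SF = Word → ℤ → ℤ

  -- Cap and cup at places j, j+1 of a tensor power of the two-dimensional representation.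
  cap : ℕ → SF → SF
  cap zero F β e = F (true ∷ false ∷ β) e - F (false ∷ true ∷ β) (e + 1ℤ)
  cap (suc j) F [] e = 0ℤ
  cap (suc j) F (x ∷ β) e = cap j (λ γ → F (x ∷ γ)) β e

  cup : ℕ → SF → SF
  cup zero G (false ∷ true ∷ β) e = G β e
  cup zero G (true ∷ false ∷ β) e = - G β (e - 1ℤ)
  cup zero G _ e = 0ℤ
  cup (suc j) G [] e = 0ℤ
  cup (suc j) G (x ∷ β) e = cup j (λ γ → G (x ∷ γ)) β e

  cap-++ : ∀ p F r e → cap (length p) F (p ++ r) e ≡ F (p ++ true ∷ false ∷ r) e - F (p ++ false ∷ true ∷ r) (e + 1ℤ)
  cap-++ [] F r e = refl
  cap-++ (x ∷ p) F r e = cap-++ p (λ γ → F (x ∷ γ)) r e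

  -- The Temperley-Lieb straightening relation. It is what lets a cup be moved one place to the left
  -- in `descend`.
  zigzag : ∀ j G β e → j ℕ.< length β → cap j (cup (suc j) G) β e ≡ G β e
  zigzag zero G (true ∷ β) e lt = ℤP.+-identityʳ _
  zigzag zero G (false ∷ β) e lt = trans (ℤP.+-identityˡ _) (trans (ℤP.neg-involutive _)
    (cong (G (false ∷ β)) (solve 1 (λ e → (e :+ con 1ℤ) :- con 1ℤ := e) refl e)))
  zigzag (suc j) G (x ∷ β) e (s≤s lt) = zigzag j (λ γ → G (x ∷ γ)) β e lt

  nt : Word → ℕ
  nt [] = 0
  nt (true ∷ β) = suc (nt β)
  nt (false ∷ β) = nt β

  nf : Word → ℕ
  nf [] = 0
  nf (true ∷ β) = nf β
  nf (false ∷ β) = suc (nf β)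

  -- Pairs of a ")" followed by a "(": the number of boxes between the path and the lowest path with
  -- the same steps.
  inv : Word → ℕ
  inv [] = 0
  inv (true ∷ β) = inv β
  inv (false ∷ β) = nt β ℕ.+ inv β

  nt-++ : ∀ p r → nt (p ++ r) ≡ nt p ℕ.+ nt r
  nt-++ [] r = refl
  nt-++ (true ∷ p) r = cong suc (nt-++ p r)
  nt-++ (false ∷ p) r = nt-++ p r

  nt-swap : ∀ p a b r → nt (p ++ a ∷ b ∷ r) ≡ nt (p ++ b ∷ a ∷ r)
  nt-swap p a b r = trans (nt-++ p _) (trans (cong (nt p ℕ.+_) (lem a b)) (sym (nt-++ p _)))
    where
    lem : ∀ a b → nt (a ∷ b ∷ r) ≡ nt (b ∷ a ∷ r)
    lem true true = refl
    lem true false = refl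
    lem false true = refl
    lem false false = refl

  inv-swap : ∀ p r → inv (p ++ false ∷ true ∷ r) ≡ suc (inv (p ++ true ∷ false ∷ r))
  inv-swap [] r = refl
  inv-swap (true ∷ p) r = inv-swap p r
  inv-swap (false ∷ p) r = trans (cong₂ ℕ._+_ (nt-swap p false true r) (inv-swap p r)) (ℕP.+-suc _ _)

  nt-insert : ∀ p r → nt (p ++ true ∷ false ∷ r) ≡ suc (nt (p ++ r))
  nt-insert p r = trans (nt-++ p _) (trans (ℕP.+-suc _ _) (cong suc (sym (nt-++ p r))))

  length-insert : ∀ (p : Word) a b r → length (p ++ a ∷ b ∷ r) ≡ suc (suc (length (p ++ r)))
  length-insert [] a b r = refl
  length-insert (x ∷ p) a b r = cong suc (length-insert p a b r)

  nf+nt : ∀ β → nf β ℕ.+ nt β ≡ length β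
  nf+nt [] = refl
  nf+nt (true ∷ β) = trans (ℕP.+-suc _ _) (cong suc (nf+nt β))
  nf+nt (false ∷ β) = cong suc (nf+nt β)

  top : ℕ → ℕ → Word
  top a b = replicate a false ++ replicate b true

  SwapClosed : (Word → Set) → Set
  SwapClosed P = ∀ p r → P (p ++ false ∷ true ∷ r) → P (p ++ true ∷ false ∷ r)

  -- Every path arises from the highest one by turning peaks ")(" into valleys "()": the tail is
  -- handled first, and then a leading "(" is moved back to the front past the ")" of the sorted
  -- tail.
  sort-induction : (P : Word → Set) → SwapClosed P → ∀ β → P (top (nf β) (nt β)) → P β
  sort-induction P sc [] h = h
  sort-induction P sc (false ∷ β) h = sort-induction (P ∘ (false ∷_)) (λ p r → sc (false ∷ p) r) β h
  sort-induction P sc (true ∷ β) h = sort-induction (P ∘ (true ∷_)) (λ p r → sc (true ∷ p) r) β (move (nf β) _ P sc h)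
    where
    move : ∀ a s (P : Word → Set) → SwapClosed P → P (replicate a false ++ true ∷ s) → P (true ∷ replicate a false ++ s)
    move zero s P sc h = h
    move (suc a) s P sc h = sc [] _ (move a s (P ∘ (false ∷_)) (λ p r → sc (false ∷ p) r) h)

  Shape : ℕ → ℕ → Word → Set
  Shape m a β = length β ≡ m × nt β ≡ a

  top-shape : ∀ {m a β} → Shape m a β → top (nf β) (nt β) ≡ top (m ℕ.∸ a) a
  top-shape {β = β} (refl , refl) = cong (λ k → top k (nt β)) (trans (sym (ℕP.m+n∸n≡m (nf β) (nt β))) (cong (ℕ._∸ nt β) (nf+nt β)))

  nt-top : ∀ a b → nt (top a b) ≡ b
  nt-top zero zero = refl
  nt-top zero (suc b) = cong suc (nt-top zero b)
  nt-top (suc a) b = nt-top a b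

  length-top : ∀ a b → length (top a b) ≡ a ℕ.+ b
  length-top a b = trans (LP.length-++ (replicate a false)) (cong₂ ℕ._+_ (LP.length-replicate a) (LP.length-replicate b))

  shape-swap : ∀ {m a} p b c r → Shape m a (p ++ b ∷ c ∷ r) → Shape m a (p ++ c ∷ b ∷ r)
  shape-swap p b c r (l , k) = trans (trans (length-insert p c b r) (sym (length-insert p b c r))) l , trans (nt-swap p c b r) k

  shape-top : ∀ {m a β} → Shape m a β → Shape m a (top (m ℕ.∸ a) a)
  shape-top {β = β} s@(refl , refl) = subst (Shape (length β) (nt β)) (top-shape {β = β} s)
    (trans (length-top (nf β) (nt β)) (nf+nt β) , nt-top (nf β) (nt β))

  inv-≤-top : ∀ {m a} β → Shape m a β → inv β ℕ.≤ inv (top (m ℕ.∸ a) a)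
  inv-≤-top {m} {a} β s = sort-induction (λ γ → Shape m a γ → inv γ ℕ.≤ inv (top (m ℕ.∸ a) a))
    (λ p r h s → ℕP.≤-trans (ℕP.n≤1+n _) (ℕP.≤-trans (ℕP.≤-reflexive (sym (inv-swap p r))) (h (shape-swap p true false r s))))
    β (λ _ → ℕP.≤-reflexive (cong inv (top-shape {β = β} s))) s

  sumTo : ℕ → (ℕ → ℤ) → ℤ
  sumTo zero g = g 0
  sumTo (suc B) g = sumTo B g + g (suc B)

  sumTo-cong : ∀ B {g g′ : ℕ → ℤ} → (∀ m → m ℕ.≤ B → g m ≡ g′ m) → sumTo B g ≡ sumTo B g′
  sumTo-cong zero h = h 0 z≤n
  sumTo-cong (suc B) h = cong₂ _+_ (sumTo-cong B (λ m l → h m (ℕP.m≤n⇒m≤1+n l))) (h (suc B) ℕP.≤-refl)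

  sumTo-- : ∀ B (g g′ : ℕ → ℤ) → sumTo B (λ m → g m - g′ m) ≡ sumTo B g - sumTo B g′
  sumTo-- zero g g′ = refl
  sumTo-- (suc B) g g′ = trans (cong (_+ (g (suc B) - g′ (suc B))) (sumTo-- B g g′))
    (solve 4 (λ a b c d → (a :- b) :+ (c :- d) := (a :+ c) :- (b :+ d)) refl (sumTo B g) (sumTo B g′) (g (suc B)) (g′ (suc B)))

  meet : ℕ → List ℕ → List ℕ
  meet m = map (m ⊓_)

  meet-meet : ∀ {m d} → m ℕ.≤ d → ∀ st → meet m (meet d st) ≡ meet m st
  meet-meet {m} {d} le st = trans (sym (LP.map-∘ st)) (LP.map-cong (λ b → trans (sym (ℕP.⊓-assoc m d b)) (cong (_⊓ b) (ℕP.m≤n⇒m⊓n≡m le))) st)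

  meet-id : ∀ {d} st → All (ℕ._≤ d) st → meet d st ≡ st
  meet-id [] [] = refl
  meet-id (b ∷ st) (p ∷ ps) = cong₂ _∷_ (ℕP.m≥n⇒m⊓n≡n p) (meet-id st ps)

  meet-All : ∀ {d} m st → All (ℕ._≤ d) st → All (ℕ._≤ d) (meet m st)
  meet-All m [] [] = []
  meet-All m (b ∷ st) (p ∷ ps) = ℕP.≤-trans (ℕP.m⊓n≤n m b) p ∷ meet-All m st ps

  meet-All′ : ∀ m st → All (ℕ._≤ m) (meet m st)
  meet-All′ m [] = []
  meet-All′ m (b ∷ st) = ℕP.m⊓n≤m m b ∷ meet-All′ m st

  -- Generating function of the edge labelings of the tree of λ that are admissible for μ, read off by one pass over both words.
  -- d is the number of boxes between the two paths in the current column; the stack holds, for every open "(", the largest label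
  -- still allowed for it: at most d at every point it encloses and at most every label already chosen inside it.
  -- A label m contributes the exponent 2m and every column the exponent −d.
  mutual
    run : ℕ → List ℕ → Word → Word → (ℤ → ℤ) → ℤ
    run d st [] [] φ = φ 0ℤ
    run d st [] (_ ∷ _) φ = 0ℤ
    run d st (_ ∷ _) [] φ = 0ℤ
    run d st (true ∷ lam) (true ∷ mu) φ = run d (d ∷ meet d st) lam mu (λ k → φ (- + d + k))
    run zero st (true ∷ lam) (false ∷ mu) φ = 0ℤ
    run (suc d) st (true ∷ lam) (false ∷ mu) φ = run d (d ∷ meet d st) lam mu (λ k → φ (- + d + k))
    run d st (false ∷ lam) (false ∷ mu) φ = pop d st lam mu (λ k → φ (- + d + k))
    run d st (false ∷ lam) (true ∷ mu) φ = pop (suc d) st lam mu (λ k → φ (- + suc d + k))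

    pop : ℕ → List ℕ → Word → Word → (ℤ → ℤ) → ℤ
    pop d [] lam mu φ = run d [] lam mu φ
    pop d (B ∷ st) lam mu φ = sumTo B (λ m → run d (meet m st) lam mu (λ k → φ (+ (2 ℕ.* m) + k)))

  N : Word → SF
  N lam mu e = run 0 [] lam mu (δ e)

  mutual
    run-cong : ∀ d st lam mu {φ ψ : ℤ → ℤ} → (∀ k → φ k ≡ ψ k) → run d st lam mu φ ≡ run d st lam mu ψ
    run-cong d st [] [] h = h 0ℤ
    run-cong d st [] (_ ∷ _) h = refl
    run-cong d st (_ ∷ _) [] h = refl
    run-cong d st (true ∷ lam) (true ∷ mu) h = run-cong d (d ∷ meet d st) lam mu (λ k → h (- + d + k))
    run-cong zero st (true ∷ lam) (false ∷ mu) h = refl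
    run-cong (suc d) st (true ∷ lam) (false ∷ mu) h = run-cong d (d ∷ meet d st) lam mu (λ k → h (- + d + k))
    run-cong d st (false ∷ lam) (false ∷ mu) h = pop-cong d st lam mu (λ k → h (- + d + k))
    run-cong d st (false ∷ lam) (true ∷ mu) h = pop-cong (suc d) st lam mu (λ k → h (- + suc d + k))

    pop-cong : ∀ d st lam mu {φ ψ : ℤ → ℤ} → (∀ k → φ k ≡ ψ k) → pop d st lam mu φ ≡ pop d st lam mu ψ
    pop-cong d [] lam mu h = run-cong d [] lam mu h
    pop-cong d (B ∷ st) lam mu h = sumTo-cong B (λ m _ → run-cong d (meet m st) lam mu (λ k → h (+ (2 ℕ.* m) + k)))

  private
    comm-1 : ∀ (φ : ℤ → ℤ) a k → φ (-1ℤ + (a + k)) ≡ φ (a + (-1ℤ + k))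
    comm-1 φ a k = cong φ (solve 2 (λ a k → con -1ℤ :+ (a :+ k) := a :+ (con -1ℤ :+ k)) refl a k)

    neg-suc : ∀ d → - + suc d ≡ -1ℤ - + d
    neg-suc d = ℤP.neg-distrib-+ 1ℤ (+ d)

  mutual
    -- With a peak of μ at the leaf the gap there is one less than with a valley. The two sums over
    -- the leaf label therefore differ by the single term of the maximal label `d`; its exponent 2d
    -- cancels the two columns of gap `d`, and since all stack bounds are at most `d` it leaves the
    -- stack as it would be without the leaf. At d = 0 the peak is not admissible, and the valley
    -- alone gives this term.
    run-valley : ∀ d st pl pm lam mu φ → All (ℕ._≤ d) st → length pl ≡ length pm →
      run d st (pl ++ true ∷ false ∷ lam) (pm ++ true ∷ false ∷ mu) φ
        - run d st (pl ++ true ∷ false ∷ lam) (pm ++ false ∷ true ∷ mu) (λ k → φ (-1ℤ + k))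
      ≡ run d st (pl ++ lam) (pm ++ mu) φ
    run-valley zero st [] [] lam mu φ ss _ = trans (ℤP.+-identityʳ _) (trans
      (cong (λ s → run 0 s lam mu (λ k → φ (0ℤ + (0ℤ + (0ℤ + k))))) (trans (meet-meet {0} {0} z≤n st) (meet-id {0} st ss)))
      (run-cong 0 st lam mu (λ k → cong φ (trans (ℤP.+-identityˡ _) (trans (ℤP.+-identityˡ _) (ℤP.+-identityˡ k))))))
    run-valley (suc d) st [] [] lam mu φ ss _ = begin
      (sumTo d g + g (suc d)) - sumTo d g′   ≡⟨ cong (λ z → (sumTo d g + g (suc d)) - z) (sumTo-cong d (λ m le → sym (same m le))) ⟩
      (sumTo d g + g (suc d)) - sumTo d g    ≡⟨ solve 2 (λ a b → (a :+ b) :- a := b) refl (sumTo d g) (g (suc d)) ⟩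
      g (suc d)                              ≡⟨ last ⟩
      run (suc d) st lam mu φ ∎
      where
      open ≡-Reasoning
      D = suc d
      g g′ : ℕ → ℤ
      g m = run D (meet m (meet D st)) lam mu (λ k → φ (- + D + (- + D + (+ (2 ℕ.* m) + k))))
      g′ m = run D (meet m (meet d st)) lam mu (λ k → φ (-1ℤ + (- + d + (- + D + (+ (2 ℕ.* m) + k)))))
      same : ∀ m → m ℕ.≤ d → g m ≡ g′ m
      same m le = trans (cong (λ s → run D s lam mu (λ k → φ (- + D + (- + D + (+ (2 ℕ.* m) + k))))) (trans (meet-meet (ℕP.m≤n⇒m≤1+n le) st) (sym (meet-meet le st))))
        (run-cong D (meet m (meet d st)) lam mu (λ k → cong φ (trans (cong (_+ (- + D + (+ (2 ℕ.* m) + k))) (neg-suc d)) (ℤP.+-assoc -1ℤ (- + d) _))))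
      last : g D ≡ run D st lam mu φ
      last = trans (cong (λ s → run D s lam mu (λ k → φ (- + D + (- + D + (+ (2 ℕ.* D) + k))))) (trans (meet-meet ℕP.≤-refl st) (meet-id st ss)))
        (run-cong D st lam mu (λ k → cong φ (trans (cong (λ z → - + D + (- + D + (z + k))) (trans (cong (λ z → + (D ℕ.+ z)) (ℕP.+-identityʳ D)) (ℤP.pos-+ D D)))
          (solve 2 (λ D k → :- D :+ (:- D :+ (D :+ D :+ k)) := k) refl (+ D) k))))
    run-valley d st (true ∷ pl) (true ∷ pm) lam mu φ ss l =
      trans (cong (λ z → run d (d ∷ meet d st) (pl ++ true ∷ false ∷ lam) (pm ++ true ∷ false ∷ mu) _ - z)
         (run-cong d (d ∷ meet d st) (pl ++ true ∷ false ∷ lam) (pm ++ false ∷ true ∷ mu) (comm-1 φ (- + d))))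
       (run-valley d (d ∷ meet d st) pl pm lam mu (λ k → φ (- + d + k)) (ℕP.≤-refl ∷ meet-All′ d st) (ℕP.suc-injective l))
    run-valley zero st (true ∷ pl) (false ∷ pm) lam mu φ ss l = refl
    run-valley (suc d) st (true ∷ pl) (false ∷ pm) lam mu φ ss l =
      trans (cong (λ z → run d (d ∷ meet d st) (pl ++ true ∷ false ∷ lam) (pm ++ true ∷ false ∷ mu) _ - z)
         (run-cong d (d ∷ meet d st) (pl ++ true ∷ false ∷ lam) (pm ++ false ∷ true ∷ mu) (comm-1 φ (- + d))))
       (run-valley d (d ∷ meet d st) pl pm lam mu (λ k → φ (- + d + k)) (ℕP.≤-refl ∷ meet-All′ d st) (ℕP.suc-injective l))
    run-valley d st (false ∷ pl) (false ∷ pm) lam mu φ ss l =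
      trans (cong (λ z → pop d st (pl ++ true ∷ false ∷ lam) (pm ++ true ∷ false ∷ mu) _ - z)
         (pop-cong d st (pl ++ true ∷ false ∷ lam) (pm ++ false ∷ true ∷ mu) (comm-1 φ (- + d))))
       (pop-valley d st pl pm lam mu (λ k → φ (- + d + k)) ss (ℕP.suc-injective l))
    run-valley d st (false ∷ pl) (true ∷ pm) lam mu φ ss l =
      trans (cong (λ z → pop (suc d) st (pl ++ true ∷ false ∷ lam) (pm ++ true ∷ false ∷ mu) _ - z)
         (pop-cong (suc d) st (pl ++ true ∷ false ∷ lam) (pm ++ false ∷ true ∷ mu) (comm-1 φ (- + suc d))))
       (pop-valley (suc d) st pl pm lam mu (λ k → φ (- + suc d + k)) (All.map ℕP.m≤n⇒m≤1+n ss) (ℕP.suc-injective l))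

    pop-valley : ∀ d st pl pm lam mu φ → All (ℕ._≤ d) st → length pl ≡ length pm →
      pop d st (pl ++ true ∷ false ∷ lam) (pm ++ true ∷ false ∷ mu) φ
        - pop d st (pl ++ true ∷ false ∷ lam) (pm ++ false ∷ true ∷ mu) (λ k → φ (-1ℤ + k))
      ≡ pop d st (pl ++ lam) (pm ++ mu) φ
    pop-valley d [] pl pm lam mu φ ss l = run-valley d [] pl pm lam mu φ [] l
    pop-valley d (B ∷ st) pl pm lam mu φ (_ ∷ ss) l = trans (sym (sumTo-- B _ _)) (sumTo-cong B (λ m _ →
      trans (cong (λ z → run d (meet m st) (pl ++ true ∷ false ∷ lam) (pm ++ true ∷ false ∷ mu) _ - z)
         (run-cong d (meet m st) (pl ++ true ∷ false ∷ lam) (pm ++ false ∷ true ∷ mu) (comm-1 φ (+ (2 ℕ.* m)))))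
       (run-valley d (meet m st) pl pm lam mu (λ k → φ (+ (2 ℕ.* m) + k)) (meet-All m st ss) l)))

  mutual
    -- Where λ has no valley, the middle gap is never below the smaller of its two neighbours, so no
    -- bound on a label depends on it. Turning the valley of μ into a peak then only removes one box
    -- from the exponent.
    run-flat : ∀ d st pl pm a b lam mu φ → ¬ (a ≡ true × b ≡ false) → length pl ≡ length pm →
      run d st (pl ++ a ∷ b ∷ lam) (pm ++ true ∷ false ∷ mu) φ
      ≡ run d st (pl ++ a ∷ b ∷ lam) (pm ++ false ∷ true ∷ mu) (λ k → φ (-1ℤ + k))
    run-flat d st [] [] true false lam mu φ ne _ = ⊥-elim (ne (refl , refl))
    run-flat zero st [] [] true true lam mu φ ne _ = refl
    run-flat (suc d) st [] [] true true lam mu φ ne _ = trans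
      (cong (λ s → run d (d ∷ s) lam mu (λ k → φ (- + suc d + (- + d + k)))) (cong₂ _∷_ (trans (ℕP.m≤n⇒m⊓n≡m (ℕP.n≤1+n d)) (sym (ℕP.⊓-idem d)))
         (trans (meet-meet (ℕP.n≤1+n d) st) (sym (meet-meet ℕP.≤-refl st)))))
      (run-cong d _ lam mu (λ k → cong φ (trans (cong (_+ (- + d + k)) (neg-suc d)) (ℤP.+-assoc -1ℤ (- + d) _))))
    run-flat d [] [] [] false true lam mu φ ne _ = run-cong d (d ∷ []) lam mu
      (λ k → cong φ (trans (cong (_+ (- + d + k)) (neg-suc d)) (ℤP.+-assoc -1ℤ (- + d) _)))
    run-flat d (B ∷ st) [] [] false true lam mu φ ne _ = sumTo-cong B (λ m _ → run-cong d (d ∷ meet d (meet m st)) lam mu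
      (λ k → cong φ (trans (cong (_+ (+ (2 ℕ.* m) + (- + d + k))) (neg-suc d)) (ℤP.+-assoc -1ℤ (- + d) _))))
    run-flat d [] [] [] false false lam mu φ ne _ = run-cong (suc d) [] lam mu
      (λ k → cong φ (trans (cong (_+ (- + suc d + k)) (neg-suc d)) (ℤP.+-assoc -1ℤ (- + d) _)))
    run-flat d (B ∷ st) [] [] false false lam mu φ ne _ = sumTo-cong B (λ m _ → pop-cong (suc d) (meet m st) lam mu
      (λ k → cong φ (trans (cong (_+ (+ (2 ℕ.* m) + (- + suc d + k))) (neg-suc d)) (trans (ℤP.+-assoc -1ℤ (- + d) _) (cong (λ z → -1ℤ + (- + d + z)) refl)))))
    run-flat d st (true ∷ pl) (true ∷ pm) a b lam mu φ ne l = trans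
      (run-flat d (d ∷ meet d st) pl pm a b lam mu (λ k → φ (- + d + k)) ne (ℕP.suc-injective l))
      (run-cong d (d ∷ meet d st) (pl ++ a ∷ b ∷ lam) (pm ++ false ∷ true ∷ mu) (λ k → sym (comm-1 φ (- + d) k)))
    run-flat zero st (true ∷ pl) (false ∷ pm) a b lam mu φ ne l = refl
    run-flat (suc d) st (true ∷ pl) (false ∷ pm) a b lam mu φ ne l = trans
      (run-flat d (d ∷ meet d st) pl pm a b lam mu (λ k → φ (- + d + k)) ne (ℕP.suc-injective l))
      (run-cong d (d ∷ meet d st) (pl ++ a ∷ b ∷ lam) (pm ++ false ∷ true ∷ mu) (λ k → sym (comm-1 φ (- + d) k)))
    run-flat d st (false ∷ pl) (false ∷ pm) a b lam mu φ ne l = trans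
      (pop-flat d st pl pm a b lam mu (λ k → φ (- + d + k)) ne (ℕP.suc-injective l))
      (pop-cong d st (pl ++ a ∷ b ∷ lam) (pm ++ false ∷ true ∷ mu) (λ k → sym (comm-1 φ (- + d) k)))
    run-flat d st (false ∷ pl) (true ∷ pm) a b lam mu φ ne l = trans
      (pop-flat (suc d) st pl pm a b lam mu (λ k → φ (- + suc d + k)) ne (ℕP.suc-injective l))
      (pop-cong (suc d) st (pl ++ a ∷ b ∷ lam) (pm ++ false ∷ true ∷ mu) (λ k → sym (comm-1 φ (- + suc d) k)))

    pop-flat : ∀ d st pl pm a b lam mu φ → ¬ (a ≡ true × b ≡ false) → length pl ≡ length pm →
      pop d st (pl ++ a ∷ b ∷ lam) (pm ++ true ∷ false ∷ mu) φ
      ≡ pop d st (pl ++ a ∷ b ∷ lam) (pm ++ false ∷ true ∷ mu) (λ k → φ (-1ℤ + k))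
    pop-flat d [] pl pm a b lam mu φ ne l = run-flat d [] pl pm a b lam mu φ ne l
    pop-flat d (B ∷ st) pl pm a b lam mu φ ne l = sumTo-cong B (λ m _ → trans
      (run-flat d (meet m st) pl pm a b lam mu (λ k → φ (+ (2 ℕ.* m) + k)) ne l)
      (run-cong d (meet m st) (pl ++ a ∷ b ∷ lam) (pm ++ false ∷ true ∷ mu) (λ k → sym (comm-1 φ (+ (2 ℕ.* m)) k))))

  δ-suc : ∀ e k → δ (e + 1ℤ) k ≡ δ e (-1ℤ + k)
  δ-suc e k = δ-inj {e + 1ℤ} {k} {e} { -1ℤ + k } (λ { refl → solve 1 (λ e → e := con -1ℤ :+ (e :+ con 1ℤ)) refl e })
    (λ { refl → solve 1 (λ k → (con -1ℤ :+ k) :+ con 1ℤ := k) refl k })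

  cap-N-valley : ∀ pl lam pm mu e → length pl ≡ length pm →
    cap (length pm) (N (pl ++ true ∷ false ∷ lam)) (pm ++ mu) e ≡ N (pl ++ lam) (pm ++ mu) e
  cap-N-valley pl lam pm mu e l = trans (cap-++ pm _ mu e) (trans
    (cong (λ z → N (pl ++ true ∷ false ∷ lam) (pm ++ true ∷ false ∷ mu) e - z) (run-cong 0 [] (pl ++ true ∷ false ∷ lam) (pm ++ false ∷ true ∷ mu) (δ-suc e)))
    (run-valley 0 [] pl pm lam mu (δ e) [] l))

  cap-N-flat : ∀ pl a b lam pm mu e → ¬ (a ≡ true × b ≡ false) → length pl ≡ length pm →
    cap (length pm) (N (pl ++ a ∷ b ∷ lam)) (pm ++ mu) e ≡ 0ℤ
  cap-N-flat pl a b lam pm mu e ne l = trans (cap-++ pm _ mu e) (trans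
    (cong (λ z → N (pl ++ a ∷ b ∷ lam) (pm ++ true ∷ false ∷ mu) e - z) (run-cong 0 [] (pl ++ a ∷ b ∷ lam) (pm ++ false ∷ true ∷ mu) (δ-suc e)))
    (ℤP.i≡j⇒i-j≡0 (run-flat 0 [] pl pm a b lam mu (δ e) ne l)))

  private
    run-trues : ∀ b st φ → run 0 st (replicate b true) (replicate b true) φ ≡ φ 0ℤ
    run-trues zero st φ = refl
    run-trues (suc b) st φ = run-trues b _ _

  run-top-self : ∀ a b φ → run 0 [] (top a b) (top a b) φ ≡ φ 0ℤ
  run-top-self zero b φ = run-trues b [] φ
  run-top-self (suc a) b φ = run-top-self a b (λ k → φ (0ℤ + k))

  -- No other path stays above the highest one: the run breaks off where λ reads its first "("
  -- against a ")" at gap 0.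
  run-top-other : ∀ a b lam φ → Shape (a ℕ.+ b) b lam → lam ≢ top a b → run 0 [] lam (top a b) φ ≡ 0ℤ
  run-top-other zero b lam φ (l , k) ne = ⊥-elim (ne (all-true lam b l k))
    where
    nt-≤ : ∀ β → nt β ℕ.≤ length β
    nt-≤ β = subst (nt β ℕ.≤_) (nf+nt β) (ℕP.m≤n+m (nt β) (nf β))
    all-true : ∀ β b → length β ≡ b → nt β ≡ b → β ≡ replicate b true
    all-true [] zero _ _ = refl
    all-true (true ∷ β) (suc b) l k = cong (true ∷_) (all-true β b (ℕP.suc-injective l) (ℕP.suc-injective k))
    all-true (false ∷ β) (suc b) l k = ⊥-elim (ℕP.<-irrefl refl
      (ℕP.≤-trans (ℕP.≤-reflexive (sym k)) (ℕP.≤-trans (nt-≤ β) (ℕP.≤-reflexive (ℕP.suc-injective l)))))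
  run-top-other (suc a) b (true ∷ lam) φ s ne = refl
  run-top-other (suc a) b (false ∷ lam) φ (l , k) ne = run-top-other a b lam (λ k → φ (0ℤ + k)) (ℕP.suc-injective l , k)
    (λ e → ne (cong (false ∷_) e))

-- Uniqueness of vectors with a given leading path

module BarFamilies where
  open import Data.Nat as ℕ using (zero; suc; z≤n; s≤s)
  open import Data.Integer using (+_; -_; 0ℤ; 1ℤ; _+_; _-_; _≤_; _<_; +<+)
  open import Data.Integer.Solver using (module +-*-Solver)
  open LaurentCoefficients
  open TensorPowers

  open +-*-Solver

  _≟W_ : (α β : Word) → Dec (α ≡ β)
  _≟W_ = LP.≡-dec BP._≟_

  -- The Kazhdan-Lusztig normalisation after rescaling. It prescribes nonnegative exponents only: a
  -- constant term 1 at `lam` and nothing else.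
  LeadsWith : ℕ → ℕ → Word → SF → Set
  LeadsWith m a lam F = ∀ β → Shape m a β → ∀ e → 0ℤ ≤ e → F β e ≡ (if does (β ≟W lam) then δ e 0ℤ else 0ℤ)

  shape-insert : ∀ {m a} p r → Shape m a (p ++ r) → Shape (suc (suc m)) (suc a) (p ++ true ∷ false ∷ r)
  shape-insert p r (l , k) = trans (length-insert p true false r) (cong (suc ∘ suc) l) , trans (nt-insert p r) (cong suc k)

  shape-remove : ∀ {m a} p r → Shape (suc (suc m)) (suc a) (p ++ true ∷ false ∷ r) → Shape m a (p ++ r)
  shape-remove p r (l , k) = ℕP.suc-injective (ℕP.suc-injective (trans (sym (length-insert p true false r)) l)) ,
    ℕP.suc-injective (trans (sym (nt-insert p r)) k)

  does-t : {A : Set} (d : Dec A) → A → does d ≡ true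
  does-t (yes _) a = refl
  does-t (no n) a = ⊥-elim (n a)

  does-f : {A : Set} (d : Dec A) → ¬ A → does d ≡ false
  does-f (yes a) n = ⊥-elim (n a)
  does-f (no _) n = refl

  split-at : ∀ j (β : Word) → j ℕ.≤ length β → ∃₂ λ p r → β ≡ p ++ r × length p ≡ j
  split-at j β le = take j β , drop j β , sym (LP.take++drop≡id j β) , trans (LP.length-take j β) (ℕP.m≤n⇒m⊓n≡m le)

  split-two : ∀ (p : Word) (lam : Word) m → length lam ≡ suc (suc m) → length p ℕ.≤ m →
    ∃₂ λ pl b → ∃₂ λ c lam′ → lam ≡ pl ++ b ∷ c ∷ lam′ × length pl ≡ length p
  split-two [] (b ∷ c ∷ lam) m l _ = [] , b , c , lam , refl , refl
  split-two (x ∷ p) (y ∷ lam) (suc m) l (s≤s le) with pl , b , c , lam′ , e , e′ ← split-two p lam m (ℕP.suc-injective l) le =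
    y ∷ pl , b , c , lam′ , cong (y ∷_) e , cong suc e′

  ++-inj : ∀ {p p′ r r′ : Word} → length p ≡ length p′ → p ++ r ≡ p′ ++ r′ → p ≡ p′ × r ≡ r′
  ++-inj {[]} {[]} l e = refl , e
  ++-inj {x ∷ p} {y ∷ p′} l e with a , b ← ++-inj {p} {p′} (ℕP.suc-injective l) (LP.∷-injectiveʳ e) =
    cong₂ _∷_ (LP.∷-injectiveˡ e) a , b

  symmetric-0 : ∀ (f : ℤ → ℤ) → (∀ e → f e ≡ f (- e)) → (∀ e → 0ℤ ≤ e → f e ≡ 0ℤ) → ∀ e → f e ≡ 0ℤ
  symmetric-0 f s z e with 0ℤ ℤP.≤? e
  ... | yes p = z e p
  ... | no np = trans (s e) (z (- e) (ℤP.neg-mono-≤ (ℤP.<⇒≤ (ℤP.≰⇒> np))))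

  -- A family of spaces of bar-invariant vectors in the tensor powers: stable under caps, and with symmetric extremal coefficients.
  record BarFamily : Set₁ where
    field
      Inv : ℕ → ℕ → SF → Set
      inv-cap : ∀ {m a F} j → j ℕ.≤ m → Inv (suc (suc m)) (suc a) F → Inv m a (cap j F)
      inv-sym : ∀ {m a F β} → Inv m a F → Shape m a β →
        (∀ γ → Shape m a γ → inv β ℕ.< inv γ → ∀ e → F γ e ≡ 0ℤ) → ∀ e → F β e ≡ F β (- e)

  module Characterisation (B : BarFamily) where
    open BarFamily B

    -- Downward induction on `inv`: once all coefficients above β vanish, the one at β is symmetric,
    -- and without nonnegative exponents it must be zero.
    vanish : ∀ {m a G} → Inv m a G → (∀ β → Shape m a β → ∀ e → 0ℤ ≤ e → G β e ≡ 0ℤ) →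
      ∀ β → Shape m a β → ∀ e → G β e ≡ 0ℤ
    vanish {m} {a} {G} I z β s = go (suc (inv (top (m ℕ.∸ a) a))) β s (ℕP.m≤n⇒m≤o+n (inv β) ℕP.≤-refl)
      where
      go : ∀ k β → Shape m a β → inv (top (m ℕ.∸ a) a) ℕ.< inv β ℕ.+ k → ∀ e → G β e ≡ 0ℤ
      go zero β s lt e = ⊥-elim (ℕP.<⇒≱ (subst (_ ℕ.<_) (ℕP.+-identityʳ (inv β)) lt) (inv-≤-top β s))
      go (suc k) β s lt = symmetric-0 (G β) (inv-sym {F = G} {β} I s (λ γ sγ l → go k γ sγ
          (ℕP.≤-trans lt (subst (ℕ._≤ inv γ ℕ.+ k) (sym (ℕP.+-suc (inv β) k)) (ℕP.+-monoˡ-≤ k l)))))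
        (z β s)

    top-coefficient : ∀ {m a F lam} → Inv m a F → Shape m a lam → LeadsWith m a lam F →
      ∀ e → F (top (m ℕ.∸ a) a) e ≡ N lam (top (m ℕ.∸ a) a) e
    top-coefficient {m} {a} {F} {lam} I s h e = trans (ext e) (sym (value (T ≟W lam) e))
      where
      T = top (m ℕ.∸ a) a
      sT = shape-top {β = lam} s
      value : (d : Dec (T ≡ lam)) → ∀ e → N lam T e ≡ (if does d then δ e 0ℤ else 0ℤ)
      value (yes refl) e = run-top-self (m ℕ.∸ a) a (δ e)
      value (no ne) e = run-top-other (m ℕ.∸ a) a lam (δ e)
        (trans (proj₁ s) (trans (sym (proj₁ sT)) (length-top (m ℕ.∸ a) a)) , proj₂ s) (λ q → ne (sym q))
      sym-F : ∀ e → F T e ≡ F T (- e)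
      sym-F = inv-sym {F = F} {T} I sT (λ γ sγ l → ⊥-elim (ℕP.<⇒≱ l (inv-≤-top γ sγ)))
      ext : ∀ e → F T e ≡ (if does (T ≟W lam) then δ e 0ℤ else 0ℤ)
      ext e with 0ℤ ℤP.≤? e
      ... | yes p = h T sT e p
      ... | no np = trans (sym-F e) (trans (h T sT (- e) (ℤP.<⇒≤ pos)) (cong (λ k → if does (T ≟W lam) then k else 0ℤ)
              (trans (δ-ne (λ q → ℤP.<⇒≢ pos (sym q))) (sym (δ-ne {e} (λ q → np (ℤP.≤-reflexive (sym q))))))))
        where
        pos : 0ℤ < - e
        pos = ℤP.neg-mono-< (ℤP.≰⇒> np)

    -- A contraction shortens words by two, so `fuel` bounds the number of steps. The value at a
    -- valley is the contraction plus the shifted value at the peak; equality of all contractions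
    -- and of the top coefficient thus spreads to every path by `sort-induction`.
    characterisation : ∀ fuel {m a F} lam → m ℕ.≤ fuel → Inv m a F → Shape m a lam → LeadsWith m a lam F →
      ∀ β → Shape m a β → ∀ e → F β e ≡ N lam β e
    characterisation fuel {m} {a} {F} lam le I s h β sβ e =
      ℤP.i-j≡0⇒i≡j _ _ (sort-induction (λ γ → Shape m a γ → ∀ e → F γ e - N lam γ e ≡ 0ℤ) step β base sβ e)
      where
      base : Shape m a (top (nf β) (nt β)) → ∀ e → F (top (nf β) (nt β)) e - N lam (top (nf β) (nt β)) e ≡ 0ℤ
      base _ e rewrite top-shape {m} {a} {β} sβ = ℤP.i≡j⇒i-j≡0 (top-coefficient {F = F} I s h e)
      capped : ∀ {m a} fuel → suc (suc m) ℕ.≤ fuel → Inv (suc (suc m)) (suc a) F → Shape (suc (suc m)) (suc a) lam →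
        LeadsWith (suc (suc m)) (suc a) lam F → ∀ p r → Shape m a (p ++ r) →
        ∀ e → cap (length p) F (p ++ r) e ≡ cap (length p) (N lam) (p ++ r) e
      capped {m} {a} (suc fuel) (s≤s le) I sl h p r spr with pl , b , c , lam′ , refl , lp ← split-two p lam m (proj₁ sl)
           (ℕP.≤-trans (ℕP.m≤m+n (length p) (length r)) (ℕP.≤-reflexive (trans (sym (LP.length-++ p)) (proj₁ spr))))
           = go b c refl
        where
        j = length p
        lp′ : ∀ p′ → length p′ ≡ j → length p′ ≡ length pl
        lp′ p′ q = trans q (sym lp)
        j≤m : j ℕ.≤ m
        j≤m = ℕP.≤-trans (ℕP.m≤m+n j (length r)) (ℕP.≤-reflexive (trans (sym (LP.length-++ p)) (proj₁ spr)))
        I′ : Inv m a (cap j F)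
        I′ = inv-cap j j≤m I
        suc-pos : ∀ e → 0ℤ ≤ e → 0ℤ < e + 1ℤ
        suc-pos e pos = subst (0ℤ <_) (ℤP.+-comm 1ℤ e) (ℤP.≤-<-trans pos (subst (_< 1ℤ + e) (ℤP.+-identityˡ e) (ℤP.+-monoˡ-< e (+<+ (s≤s z≤n)))))
        -- The peak enters one exponent higher, hence at a positive exponent, where even the leading
        -- 1 is absent. The nonnegative part of the contraction therefore comes from the path with
        -- the valley inserted.
        leading : ∀ p′ r′ → length p′ ≡ j → Shape m a (p′ ++ r′) → ∀ e → 0ℤ ≤ e →
          cap j F (p′ ++ r′) e ≡ (if does ((p′ ++ true ∷ false ∷ r′) ≟W lam) then δ e 0ℤ else 0ℤ)
        leading p′ r′ lj sh e pos = trans (subst (λ j → cap j F (p′ ++ r′) e ≡ F va e - F pe (e + 1ℤ)) lj (cap-++ p′ F r′ e)) (trans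
            (cong₂ _-_ (h va st e pos) (trans (h pe (shape-swap p′ true false r′ st) (e + 1ℤ) (ℤP.<⇒≤ (suc-pos e pos))) (zero′ (does (pe ≟W lam)))))
            (ℤP.+-identityʳ _))
          where
          va = p′ ++ true ∷ false ∷ r′
          pe = p′ ++ false ∷ true ∷ r′
          st = shape-insert p′ r′ sh
          zero′ : ∀ b → (if b then δ (e + 1ℤ) 0ℤ else 0ℤ) ≡ 0ℤ
          zero′ true = δ-ne (λ q → ℤP.<⇒≢ (suc-pos e pos) (sym q))
          zero′ false = refl
        -- If λ has no valley at this place, no word with a valley inserted there equals λ. The
        -- contraction has only negative exponents, and `vanish` applies to it.
        zeroCase : ∀ b c → lam ≡ pl ++ b ∷ c ∷ lam′ → ¬ (b ≡ true × c ≡ false) → ∀ e →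
          cap j F (p ++ r) e ≡ cap j (N (pl ++ b ∷ c ∷ lam′)) (p ++ r) e
        zeroCase b c el ne e = trans (vanish {G = cap j F} I′ z (p ++ r) spr e) (sym (cap-N-flat pl b c lam′ p r e ne lp))
          where
          z : ∀ γ → Shape m a γ → ∀ e → 0ℤ ≤ e → cap j F γ e ≡ 0ℤ
          z γ sγ e pos with p′ , r′ , refl , lj ← split-at j γ (ℕP.≤-trans j≤m (ℕP.≤-reflexive (sym (proj₁ sγ)))) =
            trans (leading p′ r′ lj sγ e pos) (cong (λ b → if b then δ e 0ℤ else 0ℤ)
              (does-f ((p′ ++ true ∷ false ∷ r′) ≟W lam) (λ q → let _ , q′ = ++-inj {p′} {pl} (lp′ p′ lj) (trans q el) in
                 ne (sym (LP.∷-injectiveˡ q′) , sym (LP.∷-injectiveˡ (LP.∷-injectiveʳ q′))))))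
        go : ∀ b c → lam ≡ pl ++ b ∷ c ∷ lam′ → ∀ e → cap j F (p ++ r) e ≡ cap j (N (pl ++ b ∷ c ∷ lam′)) (p ++ r) e
        go true false el e = trans (characterisation fuel (pl ++ lam′) (ℕP.≤-trans (ℕP.n≤1+n m) le) I′
              (shape-remove pl lam′ (subst (Shape _ _) el sl)) lead (p ++ r) spr e)
            (sym (cap-N-valley pl lam′ p r e lp))
          where
          lead : LeadsWith m a (pl ++ lam′) (cap j F)
          lead γ sγ e pos with p′ , r′ , refl , lj ← split-at j γ (ℕP.≤-trans j≤m (ℕP.≤-reflexive (sym (proj₁ sγ)))) =
            trans (leading p′ r′ lj sγ e pos) (cong (λ b → if b then δ e 0ℤ else 0ℤ) same)
            where
            same : does ((p′ ++ true ∷ false ∷ r′) ≟W lam) ≡ does ((p′ ++ r′) ≟W (pl ++ lam′))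
            same with (p′ ++ r′) ≟W (pl ++ lam′)
            ... | yes q with refl , refl ← ++-inj {p′} {pl} (lp′ p′ lj) q = does-t ((p′ ++ true ∷ false ∷ r′) ≟W lam) (sym el)
            ... | no nq = does-f ((p′ ++ true ∷ false ∷ r′) ≟W lam) (λ q → let a , q′ = ++-inj {p′} {pl} (lp′ p′ lj) (trans q el) in
                  nq (cong₂ _++_ a (LP.∷-injectiveʳ (LP.∷-injectiveʳ q′))))
        go true true el = zeroCase true true el (λ ())
        go false true el = zeroCase false true el (λ ())
        go false false el = zeroCase false false el (λ ())
      step : SwapClosed (λ γ → Shape m a γ → ∀ e → F γ e - N lam γ e ≡ 0ℤ)
      step p r ih sh e = trans (cong₂ _-_ (expand F) (expand (N lam)))
          (trans (cong (λ x → (x + F′) - (cap (length p) (N lam) (p ++ r) e + N′)) C)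
          (trans (solve 3 (λ x a b → (x :+ a) :- (x :+ b) := a :- b) refl (cap (length p) (N lam) (p ++ r) e) F′ N′)
            (ih (shape-swap p true false r sh) (e + 1ℤ))))
        where
        F′ = F (p ++ false ∷ true ∷ r) (e + 1ℤ)
        N′ = N lam (p ++ false ∷ true ∷ r) (e + 1ℤ)
        expand : ∀ G → G (p ++ true ∷ false ∷ r) e ≡ cap (length p) G (p ++ r) e + G (p ++ false ∷ true ∷ r) (e + 1ℤ)
        expand G = trans (solve 2 (λ a b → a := (a :- b) :+ b) refl (G (p ++ true ∷ false ∷ r) e) (G (p ++ false ∷ true ∷ r) (e + 1ℤ)))
          (cong (_+ G (p ++ false ∷ true ∷ r) (e + 1ℤ)) (sym (cap-++ p G r e)))
        C : cap (length p) F (p ++ r) e ≡ cap (length p) (N lam) (p ++ r) e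
        C = go (trans (sym (proj₁ sh)) (length-insert p true false r)) (trans (sym (proj₂ sh)) (nt-insert p r))
          where
          go : m ≡ suc (suc (length (p ++ r))) → a ≡ suc (nt (p ++ r)) → cap (length p) F (p ++ r) e ≡ cap (length p) (N lam) (p ++ r) e
          go refl refl = capped fuel le I s h p r (refl , refl) e

-- Cosets of W_J as lattice paths

module CosetPaths where
  open import Data.Nat
  open import Data.List.Relation.Unary.Linked using (Linked; []; [-]; _∷_)
  open import Data.List.Relation.Unary.Linked.Properties using (Linked⇒AllPairs)
  open import Data.List.Relation.Binary.Permutation.Propositional using (_↭_; refl; prep; swap; ↭-sym; ↭-trans)
  open Permutations
  open Words
  open HeckeOperators using ()
  open KazhdanLusztig using (len-induction)
  open TensorPowers using (Word; nt; nf; inv; Shape; top-shape; sort-induction; top; inv-swap; shape-swap; length-insert)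

  memb : List ℕ → ℕ → Bool
  memb xs a = anyᵇ (_≡ᵇ a) xs

  memb-∈ : ∀ xs {a} → memb xs a ≡ true → a ∈ xs
  memb-∈ (x ∷ xs) {a} e with x ≡ᵇ a in q
  ... | true = here (sym (≡ᵇ-true x a q))
  ... | false = there (memb-∈ xs e)

  ∈-memb : ∀ xs {a} → a ∈ xs → memb xs a ≡ true
  ∈-memb (x ∷ xs) (here refl) rewrite ≡ᵇ-refl x = refl
  ∈-memb (x ∷ xs) {a} (there m) with x ≡ᵇ a
  ... | true = refl
  ... | false = ∈-memb xs m

  ∉-memb : ∀ xs {a} → a ∉ xs → memb xs a ≡ false
  ∉-memb xs {a} ne with memb xs a in e
  ... | true = ⊥-elim (ne (memb-∈ xs e))
  ... | false = refl

  memb-↭ : ∀ {xs ys} → xs ↭ ys → ∀ a → memb xs a ≡ memb ys a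
  memb-↭ {xs} {ys} p a = iff-Bool (λ e → ∈-memb ys (PP.∈-resp-↭ p (memb-∈ xs e)))
    (λ e → ∈-memb xs (PP.∈-resp-↭ (↭-sym p) (memb-∈ ys e)))

  -- The left coset y·W_J as a lattice path: step a is "(" (= true) iff the value a stands in one of the first z places.
  path : ℕ → ℕ → Perm → Word
  path z n y = map (memb (take z y)) (upTo n)

  length-path : ∀ z n y → length (path z n y) ≡ n
  length-path z n y = trans (LP.length-map _ (upTo n)) (LP.length-upTo n)

  path-lmul : ∀ z n j y → suc j < n → path z n (lmul (suc j) y) ≡ adj j (path z n y)
  path-lmul z n j y jn = begin
    map (memb (take z (map t y))) (upTo n)     ≡⟨ cong (λ A → map (memb A) (upTo n)) (LP.take-map z y) ⟩
    map (memb (map t (take z y))) (upTo n)     ≡⟨ LP.map-cong pt (upTo n) ⟩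
    map (memb (take z y) ∘ t) (upTo n)         ≡⟨ LP.map-∘ (upTo n) ⟩
    map (memb (take z y)) (map t (upTo n))     ≡⟨ cong (map (memb (take z y))) (map-tr-upTo j n jn) ⟩
    map (memb (take z y)) (adj j (upTo n))     ≡⟨ map-adj _ j (upTo n) ⟩
    adj j (path z n y) ∎
    where
    open ≡-Reasoning
    t = tr j (suc j)
    pt : ∀ a → memb (map t (take z y)) a ≡ memb (take z y) (t a)
    pt a = iff-Bool
      (λ e → let b , mb , eq = ∈-map⁻ t (memb-∈ (map t (take z y)) e) in
         ∈-memb (take z y) (subst (_∈ take z y) (trans (sym (tr-invol j (suc j) b)) (cong t (sym eq))) mb))
      (λ e → ∈-memb (map t (take z y)) (subst (_∈ map t (take z y)) (tr-invol j (suc j) a) (∈-map⁺ t (memb-∈ (take z y) e))))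

  take-adj : ∀ z j (x : List ℕ) → suc j ≢ z → take z (adj j x) ↭ take z x
  take-adj zero j x ne = refl
  take-adj (suc zero) zero x ne = ⊥-elim (ne refl)
  take-adj (suc (suc z)) zero [] ne = refl
  take-adj (suc (suc z)) zero (a ∷ []) ne = refl
  take-adj (suc (suc z)) zero (a ∷ b ∷ x) ne = swap b a refl
  take-adj (suc z) (suc j) [] ne = refl
  take-adj (suc z) (suc j) (a ∷ x) ne = prep a (take-adj z j x (ne ∘ cong suc))

  path-rmul : ∀ {z n j y} → IsPerm n y → suc j < n → suc j ≢ z → path z n (rmul y (suc j)) ≡ path z n y
  path-rmul {z} {n} {j} {y} p jn ne = LP.map-cong (λ a → memb-↭ (subst (λ x → take z x ↭ take z y)
    (sym (rmul-adj y j (perm-length p) jn)) (take-adj z j y ne)) a) (upTo n)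

  ones zeros : ℕ → Word → List ℕ
  ones k [] = []
  ones k (true ∷ β) = k ∷ ones (suc k) β
  ones k (false ∷ β) = ones (suc k) β
  zeros k [] = []
  zeros k (true ∷ β) = zeros (suc k) β
  zeros k (false ∷ β) = k ∷ zeros (suc k) β

  -- The longest and the shortest element of the coset: both blocks of places are decreasing in the
  -- first and increasing in the second.
  maxrep minrep : Word → Perm
  maxrep β = reverse (ones 0 β) ++ reverse (zeros 0 β)
  minrep β = ones 0 β ++ zeros 0 β

  ones-≥ : ∀ k β → All (k ≤_) (ones k β)
  ones-≥ k [] = []
  ones-≥ k (true ∷ β) = ℕP.≤-refl ∷ All.map (ℕP.≤-trans (ℕP.n≤1+n k)) (ones-≥ (suc k) β)
  ones-≥ k (false ∷ β) = All.map (ℕP.≤-trans (ℕP.n≤1+n k)) (ones-≥ (suc k) β)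

  zeros-≥ : ∀ k β → All (k ≤_) (zeros k β)
  zeros-≥ k [] = []
  zeros-≥ k (false ∷ β) = ℕP.≤-refl ∷ All.map (ℕP.≤-trans (ℕP.n≤1+n k)) (zeros-≥ (suc k) β)
  zeros-≥ k (true ∷ β) = All.map (ℕP.≤-trans (ℕP.n≤1+n k)) (zeros-≥ (suc k) β)

  ones-sorted : ∀ k β → AllPairs _<_ (ones k β)
  ones-sorted k [] = []
  ones-sorted k (true ∷ β) = ones-≥ (suc k) β ∷ ones-sorted (suc k) β
  ones-sorted k (false ∷ β) = ones-sorted (suc k) β

  zeros-sorted : ∀ k β → AllPairs _<_ (zeros k β)
  zeros-sorted k [] = []
  zeros-sorted k (false ∷ β) = zeros-≥ (suc k) β ∷ zeros-sorted (suc k) β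
  zeros-sorted k (true ∷ β) = zeros-sorted (suc k) β

  length-ones : ∀ k β → length (ones k β) ≡ nt β
  length-ones k [] = refl
  length-ones k (true ∷ β) = cong suc (length-ones (suc k) β)
  length-ones k (false ∷ β) = length-ones (suc k) β

  applyUpTo-cong : {A : Set} {f g : ℕ → A} → (∀ i → f i ≡ g i) → ∀ n → applyUpTo f n ≡ applyUpTo g n
  applyUpTo-cong h zero = refl
  applyUpTo-cong h (suc n) = cong₂ _∷_ (h 0) (applyUpTo-cong (h ∘ suc) n)

  applyUpTo-++ : {A : Set} (f : ℕ → A) → ∀ a b → applyUpTo f (a + b) ≡ applyUpTo f a ++ applyUpTo (f ∘ (a +_)) b
  applyUpTo-++ f zero b = refl
  applyUpTo-++ f (suc a) b = cong (f 0 ∷_) (applyUpTo-++ (f ∘ suc) a b)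

  private
    bits-ones : ∀ k β → applyUpTo (λ i → memb (ones k β) (k + i)) (length β) ≡ β
    bits-ones k [] = refl
    bits-ones k (true ∷ β) = cong₂ _∷_ (∈-memb (k ∷ ones (suc k) β) (here (ℕP.+-identityʳ k)))
      (trans (applyUpTo-cong (λ i → trans (cong (_∨ memb (ones (suc k) β) (k + suc i)) (≡ᵇ-ne {k} {k + suc i} (λ e → ℕP.<⇒≢ (ℕP.m<m+n k z<s) e)))
          (cong (memb (ones (suc k) β)) (ℕP.+-suc k i))) (length β)) (bits-ones (suc k) β))
    bits-ones k (false ∷ β) = cong₂ _∷_ (∉-memb (ones (suc k) β) (λ m → ℕP.<-irrefl (sym (ℕP.+-identityʳ k)) (All.lookup (ones-≥ (suc k) β) m)))
      (trans (applyUpTo-cong (λ i → cong (memb (ones (suc k) β)) (ℕP.+-suc k i)) (length β)) (bits-ones (suc k) β))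

  take-++ : {A : Set} (xs ys : List A) → take (length xs) (xs ++ ys) ≡ xs
  take-++ [] ys = refl
  take-++ (x ∷ xs) ys = cong (x ∷_) (take-++ xs ys)

  path-of : ∀ {z n β} A B → Shape n z β → A ↭ ones 0 β → path z n (A ++ B) ≡ β
  path-of {z} {n} {β} A B (refl , refl) p = trans
    (cong (λ k → map (memb (take k (A ++ B))) (upTo (length β))) (trans (sym (length-ones 0 β)) (sym (PP.↭-length p))))
    (trans (cong (λ X → map (memb X) (upTo (length β))) (take-++ A B))
    (trans (LP.map-upTo (memb A) (length β)) (trans (applyUpTo-cong (memb-↭ p) (length β)) (bits-ones 0 β))))

  path-maxrep : ∀ {z n} β → Shape n z β → path z n (maxrep β) ≡ β
  path-maxrep β s = path-of (reverse (ones 0 β)) _ s (PP.↭-reverse (ones 0 β))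

  path-minrep : ∀ {z n} β → Shape n z β → path z n (minrep β) ≡ β
  path-minrep β s = path-of (ones 0 β) _ s refl

  private
    ones-zeros : ∀ k β → ones k β ++ zeros k β ↭ applyUpTo (k +_) (length β)
    ones-zeros k [] = refl
    ones-zeros k (true ∷ β) = subst (k ∷ ones (suc k) β ++ zeros (suc k) β ↭_)
      (cong₂ _∷_ (sym (ℕP.+-identityʳ k)) (applyUpTo-cong (λ i → sym (ℕP.+-suc k i)) (length β))) (prep k (ones-zeros (suc k) β))
    ones-zeros k (false ∷ β) = ↭-trans (PP.shift k (ones (suc k) β) (zeros (suc k) β))
     (subst (k ∷ ones (suc k) β ++ zeros (suc k) β ↭_)
      (cong₂ _∷_ (sym (ℕP.+-identityʳ k)) (applyUpTo-cong (λ i → sym (ℕP.+-suc k i)) (length β))) (prep k (ones-zeros (suc k) β)))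

  minrep-perm : ∀ {n} β → length β ≡ n → IsPerm n (minrep β)
  minrep-perm β refl = ones-zeros 0 β

  maxrep-perm : ∀ {n} β → length β ≡ n → IsPerm n (maxrep β)
  maxrep-perm β l = ↭-trans (PP.++⁺ (PP.↭-reverse (ones 0 β)) (PP.↭-reverse (zeros 0 β))) (minrep-perm β l)

  private
    tr-fix-≥ : ∀ j xs → All (suc (suc j) ≤_) xs → map (tr j (suc j)) xs ≡ xs
    tr-fix-≥ j [] [] = refl
    tr-fix-≥ j (x ∷ xs) (p ∷ ps) = cong₂ _∷_ (tr-o x (λ e → ℕP.<⇒≢ (ℕP.<-trans (ℕP.n<1+n j) p) (sym e)) (λ e → ℕP.<⇒≢ p (sym e))) (tr-fix-≥ j xs ps)

    tr-fix-< : ∀ j k i → k + suc i ≡ j → tr j (suc j) k ≡ k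
    tr-fix-< j k i e = tr-o k (ℕP.<⇒≢ lt) (ℕP.<⇒≢ (ℕP.m<n⇒m<1+n lt))
      where
      lt : k < j
      lt = subst (k <_) e (ℕP.m<m+n k z<s)

    ones-tr : ∀ j k p r → k + length p ≡ j → map (tr j (suc j)) (ones k (p ++ true ∷ false ∷ r)) ≡ ones k (p ++ false ∷ true ∷ r)
    ones-tr j k [] r e with refl ← trans (sym (ℕP.+-identityʳ k)) e = cong₂ _∷_ (tr-l k (suc k)) (tr-fix-≥ k _ (ones-≥ (suc (suc k)) r))
    ones-tr j k (true ∷ p) r e = cong₂ _∷_ (tr-fix-< j k (length p) e) (ones-tr j (suc k) p r (trans (sym (ℕP.+-suc k (length p))) e))
    ones-tr j k (false ∷ p) r e = ones-tr j (suc k) p r (trans (sym (ℕP.+-suc k (length p))) e)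

    zeros-tr : ∀ j k p r → k + length p ≡ j → map (tr j (suc j)) (zeros k (p ++ true ∷ false ∷ r)) ≡ zeros k (p ++ false ∷ true ∷ r)
    zeros-tr j k [] r e with refl ← trans (sym (ℕP.+-identityʳ k)) e = cong₂ _∷_ (tr-r k (suc k)) (tr-fix-≥ k _ (zeros-≥ (suc (suc k)) r))
    zeros-tr j k (false ∷ p) r e = cong₂ _∷_ (tr-fix-< j k (length p) e) (zeros-tr j (suc k) p r (trans (sym (ℕP.+-suc k (length p))) e))
    zeros-tr j k (true ∷ p) r e = zeros-tr j (suc k) p r (trans (sym (ℕP.+-suc k (length p))) e)

  -- The valley has `length p` in the first block and its successor in the second. Exchanging these
  -- consecutive values keeps both blocks sorted; the same holds for `lmul-maxrep`.
  lmul-minrep : ∀ p r → lmul (suc (length p)) (minrep (p ++ true ∷ false ∷ r)) ≡ minrep (p ++ false ∷ true ∷ r)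
  lmul-minrep p r = trans (LP.map-++ _ (ones 0 (p ++ true ∷ false ∷ r)) _)
    (cong₂ _++_ (ones-tr _ 0 p r refl) (zeros-tr _ 0 p r refl))

  lmul-maxrep : ∀ p r → lmul (suc (length p)) (maxrep (p ++ true ∷ false ∷ r)) ≡ maxrep (p ++ false ∷ true ∷ r)
  lmul-maxrep p r = trans (LP.map-++ t (reverse (ones 0 β)) _)
    (cong₂ _++_ (trans (LP.reverse-map t (ones 0 β)) (cong reverse (ones-tr _ 0 p r refl)))
                (trans (LP.reverse-map t (zeros 0 β)) (cong reverse (zeros-tr _ 0 p r refl))))
    where
    β = p ++ true ∷ false ∷ r
    t = tr (length p) (suc (length p))

  before-∈ : ∀ z u v x → u ∈ take z x → v ∉ take z x → before u v x ≡ true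
  before-∈ (suc z) u v (c ∷ x) m nv with c ≟ u
  ... | yes refl rewrite ≡ᵇ-refl c = refl
  ... | no ne rewrite ≡ᵇ-ne ne | ≡ᵇ-ne {c} {v} (λ e → nv (here (sym e))) with m
  ...   | here e = ⊥-elim (ne (sym e))
  ...   | there m′ = before-∈ z u v x m′ (nv ∘ there)

  atB : Word → ℕ → Bool
  atB [] _ = false
  atB (b ∷ β) zero = b
  atB (b ∷ β) (suc i) = atB β i

  atB-++ : ∀ p b r → atB (p ++ b ∷ r) (length p) ≡ b
  atB-++ [] b r = refl
  atB-++ (_ ∷ p) b r = atB-++ p b r

  atB-++₂ : ∀ p b c r → atB (p ++ b ∷ c ∷ r) (suc (length p)) ≡ c
  atB-++₂ [] b c r = refl
  atB-++₂ (_ ∷ p) b c r = atB-++₂ p b c r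

  atB-applyUpTo : ∀ (g : ℕ → Bool) n a → a < n → atB (applyUpTo g n) a ≡ g a
  atB-applyUpTo g (suc n) zero _ = refl
  atB-applyUpTo g (suc n) (suc a) (s≤s lt) = atB-applyUpTo (g ∘ suc) n a lt

  atB-path : ∀ z n y a → a < n → atB (path z n y) a ≡ memb (take z y) a
  atB-path z n y a lt = trans (cong (λ β → atB β a) (LP.map-upTo _ n)) (atB-applyUpTo _ n a lt)

  split-lt : ∀ {n} (p : Word) b c r → length (p ++ b ∷ c ∷ r) ≡ n → suc (length p) < n
  split-lt p b c r refl = subst (suc (length p) <_) (sym (length-insert p b c r))
    (s≤s (s≤s (ℕP.≤-trans (ℕP.m≤m+n (length p) (length r)) (ℕP.≤-reflexive (sym (LP.length-++ p))))))

  path-bits : ∀ {z n y} p b c r → path z n y ≡ p ++ b ∷ c ∷ r →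
    suc (length p) < n × memb (take z y) (length p) ≡ b × memb (take z y) (suc (length p)) ≡ c
  path-bits {z} {n} {y} p b c r e = lt ,
    trans (sym (atB-path z n y (length p) (ℕP.<-trans (ℕP.n<1+n _) lt))) (trans (cong (λ β → atB β (length p)) e) (atB-++ p b (c ∷ r))) ,
    trans (sym (atB-path z n y (suc (length p)) lt)) (trans (cong (λ β → atB β (suc (length p))) e) (atB-++₂ p b c r))
    where
    lt = split-lt p b c r (trans (sym (cong length e)) (length-path z n y))

  private
    memb-f : ∀ {xs a} → memb xs a ≡ false → a ∉ xs
    memb-f {xs} e m = t≢f (trans (sym (∈-memb xs m)) e)

  before-peak : ∀ {z n y} p r → path z n y ≡ p ++ false ∷ true ∷ r → before (suc (length p)) (length p) y ≡ true
  before-peak {z} {n} {y} p r e with _ , a , b ← path-bits {z} {n} {y} p false true r e =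
    before-∈ z _ _ y (memb-∈ (take z y) b) (memb-f a)

  before-valley : ∀ {z n y} p r → IsPerm n y → path z n y ≡ p ++ true ∷ false ∷ r → before (suc (length p)) (length p) y ≡ false
  before-valley {z} {n} {y} p r py e with lt , a , b ← path-bits {z} {n} {y} p true false r e =
    trans (before-swap (length p) (suc (length p)) y (λ e → ℕP.<⇒≢ (ℕP.n<1+n _) e) (perm-∈ py (ℕP.<-trans (ℕP.n<1+n _) lt)))
      (cong not (before-∈ z _ _ y (memb-∈ (take z y) a) (memb-f b)))

  desc-peak : ∀ {z n y} p r → IsPerm n y → path z n y ≡ p ++ false ∷ true ∷ r → dl (suc (length p)) y ≡ true
  desc-peak {z} {n} {y} p r py e = trans (dl-before (length p) py (proj₁ (path-bits {z} {n} {y} p false true r e))) (before-peak {z} {n} p r e)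

  desc-valley : ∀ {z n y} p r → IsPerm n y → path z n y ≡ p ++ true ∷ false ∷ r → dl (suc (length p)) y ≡ false
  desc-valley {z} {n} {y} p r py e = trans (dl-before (length p) py (proj₁ (path-bits {z} {n} {y} p true false r e))) (before-valley {z} {n} p r py e)

  height : Word → ℕ
  height β = len (maxrep β)

  height-swap : ∀ p r → height (p ++ false ∷ true ∷ r) ≡ suc (height (p ++ true ∷ false ∷ r))
  height-swap p r = trans (cong len (sym (lmul-maxrep p r)))
    (lmul-up (length p) mp (split-lt p true false r refl) (before-valley {nt β} p r mp (path-maxrep β (refl , refl))))
    where
    β = p ++ true ∷ false ∷ r
    mp = maxrep-perm β refl

  nt-map : ∀ (g : ℕ → Bool) xs → nt (map g xs) ≡ cnt g xs
  nt-map g [] = refl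
  nt-map g (x ∷ xs) with g x
  ... | true = cong suc (nt-map g xs)
  ... | false = nt-map g xs

  take-drop-disjoint : ∀ z (y : List ℕ) → Unique y → ∀ {x} → x ∈ take z y → x ∉ drop z y
  take-drop-disjoint z y u = disjoint (take z y) (drop z y) (subst Unique (sym (LP.take++drop≡id z y)) u)
    where
    disjoint : ∀ xs ys → Unique (xs ++ ys) → ∀ {x} → x ∈ xs → x ∉ ys
    disjoint (a ∷ xs) ys (pa ∷ u) (here refl) m = All.lookup pa (∈-++⁺ʳ xs m) refl
    disjoint (a ∷ xs) ys (pa ∷ u) (there m) m′ = disjoint xs ys u m m′

  nt-path : ∀ {z n y} → IsPerm n y → z ≤ n → nt (path z n y) ≡ z
  nt-path {z} {n} {y} p le = begin
    nt (map g (upTo n))              ≡⟨ nt-map g (upTo n) ⟩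
    cnt g (upTo n)                   ≡⟨ cnt-↭ g p ⟨
    cnt g y                          ≡⟨ cong (cnt g) (LP.take++drop≡id z y) ⟨
    cnt g (A ++ B)                   ≡⟨ cnt-++ g A B ⟩
    cnt g A + cnt g B                ≡⟨ cong₂ _+_ (cnt-all g A (λ x m → ∈-memb A m)) (cnt-none g B (λ x m → ∉-memb A (λ mA → take-drop-disjoint z y (perm-unique p) mA m))) ⟩
    length A + 0                     ≡⟨ ℕP.+-identityʳ _ ⟩
    length A                         ≡⟨ LP.length-take z y ⟩
    z ⊓ length y                     ≡⟨ ℕP.m≤n⇒m⊓n≡m (subst (z ≤_) (sym (perm-length p)) le) ⟩
    z ∎
    where
    open ≡-Reasoning
    A = take z y
    B = drop z y
    g = memb A
    cnt-++ : ∀ (g : ℕ → Bool) xs ys → cnt g (xs ++ ys) ≡ cnt g xs + cnt g ys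
    cnt-++ g [] ys = refl
    cnt-++ g (x ∷ xs) ys with g x
    ... | true = cong suc (cnt-++ g xs ys)
    ... | false = cnt-++ g xs ys
    cnt-all : ∀ (g : ℕ → Bool) xs → (∀ x → x ∈ xs → g x ≡ true) → cnt g xs ≡ length xs
    cnt-all g [] h = refl
    cnt-all g (x ∷ xs) h rewrite h x (here refl) = cong suc (cnt-all g xs (λ y m → h y (there m)))
    cnt-none : ∀ (g : ℕ → Bool) xs → (∀ x → x ∈ xs → g x ≡ false) → cnt g xs ≡ 0
    cnt-none g [] h = refl
    cnt-none g (x ∷ xs) h rewrite h x (here refl) = cnt-none g xs (λ y m → h y (there m))

  path-shape : ∀ {z n y} → IsPerm n y → z ≤ n → Shape n z (path z n y)
  path-shape {z} {n} {y} p le = length-path z n y , nt-path p le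

  allPairs-reverse : {R S : ℕ → ℕ → Set} → (∀ {a b} → R a b → S b a) → ∀ {xs} → AllPairs R xs → AllPairs S (reverse xs)
  allPairs-reverse f [] = []
  allPairs-reverse {R} {S} f {x ∷ xs} (px ∷ ps) = subst (AllPairs S) (sym (LP.unfold-reverse x xs))
    (APP.++⁺ (allPairs-reverse f ps) ([] ∷ []) (PP.All-resp-↭ (↭-sym (PP.↭-reverse xs)) (All.map (λ r → f r ∷ []) px)))

  ∈-ones : ∀ k β {a} → a ∈ ones k β → ∃ λ i → a ≡ k + i × i < length β × atB β i ≡ true
  ∈-ones k (true ∷ β) (here refl) = 0 , sym (ℕP.+-identityʳ k) , z<s , refl
  ∈-ones k (true ∷ β) (there m) with i , refl , l , e ← ∈-ones (suc k) β m = suc i , sym (ℕP.+-suc k i) , s≤s l , e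
  ∈-ones k (false ∷ β) m with i , refl , l , e ← ∈-ones (suc k) β m = suc i , sym (ℕP.+-suc k i) , s≤s l , e

  ∈-zeros : ∀ k β {a} → a ∈ zeros k β → ∃ λ i → a ≡ k + i × i < length β × atB β i ≡ false
  ∈-zeros k (false ∷ β) (here refl) = 0 , sym (ℕP.+-identityʳ k) , z<s , refl
  ∈-zeros k (false ∷ β) (there m) with i , refl , l , e ← ∈-zeros (suc k) β m = suc i , sym (ℕP.+-suc k i) , s≤s l , e
  ∈-zeros k (true ∷ β) m with i , refl , l , e ← ∈-zeros (suc k) β m = suc i , sym (ℕP.+-suc k i) , s≤s l , e

  ones-∈ : ∀ k β i → i < length β → atB β i ≡ true → k + i ∈ ones k β
  ones-∈ k (true ∷ β) zero l e = here (ℕP.+-identityʳ k)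
  ones-∈ k (true ∷ β) (suc i) (s≤s l) e = there (subst (_∈ ones (suc k) β) (sym (ℕP.+-suc k i)) (ones-∈ (suc k) β i l e))
  ones-∈ k (false ∷ β) (suc i) (s≤s l) e = subst (_∈ ones (suc k) β) (sym (ℕP.+-suc k i)) (ones-∈ (suc k) β i l e)

  zeros-∈ : ∀ k β i → i < length β → atB β i ≡ false → k + i ∈ zeros k β
  zeros-∈ k (false ∷ β) zero l e = here (ℕP.+-identityʳ k)
  zeros-∈ k (false ∷ β) (suc i) (s≤s l) e = there (subst (_∈ zeros (suc k) β) (sym (ℕP.+-suc k i)) (zeros-∈ (suc k) β i l e))
  zeros-∈ k (true ∷ β) (suc i) (s≤s l) e = subst (_∈ zeros (suc k) β) (sym (ℕP.+-suc k i)) (zeros-∈ (suc k) β i l e)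

  module _ {z n : ℕ} {y : Perm} (p : IsPerm n y) where
    private
      A = take z y
      B = drop z y
      β = path z n y
      bit : ∀ {a} → a < n → atB β a ≡ memb A a
      bit = atB-path z n y _
      ∈y : ∀ {a} → a ∈ A ⊎ a ∈ B → a ∈ y
      ∈y (inj₁ m) = subst (_ ∈_) (LP.take++drop≡id z y) (∈-++⁺ˡ m)
      ∈y (inj₂ m) = subst (_ ∈_) (LP.take++drop≡id z y) (∈-++⁺ʳ A m)
      l : ∀ {a} → a < n → a < length β
      l = subst (_ <_) (sym (length-path z n y))
      l′ : ∀ {a} → a < length β → a < n
      l′ = subst (_ <_) (length-path z n y)

    take-∈ : ∀ {a} → a ∈ A → a ∈ ones 0 β
    take-∈ m = ones-∈ 0 β _ (l (perm-< p (∈y (inj₁ m)))) (trans (bit (perm-< p (∈y (inj₁ m)))) (∈-memb A m))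

    ∈-take : ∀ {a} → a ∈ ones 0 β → a ∈ A
    ∈-take m with i , refl , li , e ← ∈-ones 0 β m = memb-∈ A (trans (sym (bit (l′ li))) e)

    drop-∈ : ∀ {a} → a ∈ B → a ∈ zeros 0 β
    drop-∈ m = zeros-∈ 0 β _ (l (perm-< p (∈y (inj₂ m)))) (trans (bit (perm-< p (∈y (inj₂ m)))) (∉-memb A (λ mA → take-drop-disjoint z y (perm-unique p) mA m)))

    ∈-drop : ∀ {a} → a ∈ zeros 0 β → a ∈ B
    ∈-drop m with i , refl , li , e ← ∈-zeros 0 β m with ∈-++⁻ A (subst (i ∈_) (sym (LP.take++drop≡id z y)) (perm-∈ p (l′ li)))
    ... | inj₁ mA = ⊥-elim (t≢f (trans (sym (∈-memb A mA)) (trans (sym (bit (l′ li))) e)))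
    ... | inj₂ mB = mB

    private
      blocks : ∀ {R : ℕ → ℕ → Set} → (∀ {a b c} → R a b → R b c → R a c) →
        (∀ j → suc j < n → suc j ≢ z → R (at y j) (at y (suc j))) → AllPairs R A × AllPairs R B
      blocks {R} tr h = Linked⇒AllPairs tr (linked A (λ i l → subst₂ R (sym (at-take z y i (ℕP.<-trans (ℕP.n<1+n i) l)))
            (sym (at-take z y (suc i) l)) (h i (ly (ℕP.≤-trans l (len-take z y))) (ℕP.<⇒≢ (ℕP.≤-trans l (len-take′ z y)))))) ,
          Linked⇒AllPairs tr (linked B (λ i l → subst₂ R (sym (at-drop z y i)) (sym (trans (at-drop z y (suc i)) (cong (at y) (ℕP.+-suc z i))))
            (h (z + i) (ly (subst (_< length y) (ℕP.+-suc z i) (len-drop z y _ l))) (λ e → ℕP.<⇒≢ (s≤s (ℕP.m≤m+n z i)) (sym e)))))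
        where
        ly : ∀ {a} → a < length y → a < n
        ly = subst (_ <_) (perm-length p)
        linked : ∀ x → (∀ i → suc i < length x → R (at x i) (at x (suc i))) → Linked R x
        linked [] h = []
        linked (a ∷ []) h = [-]
        linked (a ∷ b ∷ x) h = h 0 (s≤s z<s) ∷ linked (b ∷ x) (λ i l → h (suc i) (s≤s l))
        at-take : ∀ z x i → i < length (take z x) → at (take z x) i ≡ at x i
        at-take (suc z) (a ∷ x) zero l = refl
        at-take (suc z) (a ∷ x) (suc i) (s≤s l) = at-take z x i l
        at-drop : ∀ z x i → at (drop z x) i ≡ at x (z + i)
        at-drop zero x i = refl
        at-drop (suc z) [] i = refl
        at-drop (suc z) (a ∷ x) i = at-drop z x i
        len-take : ∀ z (x : List ℕ) → length (take z x) ≤ length x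
        len-take z x = subst (_≤ length x) (sym (LP.length-take z x)) (ℕP.m⊓n≤n z (length x))
        len-take′ : ∀ z (x : List ℕ) → length (take z x) ≤ z
        len-take′ z x = subst (_≤ z) (sym (LP.length-take z x)) (ℕP.m⊓n≤m z (length x))
        len-drop : ∀ z (x : List ℕ) i → i < length (drop z x) → z + i < length x
        len-drop zero x i l = l
        len-drop (suc z) (a ∷ x) i l = s≤s (len-drop z x i l)

    no-ascent⇒maxrep : (∀ j → suc j < n → suc j ≢ z → at y (suc j) < at y j) → y ≡ maxrep β
    no-ascent⇒maxrep h = trans (sym (LP.take++drop≡id z y)) (cong₂ _++_
        (trans (sym (LP.reverse-involutive A)) (cong reverse (sorted-unique (allPairs-reverse id (proj₁ bl)) (ones-sorted 0 β)
          (take-∈ ∘ PP.∈-resp-↭ (PP.↭-reverse A)) (PP.∈-resp-↭ (↭-sym (PP.↭-reverse A)) ∘ ∈-take))))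
        (trans (sym (LP.reverse-involutive B)) (cong reverse (sorted-unique (allPairs-reverse id (proj₂ bl)) (zeros-sorted 0 β)
          (drop-∈ ∘ PP.∈-resp-↭ (PP.↭-reverse B)) (PP.∈-resp-↭ (↭-sym (PP.↭-reverse B)) ∘ ∈-drop)))))
      where
      bl = blocks {λ a b → b < a} (λ r s → ℕP.<-trans s r) h

  -- Every element of a coset climbs to the longest one by right ascents other than s_z. A property
  -- is therefore handed down from `maxrep β` along these ascents.
  climb-induction : ∀ {z n} (Q : Perm → Set) (β : Word) → Q (maxrep β) →
    (∀ y j → IsPerm n y → path z n y ≡ β → suc j < n → suc j ≢ z → at y j < at y (suc j) → Q (rmul y (suc j)) → Q y) →
    ∀ y → IsPerm n y → path z n y ≡ β → Q y
  climb-induction {z} {n} Q β base up = len-induction (λ y → path z n y ≡ β → Q y) step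
    where
    ascent? : ∀ y → Dec (∃ λ j → j < n × suc j < n × suc j ≢ z × at y j < at y (suc j))
    ascent? y = ℕP.anyUpTo? (λ j → (suc j <? n) ×-dec ¬? (suc j ≟ z) ×-dec (at y j <? at y (suc j))) n
    step : ∀ y → IsPerm n y → (∀ x → IsPerm n x → len y < len x → path z n x ≡ β → Q x) → path z n y ≡ β → Q y
    step y p ih e with ascent? y
    ... | yes (j , _ , lt , ne , asc) = up y j p e lt ne asc (ih (rmul y (suc j)) (rmul-perm j p lt)
            (ℕP.≤-reflexive (sym (rmul-up j p lt asc))) (trans (path-rmul {z} {n} {j} {y} p lt ne) e))
    ... | no none = subst Q (sym (trans (no-ascent⇒maxrep {z} p (λ j lt ne → ℕP.≤∧≢⇒< (ℕP.≮⇒≥ (λ asc → none (j , ℕP.<-trans (ℕP.n<1+n j) lt , lt , ne , asc)))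
            (λ q → at-≢ j p lt (sym q)))) (cong maxrep e))) base

  len-≤-height : ∀ {z n y} → IsPerm n y → len y ≤ height (path z n y)
  len-≤-height {z} {n} {y} p = climb-induction {z} {n} (λ y → len y ≤ height β) β ℕP.≤-refl
    (λ y j p e lt ne asc h → ℕP.≤-trans (ℕP.n≤1+n _) (subst (_≤ height β) (rmul-up j p lt asc) h)) y p refl
    where β = path z n y

  -- Both `height` and `inv` drop by one when a peak becomes a valley, so they differ by a constant.
  -- The additive form avoids truncated subtraction.
  height-inv : ∀ {m a} β → Shape m a β → height β + inv (top (m ∸ a) a) ≡ inv β + height (top (m ∸ a) a)
  height-inv {m} {a} β s = sort-induction (λ γ → Shape m a γ → height γ + inv T ≡ inv γ + height T)
      (λ p r h s → ℕP.suc-injective (trans (cong (_+ inv T) (sym (height-swap p r))) (trans (h (shape-swap p true false r s))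
          (cong (_+ height T) (inv-swap p r))))) β
      (λ _ → trans (cong (λ γ → height γ + inv T) tt) (trans (ℕP.+-comm (height T) (inv T)) (cong (λ γ → inv γ + height T) (sym tt)))) s
    where
    T = top (m ∸ a) a
    tt : top (nf β) (nt β) ≡ T
    tt = top-shape {β = β} s

-- The Kazhdan-Lusztig element as the generating function of labelings

module KLVectors where
  open import Data.Nat as ℕ using (zero; suc; z≤n; s≤s)
  open import Data.Integer using (+_; -_; 0ℤ; 1ℤ; _+_; _-_; _≤_; _<_)
  open import Data.Integer.Solver using (module +-*-Solver)
  open LaurentCoefficients
  open Permutations
  open Words
  open HeckeOperators
  open BarInvolution
  open KazhdanLusztig
  open CosetPaths
  open TensorPowers
  open BarFamilies

  open +-*-Solver

  cup-cong : ∀ j {G G′ : SF} β → (∀ γ → suc (suc (length γ)) ≡ length β → ∀ e → G γ e ≡ G′ γ e) → ∀ e → cup j G β e ≡ cup j G′ β e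
  cup-cong zero [] h e = refl
  cup-cong zero (true ∷ []) h e = refl
  cup-cong zero (false ∷ []) h e = refl
  cup-cong zero (true ∷ true ∷ β) h e = refl
  cup-cong zero (true ∷ false ∷ β) h e = cong -_ (h β refl (e - 1ℤ))
  cup-cong zero (false ∷ true ∷ β) h e = h β refl e
  cup-cong zero (false ∷ false ∷ β) h e = refl
  cup-cong (suc j) [] h e = refl
  cup-cong (suc j) (x ∷ β) h e = cup-cong j β (λ γ l → h (x ∷ γ) (cong suc l)) e

  cup-++ : ∀ p G b c r e → cup (length p) G (p ++ b ∷ c ∷ r) e ≡ cup 0 (λ γ → G (p ++ γ)) (b ∷ c ∷ r) e
  cup-++ [] G b c r e = refl
  cup-++ (x ∷ p) G b c r e = cup-++ p (λ γ → G (x ∷ γ)) b c r e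

  E⟨_⟩ : ℕ → SF → SF
  E⟨ j ⟩ F = cup j (cap j F)

  cups : ℕ → SF → SF
  cups zero F = F
  cups (suc k) F = cups k (cup 0 F)

  cups-cong : ∀ k {F F′ : SF} β → (∀ γ → length β ≡ k ℕ.+ k ℕ.+ length γ → ∀ e → F γ e ≡ F′ γ e) → ∀ e → cups k F β e ≡ cups k F′ β e
  cups-cong zero β h e = h β refl e
  cups-cong (suc k) β h e = cups-cong k β (λ γ l → cup-cong 0 γ (λ γ′ l′ → h γ′ (trans l
    (trans (cong (k ℕ.+ k ℕ.+_) (sym l′)) (trans (ℕP.+-suc (k ℕ.+ k) _) (cong suc (trans (ℕP.+-suc (k ℕ.+ k) _) (cong (ℕ._+ length γ′) (sym (ℕP.+-suc k k)))))))))) e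

  private
    cap-lin : ∀ j F β e → cap j (λ γ k → - F γ (k - 1ℤ)) β e ≡ - cap j F β (e - 1ℤ)
    cap-lin zero F β e = trans (solve 2 (λ a b → (:- a) :- (:- b) := :- (a :- b)) refl (F (true ∷ false ∷ β) (e - 1ℤ)) (F (false ∷ true ∷ β) (e + 1ℤ - 1ℤ)))
      (cong (λ k → - (F (true ∷ false ∷ β) (e - 1ℤ) - F (false ∷ true ∷ β) k)) (solve 1 (λ e → e :+ con 1ℤ :- con 1ℤ := e :- con 1ℤ :+ con 1ℤ) refl e))
    cap-lin (suc j) F [] e = refl
    cap-lin (suc j) F (x ∷ β) e = cap-lin j (λ γ → F (x ∷ γ)) β e

    cup-lin : ∀ j F β e → cup j (λ γ k → - F γ (k - 1ℤ)) β e ≡ - cup j F β (e - 1ℤ)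
    cup-lin zero F [] e = refl
    cup-lin zero F (true ∷ []) e = refl
    cup-lin zero F (false ∷ []) e = refl
    cup-lin zero F (true ∷ true ∷ β) e = refl
    cup-lin zero F (true ∷ false ∷ β) e = refl
    cup-lin zero F (false ∷ true ∷ β) e = refl
    cup-lin zero F (false ∷ false ∷ β) e = refl
    cup-lin (suc j) F [] e = refl
    cup-lin (suc j) F (x ∷ β) e = cup-lin j (λ γ → F (x ∷ γ)) β e

    cap-zero : ∀ j β e → cap j (λ _ _ → 0ℤ) β e ≡ 0ℤ
    cap-zero zero β e = refl
    cap-zero (suc j) [] e = refl
    cap-zero (suc j) (x ∷ β) e = cap-zero j β e

    cup-zero : ∀ j β e → cup j (λ _ _ → 0ℤ) β e ≡ 0ℤ
    cup-zero zero [] e = refl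
    cup-zero zero (true ∷ []) e = refl
    cup-zero zero (false ∷ []) e = refl
    cup-zero zero (true ∷ true ∷ β) e = refl
    cup-zero zero (true ∷ false ∷ β) e = refl
    cup-zero zero (false ∷ true ∷ β) e = refl
    cup-zero zero (false ∷ false ∷ β) e = refl
    cup-zero (suc j) [] e = refl
    cup-zero (suc j) (x ∷ β) e = cup-zero j β e

    -- Operators at disjoint places commute; passing the cup at the left end shifts the place by
    -- two.
    E-cup0 : ∀ j F β e → E⟨ suc (suc j) ⟩ (cup 0 F) β e ≡ cup 0 (E⟨ j ⟩ F) β e
    E-cup0 j F [] e = refl
    E-cup0 j F (true ∷ []) e = refl
    E-cup0 j F (false ∷ []) e = refl
    E-cup0 j F (true ∷ true ∷ β) e = trans (cup-cong j β (λ γ _ → cap-zero j γ) e) (cup-zero j β e)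
    E-cup0 j F (false ∷ false ∷ β) e = trans (cup-cong j β (λ γ _ → cap-zero j γ) e) (cup-zero j β e)
    E-cup0 j F (false ∷ true ∷ β) e = refl
    E-cup0 j F (true ∷ false ∷ β) e = trans (cup-cong j β (λ γ _ → cap-lin j F γ) e) (cup-lin j (cap j F) β e)

  E-cups : ∀ k j F β e → E⟨ k ℕ.+ k ℕ.+ j ⟩ (cups k F) β e ≡ cups k (E⟨ j ⟩ F) β e
  E-cups zero j F β e = refl
  E-cups (suc k) j F β e = trans (cong (λ i → E⟨ i ⟩ (cups k (cup 0 F)) β e) idx)
    (trans (E-cups k (suc (suc j)) (cup 0 F) β e) (cups-cong k β (λ γ _ → E-cup0 j F γ) e))
    where
    idx : suc k ℕ.+ suc k ℕ.+ j ≡ k ℕ.+ k ℕ.+ suc (suc j)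
    idx = trans (cong (λ i → suc (i ℕ.+ j)) (ℕP.+-suc k k)) (sym (trans (ℕP.+-suc (k ℕ.+ k) (suc j)) (cong suc (ℕP.+-suc (k ℕ.+ k) j))))

  -- Φ is the coefficient function, on max-length coset representatives and rescaled by their lengths, of a bar-invariant element.
  record Realised (n z : ℕ) (Φ : SF) : Set where
    constructor realised
    field
      element : Hk
      barInv : BarInv n element
      coefficients : ∀ y → IsPerm n y → ∀ e → coefL (element y) e ≡ Φ (path z n y) (e + + height (path z n y))

  open Realised

  Realised-cong : ∀ {n z Φ Ψ} → (∀ β → length β ≡ n → ∀ e → Φ β e ≡ Ψ β e) → Realised n z Φ → Realised n z Ψ
  Realised-cong {n} {z} h (realised x b c) = realised x b (λ y p e → trans (c y p e) (h _ (length-path z n y) _))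

  split2 : ∀ j (β : Word) → suc j ℕ.< length β → ∃₂ λ p b → ∃₂ λ c r → β ≡ p ++ b ∷ c ∷ r × length p ≡ j
  split2 zero (b ∷ []) (s≤s ())
  split2 zero (b ∷ c ∷ r) _ = [] , b , c , r , refl , refl
  split2 (suc j) (x ∷ β) (s≤s lt) with p , b , c , r , e , l ← split2 j β lt = x ∷ p , b , c , r , cong (x ∷_) e , cong suc l

  -- If the two steps differ, the generator exchanges a peak with a valley, and the change of height
  -- by one matches the powers of q^(1/2) in cup and cap. If they are equal, the generator fixes the
  -- coset, both coefficients coincide and the operator gives 0, as the cup does.
  Realised-E : ∀ {n z Φ} j → suc j ℕ.< n → Realised n z Φ → Realised n z (E⟨ j ⟩ Φ)
  Realised-E {n} {z} {Φ} j jn (realised h b co) = realised (E[ lmul (suc j) ] h) (BarInv-lmul h l b) coeffs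
    where
    l : Letter n (suc j)
    l = s≤s z≤n , jn
    s = lmul (suc j)
    I = lmul-reflection l
    coeffs : ∀ y → IsPerm n y → ∀ e → coefL (E[ s ] h y) e ≡ E⟨ j ⟩ Φ (path z n y) (e + + height (path z n y))
    coeffs y p e with P , x , w , r , eq , lP ← split2 j (path z n y) (subst (suc j ℕ.<_) (sym (length-path z n y)) jn) =
      trans (E-coefs s h y e) (trans (go x w refl refl) (sym (trans (cong (λ β → E⟨ j ⟩ Φ β (e + + height β)) eq)
        (trans (cong (λ i → E⟨ i ⟩ Φ (P ++ x ∷ w ∷ r) (e + + height (P ++ x ∷ w ∷ r))) (sym lP)) (cup-++ P (cap (length P) Φ) x w r _)))))
      where
      swapped : path z n (s y) ≡ P ++ w ∷ x ∷ r
      swapped = trans (path-lmul z n j y jn) (trans (cong (adj j) eq) (trans (cong (λ i → adj i (P ++ x ∷ w ∷ r)) (sym lP)) (adj-split P x w r)))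
      at-y : ∀ k → coefL (h y) k ≡ Φ (P ++ x ∷ w ∷ r) (k + + height (P ++ x ∷ w ∷ r))
      at-y k = trans (co y p k) (cong (λ β → Φ β (k + + height β)) eq)
      at-sy : ∀ k → coefL (h (s y)) k ≡ Φ (P ++ w ∷ x ∷ r) (k + + height (P ++ w ∷ x ∷ r))
      at-sy k = trans (co (s y) (IsReflection.closed I p) k) (cong (λ β → Φ β (k + + height β)) swapped)
      flat : ∀ {a b c d} → a ≡ b → c ≡ d → (if desc s y then a - b else c - d) ≡ 0ℤ
      flat u v with desc s y
      ... | true = ℤP.i≡j⇒i-j≡0 u
      ... | false = ℤP.i≡j⇒i-j≡0 v
      go : ∀ x′ w′ → x ≡ x′ → w ≡ w′ → EF s (coefs h) y e ≡ cup 0 (λ γ → cap (length P) Φ (P ++ γ)) (x′ ∷ w′ ∷ r) (e + + height (P ++ x′ ∷ w′ ∷ r))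
      go false true refl refl = trans (EF-t s (coefs h) y e d) (trans (cong₂ _-_ (at-sy (e + 1ℤ)) (at-y (e + 1ℤ)))
          (trans (cong₂ (λ a b → Φ (P ++ true ∷ false ∷ r) a - Φ (P ++ false ∷ true ∷ r) b) e₁ e₂) (sym (cap-++ P Φ r _))))
        where
        d : desc s y ≡ true
        d = subst (λ i → dl (suc i) y ≡ true) lP (desc-peak {z} P r p eq)
        e₁ : e + 1ℤ + + height (P ++ true ∷ false ∷ r) ≡ e + + height (P ++ false ∷ true ∷ r)
        e₁ = trans (ℤP.+-assoc e 1ℤ _) (cong (λ k → e + + k) (sym (height-swap P r)))
        e₂ : e + 1ℤ + + height (P ++ false ∷ true ∷ r) ≡ (e + + height (P ++ false ∷ true ∷ r)) + 1ℤ
        e₂ = solve 2 (λ e h → e :+ con 1ℤ :+ h := e :+ h :+ con 1ℤ) refl e (+ height (P ++ false ∷ true ∷ r))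
      go true false refl refl = trans (EF-f s (coefs h) y e d) (trans (cong₂ _-_ (at-sy (e - 1ℤ)) (at-y (e - 1ℤ)))
          (trans (cong₂ (λ a b → Φ (P ++ false ∷ true ∷ r) a - Φ (P ++ true ∷ false ∷ r) b) e₁ e₂)
          (trans (solve 2 (λ a b → a :- b := :- (b :- a)) refl (Φ (P ++ false ∷ true ∷ r) ((e + + H) - 1ℤ + 1ℤ)) (Φ (P ++ true ∷ false ∷ r) ((e + + H) - 1ℤ))) (cong -_ (sym (cap-++ P Φ r _))))))
        where
        d : desc s y ≡ false
        d = subst (λ i → dl (suc i) y ≡ false) lP (desc-valley {z} P r p eq)
        H = height (P ++ true ∷ false ∷ r)
        e₁ : e - 1ℤ + + height (P ++ false ∷ true ∷ r) ≡ ((e + + H) - 1ℤ) + 1ℤ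
        e₁ = trans (cong (λ k → e - 1ℤ + + k) (height-swap P r)) (trans (cong (λ k → e - 1ℤ + k) (ℤP.pos-+ 1 H))
          (solve 2 (λ e h → e :- con 1ℤ :+ (con 1ℤ :+ h) := e :+ h :- con 1ℤ :+ con 1ℤ) refl e (+ H)))
        e₂ : e - 1ℤ + + H ≡ (e + + H) - 1ℤ
        e₂ = solve 2 (λ e h → e :- con 1ℤ :+ h := e :+ h :- con 1ℤ) refl e (+ H)
      go true true refl refl = flat (trans (at-sy _) (sym (at-y _))) (trans (at-sy _) (sym (at-y _)))
      go false false refl refl = flat (trans (at-sy _) (sym (at-y _))) (trans (at-sy _) (sym (at-y _)))

  module Family (n z : ℕ) (z≤n′ : z ℕ.≤ n) where

    -- A vector of a smaller tensor power is bar-invariant if it becomes so after inserting k cups on the left.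
    record InvF (m a : ℕ) (F : SF) : Set where
      constructor invF
      field
        depth : ℕ
        length-eq : n ≡ depth ℕ.+ depth ℕ.+ m
        weight-eq : z ≡ depth ℕ.+ a
        realisation : Realised n z (cups depth F)

    private
      lift-E : ∀ {m F} k j → n ≡ k ℕ.+ k ℕ.+ m → suc j ℕ.< m → Realised n z (cups k F) → Realised n z (cups k (E⟨ j ⟩ F))
      lift-E {m} {F} k j refl lt R = Realised-cong (λ β _ → E-cups k j F β)
        (Realised-E (k ℕ.+ k ℕ.+ j) (subst (ℕ._< k ℕ.+ k ℕ.+ m) (ℕP.+-suc (k ℕ.+ k) j) (ℕP.+-monoʳ-< (k ℕ.+ k) lt)) R)

      -- Applying `E⟨ j ⟩` next to a cup at `suc j` turns it, by `zigzag`, into the cup at `j`. Each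
      -- application preserves bar invariance, so the new cup arrives at the left end.
      descend : ∀ {m G} k j → n ≡ k ℕ.+ k ℕ.+ suc (suc m) → j ℕ.≤ m → Realised n z (cups k (cup j G)) → Realised n z (cups k (cup 0 G))
      descend k zero e le R = R
      descend {m} {G} k (suc j) e le R = descend k j e (ℕP.≤-trans (ℕP.n≤1+n j) le)
        (Realised-cong (λ β lβ → cups-cong k β (λ γ lγ → cup-cong j γ (λ γ′ lγ′ → λ e′ → zigzag j G γ′ e′
            (subst (j ℕ.<_) (sym (ℕP.suc-injective (ℕP.suc-injective (trans lγ′ (ℕP.+-cancelˡ-≡ (k ℕ.+ k) _ _ (trans (sym lγ) (trans lβ e))))))) le))))
          (lift-E k j e (s≤s (ℕP.m≤n⇒m≤1+n le)) R))

    private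
      suc-suc : ∀ k m → suc k ℕ.+ suc k ℕ.+ m ≡ k ℕ.+ k ℕ.+ suc (suc m)
      suc-suc k m = sym (trans (ℕP.+-suc (k ℕ.+ k) _) (cong suc (trans (ℕP.+-suc (k ℕ.+ k) _) (cong (ℕ._+ m) (sym (ℕP.+-suc k k))))))

      -- The inserted cups read as peaks. On this path `cups k F` takes the value of `F` at β, and
      -- it is the highest path on which that value enters.
      peaks : ℕ → Word → Word
      peaks zero β = β
      peaks (suc k) β = peaks k (false ∷ true ∷ β)

      cups-peaks : ∀ k F β e → cups k F (peaks k β) e ≡ F β e
      cups-peaks zero F β e = refl
      cups-peaks (suc k) F β e = cups-peaks k (cup 0 F) (false ∷ true ∷ β) e

      peaks-shape : ∀ k {m a} β → Shape m a β → Shape (k ℕ.+ k ℕ.+ m) (k ℕ.+ a) (peaks k β)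
      peaks-shape zero β s = s
      peaks-shape (suc k) β (refl , refl) with l , t ← peaks-shape k (false ∷ true ∷ β) (refl , refl) =
        trans l (sym (suc-suc k (length β))) , trans t (ℕP.+-suc k _)

      -- A cup is supported on the peak and the valley at its place, and the valley has one box
      -- less. A path in the support above `peaks k β` must therefore end in some γ strictly above
      -- β, where `F` vanishes.
      cups-vanish : ∀ k F {m a} β → Shape m a β → (∀ γ → Shape m a γ → inv β ℕ.< inv γ → ∀ e → F γ e ≡ 0ℤ) →
        ∀ γ → Shape (k ℕ.+ k ℕ.+ m) (k ℕ.+ a) γ → inv (peaks k β) ℕ.< inv γ → ∀ e → cups k F γ e ≡ 0ℤ
      cups-vanish zero F β s h γ sγ lt e = h γ sγ lt e
      cups-vanish (suc k) F {m} {a} β s h γ (l , t) lt e = cups-vanish k (cup 0 F) {suc (suc m)} {suc a} (false ∷ true ∷ β)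
          (cong (suc ∘ suc) (proj₁ s) , cong suc (proj₂ s)) h′ γ (trans l (suc-suc k m) , trans t (sym (ℕP.+-suc k a))) lt e
        where
        h′ : ∀ γ → Shape (suc (suc m)) (suc a) γ → suc (nt β) ℕ.+ inv β ℕ.< inv γ → ∀ e → cup 0 F γ e ≡ 0ℤ
        h′ (true ∷ true ∷ γ) _ _ e = refl
        h′ (false ∷ false ∷ γ) _ _ e = refl
        h′ (false ∷ true ∷ γ) (l , t) lt e = h γ (ℕP.suc-injective (ℕP.suc-injective l) , t′)
            (ℕP.+-cancelˡ-< (suc (nt β)) _ _ (subst (λ k → suc (nt β) ℕ.+ inv β ℕ.< suc k ℕ.+ inv γ) (trans t′ (sym (proj₂ s))) lt)) e
          where t′ = ℕP.suc-injective t
        h′ (true ∷ false ∷ γ) (l , t) lt e = cong -_ (h γ (ℕP.suc-injective (ℕP.suc-injective l) , t′)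
            (ℕP.+-cancelˡ-< (nt β) _ _ (subst (λ k → nt β ℕ.+ inv β ℕ.< k ℕ.+ inv γ) (trans t′ (sym (proj₂ s))) (ℕP.<-trans (ℕP.n<1+n _) lt))) (e - 1ℤ))
          where t′ = ℕP.suc-injective t

      height-<-inv : ∀ β γ → Shape n z β → Shape n z γ → height β ℕ.< height γ → inv β ℕ.< inv γ
      height-<-inv β γ sβ sγ lt = ℕP.+-cancelʳ-< (height T) _ _ (subst₂ ℕ._<_ (height-inv β sβ) (height-inv γ sγ) (ℕP.+-monoˡ-< (inv T) lt))
        where T = top (n ℕ.∸ z) z

      inv-capF : ∀ {m a F} j → j ℕ.≤ m → InvF (suc (suc m)) (suc a) F → InvF m a (cap j F)
      inv-capF {m} {a} {F} j le (invF k l w R) = invF (suc k) (trans l (sym (suc-suc k m))) (trans w (ℕP.+-suc k a))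
        (descend {m} {cap j F} k j l le (lift-E k j l (s≤s (s≤s le)) R))

      inv-symF : ∀ {m a F β} → InvF m a F → Shape m a β →
        (∀ γ → Shape m a γ → inv β ℕ.< inv γ → ∀ e → F γ e ≡ 0ℤ) → ∀ e → F β e ≡ F β (- e)
      inv-symF {m} {a} {F} {β} (invF k refl refl (realised h b co)) s van e = begin
        F β e                                      ≡⟨ value e ⟨
        coefL (h x) (e - H)                        ≡⟨ BarInv-symmetric h b px high (e - H) ⟩
        coefL (h x) (- ((e - H) + + (len x ℕ.+ len x)))  ≡⟨ cong (coefL (h x)) (trans (cong (λ k → - ((e - H) + k)) (ℤP.pos-+ (len x) (len x)))
                                                      (solve 2 (λ e h → :- ((e :- h) :+ (h :+ h)) := (:- e) :- h) refl e H)) ⟩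
        coefL (h x) (- e - H)                      ≡⟨ value (- e) ⟩
        F β (- e) ∎
        where
        open ≡-Reasoning
        α = peaks k β
        sα = peaks-shape k β s
        -- The longest element over `peaks k β`. There the realising element has the coefficient of
        -- `F` at β, so the symmetry of `BarInv-symmetric` becomes that of `F`.
        x = maxrep α
        H = + len x
        px : IsPerm n x
        px = maxrep-perm α (proj₁ sα)
        value : ∀ e → coefL (h x) (e - H) ≡ F β e
        value e = trans (co x px (e - H)) (trans (cong (λ γ → cups k F γ (e - H + + height γ)) (path-maxrep α sα))
          (trans (cups-peaks k F β (e - H + H)) (cong (F β) (solve 2 (λ e h → e :- h :+ h := e) refl e H))))
        high : ∀ y → IsPerm n y → len x ℕ.< len y → ∀ e → coefL (h y) e ≡ 0ℤ
        high y p lt e = trans (co y p e) (cups-vanish k F β s van (path z n y) sy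
          (height-<-inv α (path z n y) sα sy (ℕP.<-≤-trans lt (len-≤-height {z} {n} {y} p))) (e + + height (path z n y)))
          where
          sy = path-shape {z} {n} {y} p z≤n′

    family : BarFamily
    family = record { Inv = InvF ; inv-cap = inv-capF ; inv-sym = λ {m} {a} {F} {β} → inv-symF {m} {a} {F} {β} }

  -- The descents of `w` make C'_w constant on cosets and `w` the longest element of its own coset.
  -- The characterisation then applies with no cups inserted.
  KL-vector : ∀ {n z w P} → z ℕ.≤ n → IsPerm n w → IsKL n w P → (∀ j → suc j ℕ.< n → suc j ≢ z → desc (rmulʳ (suc j)) w ≡ true) →
    ∀ y → IsPerm n y → ∀ e → coefL (Cform w P y) e ≡ N (path z n w) (path z n y) (e + + height (path z n y))
  KL-vector {n} {z} {w} {P} zn pw kl dw y p e = trans (coset y p e)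
    (trans (cong (coefL (C (maxrep (path z n y)))) (sym (solve 2 (λ e h → e :+ h :- h := e) refl e (+ height (path z n y)))))
    (Characterisation.characterisation (Family.family n z zn) n lam ℕP.≤-refl I sλ lead (path z n y) (path-shape {z} p zn) (e + + height (path z n y))))
    where
    C = Cform w P
    lam = path z n w
    sλ = path-shape {z} pw zn
    F : SF
    F β e = coefL (C (maxrep β)) (e - + height β)
    coset : ∀ y → IsPerm n y → ∀ e → coefL (C y) e ≡ coefL (C (maxrep (path z n y))) e
    coset y p = climb-induction {z} {n} (λ x → ∀ e → coefL (C x) e ≡ coefL (C (maxrep (path z n y))) e) (path z n y) (λ e → refl)
      (λ x j px ex lt ne asc h e → trans (sym (Cform-rmul {P = P} pw kl (s≤s z≤n , lt) (dw j lt ne) x px e)) (h e)) y p refl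
    maxrep-w : maxrep lam ≡ w
    maxrep-w = sym (no-ascent⇒maxrep {z} pw (λ j lt ne → <ᵇ-true _ _ (trans (sym (dr-at j pw lt)) (dw j lt ne))))
    I : Family.InvF n z zn n z F
    I = Family.invF 0 refl refl (realised C (proj₂ (proj₂ kl)) (λ y p e → trans (coset y p e)
      (cong (coefL (C (maxrep (path z n y)))) (sym (solve 2 (λ e h → e :+ h :- h := e) refl e (+ height (path z n y)))))))
    lead : LeadsWith n z lam F
    lead β sβ e pos = trans (Cform-bounded {P = P} pw kl (maxrep β) (maxrep-perm β (proj₁ sβ)) (e - H)
        (subst (0ℤ ≤_) (sym eh) pos)) (trans (cong (basis w (maxrep β)) eh) (cong (λ b → if b then δ e 0ℤ else 0ℤ) same))
      where
      H = + height β
      eh : e - H + H ≡ e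
      eh = solve 2 (λ e h → e :- h :+ h := e) refl e H
      same : eqL (maxrep β) w ≡ does (β ≟W lam)
      same with β ≟W lam
      ... | yes refl = trans (cong (eqL (maxrep β)) (sym maxrep-w)) (eqL-refl (maxrep β))
      ... | no ne = eqL-ne {maxrep β} {w} (λ q → ne (trans (sym (path-maxrep β sβ)) (cong (path z n) q)))

-- Bruhat order below longest coset representatives

module BruhatOrder where
  open import Data.Nat
  open import Data.Nat.Solver using (module +-*-Solver)
  open import Data.List.Relation.Binary.Permutation.Propositional using (_↭_; refl; prep; swap; ↭-sym; ↭-trans)
  open Permutations
  open Words
  open HeckeOperators using (eqL-true; eqL-refl)
  open KazhdanLusztig using ()
  open CosetPaths
  open TensorPowers using (Word; nt; inv; Shape; inv-swap; shape-swap)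

  bit : Bool → ℕ
  bit b = if b then 1 else 0

  cnt-bit : {A : Set} (p : A → Bool) → ∀ x xs → cnt p (x ∷ xs) ≡ bit (p x) + cnt p xs
  cnt-bit = cnt-∷

  bit-mono : ∀ a b → (a ≡ true → b ≡ true) → bit a ≤ bit b
  bit-mono false b h = z≤n
  bit-mono true b h rewrite h refl = ℕP.≤-refl

  <ᵇ-trans-≤ : ∀ {u v} k → v ≤ u → (u <ᵇ k) ≡ true → (v <ᵇ k) ≡ true
  <ᵇ-trans-≤ {u} k le e = <ᵇ-t (ℕP.≤-<-trans le (<ᵇ-true u k e))

  cnt-replace : ∀ k {u v} M R → v ≤ u → cnt (_<ᵇ k) (M ++ u ∷ R) ≤ cnt (_<ᵇ k) (M ++ v ∷ R)
  cnt-replace k {u} {v} [] R le rewrite cnt-bit (_<ᵇ k) u R | cnt-bit (_<ᵇ k) v R =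
    ℕP.+-monoˡ-≤ _ (bit-mono _ _ (<ᵇ-trans-≤ {u} k le))
  cnt-replace k {u} {v} (m ∷ M) R le rewrite cnt-bit (_<ᵇ k) m (M ++ u ∷ R) | cnt-bit (_<ᵇ k) m (M ++ v ∷ R) =
    ℕP.+-monoʳ-≤ (bit (m <ᵇ k)) (cnt-replace k M R le)

  -- Used contrapositively: a transposition that lowers the length has to move a smaller entry to
  -- the left. A weak inequality is enough for this.
  len-transposition : ∀ {u v} P M R → u ≤ v → len (P ++ u ∷ M ++ v ∷ R) ≤ len (P ++ v ∷ M ++ u ∷ R)
  len-transposition {u} {v} (p ∷ P) M R le = ℕP.+-mono-≤ (ℕP.≤-reflexive (cnt-↭ (_<ᵇ p) perm)) (len-transposition P M R le)
    where
    perm : P ++ u ∷ M ++ v ∷ R ↭ P ++ v ∷ M ++ u ∷ R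
    perm = PP.++⁺ˡ P (↭-trans (prep u (PP.shift v M R)) (↭-trans (swap u v refl) (prep v (↭-sym (PP.shift u M R)))))
  len-transposition {u} {v} [] M R le = go M
    where
    go : ∀ M → cnt (_<ᵇ u) (M ++ v ∷ R) + len (M ++ v ∷ R) ≤ cnt (_<ᵇ v) (M ++ u ∷ R) + len (M ++ u ∷ R)
    go [] rewrite cnt-bit (_<ᵇ u) v R | cnt-bit (_<ᵇ v) u R | <ᵇ-f {v} {u} le = ℕP.≤-trans
      (ℕP.≤-reflexive (solve 3 (λ a b c → a :+ (b :+ c) := b :+ (a :+ c)) refl (cnt (_<ᵇ u) R) (cnt (_<ᵇ v) R) (len R)))
      (ℕP.+-monoˡ-≤ (cnt (_<ᵇ u) R + len R) (ℕP.m≤n+m (cnt (_<ᵇ v) R) (bit (u <ᵇ v))))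
      where open +-*-Solver
    go (m ∷ M) rewrite cnt-bit (_<ᵇ u) m (M ++ v ∷ R) | cnt-bit (_<ᵇ v) m (M ++ u ∷ R) = subst₂ _≤_
        (rearr (bit (m <ᵇ u)) _ _ _) (rearr (bit (m <ᵇ v)) _ _ _)
        (ℕP.+-mono-≤ (ℕP.+-mono-≤ (bit-mono _ _ (λ e → <ᵇ-t (ℕP.<-≤-trans (<ᵇ-true m u e) le))) (go M)) (cnt-replace m M R le))
      where
      open +-*-Solver
      rearr : ∀ a b c d → (a + (b + c)) + d ≡ (a + b) + (d + c)
      rearr = solve 4 (λ a b c d → (a :+ (b :+ c)) :+ d := (a :+ b) :+ (d :+ c)) refl

  at-transposition : ∀ {u v} P M R i →
    at (P ++ v ∷ M ++ u ∷ R) i ≡ at (P ++ u ∷ M ++ v ∷ R) (tr (length P) (length P + suc (length M)) i)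
  at-transposition (p ∷ P) M R zero = refl
  at-transposition {u} {v} (p ∷ P) M R (suc i) = trans (at-transposition P M R i)
    (cong (at (p ∷ P ++ u ∷ M ++ v ∷ R)) (sym (tr-suc (length P) (length P + suc (length M)) i)))
  at-transposition {u} {v} [] M R zero = sym (at-M M)
    where
    at-M : ∀ M → at (M ++ v ∷ R) (length M) ≡ v
    at-M [] = refl
    at-M (m ∷ M) = at-M M
  at-transposition {u} {v} [] M R (suc i) = go M i (u ∷ M ++ v ∷ R) refl
    where
    at-M : ∀ M → at (M ++ u ∷ R) (length M) ≡ u
    at-M [] = refl
    at-M (m ∷ M) = at-M M
    at-ne : ∀ M i → i ≢ length M → at (M ++ u ∷ R) i ≡ at (M ++ v ∷ R) i
    at-ne [] zero ne = ⊥-elim (ne refl)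
    at-ne [] (suc i) ne = refl
    at-ne (m ∷ M) zero ne = refl
    at-ne (m ∷ M) (suc i) ne = at-ne M i (ne ∘ cong suc)
    go : ∀ M i x → x ≡ u ∷ M ++ v ∷ R → at (M ++ u ∷ R) i ≡ at x (tr 0 (suc (length M)) (suc i))
    go M i x refl with i ≟ length M
    ... | yes refl rewrite ≡ᵇ-refl (length M) = at-M M
    ... | no ne rewrite ≡ᵇ-ne ne = at-ne M i ne

  swapPos-list : ∀ {u v} P M R → swapPos (length P) (length P + suc (length M)) (P ++ u ∷ M ++ v ∷ R) ≡ P ++ v ∷ M ++ u ∷ R
  swapPos-list {u} {v} P M R = at-ext _ _ (trans (LP.length-map _ (upTo (length x))) (trans (LP.length-upTo _) lens))
      (λ i lt → let il = subst (i <_) (LP.length-map _ (upTo (length x))) lt in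
        trans (at-map _ (upTo (length x)) i il) (trans (cong (λ k → at x (tr a b k)) (at-upTo (length x) i (subst (i <_) (LP.length-upTo _) il)))
          (sym (at-transposition P M R i))))
    where
    x = P ++ u ∷ M ++ v ∷ R
    a = length P
    b = length P + suc (length M)
    lens : length x ≡ length (P ++ v ∷ M ++ u ∷ R)
    lens = trans (LP.length-++ P) (trans (cong (λ k → length P + suc k) (trans (LP.length-++ M) (sym (LP.length-++ M)))) (sym (LP.length-++ P)))

  split1 : ∀ b (x : List ℕ) → b < length x → ∃₂ λ M v → ∃ λ R → x ≡ M ++ v ∷ R × b ≡ length M
  split1 zero (v ∷ R) _ = [] , v , R , refl , refl
  split1 (suc b) (m ∷ x) (s≤s lt) with M , v , R , e , l ← split1 b x lt = m ∷ M , v , R , cong (m ∷_) e , cong suc l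

  split3 : ∀ a b (x : List ℕ) → a < b → b < length x → ∃₂ λ P u → ∃₂ λ M v → ∃ λ R →
    x ≡ P ++ u ∷ M ++ v ∷ R × a ≡ length P × b ≡ length P + suc (length M)
  split3 zero (suc b) (u ∷ x) _ (s≤s lt) with M , v , R , e , l ← split1 b x lt = [] , u , M , v , R , cong (u ∷_) e , refl , cong suc l
  split3 (suc a) (suc b) (p ∷ x) (s≤s ab) (s≤s lt) with P , u , M , v , R , e , la , lb ← split3 a b x ab lt =
    p ∷ P , u , M , v , R , cong (p ∷_) e , cong suc la , cong suc lb

  -- The smaller of the two values moves to the left, so no initial segment loses values below `k`.
  take-transposition : ∀ k z {u v} P M R → v ≤ u → cnt (_<ᵇ k) (take z (P ++ u ∷ M ++ v ∷ R)) ≤ cnt (_<ᵇ k) (take z (P ++ v ∷ M ++ u ∷ R))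
  take-transposition k zero P M R le = z≤n
  take-transposition k (suc z) {u} {v} (p ∷ P) M R le
    rewrite cnt-bit (_<ᵇ k) p (take z (P ++ u ∷ M ++ v ∷ R)) | cnt-bit (_<ᵇ k) p (take z (P ++ v ∷ M ++ u ∷ R)) =
    ℕP.+-monoʳ-≤ (bit (p <ᵇ k)) (take-transposition k z P M R le)
  take-transposition k (suc z) {u} {v} [] M R le
    rewrite cnt-bit (_<ᵇ k) u (take z (M ++ v ∷ R)) | cnt-bit (_<ᵇ k) v (take z (M ++ u ∷ R)) = go z M
    where
    go : ∀ z M → bit (u <ᵇ k) + cnt (_<ᵇ k) (take z (M ++ v ∷ R)) ≤ bit (v <ᵇ k) + cnt (_<ᵇ k) (take z (M ++ u ∷ R))
    go zero M = ℕP.+-monoˡ-≤ 0 (bit-mono _ _ (<ᵇ-trans-≤ {u} k le))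
    go (suc z) [] rewrite cnt-bit (_<ᵇ k) u (take z R) | cnt-bit (_<ᵇ k) v (take z R) = ℕP.≤-reflexive
      (solve 3 (λ a b c → a :+ (b :+ c) := b :+ (a :+ c)) refl (bit (u <ᵇ k)) (bit (v <ᵇ k)) (cnt (_<ᵇ k) (take z R)))
      where open +-*-Solver
    go (suc z) (m ∷ M) rewrite cnt-bit (_<ᵇ k) m (take z (M ++ u ∷ R)) | cnt-bit (_<ᵇ k) m (take z (M ++ v ∷ R)) =
      subst₂ _≤_ (rearr (bit (u <ᵇ k)) (bit (m <ᵇ k)) _) (rearr (bit (v <ᵇ k)) (bit (m <ᵇ k)) _) (ℕP.+-monoʳ-≤ (bit (m <ᵇ k)) (go z M))
      where
      open +-*-Solver
      rearr : ∀ a b c → b + (a + c) ≡ a + (b + c)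
      rearr = solve 3 (λ a b c → b :+ (a :+ c) := a :+ (b :+ c)) refl

  rank : ℕ → Word → ℕ
  rank k β = nt (take k β)

  private
    cnt-snoc : {A : Set} (p : A → Bool) → ∀ xs x → cnt p (xs ∷ʳ x) ≡ cnt p xs + bit (p x)
    cnt-snoc p xs x = trans (cnt-↭ p (PP.++-comm xs (x ∷ []))) (trans (cnt-bit p x xs) (ℕP.+-comm (bit (p x)) _))

    cnt-< : ∀ m A → Unique A → cnt (_<ᵇ suc m) A ≡ cnt (_<ᵇ m) A + bit (memb A m)
    cnt-< m [] _ = refl
    cnt-< m (a ∷ A) (pa ∷ u) rewrite cnt-bit (_<ᵇ suc m) a A | cnt-bit (_<ᵇ m) a A with a ≟ m
    ... | yes refl rewrite ≡ᵇ-refl a | <ᵇ-t (ℕP.n<1+n a) | <ᵇ-f {a} {a} ℕP.≤-refl =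
      trans (cong suc (trans (cnt-< a A u) (trans (cong (λ b → cnt (_<ᵇ a) A + bit b) (∉-memb A (All-∉ pa))) (ℕP.+-identityʳ _))))
        (ℕP.+-comm 1 _)
    ... | no ne rewrite ≡ᵇ-ne ne = trans (cong₂ _+_ (cong bit (iff-Bool (λ e → <ᵇ-t (ℕP.≤∧≢⇒< (ℕP.≤-pred (<ᵇ-true a (suc m) e)) ne))
              (λ e → <ᵇ-t (ℕP.m<n⇒m<1+n (<ᵇ-true a m e))))) (cnt-< m A u)) (sym (ℕP.+-assoc (bit (a <ᵇ m)) _ _))

    nt-memb : ∀ A → Unique A → ∀ m → nt (map (memb A) (upTo m)) ≡ cnt (_<ᵇ m) A
    nt-memb A u m = trans (nt-map (memb A) (upTo m)) (go m)
      where
      none : ∀ A → cnt (_<ᵇ 0) A ≡ 0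
      none [] = refl
      none (a ∷ A) = none A
      go : ∀ m → cnt (memb A) (upTo m) ≡ cnt (_<ᵇ m) A
      go zero = sym (none A)
      go (suc m) = trans (cong (cnt (memb A)) (sym (LP.upTo-∷ʳ m))) (trans (cnt-snoc (memb A) (upTo m) m)
        (trans (cong (_+ bit (memb A m)) (go m)) (sym (cnt-< m A u))))

  take-upTo : ∀ k n → k ≤ n → take k (upTo n) ≡ upTo k
  take-upTo k n le = go k n le id
    where
    go : ∀ k n → k ≤ n → (f : ℕ → ℕ) → take k (applyUpTo f n) ≡ applyUpTo f k
    go zero n le f = refl
    go (suc k) (suc n) (s≤s le) f = cong (f 0 ∷_) (go k n le (f ∘ suc))

  rank-path : ∀ {z n y} → IsPerm n y → ∀ k → k ≤ n → rank k (path z n y) ≡ cnt (_<ᵇ k) (take z y)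
  rank-path {z} {n} {y} p k le = trans (cong nt (trans (LP.take-map k (upTo n)) (cong (map (memb (take z y))) (take-upTo k n le))))
    (nt-memb (take z y) (UP.take⁺ z (perm-unique p)) k)

  -- A larger rank means more "(" so far and hence a lower path: `Dom lam mu` puts the path of μ
  -- weakly below that of λ. This is what Bruhat order becomes on cosets.
  Dom : Word → Word → Set
  Dom lam mu = ∀ k → rank k lam ≤ rank k mu

  dom-path : ∀ {z n x y} → IsPerm n x → IsPerm n y → (∀ k → cnt (_<ᵇ k) (take z x) ≤ cnt (_<ᵇ k) (take z y)) → Dom (path z n x) (path z n y)
  dom-path {z} {n} {x} {y} p q h k with k ≤? n
  ... | yes le = subst₂ _≤_ (sym (rank-path {z} p k le)) (sym (rank-path {z} q k le)) (h k)
  ... | no nle = subst₂ _≤_ (sym (all x p)) (sym (all y q)) (h n)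
    where
    all : ∀ x → IsPerm n x → rank k (path z n x) ≡ cnt (_<ᵇ n) (take z x)
    all x p = trans (cong nt (trans (take-all k (path z n x) (subst (_≤ k) (sym (length-path z n x)) (ℕP.<⇒≤ (ℕP.≰⇒> nle))))
        (sym (take-all n (path z n x) (ℕP.≤-reflexive (length-path z n x)))))) (rank-path {z} p n ℕP.≤-refl)
      where
      take-all : ∀ k (β : Word) → length β ≤ k → take k β ≡ β
      take-all k β le = LP.take-all k β le

  swapPos-perm : ∀ {n x} a b → IsPerm n x → a < b → b < n → IsPerm n (swapPos a b x)
  swapPos-perm {n} {x} a b p ab bn with P , u , M , v , R , refl , refl , refl ← split3 a b x ab (subst (b <_) (sym (perm-length p)) bn) =
    subst (IsPerm n) (sym (swapPos-list P M R)) (↭-trans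
      (PP.++⁺ˡ P (↭-trans (prep v (PP.shift u M R)) (↭-trans (swap v u refl) (prep u (↭-sym (PP.shift v M R)))))) p)

  dom-swapPos : ∀ {z n x} a b → IsPerm n x → a < b → b < n → len (swapPos a b x) < len x → Dom (path z n x) (path z n (swapPos a b x))
  dom-swapPos {z} {n} {x} a b p ab bn lt = dom-path {z} p (swapPos-perm a b p ab bn) go
    where
    go : ∀ k → cnt (_<ᵇ k) (take z x) ≤ cnt (_<ᵇ k) (take z (swapPos a b x))
    go k with P , u , M , v , R , refl , refl , refl ← split3 a b x ab (subst (b <_) (sym (perm-length p)) bn) with v ≤? u
    ... | yes le = subst (λ y → cnt (_<ᵇ k) (take z x) ≤ cnt (_<ᵇ k) (take z y)) (sym (swapPos-list P M R)) (take-transposition k z P M R le)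
    ... | no nle = ⊥-elim (ℕP.<⇒≱ lt (subst (λ y → len x ≤ len y) (sym (swapPos-list P M R)) (len-transposition P M R (ℕP.<⇒≤ (ℕP.≰⇒> nle)))))

  private
    transpositions-∈ : ∀ m {a b} → (a , b) ∈ transpositions m → a < b × b < m
    transpositions-∈ m e with b , mb , m′ ← ∈-concatMap-elim _ (upTo m) e with a , ma , refl ← ∈-map⁻ _ m′ = ∈-upTo⁻ ma , ∈-upTo⁻ mb

    ∈-transpositions : ∀ m {a b} → a < b → b < m → (a , b) ∈ transpositions m
    ∈-transpositions m ab bm = ∈-concatMap-intro _ (upTo m) (∈-upTo⁺ bm) (∈-map⁺ _ (∈-upTo⁺ ab))

  bruhatF⇒dom : ∀ {z n} f {y x} → IsPerm n x → bruhatF f y x ≡ true → Dom (path z n x) (path z n y)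
  bruhatF⇒dom zero {y} {x} p e with refl ← eqL-true y x e = λ k → ℕP.≤-refl
  bruhatF⇒dom {z} {n} (suc f) {y} {x} p e with eqL y x in q
  ... | true with refl ← eqL-true y x q = λ k → ℕP.≤-refl
  ... | false with (a , b) , m , r ← anyᵇ-true _ (transpositions (length x)) e
    with ab , bx ← transpositions-∈ (length x) m | lt , br ← ∧-true (len (swapPos a b x) <ᵇ len x) _ r =
    λ k → ℕP.≤-trans (dom-swapPos {z} a b p ab bn (<ᵇ-true _ _ lt) k) (bruhatF⇒dom {z} f {y} {swapPos a b x} (swapPos-perm a b p ab bn) br k)
    where
    bn : b < n
    bn = subst (b <_) (perm-length p) bx

  -- The descending chains searched by `bruhatF`, freed from the fuel so that they can be composed.
  data _⊑_ (y : Perm) : Perm → Set where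
    done : y ⊑ y
    down : ∀ {x} a b → a < b → b < length x → len (swapPos a b x) < len x → y ⊑ swapPos a b x → y ⊑ x

  ⊑-trans : ∀ {x y z} → x ⊑ y → y ⊑ z → x ⊑ z
  ⊑-trans p done = p
  ⊑-trans p (down a b ab bl lt q) = down a b ab bl lt (⊑-trans p q)

  ⊑⇒bruhatF : ∀ f {y x} → y ⊑ x → len x ≤ f → bruhatF (suc f) y x ≡ true
  ⊑⇒bruhatF f {y} done le rewrite eqL-refl y = refl
  ⊑⇒bruhatF zero (down a b ab bl lt p) le = ⊥-elim (ℕP.n≮0 (ℕP.<-≤-trans lt le))
  ⊑⇒bruhatF (suc f) {y} {x} (down a b ab bl lt p) le with eqL y x
  ... | true = refl
  ... | false = anyᵇ-∈ _ (transpositions (length x)) (∈-transpositions (length x) ab bl)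
    (cong₂ _∧_ (<ᵇ-t lt) (⊑⇒bruhatF f p (ℕP.≤-pred (ℕP.≤-trans lt le))))

  ⊑-maxrep : ∀ {z n y} → IsPerm n y → y ⊑ maxrep (path z n y)
  ⊑-maxrep {z} {n} {y} p = climb-induction {z} {n} (λ x → x ⊑ maxrep (path z n y)) (path z n y) done step y p refl
    where
    step : ∀ x j → IsPerm n x → path z n x ≡ path z n y → suc j < n → suc j ≢ z → at x j < at x (suc j) →
      rmul x (suc j) ⊑ maxrep (path z n y) → x ⊑ maxrep (path z n y)
    step x j px e lt ne asc h = ⊑-trans (down j (suc j) (ℕP.n<1+n j) (subst (suc j <_) (sym (perm-length pr)) lt)
        (subst (λ w → len w < len (rmul x (suc j))) (sym inv′) (ℕP.≤-reflexive (sym (rmul-up j px lt asc))))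
        (subst (x ⊑_) (sym inv′) done)) h
      where
      pr = rmul-perm j px lt
      inv′ : swapPos j (suc j) (rmul x (suc j)) ≡ x
      inv′ = rmul-invol j (perm-length px) lt

  private
    split-before : ∀ u v x → u ∈ x → v ∈ x → before u v x ≡ true → ∃₂ λ P M → ∃ λ R → x ≡ P ++ u ∷ M ++ v ∷ R ⊎ u ≡ v
    split-before u v (c ∷ x) mu mv b with c ≟ u
    split-before u v (.u ∷ x) mu (here e) b | yes refl = [] , [] , [] , inj₂ (sym e)
    split-before u v (.u ∷ x) mu (there mv) b | yes refl with M , R , e ← ∈-∃++ mv = [] , M , R , inj₁ (cong (u ∷_) e)
    ... | no ne with mu
    ...   | here e = ⊥-elim (ne (sym e))
    ...   | there mu′ with c ≟ v
    ...     | yes refl rewrite ≡ᵇ-refl c | ≡ᵇ-ne ne with () ← b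
    ...     | no nv with mv
    ...       | here e = ⊥-elim (nv (sym e))
    ...       | there mv′ rewrite ≡ᵇ-ne ne | ≡ᵇ-ne nv with split-before u v x mu′ mv′ b
    ...         | P , M , R , inj₁ e = c ∷ P , M , R , inj₁ (cong (c ∷_) e)
    ...         | P , M , R , inj₂ e = P , M , R , inj₂ e

    map-tr-list : ∀ j P M R → Unique (P ++ suc j ∷ M ++ j ∷ R) → map (tr j (suc j)) (P ++ suc j ∷ M ++ j ∷ R) ≡ P ++ j ∷ M ++ suc j ∷ R
    map-tr-list j (p ∷ P) M R (pp ∷ u) = cong₂ _∷_
      (tr-o p (All.lookup pp (∈-++⁺ʳ P (there (∈-++⁺ʳ M (here refl))))) (All.lookup pp (∈-++⁺ʳ P (here refl)))) (map-tr-list j P M R u)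
    map-tr-list j [] M R (ps ∷ u) = cong₂ _∷_ (tr-r j (suc j)) (go M u ps)
      where
      go : ∀ M → Unique (M ++ j ∷ R) → All (suc j ≢_) (M ++ j ∷ R) → map (tr j (suc j)) (M ++ j ∷ R) ≡ M ++ suc j ∷ R
      go (m ∷ M) (pm ∷ u) (ne ∷ ps) = cong₂ _∷_ (tr-o m (All.lookup pm (∈-++⁺ʳ M (here refl))) (λ e → ne (sym e))) (go M u ps)
      go [] (pj ∷ u) (_ ∷ ps) = cong₂ _∷_ (tr-l j (suc j)) (fix R pj ps)
        where
        fix : ∀ R → All (j ≢_) R → All (suc j ≢_) R → map (tr j (suc j)) R ≡ R
        fix [] _ _ = refl
        fix (r ∷ R) (a ∷ as) (b ∷ bs) = cong₂ _∷_ (tr-o r (λ e → a (sym e)) (λ e → b (sym e))) (fix R as bs)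

  -- Removing a box exchanges the values `j` and `suc j` wherever they stand. In terms of places
  -- this is a single transposition, whose two places are found by `split-before`.
  maxrep-box : ∀ {z n} p r → Shape n z (p ++ false ∷ true ∷ r) → maxrep (p ++ true ∷ false ∷ r) ⊑ maxrep (p ++ false ∷ true ∷ r)
  maxrep-box {z} {n} p r s = go (split-before (suc j) j x (perm-∈ px jn) (perm-∈ px (ℕP.<-trans (ℕP.n<1+n j) jn)) (before-peak {z} {n} p r (path-maxrep α s)))
    where
    j = length p
    α = p ++ false ∷ true ∷ r
    x = maxrep α
    px : IsPerm n x
    px = maxrep-perm α (proj₁ s)
    jn : suc j < n
    jn = split-lt p false true r (proj₁ s)
    go : (∃₂ λ P M → ∃ λ R → x ≡ P ++ suc j ∷ M ++ j ∷ R ⊎ suc j ≡ j) → maxrep (p ++ true ∷ false ∷ r) ⊑ x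
    go (P , M , R , inj₂ e) = ⊥-elim (ℕP.<⇒≢ (ℕP.n<1+n j) (sym e))
    go (P , M , R , inj₁ e) = down (length P) (length P + suc (length M)) (ℕP.m<m+n (length P) z<s)
        (subst (λ y → length P + suc (length M) < length y) (sym e)
           (ℕP.<-≤-trans (ℕP.+-monoʳ-< (length P) (s≤s (subst (length M <_) (sym (LP.length-++ M)) (ℕP.m<m+n (length M) z<s)))) (ℕP.≤-reflexive (sym (LP.length-++ P)))))
        (subst (λ y → len y < len x) (sym sw) (ℕP.≤-reflexive (sym (height-swap p r)))) (subst (maxrep (p ++ true ∷ false ∷ r) ⊑_) (sym sw) done)
      where
      sw : swapPos (length P) (length P + suc (length M)) x ≡ maxrep (p ++ true ∷ false ∷ r)
      sw = trans (cong (swapPos (length P) (length P + suc (length M))) e) (trans (swapPos-list P M R)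
        (trans (sym (map-tr-list j P M R (subst Unique e (perm-unique px)))) (trans (cong (lmul (suc j)) (sym e))
        (trans (cong (lmul (suc j)) (sym (lmul-maxrep p r))) (lmul-invol (suc j) (maxrep (p ++ true ∷ false ∷ r)))))))

  -- Le d λ μ: the path of μ stays weakly below the path of λ, which starts d boxes above it.
  data Le : ℕ → Word → Word → Set where
    nil : Le 0 [] []
    same : ∀ {d lam mu} b → Le d lam mu → Le d (b ∷ lam) (b ∷ mu)
    up : ∀ {d lam mu} → Le (suc d) lam mu → Le d (false ∷ lam) (true ∷ mu)
    dn : ∀ {d lam mu} → Le d lam mu → Le (suc d) (true ∷ lam) (false ∷ mu)

  private
    Lowered : ℕ → Word → Word → Set
    Lowered d lam mu = ∃₂ λ p r → lam ≡ p ++ false ∷ true ∷ r × Le d (p ++ true ∷ false ∷ r) mu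

    cons-lowered : ∀ {d d′ lam mu} b c → (∀ {lam} → Le d lam mu → Le d′ (b ∷ lam) (c ∷ mu)) → Lowered d lam mu → Lowered d′ (b ∷ lam) (c ∷ mu)
    cons-lowered b c f (p , r , e , l) = b ∷ p , r , cong (b ∷_) e , f l

    mutual
      -- After this ")" the gap is positive, and it has to return to 0, so λ contains a later "(".
      -- The first one completes a peak lying strictly above μ, whose box can be removed.
      lower-up : ∀ {d lam mu} → Le (suc d) lam mu → Lowered d (false ∷ lam) (true ∷ mu)
      lower-up (same true l) = [] , _ , refl , same true (up l)
      lower-up (dn l) = [] , _ , refl , same true (same false l)
      lower-up (same false l) = cons-lowered false true up (lower-same l)
      lower-up (up l) = cons-lowered false true up (lower-up l)

      lower-same : ∀ {d lam mu} → Le (suc d) lam mu → Lowered (suc d) (false ∷ lam) (false ∷ mu)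
      lower-same (same true l) = [] , _ , refl , dn (up l)
      lower-same (dn l) = [] , _ , refl , dn (same false l)
      lower-same (same false l) = cons-lowered false false (same false) (lower-same l)
      lower-same (up l) = cons-lowered false false (same false) (lower-up l)

  lower : ∀ {lam mu} → Le 0 lam mu → lam ≡ mu ⊎ Lowered 0 lam mu
  lower nil = inj₁ refl
  lower (same b l) with lower l
  ... | inj₁ e = inj₁ (cong (b ∷_) e)
  ... | inj₂ s = inj₂ (cons-lowered b b (same b) s)
  lower (up l) = inj₂ (lower-up l)

  maxrep-mono : ∀ {z n} fuel lam mu → inv lam ≤ fuel → Shape n z lam → Le 0 lam mu → maxrep mu ⊑ maxrep lam
  maxrep-mono {z} {n} fuel lam mu le s l with lower l
  ... | inj₁ refl = done
  maxrep-mono {z} {n} fuel lam mu le s l | inj₂ (p , r , refl , l′) with fuel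
  ... | zero = ⊥-elim (ℕP.n≮0 (subst (_≤ 0) (inv-swap p r) le))
  ... | suc fuel = ⊑-trans (maxrep-mono {z} {n} fuel (p ++ true ∷ false ∷ r) mu (ℕP.≤-pred (subst (_≤ suc fuel) (inv-swap p r) le))
          (shape-swap p false true r s) l′) (maxrep-box {z} {n} p r s)

  -- The number `d` absorbs the lead of λ at the point already reached; a step of μ across λ would
  -- need d = 0 and contradicts the rank inequality at k = 1.
  dom⇒Le : ∀ d lam mu → length lam ≡ length mu → nt lam ≡ nt mu + d → (∀ k → rank k lam ≤ rank k mu + d) → Le d lam mu
  dom⇒Le zero [] [] _ _ _ = nil
  dom⇒Le (suc d) [] [] _ () _
  dom⇒Le d (true ∷ lam) (true ∷ mu) l t h = same true (dom⇒Le d lam mu (ℕP.suc-injective l) (ℕP.suc-injective t) (λ k → ℕP.≤-pred (h (suc k))))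
  dom⇒Le d (false ∷ lam) (false ∷ mu) l t h = same false (dom⇒Le d lam mu (ℕP.suc-injective l) t (λ k → h (suc k)))
  dom⇒Le d (false ∷ lam) (true ∷ mu) l t h = up (dom⇒Le (suc d) lam mu (ℕP.suc-injective l) (trans t (sym (ℕP.+-suc (nt mu) d)))
    (λ k → ℕP.≤-trans (h (suc k)) (ℕP.≤-reflexive (sym (ℕP.+-suc _ d)))))
  dom⇒Le zero (true ∷ lam) (false ∷ mu) l t h with () ← h 1
  dom⇒Le (suc d) (true ∷ lam) (false ∷ mu) l t h = dn (dom⇒Le d lam mu (ℕP.suc-injective l) (ℕP.suc-injective (trans t (ℕP.+-suc (nt mu) d)))
    (λ k → ℕP.≤-pred (ℕP.≤-trans (h (suc k)) (ℕP.≤-reflexive (ℕP.+-suc _ d)))))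

  bruhat⇒dom : ∀ {z n y} mu → Shape n z mu → bruhat y (maxrep mu) ≡ true → Dom mu (path z n y)
  bruhat⇒dom {z} {n} {y} mu s e = subst (λ β → Dom β (path z n y)) (path-maxrep mu s)
    (bruhatF⇒dom {z} {n} (suc (len (maxrep mu))) {y} (maxrep-perm mu (proj₁ s)) e)

  dom⇒bruhat : ∀ {z n y} mu → Shape n z mu → IsPerm n y → z ≤ n → Dom mu (path z n y) → bruhat y (maxrep mu) ≡ true
  dom⇒bruhat {z} {n} {y} mu s p le h = ⊑⇒bruhatF (len (maxrep mu)) (⊑-trans (⊑-maxrep {z} p)
    (maxrep-mono {z} {n} (inv mu) mu (path z n y) ℕP.≤-refl s (dom⇒Le 0 mu (path z n y)
      (trans (proj₁ s) (sym (length-path z n y))) (trans (proj₂ s) (trans (sym (nt-path {z} p le)) (sym (ℕP.+-identityʳ _))))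
      (λ k → ℕP.≤-trans (h k) (ℕP.≤-reflexive (sym (ℕP.+-identityʳ _))))))) ℕP.≤-refl

-- Reduced words of v as sequences of boxes

module Boxes where
  open import Data.Nat
  open Permutations
  open Words
  open HeckeOperators using ()
  open CosetPaths
  open TensorPowers using (Word; nt; Shape; nt-swap; length-insert)
  open KLVectors using (split2)
  open BruhatOrder using (rank; bit; cnt-bit)

  private
    -- Right multiplication only moves places. As swaps of an arbitrary list it can be evaluated by
    -- peeling off entries, which one-line notation of a permutation would not permit.
    fadj : Perm → List ℕ → Perm
    fadj = foldl (λ x i → adj (i ∸ 1) x)

    foldl-fadj : ∀ {n x} ws → Valid n ws → length x ≡ n → foldl rmul x ws ≡ fadj x ws
    foldl-fadj [] [] l = refl
    foldl-fadj {n} {x} (suc j ∷ ws) ((_ , jn) ∷ v) l = trans (cong (λ y → foldl rmul y ws) (rmul-adj x j l jn))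
      (foldl-fadj ws v (trans (length-adj j x) l))

    fadj-++ : ∀ x u w → fadj x (u ++ w) ≡ fadj (fadj x u) w
    fadj-++ x u w = LP.foldl-++ _ x u w

    shift-right : ∀ P a xs ys → fadj (P ++ a ∷ xs ++ ys) (applyUpTo (λ i → suc (length P + i)) (length xs)) ≡ P ++ xs ++ a ∷ ys
    shift-right P a [] ys = refl
    shift-right P a (b ∷ xs) ys = begin
      fadj (adj (length P + 0) (P ++ a ∷ b ∷ xs ++ ys)) (applyUpTo (λ i → suc (length P + suc i)) (length xs))
        ≡⟨ cong₂ fadj (trans (cong (λ k → adj k (P ++ a ∷ b ∷ xs ++ ys)) (ℕP.+-identityʳ (length P)))
               (trans (adj-split P a b (xs ++ ys)) (sym (LP.++-assoc P (b ∷ []) (a ∷ xs ++ ys)))))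
             (applyUpTo-cong (λ i → cong suc (trans (ℕP.+-suc (length P) i) (trans (cong (_+ i) (ℕP.+-comm 1 (length P))) (cong (_+ i) (sym (LP.length-++ P)))))) (length xs)) ⟩
      fadj ((P ++ b ∷ []) ++ a ∷ xs ++ ys) (applyUpTo (λ i → suc (length (P ++ b ∷ []) + i)) (length xs))
        ≡⟨ shift-right (P ++ b ∷ []) a xs ys ⟩
      (P ++ b ∷ []) ++ xs ++ a ∷ ys
        ≡⟨ LP.++-assoc P (b ∷ []) (xs ++ a ∷ ys) ⟩
      P ++ b ∷ xs ++ a ∷ ys ∎
      where open ≡-Reasoning

    -- Each factor s_1⋯s_k carries the first entry behind the following k ones, so the entries pile
    -- up in reverse order in front of `D`.
    reverse-front : ∀ xs D → fadj (xs ++ D) (concatMap (λ k → map suc (upTo k)) (downFrom (length xs))) ≡ reverse xs ++ D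
    reverse-front [] D = refl
    reverse-front (a ∷ xs) D = trans (fadj-++ (a ∷ xs ++ D) (map suc (upTo (length xs))) _)
      (trans (cong (λ y → fadj y (concatMap (λ k → map suc (upTo k)) (downFrom (length xs))))
         (trans (cong (fadj (a ∷ xs ++ D)) (LP.map-upTo suc (length xs))) (shift-right [] a xs D)))
      (trans (reverse-front xs (a ∷ D)) (trans (sym (LP.++-assoc (reverse xs) (a ∷ []) D)) (cong (_++ D) (sym (LP.unfold-reverse a xs))))))

    map-downFrom : ∀ k m → map (k +_) (downFrom (suc m)) ≡ map (suc k +_) (downFrom m) ++ k ∷ []
    map-downFrom k zero = cong (_∷ []) (ℕP.+-identityʳ k)
    map-downFrom k (suc m) = cong₂ _∷_ (ℕP.+-suc k m) (map-downFrom k m)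

    shift-left : ∀ P ys a → fadj (P ++ ys ++ a ∷ []) (map (suc (length P) +_) (downFrom (length ys))) ≡ P ++ a ∷ ys
    shift-left P [] a = refl
    shift-left P (y ∷ ys) a = begin
      fadj (P ++ y ∷ ys ++ a ∷ []) (map (suc (length P) +_) (downFrom (suc (length ys))))
        ≡⟨ cong (fadj (P ++ y ∷ ys ++ a ∷ [])) (map-downFrom (suc (length P)) (length ys)) ⟩
      fadj (P ++ y ∷ ys ++ a ∷ []) (map (suc (suc (length P)) +_) (downFrom (length ys)) ++ suc (length P) ∷ [])
        ≡⟨ fadj-++ (P ++ y ∷ ys ++ a ∷ []) (map (suc (suc (length P)) +_) (downFrom (length ys))) _ ⟩
      adj (length P) (fadj (P ++ y ∷ ys ++ a ∷ []) (map (suc (suc (length P)) +_) (downFrom (length ys))))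
        ≡⟨ cong (adj (length P)) (trans (cong₂ fadj (sym (LP.++-assoc P (y ∷ []) (ys ++ a ∷ [])))
             (cong (λ k → map (suc k +_) (downFrom (length ys))) (trans (ℕP.+-comm 1 (length P)) (sym (LP.length-++ P)))))
             (trans (shift-left (P ++ y ∷ []) ys a) (LP.++-assoc P (y ∷ []) (a ∷ ys)))) ⟩
      adj (length P) (P ++ y ∷ a ∷ ys)
        ≡⟨ adj-split P y a ys ⟩
      P ++ a ∷ y ∷ ys ∎
      where open ≡-Reasoning

    cycle : ℕ → ℕ → List ℕ
    cycle n k = reverse (map (λ j → k + j) (upTo (n ∸ k)))

    cycle-downFrom : ∀ n k → cycle n k ≡ map (k +_) (downFrom (n ∸ k))
    cycle-downFrom n k = trans (sym (LP.reverse-map (k +_) (upTo (n ∸ k)))) (cong (map (k +_)) (LP.reverse-upTo (n ∸ k)))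

    -- The mirror image for the second block: each factor s_(n-1)⋯s_k brings the last entry of the
    -- remaining block to its front.
    reverse-back : ∀ n zs P → length P + length zs ≡ n →
      fadj (P ++ reverse zs) (concatMap (cycle n) (applyUpTo (suc (length P) +_) (length zs ∸ 1))) ≡ P ++ zs
    reverse-back n [] P l = refl
    reverse-back n (a ∷ []) P l = refl
    reverse-back n (a ∷ zs@(_ ∷ zs′)) P l = begin
      fadj (P ++ reverse (a ∷ zs)) (cycle n (suc (length P) + 0) ++ rest)
        ≡⟨ fadj-++ (P ++ reverse (a ∷ zs)) (cycle n (suc (length P) + 0)) rest ⟩
      fadj (fadj (P ++ reverse (a ∷ zs)) (cycle n (suc (length P) + 0))) rest
        ≡⟨ cong₂ fadj (trans (cong₂ fadj (cong (P ++_) (LP.unfold-reverse a zs)) c-eq) (trans (shift-left P (reverse zs) a) (sym (LP.++-assoc P (a ∷ []) (reverse zs))))) r-eq ⟩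
      fadj ((P ++ a ∷ []) ++ reverse zs) (concatMap (cycle n) (applyUpTo (suc (length (P ++ a ∷ [])) +_) (length zs ∸ 1)))
        ≡⟨ reverse-back n zs (P ++ a ∷ []) (trans (cong (_+ length zs) lenP) (trans (sym (ℕP.+-suc (length P) (length zs))) l)) ⟩
      (P ++ a ∷ []) ++ zs
        ≡⟨ LP.++-assoc P (a ∷ []) zs ⟩
      P ++ a ∷ zs ∎
      where
      open ≡-Reasoning
      lenP : length (P ++ a ∷ []) ≡ suc (length P)
      lenP = trans (LP.length-++ P) (ℕP.+-comm (length P) 1)
      rest = concatMap (cycle n) (applyUpTo (λ i → suc (length P) + suc i) (length zs′))
      c-eq : cycle n (suc (length P) + 0) ≡ map (suc (length P) +_) (downFrom (length (reverse zs)))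
      c-eq = trans (cong (cycle n) (ℕP.+-identityʳ (suc (length P)))) (trans (cycle-downFrom n (suc (length P)))
        (cong (λ k → map (suc (length P) +_) (downFrom k)) (trans (cong (_∸ suc (length P)) (trans (sym l) (ℕP.+-suc (length P) (length zs))))
          (trans (ℕP.m+n∸m≡n (suc (length P)) (length zs)) (sym (LP.length-reverse zs))))))
      r-eq : rest ≡ concatMap (cycle n) (applyUpTo (suc (length (P ++ a ∷ [])) +_) (length zs ∸ 1))
      r-eq = cong (concatMap (cycle n)) (applyUpTo-cong (λ i → trans (ℕP.+-suc (suc (length P)) i) (cong (λ k → suc k + i) (sym lenP))) (length zs′))

  base : ℕ → ℕ → Word
  base n z = replicate z true ++ replicate (n ∸ z) false

  private
    ones-base : ∀ k a b → ones k (replicate a true ++ replicate b false) ≡ applyUpTo (k +_) a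
    ones-base k zero zero = refl
    ones-base k zero (suc b) = ones-base (suc k) zero b
    ones-base k (suc a) b = cong₂ _∷_ (sym (ℕP.+-identityʳ k)) (trans (ones-base (suc k) a b) (applyUpTo-cong (λ i → sym (ℕP.+-suc k i)) a))

    zeros-base : ∀ k a b → zeros k (replicate a true ++ replicate b false) ≡ applyUpTo (k + a +_) b
    zeros-base k zero zero = refl
    zeros-base k zero (suc b) = cong₂ _∷_ (sym (trans (ℕP.+-identityʳ _) (ℕP.+-identityʳ k)))
      (trans (zeros-base (suc k) zero b) (applyUpTo-cong (λ i → sym (ℕP.+-suc (k + 0) i)) b))
    zeros-base k (suc a) b = trans (zeros-base (suc k) a b) (applyUpTo-cong (λ i → cong (_+ i) (sym (ℕP.+-suc k a))) b)

    nt-base : ∀ a b → nt (replicate a true ++ replicate b false) ≡ a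
    nt-base zero zero = refl
    nt-base zero (suc b) = nt-base zero b
    nt-base (suc a) b = cong suc (nt-base a b)

  base-shape : ∀ {n z} → z ≤ n → Shape n z (base n z)
  base-shape {n} {z} le = trans (LP.length-++ (replicate z true)) (trans (cong₂ _+_ (LP.length-replicate z) (LP.length-replicate (n ∸ z))) (ℕP.m+[n∸m]≡n le)) ,
    nt-base z (n ∸ z)

  minrep-base : ∀ {n z} → z ≤ n → minrep (base n z) ≡ idP n
  minrep-base {n} {z} le = trans (cong₂ _++_ (ones-base 0 z (n ∸ z)) (zeros-base 0 z (n ∸ z)))
    (trans (sym (applyUpTo-++ id z (n ∸ z))) (cong upTo (ℕP.m+[n∸m]≡n le)))

  private
    All-concatMap : {A B : Set} {P : B → Set} (f : A → List B) → ∀ {xs} → All (λ x → All P (f x)) xs → All P (concatMap f xs)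
    All-concatMap f [] = []
    All-concatMap f (p ∷ ps) = AllP.++⁺ p (All-concatMap f ps)

  wordJ-valid : ∀ n z → z ≤ n → Valid n (wordJ n z)
  wordJ-valid n z le = AllP.++⁺
    (All-concatMap (λ k → map suc (upTo k)) {reverse (upTo z)} (All.tabulate (λ {k} mk → AllP.map⁺ (All.tabulate (λ {i} mi → s≤s z≤n ,
        ℕP.<-≤-trans (s≤s (∈-upTo⁻ mi)) (ℕP.≤-trans (k<z mk) le))))))
    (All-concatMap (cycle n) {map (λ j → (z + 1) + j) (upTo (n ∸ (z + 1)))} (AllP.map⁺ (All.tabulate (λ {j} mj → valid-reverse _ (AllP.map⁺ (All.tabulate (λ {i} mi →
        ℕP.≤-trans (ℕP.≤-trans (ℕP.m≤n+m 1 z) (ℕP.m≤m+n (z + 1) j)) (ℕP.m≤m+n (z + 1 + j) i) ,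
        below i (z + 1 + j) (∈-upTo⁻ mi))))))))
    where
    k<z : ∀ {k} → k ∈ reverse (upTo z) → k < z
    k<z mk = ∈-upTo⁻ (PP.∈-resp-↭ (PP.↭-reverse (upTo z)) mk)
    below : ∀ i k → i < n ∸ k → k + i < n
    below i k lt = ℕP.<-≤-trans (ℕP.+-monoʳ-< k lt) (ℕP.≤-reflexive (ℕP.m+[n∸m]≡n (ℕP.<⇒≤ (ℕP.m∸n≢0⇒n<m {n} {k} (λ e → ℕP.n≮0 (subst (i <_) e lt))))))

  w0J-maxrep : ∀ n z → z ≤ n → w0J n z ≡ maxrep (base n z)
  w0J-maxrep n z le = begin
    evalWord n (wordJ n z)                      ≡⟨ foldl-fadj (wordJ n z) (wordJ-valid n z le) (LP.length-upTo n) ⟩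
    fadj (upTo n) (wordJ n z)                   ≡⟨ fadj-++ (upTo n) front back ⟩
    fadj (fadj (upTo n) front) back             ≡⟨ cong₂ fadj front-eq back-eq ⟩
    fadj (reverse A ++ B) (concatMap (cycle n) (applyUpTo (suc (length (reverse A)) +_) (length (reverse B) ∸ 1)))
      ≡⟨ cong (λ X → fadj (reverse A ++ X) (concatMap (cycle n) (applyUpTo (suc (length (reverse A)) +_) (length (reverse B) ∸ 1)))) (sym (LP.reverse-involutive B)) ⟩
    fadj (reverse A ++ reverse (reverse B)) (concatMap (cycle n) (applyUpTo (suc (length (reverse A)) +_) (length (reverse B) ∸ 1)))
      ≡⟨ reverse-back n (reverse B) (reverse A) (trans (cong₂ _+_ lA lB) (ℕP.m+[n∸m]≡n le)) ⟩
    reverse A ++ reverse B                      ≡⟨ cong₂ (λ X Y → reverse X ++ reverse Y) (ones-base 0 z (n ∸ z)) (zeros-base 0 z (n ∸ z)) ⟨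
    maxrep (base n z) ∎
    where
    open ≡-Reasoning
    A = applyUpTo id z
    B = applyUpTo (z +_) (n ∸ z)
    lA : length (reverse A) ≡ z
    lA = trans (LP.length-reverse A) (LP.length-applyUpTo id z)
    lB : length (reverse B) ≡ n ∸ z
    lB = trans (LP.length-reverse B) (LP.length-applyUpTo _ (n ∸ z))
    front = concatMap (λ k → map suc (upTo k)) (reverse (upTo z))
    back = concatMap (cycle n) (map (λ j → (z + 1) + j) (upTo (n ∸ (z + 1))))
    front-eq : fadj (upTo n) front ≡ reverse A ++ B
    front-eq = trans (cong₂ (λ x l → fadj x (concatMap (λ k → map suc (upTo k)) l))
        (trans (cong upTo (sym (ℕP.m+[n∸m]≡n le))) (applyUpTo-++ id z (n ∸ z)))
        (trans (LP.reverse-upTo z) (cong downFrom (sym (LP.length-applyUpTo id z))))) (reverse-front A B)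
    back-eq : back ≡ concatMap (cycle n) (applyUpTo (suc (length (reverse A)) +_) (length (reverse B) ∸ 1))
    back-eq = cong (concatMap (cycle n)) (trans (LP.map-upTo _ (n ∸ (z + 1)))
      (trans (applyUpTo-cong (λ i → cong (_+ i) (trans (ℕP.+-comm z 1) (cong suc (sym lA)))) (n ∸ (z + 1)))
       (cong (applyUpTo (suc (length (reverse A)) +_)) (trans (sym (ℕP.∸-+-assoc n z 1)) (cong (_∸ 1) (sym lB))))))

  -- Composition with w₀ᴶ reverses each of the two blocks of places and turns decreasing blocks into
  -- increasing ones.
  vOf-minrep : ∀ {n z} lam → z ≤ n → Shape n z lam → vOf n z (maxrep lam) ≡ minrep lam
  vOf-minrep {n} {z} lam le (l , t) = begin
    map (at w) (w0J n z)                                    ≡⟨ cong (map (at w)) (trans (w0J-maxrep n z le)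
                                                                  (cong₂ (λ X Y → reverse X ++ reverse Y) (ones-base 0 z (n ∸ z)) (zeros-base 0 z (n ∸ z)))) ⟩
    map (at w) (reverse (upTo z) ++ reverse (applyUpTo (z +_) (n ∸ z)))
      ≡⟨ trans (LP.map-++ (at w) (reverse (upTo z)) _) (cong₂ _++_ (LP.reverse-map (at w) (upTo z)) (LP.reverse-map (at w) (applyUpTo (z +_) (n ∸ z)))) ⟩
    reverse (map (at w) (upTo z)) ++ reverse (map (at w) (applyUpTo (z +_) (n ∸ z)))
      ≡⟨ cong₂ (λ X Y → reverse X ++ reverse Y) first second ⟩
    reverse A ++ reverse B                                  ≡⟨ cong₂ _++_ (LP.reverse-involutive (ones 0 lam)) (LP.reverse-involutive (zeros 0 lam)) ⟩
    minrep lam ∎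
    where
    open ≡-Reasoning
    w = maxrep lam
    A = reverse (ones 0 lam)
    B = reverse (zeros 0 lam)
    lA : length A ≡ z
    lA = trans (LP.length-reverse (ones 0 lam)) (trans (length-ones 0 lam) t)
    lB : length B ≡ n ∸ z
    lB = trans (sym (ℕP.m+n∸m≡n z (length B))) (cong (_∸ z) (trans (cong (_+ length B) (sym lA)) (trans (sym (LP.length-++ A)) (perm-length (maxrep-perm lam l)))))
    at-++ : ∀ xs (ys : List ℕ) i → at (xs ++ ys) (length xs + i) ≡ at ys i
    at-++ [] ys i = refl
    at-++ (x ∷ xs) ys i = at-++ xs ys i
    front : ∀ xs (ys : List ℕ) → applyUpTo (at (xs ++ ys)) (length xs) ≡ xs
    front [] ys = refl
    front (x ∷ xs) ys = cong (x ∷_) (front xs ys)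
    first : map (at w) (upTo z) ≡ A
    first = trans (LP.map-upTo (at w) z) (trans (cong (applyUpTo (at w)) (sym lA)) (front A B))
    second : map (at w) (applyUpTo (z +_) (n ∸ z)) ≡ B
    second = trans (LP.map-applyUpTo (z +_) (at w) (n ∸ z)) (trans (applyUpTo-cong (λ i → trans (cong (λ k → at w (k + i)) (sym lA)) (at-++ A B i)) (n ∸ z))
      (trans (cong (applyUpTo (at B)) (sym lB)) (trans (cong (λ Y → applyUpTo (at Y) (length B)) (sym (LP.++-identityʳ B))) (front B []))))

  -- A word that builds λ by adding one box after another, read from the right.
  data Built (n z : ℕ) : List ℕ → Word → Set where
    empty : Built n z [] (base n z)
    box : ∀ {u} p r → Built n z u (p ++ true ∷ false ∷ r) → Built n z (suc (length p) ∷ u) (p ++ false ∷ true ∷ r)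

  private
    before-sorted : ∀ j xs ys → AllPairs _<_ xs → j ∈ xs → before (suc j) j (xs ++ ys) ≡ false
    before-sorted j (x ∷ xs) ys (px ∷ s) (here refl) rewrite ≡ᵇ-refl j | ≡ᵇ-ne {j} {suc j} (ℕP.<⇒≢ (ℕP.n<1+n j)) = refl
    before-sorted j (x ∷ xs) ys (px ∷ s) (there m)
      rewrite ≡ᵇ-ne {x} {j} (ℕP.<⇒≢ (All.lookup px m)) | ≡ᵇ-ne {x} {suc j} (ℕP.<⇒≢ (ℕP.m<n⇒m<1+n (All.lookup px m))) = before-sorted j xs ys s m

    before-skip : ∀ u v xs ys → u ∉ xs → v ∉ xs → before u v (xs ++ ys) ≡ before u v ys
    before-skip u v [] ys _ _ = refl
    before-skip u v (x ∷ xs) ys nu nv rewrite ≡ᵇ-ne {x} {u} (λ e → nu (here (sym e))) | ≡ᵇ-ne {x} {v} (λ e → nv (here (sym e))) =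
      before-skip u v xs ys (nu ∘ there) (nv ∘ there)

    ∉-ones : ∀ β i → atB β i ≡ false → i ∉ ones 0 β
    ∉-ones β i e m with k , refl , _ , e′ ← ∈-ones 0 β m = t≢f (trans (sym e′) e)

    -- Both blocks are increasing, so a value can precede its predecessor only if it lies in the
    -- first block and the predecessor in the second.
    minrep-descent : ∀ p b c r → before (suc (length p)) (length p) (minrep (p ++ b ∷ c ∷ r)) ≡ true → b ≡ false × c ≡ true
    minrep-descent p true c r e = ⊥-elim (t≢f (trans (sym e) (before-sorted (length p) (ones 0 β) (zeros 0 β) (ones-sorted 0 β)
        (ones-∈ 0 β (length p) (ℕP.<-trans (ℕP.n<1+n _) (split-lt p true c r refl)) (atB-++ p true (c ∷ r))))))
      where β = p ++ true ∷ c ∷ r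
    minrep-descent p false true r e = refl , refl
    minrep-descent p false false r e = ⊥-elim (t≢f (trans (sym e) (trans
        (before-skip (suc (length p)) (length p) (ones 0 β) (zeros 0 β) (∉-ones β _ (atB-++₂ p false false r)) (∉-ones β _ (atB-++ p false (false ∷ r))))
        (trans (cong (before (suc (length p)) (length p)) (sym (LP.++-identityʳ (zeros 0 β))))
         (before-sorted (length p) (zeros 0 β) [] (zeros-sorted 0 β)
          (zeros-∈ 0 β (length p) (ℕP.<-trans (ℕP.n<1+n _) (split-lt p false false r refl)) (atB-++ p false (false ∷ r))))))))
      where β = p ++ false ∷ false ∷ r

    shape-down : ∀ {n z} p r → Shape n z (p ++ false ∷ true ∷ r) → Shape n z (p ++ true ∷ false ∷ r)
    shape-down p r (l , t) = trans (trans (length-insert p true false r) (sym (length-insert p false true r))) l , trans (nt-swap p true false r) t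

  -- The first letter of a reduced word is a left descent of v, hence a peak of its path. Removing
  -- that box leaves the shortest representative of the lower path, with the tail as a reduced word.
  reduced⇒built : ∀ {n z} u lam → z ≤ n → Valid n u → Shape n z lam → evalWord n u ≡ minrep lam → length u ≡ len (minrep lam) → Built n z u lam
  reduced⇒built {n} {z} [] lam le [] s e l = subst (Built n z []) (trans (sym (path-minrep (base n z) (base-shape le)))
      (trans (cong (path z n) (trans (minrep-base le) e)) (path-minrep lam s))) empty
  reduced⇒built {n} {z} (suc j ∷ u) lam le (v@((_ , jn) ∷ vu)) s e l
    with p , b , c , r , el , lp ← split2 j lam (subst (suc j <_) (sym (proj₁ s)) jn) =
      go {p} {r} b c lp el (minrep-descent p b c r (subst₂ (λ k x → before (suc k) k (minrep x) ≡ true) (sym lp) el (proj₁ down)))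
    where
    px : ∀ {x} → x ≡ evalWord n (suc j ∷ u) → IsPerm n x
    px refl = eval-perm n (suc j ∷ u) v
    y = evalWord n u
    y≡ : lmul (suc j) (minrep lam) ≡ y
    y≡ = trans (cong (lmul (suc j)) (trans (sym e) (eval-cons n (suc j) u v))) (lmul-invol (suc j) y)
    down : before (suc j) j (minrep lam) ≡ true × len (minrep lam) ≡ suc (len y)
    down with dl-dec j (px (sym e)) jn
    ... | inj₁ (d , q) = trans (sym (dl-before j (px (sym e)) jn)) d , trans q (cong (suc ∘ len) y≡)
    ... | inj₂ (_ , q) = ⊥-elim (ℕP.<-irrefl refl (ℕP.≤-trans (ℕP.≤-reflexive (trans (cong suc l) (trans (sym q) (cong len y≡))))
            (ℕP.≤-trans (len-eval-≤ n u vu) (ℕP.n≤1+n _))))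
    go : ∀ {p r} b c → length p ≡ j → lam ≡ p ++ b ∷ c ∷ r → b ≡ false × c ≡ true → Built n z (suc j ∷ u) lam
    go {p} {r} _ _ lp refl (refl , refl) = subst (λ k → Built n z (suc k ∷ u) lam) lp (box p r (reduced⇒built u (p ++ true ∷ false ∷ r) le vu (shape-down p r s) ev
        (ℕP.suc-injective (trans l (trans (proj₂ down) (cong (suc ∘ len) ev))))))
      where
      ev : y ≡ minrep (p ++ true ∷ false ∷ r)
      ev = trans (sym (lmul-invol (suc j) y)) (trans (cong (lmul (suc j)) (trans (sym (eval-cons n (suc j) u v)) (trans e (sym (lmul-minrep p r)))))
        (trans (cong (λ k → lmul (suc j) (lmul (suc k) (minrep (p ++ true ∷ false ∷ r)))) lp) (lmul-invol (suc j) (minrep (p ++ true ∷ false ∷ r)))))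

  cn : ℕ → List ℕ → ℕ
  cn k u = countᵇ k u

  cn-∷ : ∀ k x u → cn k (x ∷ u) ≡ bit (x ≡ᵇ k) + cn k u
  cn-∷ k x u = cnt-bit (_≡ᵇ k) x u

  rank-suc : ∀ k β → k < length β → rank (suc k) β ≡ rank k β + bit (atB β k)
  rank-suc zero (true ∷ β) _ = refl
  rank-suc zero (false ∷ β) _ = refl
  rank-suc (suc k) (true ∷ β) (s≤s lt) = cong suc (rank-suc k β lt)
  rank-suc (suc k) (false ∷ β) (s≤s lt) = rank-suc k β lt

  rank-mono : ∀ k β → rank k β ≤ rank (suc k) β
  rank-mono zero β = z≤n
  rank-mono (suc k) [] = z≤n
  rank-mono (suc k) (true ∷ β) = s≤s (rank-mono k β)
  rank-mono (suc k) (false ∷ β) = rank-mono k β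

  rank-suc-≤ : ∀ k β → rank (suc k) β ≤ suc (rank k β)
  rank-suc-≤ zero [] = z≤n
  rank-suc-≤ zero (true ∷ β) = s≤s z≤n
  rank-suc-≤ zero (false ∷ β) = z≤n
  rank-suc-≤ (suc k) [] = z≤n
  rank-suc-≤ (suc k) (true ∷ β) = s≤s (rank-suc-≤ k β)
  rank-suc-≤ (suc k) (false ∷ β) = rank-suc-≤ k β

  rank-box : ∀ k p r → rank k (p ++ true ∷ false ∷ r) ≡ bit (suc (length p) ≡ᵇ k) + rank k (p ++ false ∷ true ∷ r)
  rank-box zero p r = refl
  rank-box (suc zero) [] r = refl
  rank-box (suc (suc k)) [] r = refl
  rank-box (suc k) (true ∷ p) r = trans (cong suc (rank-box k p r)) (sym (ℕP.+-suc _ _))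
  rank-box (suc k) (false ∷ p) r = rank-box k p r

  -- A box in column `k` lowers `rank k` by one and changes no other rank. The letters in a column
  -- thus count the boxes between the path and the lowest path `base n z`.
  count-rank : ∀ {n z u mu} → Built n z u mu → ∀ k → cn k u + rank k mu ≡ rank k (base n z)
  count-rank empty k = refl
  count-rank {u = x ∷ u} (box p r b) k = trans (cong (_+ rank k (p ++ false ∷ true ∷ r)) (cn-∷ k x u))
    (trans (trans (cong (_+ rank k (p ++ false ∷ true ∷ r)) (ℕP.+-comm (bit (x ≡ᵇ k)) (cn k u))) (ℕP.+-assoc (cn k u) _ _))
      (trans (cong (cn k u +_) (sym (rank-box k p r))) (count-rank b k)))

  built-shape : ∀ {n z u mu} → z ≤ n → Built n z u mu → Shape n z mu
  built-shape le empty = base-shape le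
  built-shape le (box p r b) with l , t ← built-shape le b =
    trans (trans (length-insert p false true r) (sym (length-insert p true false r))) l , trans (nt-swap p false true r) t

  built-valid : ∀ {n z u mu} → z ≤ n → Built n z u mu → Valid n u
  built-valid le empty = []
  built-valid le (box p r b) = (s≤s z≤n , split-lt p true false r (proj₁ (built-shape le b))) ∷ built-valid le b

  eval-built : ∀ {n z u mu} → z ≤ n → Built n z u mu → evalWord n (u ++ wordJ n z) ≡ maxrep mu
  eval-built {n} {z} le empty = w0J-maxrep n z le
  eval-built {n} {z} {x ∷ u} le bx@(box p r b) with l ∷ v ← built-valid le bx =
    trans (eval-cons n x (u ++ wordJ n z) (l ∷ AllP.++⁺ v (wordJ-valid n z le)))
      (trans (cong (lmul x) (eval-built le b)) (lmul-maxrep p r))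

  -- The value `true` strikes a letter out: `K` is the complement of the mask, in agreement with
  -- `killed`.
  keep : (ℕ → Bool) → List ℕ → List ℕ
  keep K [] = []
  keep K (x ∷ u) = if K 0 then keep (K ∘ suc) u else x ∷ keep (K ∘ suc) u

  UpClosed : (ℕ → Bool) → List ℕ → Set
  UpClosed K u = ∀ p q → p < q → q < length u → noncomm (at u p) (at u q) ≡ true → K q ≡ true → K p ≡ true

  upClosed-tail : ∀ {K x u} → UpClosed K (x ∷ u) → UpClosed (K ∘ suc) u
  upClosed-tail h p q pq ql = h (suc p) (suc q) (s≤s pq) (s≤s ql)

  noncomm-t : ∀ {a b} → a ≤ suc b → b ≤ suc a → noncomm a b ≡ true
  noncomm-t p q = cong₂ _∧_ (≤ᵇ-t p) (≤ᵇ-t q)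

  private
    keep-cn : ∀ K u k → (∀ q → q < length u → at u q ≡ k → K q ≡ false) → cn k (keep K u) ≡ cn k u
    keep-cn K [] k h = refl
    keep-cn K (x ∷ u) k h with x ≟ k
    ... | yes refl rewrite h 0 z<s refl | ≡ᵇ-refl x = cong suc (keep-cn (K ∘ suc) u k (λ q l e → h (suc q) (s≤s l) e))
    ... | no ne with K 0
    ...   | true rewrite ≡ᵇ-ne ne = keep-cn (K ∘ suc) u k (λ q l e → h (suc q) (s≤s l) e)
    ...   | false rewrite ≡ᵇ-ne ne = keep-cn (K ∘ suc) u k (λ q l e → h (suc q) (s≤s l) e)

  -- An order ideal of the heap is again built box by box: whether a box can be added depends only on the three columns around it.
  built-keep : ∀ {n z u mu} → z ≤ n → Built n z u mu → ∀ K → UpClosed K u → ∃ λ nu → Built n z (keep K u) nu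
  built-keep le empty K h = _ , empty
  built-keep {n} {z} {x ∷ u} le (box p r b) K h with K 0 in K0
  ... | true = built-keep le b (K ∘ suc) (upClosed-tail {K} {x} {u} h)
  ... | false with nu , b′ ← built-keep le b (K ∘ suc) (upClosed-tail {K} {x} {u} h) = go (split2 (length p) nu lt)
    where
    j = length p
    sn = built-shape le b′
    lt : suc j < length nu
    lt = subst (suc j <_) (sym (proj₁ sn)) (split-lt p true false r (proj₁ (built-shape le b)))
    α = p ++ true ∷ false ∷ r
    lα : suc j < length α
    lα = split-lt p true false r refl
    -- A struck later letter in column `x` or a neighbouring column would not commute with `x` and
    -- would strike position 0 as well. These columns thus keep all their boxes and ranks, so the
    -- valley needed for the box at `x` is still present.
    alive : ∀ k → k ≤ suc x → x ≤ suc k → rank k nu ≡ rank k α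
    alive k k≤ x≤ = ℕP.+-cancelˡ-≡ (cn k u) _ _ (trans (cong (_+ rank k nu) (sym same))
        (trans (count-rank b′ k) (sym (count-rank b k))))
      where
      same : cn k (keep (K ∘ suc) u) ≡ cn k u
      same = keep-cn (K ∘ suc) u k unkilled
        where
        unkilled : ∀ q → q < length u → at u q ≡ k → K (suc q) ≡ false
        unkilled q l e with K (suc q) in eq
        ... | false = refl
        ... | true = ⊥-elim (t≢f (trans (sym (h 0 (suc q) z<s (s≤s l) (subst (λ k → noncomm x k ≡ true) (sym e) (noncomm-t x≤ k≤)) eq)) K0))
    bits : ∀ k → k < length nu → k < length α → rank k nu ≡ rank k α → rank (suc k) nu ≡ rank (suc k) α → atB nu k ≡ atB α k
    bits k l l′ e e′ = bit-inj (ℕP.+-cancelˡ-≡ (rank k nu) _ _ (trans (sym (rank-suc k nu l)) (trans e′ (trans (rank-suc k α l′) (cong (_+ bit (atB α k)) (sym e))))))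
      where
      bit-inj : ∀ {a b} → bit a ≡ bit b → a ≡ b
      bit-inj {true} {true} _ = refl
      bit-inj {false} {false} _ = refl
    go : (∃₂ λ p′ c → ∃₂ λ d r′ → nu ≡ p′ ++ c ∷ d ∷ r′ × length p′ ≡ j) → ∃ λ nu → Built n z (x ∷ keep (K ∘ suc) u) nu
    go (p′ , c , d , r′ , refl , lp) = finish c≡ d≡
      where
      c≡ : c ≡ true
      c≡ = trans (sym (trans (cong (atB (p′ ++ c ∷ d ∷ r′)) (sym lp)) (atB-++ p′ c (d ∷ r′))))
        (trans (bits j (ℕP.<-trans (ℕP.n<1+n j) lt) (ℕP.<-trans (ℕP.n<1+n j) lα) (alive j (ℕP.≤-trans (ℕP.n≤1+n j) (ℕP.n≤1+n x)) ℕP.≤-refl) (alive (suc j) (ℕP.n≤1+n x) (ℕP.n≤1+n x)))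
          (atB-++ p true (false ∷ r)))
      d≡ : d ≡ false
      d≡ = trans (sym (trans (cong (atB (p′ ++ c ∷ d ∷ r′)) (cong suc (sym lp))) (atB-++₂ p′ c d r′)))
        (trans (bits (suc j) lt lα (alive (suc j) (ℕP.n≤1+n x) (ℕP.n≤1+n x)) (alive (suc (suc j)) ℕP.≤-refl (ℕP.≤-trans (ℕP.n≤1+n x) (ℕP.n≤1+n (suc x)))))
          (atB-++₂ p true false r))
      finish : c ≡ true → d ≡ false → ∃ λ nu → Built n z (x ∷ keep (K ∘ suc) u) nu
      finish refl refl = p′ ++ false ∷ true ∷ r′ , subst (λ k → Built n z (suc k ∷ keep (K ∘ suc) u) (p′ ++ false ∷ true ∷ r′)) lp (box p′ r′ b′)

-- Masks and the cosets below x(t)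

module Masks where
  open import Data.Nat
  open Permutations
  open Words
  open CosetPaths
  open TensorPowers using (Word)
  open BruhatOrder hiding (lower)
  open Boxes

  private
    touches : List ℕ → ℕ → List ℕ → Bool
    touches W p acc = anyᵇ (λ q → noncomm (at W p) (at W q)) acc

    next : List ℕ → ℕ → List ℕ → List ℕ
    next W p acc = if touches W p acc then p ∷ acc else acc

    next-⊆ : ∀ W p acc {q} → q ∈ acc → q ∈ next W p acc
    next-⊆ W p acc m with touches W p acc
    ... | true = there m
    ... | false = m

    next-∈ : ∀ W p acc {q} → q ∈ next W p acc → q ∈ acc ⊎ q ≡ p
    next-∈ W p acc m with touches W p acc
    next-∈ W p acc (here e) | true = inj₂ e
    next-∈ W p acc (there m) | true = inj₁ m
    ... | false = inj₁ m

    go-⊆ : ∀ W s acc {q} → q ∈ acc → q ∈ upSetGo W s acc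
    go-⊆ W zero acc m = m
    go-⊆ W (suc s) acc m = go-⊆ W s (next W s acc) (next-⊆ W s acc m)

    go-closed : ∀ W s acc → (∀ {q} → q ∈ acc → s ≤ q) →
      (∀ {p q} → s ≤ p → p < q → q ∈ acc → noncomm (at W p) (at W q) ≡ true → p ∈ acc) →
      ∀ {p q} → p < q → q ∈ upSetGo W s acc → noncomm (at W p) (at W q) ≡ true → p ∈ upSetGo W s acc
    go-closed W zero acc ge cl lt m nc = cl z≤n lt m nc
    go-closed W (suc s) acc ge cl = go-closed W s (next W s acc) ge′ cl′
      where
      ge′ : ∀ {q} → q ∈ next W s acc → s ≤ q
      ge′ m with next-∈ W s acc m
      ... | inj₁ m′ = ℕP.<⇒≤ (ge m′)
      ... | inj₂ refl = ℕP.≤-refl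
      cl′ : ∀ {p q} → s ≤ p → p < q → q ∈ next W s acc → noncomm (at W p) (at W q) ≡ true → p ∈ next W s acc
      cl′ {p} {q} sp pq m nc with next-∈ W s acc m
      ... | inj₂ refl = ⊥-elim (ℕP.<⇒≱ pq sp)
      ... | inj₁ m′ with p ≟ s
      ...   | no ne = next-⊆ W s acc (cl (ℕP.≤∧≢⇒< sp (λ e → ne (sym e))) pq m′ nc)
      ...   | yes refl with touches W p acc in eq
      ...     | true = here refl
      ...     | false = ⊥-elim (t≢f (trans (sym (anyᵇ-∈ _ acc m′ nc)) eq))

    go-minimal : ∀ W (Q : ℕ → Set) → (∀ {p q} → p < q → Q q → noncomm (at W p) (at W q) ≡ true → Q p) →
      ∀ s acc → (∀ {q} → q ∈ acc → s ≤ q × Q q) → ∀ {q} → q ∈ upSetGo W s acc → Q q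
    go-minimal W Q cl zero acc h m = proj₂ (h m)
    go-minimal W Q cl (suc s) acc h = go-minimal W Q cl s (next W s acc) h′
      where
      h′ : ∀ {q} → q ∈ next W s acc → s ≤ q × Q q
      h′ {q} m with touches W s acc in eq
      ... | false = ℕP.<⇒≤ (proj₁ (h m)) , proj₂ (h m)
      h′ (there m) | true = ℕP.<⇒≤ (proj₁ (h m)) , proj₂ (h m)
      h′ (here refl) | true with q′ , m′ , nc ← anyᵇ-true _ acc eq = ℕP.≤-refl , cl (proj₁ (h m′)) (proj₂ (h m′)) nc

  upSet-self : ∀ W r → r ∈ upSet W r
  upSet-self W r = go-⊆ W r (r ∷ []) (here refl)

  upSet-closed : ∀ W r {p q} → p < q → q ∈ upSet W r → noncomm (at W p) (at W q) ≡ true → p ∈ upSet W r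
  upSet-closed W r = go-closed W r (r ∷ []) (λ { (here refl) → ℕP.≤-refl }) (λ { sp pq (here refl) _ → ⊥-elim (ℕP.<⇒≱ pq sp) })

  upSet-minimal : ∀ W r (Q : ℕ → Set) → (∀ {p q} → p < q → Q q → noncomm (at W p) (at W q) ≡ true → Q p) → Q r →
    ∀ {q} → q ∈ upSet W r → Q q
  upSet-minimal W r Q cl qr = go-minimal W Q cl r (r ∷ []) (λ { (here refl) → ℕP.≤-refl , qr })

  private
    occF : (ℕ → ℕ) → ℕ → List ℕ → List ℕ
    occF f k W = map proj₁ (filterᵇ (λ p → proj₂ p ≡ᵇ k) (zip (applyUpTo f (length W)) W))

    -- The top `m` entries of a column are those preceded by fewer than `m` equal letters, a
    -- condition that passes to the tail; `f` carries the shifted positions.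
    occF-∈ : ∀ f k W m {r} → r ∈ take m (occF f k W) → ∃ λ i → r ≡ f i × i < length W × at W i ≡ k × cn k (take i W) < m
    occF-∈ f k [] (suc m) ()
    occF-∈ f k (x ∷ W) m mem with x ≡ᵇ k in eq
    occF-∈ f k (x ∷ W) (suc m) (here refl) | true = 0 , refl , z<s , ≡ᵇ-true x k eq , z<s
    occF-∈ f k (x ∷ W) (suc m) (there mem) | true with i , e , l , a , c ← occF-∈ (f ∘ suc) k W m mem =
      suc i , e , s≤s l , a , ℕP.≤-trans (ℕP.≤-reflexive (cong suc (trans (cn-∷ k x (take i W)) (cong (λ b → bit b + cn k (take i W)) eq)))) (s≤s c)
    ... | false with i , e , l , a , c ← occF-∈ (f ∘ suc) k W m mem =
      suc i , e , s≤s l , a , ℕP.≤-trans (ℕP.≤-reflexive (cong suc (trans (cn-∷ k x (take i W)) (cong (λ b → bit b + cn k (take i W)) eq)))) c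

    ∈-occF : ∀ f k W m i → i < length W → at W i ≡ k → cn k (take i W) < m → f i ∈ take m (occF f k W)
    ∈-occF f k (x ∷ W) (suc m) zero l refl c rewrite ≡ᵇ-refl x = here refl
    ∈-occF f k (x ∷ W) (suc m) (suc i) (s≤s l) a c with x ≡ᵇ k in eq
    ... | true = there (∈-occF (f ∘ suc) k W m i l a (ℕP.≤-pred c))
    ... | false = ∈-occF (f ∘ suc) k W (suc m) i l a c

  occurrences-∈ : ∀ k W m {r} → r ∈ take m (occurrences k W) → r < length W × at W r ≡ k × cn k (take r W) < m
  occurrences-∈ k W m mem with i , refl , l , a , c ← occF-∈ id k W m mem = l , a , c

  ∈-occurrences : ∀ k W m i → i < length W → at W i ≡ k → cn k (take i W) < m → i ∈ take m (occurrences k W)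
  ∈-occurrences k W m i = ∈-occF id k W m i

  keep-indexed : ∀ K W → map proj₂ (filterᵇ (λ pw → not (K (proj₁ pw))) (indexed W)) ≡ keep K W
  keep-indexed K W = go id W
    where
    go : ∀ f W → map proj₂ (filterᵇ (λ pw → not (K (proj₁ pw))) (zip (applyUpTo f (length W)) W)) ≡ keep (K ∘ f) W
    go f [] = refl
    go f (x ∷ W) with K (f 0)
    ... | true = go (f ∘ suc) W
    ... | false = cong (x ∷_) (go (f ∘ suc) W)

  keep-++ : ∀ K u W → (∀ p → length u ≤ p → K p ≡ false) → keep K (u ++ W) ≡ keep K u ++ W
  keep-++ K [] W h = keep-all K W (λ p → h p z≤n)
    where
    keep-all : ∀ K W → (∀ p → K p ≡ false) → keep K W ≡ W
    keep-all K [] h = refl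
    keep-all K (x ∷ W) h rewrite h 0 = cong (x ∷_) (keep-all (K ∘ suc) W (h ∘ suc))
  keep-++ K (x ∷ u) W h with K 0
  ... | true = keep-++ (K ∘ suc) u W (λ p l → h (suc p) (s≤s l))
  ... | false = cong (x ∷_) (keep-++ (K ∘ suc) u W (λ p l → h (suc p) (s≤s l)))

  at-++ˡ : ∀ u W p → p < length u → at (u ++ W) p ≡ at u p
  at-++ˡ (x ∷ u) W zero l = refl
  at-++ˡ (x ∷ u) W (suc p) (s≤s l) = at-++ˡ u W p l

  take-++ˡ : ∀ (u W : List ℕ) p → p ≤ length u → take p (u ++ W) ≡ take p u
  take-++ˡ u W zero l = refl
  take-++ˡ (x ∷ u) W (suc p) (s≤s l) = cong (x ∷_) (take-++ˡ u W p l)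

  cn-++ : ∀ k u W → cn k (u ++ W) ≡ cn k u + cn k W
  cn-++ k [] W = refl
  cn-++ k (x ∷ u) W = trans (cn-∷ k x (u ++ W)) (trans (cong (bit (x ≡ᵇ k) +_) (cn-++ k u W))
    (trans (sym (ℕP.+-assoc (bit (x ≡ᵇ k)) (cn k u) (cn k W))) (cong (_+ cn k W) (sym (cn-∷ k x u)))))

  cn-take-≥ : ∀ k u W r → length u ≤ r → cn k u ≤ cn k (take r (u ++ W))
  cn-take-≥ k u W r le = subst (λ l → cn k u ≤ cn k l) (sym (split u r le)) (subst (cn k u ≤_) (sym (cn-++ k u (take (r ∸ length u) W))) (ℕP.m≤m+n _ _))
    where
    split : ∀ u r → length u ≤ r → take r (u ++ W) ≡ u ++ take (r ∸ length u) W
    split [] r le = refl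
    split (x ∷ u) (suc r) (s≤s le) = cong (x ∷_) (split u r le)

  cn-split : ∀ k u p → p < length u → at u p ≡ k → cn k u ≡ suc (cn k (take p u) + cn k (drop (suc p) u))
  cn-split k (x ∷ u) zero l refl rewrite ≡ᵇ-refl x = refl
  cn-split k (x ∷ u) (suc p) (s≤s l) e = trans (cn-∷ k x u) (trans (cong (bit (x ≡ᵇ k) +_) (cn-split k u p l e))
    (trans (ℕP.+-suc _ _) (cong suc (trans (sym (ℕP.+-assoc (bit (x ≡ᵇ k)) _ _)) (cong (_+ cn k (drop (suc p) u)) (sym (cn-∷ k x (take p u))))))))

  keep-cn-≤ : ∀ K u k → cn k (keep K u) ≤ cn k u
  keep-cn-≤ K [] k = z≤n
  keep-cn-≤ K (x ∷ u) k with K 0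
  ... | true = ℕP.≤-trans (keep-cn-≤ (K ∘ suc) u k) (ℕP.≤-trans (ℕP.m≤n+m _ (bit (x ≡ᵇ k))) (ℕP.≤-reflexive (sym (cn-∷ k x u))))
  ... | false rewrite cn-∷ k x u | cn-∷ k x (keep (K ∘ suc) u) = ℕP.+-monoʳ-≤ (bit (x ≡ᵇ k)) (keep-cn-≤ (K ∘ suc) u k)

  keep-cn-killed : ∀ K u k m → (∀ i → i < length u → at u i ≡ k → cn k (take i u) < m → K i ≡ true) →
    m ≤ cn k u → cn k (keep K u) + m ≤ cn k u
  keep-cn-killed K u k zero h le = ℕP.≤-trans (ℕP.≤-reflexive (ℕP.+-identityʳ _)) (keep-cn-≤ K u k)
  keep-cn-killed K (x ∷ u) k (suc m) h le with x ≟ k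
  ... | yes refl rewrite h 0 z<s refl z<s | ≡ᵇ-refl x = ℕP.≤-trans (ℕP.≤-reflexive (ℕP.+-suc _ m))
        (s≤s (keep-cn-killed (K ∘ suc) u k m (λ i l e c → h (suc i) (s≤s l) e (subst (_< suc m) (sym (trans (cn-∷ k k (take i u)) (cong (λ b → bit b + cn k (take i u)) (≡ᵇ-refl k)))) (s≤s c))) (ℕP.≤-pred le)))
  ... | no ne = ℕP.≤-trans (ℕP.≤-reflexive (cong (_+ suc m) head)) (ℕP.≤-trans
        (keep-cn-killed (K ∘ suc) u k (suc m) (λ i l e c → h (suc i) (s≤s l) e (subst (_< suc m) (sym (skip (take i u))) c)) (subst (suc m ≤_) (skip u) le))
        (ℕP.≤-reflexive (sym (skip u))))
    where
    skip : ∀ v → cn k (x ∷ v) ≡ cn k v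
    skip v = trans (cn-∷ k x v) (cong (λ b → bit b + cn k v) (≡ᵇ-ne ne))
    head : cn k (keep K (x ∷ u)) ≡ cn k (keep (K ∘ suc) u)
    head with K 0
    ... | true = refl
    ... | false = skip (keep (K ∘ suc) u)

  -- Positions of u whose box lies outside the path β.
  Outside : ℕ → ℕ → Word → List ℕ → ℕ → Set
  Outside n z β u p = rank (at u p) (base n z) < suc (cn (at u p) (drop (suc p) u)) + rank (at u p) β

  -- With `p` on top, the path α before that box has a valley at `x`. The box of `q` being outside
  -- puts α strictly above β in the column of `q`; the valley and unit steps leave α weakly above β
  -- in column `x`, so the box added there is outside too.
  outside-closed : ∀ {n z u mu} → z ≤ n → Built n z u mu → ∀ β p q → p < q → q < length u →
    noncomm (at u p) (at u q) ≡ true → Outside n z β u q → Outside n z β u p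
  outside-closed {u = x ∷ u} le (box pl r b) β (suc p) (suc q) (s≤s pq) (s≤s ql) nc o = outside-closed le b β p q pq ql nc o
  outside-closed {n} {z} {x ∷ u} le (box pl r b) β zero (suc q) _ (s≤s ql) nc o with xk , kx ← ∧-true (x ≤ᵇ suc (at u q)) _ nc =
    ℕP.≤-trans (s≤s (ℕP.≤-trans (ℕP.≤-reflexive (sym (count-rank b x))) (ℕP.+-monoʳ-≤ (cn x u) (main k (≤ᵇ-true _ _ xk) (≤ᵇ-true _ _ kx) below)))) ℕP.≤-refl
    where
    k = at u q
    α = pl ++ true ∷ false ∷ r
    lα : x < length α
    lα = split-lt pl true false r refl
    below : rank k α < rank k β
    below = ℕP.+-cancelˡ-< (cn k u) _ _ (subst (_< cn k u + rank k β) (sym (count-rank b k))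
      (ℕP.<-≤-trans o (ℕP.+-monoˡ-≤ (rank k β) (ℕP.≤-trans (s≤s (ℕP.m≤n+m _ (cn k (take q u)))) (ℕP.≤-reflexive (sym (cn-split k u q ql refl)))))))
    main : ∀ k → x ≤ suc k → k ≤ suc x → rank k α < rank k β → rank x α ≤ rank x β
    main k xk kx lt with k ≟ x | k ≟ suc x
    ... | yes refl | _ = ℕP.<⇒≤ lt
    ... | no _ | yes refl = ℕP.≤-pred (ℕP.≤-trans (subst (_< rank (suc x) β) flat lt) (rank-suc-≤ x β))
      where
      flat : rank (suc x) α ≡ rank x α
      flat = trans (rank-suc x α lα) (trans (cong (λ c → rank x α + bit c) (atB-++₂ pl true false r)) (ℕP.+-identityʳ _))
    ... | no a | no c = ℕP.≤-trans (rank-suc-≤ (length pl) α) (ℕP.≤-trans (subst (λ k → rank k α < rank k β) k≡ lt) (rank-mono (length pl) β))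
      where
      k≡ : k ≡ length pl
      k≡ = ℕP.≤-antisym (ℕP.≤-pred (ℕP.≤∧≢⇒< (ℕP.≤-pred (ℕP.≤∧≢⇒< kx c)) a)) (ℕP.≤-pred xk)

  -- Struck boxes lie outside β, so every column retains its boxes inside β. The minimum covers
  -- suffixes of the word that do not yet contain all of these boxes.
  keep-outside : ∀ {n z} β K u k → (∀ p → p < length u → K p ≡ true → Outside n z β u p) →
    rank k (base n z) ⊓ (cn k u + rank k β) ≤ cn k (keep K u) + rank k β
  keep-outside {n} {z} β K [] k h = ℕP.m⊓n≤n (rank k (base n z)) (rank k β)
  keep-outside {n} {z} β K (x ∷ u) k h with keep-outside {n} {z} β (K ∘ suc) u k (λ p l e → h (suc p) (s≤s l) e) | x ≟ k
  ... | ih | yes refl rewrite cn-∷ x x u | ≡ᵇ-refl x with K 0 in K0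
  ...   | true = ℕP.≤-trans (ℕP.m⊓n≤m (rank x (base n z)) _) (subst (_≤ _) (ℕP.m≤n⇒m⊓n≡m (ℕP.≤-pred (h 0 z<s K0))) ih)
  ...   | false rewrite ≡ᵇ-refl x = ℕP.≤-trans (ℕP.⊓-monoˡ-≤ (suc (cn x u + rank x β)) (ℕP.n≤1+n (rank x (base n z)))) (s≤s ih)
  keep-outside {n} {z} β K (x ∷ u) k h | ih | no ne rewrite cn-∷ k x u | ≡ᵇ-ne ne with K 0
  ... | true = ih
  ... | false rewrite ≡ᵇ-ne ne = ih

  killed : ℕ → ℕ → List ℕ → List ℕ → ℕ → Bool
  killed n z vw t p = anyᵇ (λ pm → isValley (proj₁ pm) ∧
      anyᵇ (λ r → anyᵇ (λ u → u ≡ᵇ p) (upSet (fullWord n z vw) r))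
           (take (proj₂ pm) (occurrences (valleyCol vw (proj₁ pm)) (fullWord n z vw))))
    (zip (pairsT vw) t)

  module _ {n z : ℕ} {vw : List ℕ} {lam : Word} (le : z ≤ n) (b : Built n z vw lam) (t : List ℕ) where
    private
      W = fullWord n z vw
      PL = zip (pairsT vw) t
      K = killed n z vw t

      killed-true : ∀ {p} → K p ≡ true → ∃ λ pm → pm ∈ PL × isValley (proj₁ pm) ≡ true ×
        ∃ λ r → r ∈ take (proj₂ pm) (occurrences (valleyCol vw (proj₁ pm)) W) × p ∈ upSet W r
      killed-true {p} e with pm , m , e′ ← anyᵇ-true _ PL e
        with v , e″ ← ∧-true (isValley (proj₁ pm)) _ e′
        with r , mr , e‴ ← anyᵇ-true _ (take (proj₂ pm) (occurrences (valleyCol vw (proj₁ pm)) W)) e″ = pm , m , v , r , mr , memb-∈ (upSet W r) e‴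

      true-killed : ∀ {p pm r} → pm ∈ PL → isValley (proj₁ pm) ≡ true →
        r ∈ take (proj₂ pm) (occurrences (valleyCol vw (proj₁ pm)) W) → p ∈ upSet W r → K p ≡ true
      true-killed {p} {pm} {r} m v mr mp = anyᵇ-∈ _ PL m (cong₂ _∧_ v (anyᵇ-∈ (λ r → anyᵇ (λ u → u ≡ᵇ p) (upSet W r)) _ mr (∈-memb (upSet W r) mp)))

    module _ (cap : ∀ {pm} → pm ∈ PL → isValley (proj₁ pm) ≡ true → proj₂ pm ≤ capacity vw (proj₁ pm)) where
      private
        -- The capacity bound keeps the top occurrences of the valley column inside the word of v.
        -- Elements above them have smaller positions, so the letters of w₀ᴶ are never struck.
        seed-< : ∀ {pm r} → pm ∈ PL → isValley (proj₁ pm) ≡ true → r ∈ take (proj₂ pm) (occurrences (valleyCol vw (proj₁ pm)) W) →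
          r < length vw × at vw r ≡ valleyCol vw (proj₁ pm) × cn (valleyCol vw (proj₁ pm)) (take r vw) < proj₂ pm
        seed-< {pm} {r} m v mr with l , a , c ← occurrences-∈ (valleyCol vw (proj₁ pm)) W (proj₂ pm) mr with r <? length vw
        ... | yes lt = lt , trans (sym (at-++ˡ vw (wordJ n z) r lt)) a ,
              subst (λ u → cn (valleyCol vw (proj₁ pm)) u < proj₂ pm) (take-++ˡ vw (wordJ n z) r (ℕP.<⇒≤ lt)) c
        ... | no nlt = ⊥-elim (ℕP.<⇒≱ c (ℕP.≤-trans (cap m v) (cn-take-≥ (valleyCol vw (proj₁ pm)) vw (wordJ n z) r (ℕP.≮⇒≥ nlt))))

        killed-< : ∀ {p} → K p ≡ true → p < length vw
        killed-< {p} e with pm , m , v , r , mr , mp ← killed-true e =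
          upSet-minimal W r (_< length vw) (λ pq q _ → ℕP.<-trans pq q) (proj₁ (seed-< m v mr)) mp

        K-closed : UpClosed K vw
        K-closed p q pq ql nc e with pm , m , v , r , mr , mp ← killed-true e =
          true-killed m v mr (upSet-closed W r pq mp (subst₂ (λ a c → noncomm a c ≡ true)
            (sym (at-++ˡ vw (wordJ n z) p (ℕP.<-trans pq ql))) (sym (at-++ˡ vw (wordJ n z) q ql)) nc))

        K-false : ∀ p → length vw ≤ p → K p ≡ false
        K-false p le with K p in e
        ... | false = refl
        ... | true = ⊥-elim (ℕP.<⇒≱ (killed-< e) le)

      mask-path : Word
      mask-path = proj₁ (built-keep le b K K-closed)

      mask-built : Built n z (keep K vw) mask-path
      mask-built = proj₂ (built-keep le b K K-closed)

      xOf-maxrep : xOf n z vw t ≡ maxrep mask-path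
      xOf-maxrep = trans (cong (evalWord n) (trans (keep-indexed K W) (keep-++ K vw (wordJ n z) K-false))) (eval-built le mask-built)

      module _ {y : Perm} (py : IsPerm n y) where
        private β = path z n y

        -- Striking letters only lowers the path, and the struck letters of a valley column lower it
        -- there by at least the label. What lies below the masked path inherits both inequalities.
        bruhat-xOf⇒ : bruhat y (xOf n z vw t) ≡ true → Dom lam β ×
          (∀ {pm} → pm ∈ PL → isValley (proj₁ pm) ≡ true → proj₂ pm + rank (valleyCol vw (proj₁ pm)) lam ≤ rank (valleyCol vw (proj₁ pm)) β)
        bruhat-xOf⇒ e = (λ k → ℕP.≤-trans (lower k) (dom k)) , valley
          where
          dom : Dom mask-path β
          dom = bruhat⇒dom {z} {n} {y} mask-path (built-shape le mask-built) (trans (cong (bruhat y) (sym xOf-maxrep)) e)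
          lower : ∀ k → rank k lam ≤ rank k mask-path
          lower k = ℕP.+-cancelˡ-≤ (cn k vw) _ _ (subst (_≤ cn k vw + rank k mask-path) (trans (count-rank mask-built k) (sym (count-rank b k)))
            (ℕP.+-monoˡ-≤ (rank k mask-path) (keep-cn-≤ K vw k)))
          valley : ∀ {pm} → pm ∈ PL → isValley (proj₁ pm) ≡ true → proj₂ pm + rank (valleyCol vw (proj₁ pm)) lam ≤ rank (valleyCol vw (proj₁ pm)) β
          valley {pm} m v = ℕP.≤-trans (ℕP.+-cancelˡ-≤ (cn c (keep K vw)) _ _ (begin
              cn c (keep K vw) + (proj₂ pm + rank c lam)   ≡⟨ ℕP.+-assoc (cn c (keep K vw)) _ _ ⟨
              cn c (keep K vw) + proj₂ pm + rank c lam     ≤⟨ ℕP.+-monoˡ-≤ (rank c lam) (keep-cn-killed K vw c (proj₂ pm) kill (cap m v)) ⟩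
              cn c vw + rank c lam                         ≡⟨ trans (count-rank b c) (sym (count-rank mask-built c)) ⟩
              cn c (keep K vw) + rank c mask-path ∎)) (dom c)
            where
            open ℕP.≤-Reasoning
            c = valleyCol vw (proj₁ pm)
            kill : ∀ i → i < length vw → at vw i ≡ c → cn c (take i vw) < proj₂ pm → K i ≡ true
            kill i l a lt = true-killed m v (∈-occurrences c W (proj₂ pm) i
                (ℕP.<-≤-trans l (ℕP.≤-trans (ℕP.m≤m+n (length vw) _) (ℕP.≤-reflexive (sym (LP.length-++ vw)))))
                (trans (at-++ˡ vw (wordJ n z) i l) a) (subst (λ u → cn c u < proj₂ pm) (sym (take-++ˡ vw (wordJ n z) i (ℕP.<⇒≤ l))) lt))
              (upSet-self W i)

        -- If the gap in a valley column is at least the label, the struck boxes of that column are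
        -- outside β. `outside-closed` extends this to everything above them, so the boxes that
        -- remain still contain β.
        ⇒bruhat-xOf : Dom lam β →
          (∀ {pm} → pm ∈ PL → isValley (proj₁ pm) ≡ true → proj₂ pm + rank (valleyCol vw (proj₁ pm)) lam ≤ rank (valleyCol vw (proj₁ pm)) β) →
          bruhat y (xOf n z vw t) ≡ true
        ⇒bruhat-xOf dom valley = trans (cong (bruhat y) xOf-maxrep) (dom⇒bruhat {z} mask-path (built-shape le mask-built) py le upper)
          where
          outside : ∀ p → p < length vw → K p ≡ true → Outside n z β vw p
          outside p _ e with pm , m , v , r , mr , mp ← killed-true e with rl , ra , rc ← seed-< m v mr =
            proj₂ (upSet-minimal W r (λ q → q < length vw × Outside n z β vw q)
              (λ pq (ql , o) nc → ℕP.<-trans pq ql , outside-closed le b β _ _ pq ql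
                  (subst₂ (λ a c → noncomm a c ≡ true) (at-++ˡ vw (wordJ n z) _ (ℕP.<-trans pq ql)) (at-++ˡ vw (wordJ n z) _ ql) nc) o)
              (rl , seed) mp)
            where
            open ℕP.≤-Reasoning
            c = valleyCol vw (proj₁ pm)
            seed : Outside n z β vw r
            seed rewrite ra = begin-strict
              rank c (base n z)                                              ≡⟨ count-rank b c ⟨
              cn c vw + rank c lam                                           ≡⟨ cong (_+ rank c lam) (cn-split c vw r rl ra) ⟩
              suc (cn c (take r vw) + cn c (drop (suc r) vw)) + rank c lam   ≤⟨ ℕP.+-monoˡ-≤ (rank c lam) (ℕP.+-monoˡ-≤ (cn c (drop (suc r) vw)) rc) ⟩
              proj₂ pm + cn c (drop (suc r) vw) + rank c lam                 ≡⟨ trans (cong (_+ rank c lam) (ℕP.+-comm (proj₂ pm) _)) (ℕP.+-assoc (cn c (drop (suc r) vw)) _ _) ⟩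
              cn c (drop (suc r) vw) + (proj₂ pm + rank c lam)               ≤⟨ ℕP.+-monoʳ-≤ (cn c (drop (suc r) vw)) (valley m v) ⟩
              cn c (drop (suc r) vw) + rank c β                              <⟨ ℕP.n<1+n _ ⟩
              suc (cn c (drop (suc r) vw)) + rank c β ∎
          upper : Dom mask-path β
          upper k = ℕP.+-cancelˡ-≤ (cn k (keep K vw)) _ _ (subst (_≤ cn k (keep K vw) + rank k β) (sym (count-rank mask-built k))
            (subst (_≤ cn k (keep K vw) + rank k β) (ℕP.m≤n⇒m⊓n≡m (subst (_≤ cn k vw + rank k β) (count-rank b k) (ℕP.+-monoʳ-≤ (cn k vw) (dom k))))
              (keep-outside {n} {z} β K vw k outside)))

-- From gaps in all columns to gaps at the leaves

module Runs where
  open import Data.Nat as ℕ using (zero; suc; s≤s; _⊓_; _≤_; _<_; _≤ᵇ_)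
  open import Data.Nat.ListAction using (sum)
  open import Data.Nat.Solver renaming (module +-*-Solver to ℕSolver)
  open import Data.Integer using (+_; -_; 0ℤ; _+_; _-_)
  open import Data.Integer.Solver using (module +-*-Solver)
  open LaurentCoefficients
  open Permutations
  open TensorPowers
  open CosetPaths using (height; height-inv)
  open BruhatOrder using (Le; nil; same; up; dn; rank)

  Le-nt : ∀ {d lam mu} → Le d lam mu → nt lam ≡ nt mu ℕ.+ d
  Le-nt nil = refl
  Le-nt (same true l) = cong suc (Le-nt l)
  Le-nt (same false l) = Le-nt l
  Le-nt {d} (up {mu = mu} l) = trans (Le-nt l) (ℕP.+-suc (nt mu) d)
  Le-nt (dn {d} {mu = mu} l) = trans (cong suc (Le-nt l)) (sym (ℕP.+-suc (nt mu) d))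

  -- The number of boxes between the two paths in column k.
  gap : ∀ {d lam mu} → Le d lam mu → ℕ → ℕ
  gap {d} l zero = d
  gap nil (suc k) = 0
  gap (same b l) (suc k) = gap l k
  gap (up l) (suc k) = gap l k
  gap (dn l) (suc k) = gap l k

  gap-rank : ∀ {d lam mu} (l : Le d lam mu) k → gap l k ℕ.+ rank k lam ≡ rank k mu ℕ.+ d
  gap-rank l zero = ℕP.+-identityʳ _
  gap-rank nil (suc k) = refl
  gap-rank (same true l) (suc k) = trans (ℕP.+-suc _ _) (cong suc (gap-rank l k))
  gap-rank (same false l) (suc k) = gap-rank l k
  gap-rank {d} (up l) (suc k) = trans (gap-rank l k) (ℕP.+-suc _ d)
  gap-rank (dn {d} l) (suc k) = trans (ℕP.+-suc _ _) (trans (cong suc (gap-rank l k)) (sym (ℕP.+-suc _ d)))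

  area : ∀ {d lam mu} → Le d lam mu → ℕ
  area nil = 0
  area (same {d} b l) = d ℕ.+ area l
  area (up {d} l) = suc d ℕ.+ area l
  area (dn {d} l) = d ℕ.+ area l

  private
    tri : ℕ → ℕ
    tri zero = 0
    tri (suc d) = tri d ℕ.+ d

    -- The generalisation to paths starting `d` boxes apart: the extra area is `d` for every "(" of
    -- μ plus the triangular number `tri d` = d(d-1)/2. At d = 0 the area is the difference of the
    -- inversion numbers.
    area-inv : ∀ {d lam mu} (l : Le d lam mu) → area l ℕ.+ inv mu ≡ inv lam ℕ.+ (d ℕ.* nt mu ℕ.+ tri d)
    area-inv nil = refl
    area-inv (same {d} {lam} {mu} true l) = trans (ℕP.+-assoc d (area l) (inv mu)) (trans (cong (d ℕ.+_) (area-inv l))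
      (solve 4 (λ d i n t → d :+ (i :+ (d :* n :+ t)) := i :+ (d :* (con 1 :+ n) :+ t)) refl d (inv lam) (nt mu) (tri d)))
      where open ℕSolver
    area-inv (same {d} {lam} {mu} false l) = trans (solve 4 (λ d a n i → (d :+ a) :+ (n :+ i) := (n :+ d) :+ (a :+ i)) refl d (area l) (nt mu) (inv mu))
      (trans (cong₂ ℕ._+_ (sym (Le-nt l)) (area-inv l)) (sym (ℕP.+-assoc (nt lam) (inv lam) _)))
      where open ℕSolver
    area-inv (up {d} {lam} {mu} l) = trans (ℕP.+-assoc (suc d) (area l) (inv mu)) (trans (cong (suc d ℕ.+_) (area-inv l))
      (trans (solve 4 (λ d i n t → (con 1 :+ d) :+ (i :+ ((con 1 :+ d) :* n :+ (t :+ d))) := (n :+ (con 1 :+ d)) :+ i :+ (d :* (con 1 :+ n) :+ t)) refl d (inv lam) (nt mu) (tri d))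
        (cong (λ k → k ℕ.+ inv lam ℕ.+ (d ℕ.* suc (nt mu) ℕ.+ tri d)) (sym (Le-nt l)))))
      where open ℕSolver
    area-inv (dn {d} {lam} {mu} l) = trans (solve 4 (λ d a n i → (d :+ a) :+ (n :+ i) := (n :+ d) :+ (a :+ i)) refl d (area l) (nt mu) (inv mu))
      (trans (cong (nt mu ℕ.+ d ℕ.+_) (area-inv l))
        (solve 4 (λ d i n t → (n :+ d) :+ (i :+ (d :* n :+ t)) := i :+ ((con 1 :+ d) :* n :+ (t :+ d))) refl d (inv lam) (nt mu) (tri d)))
      where open ℕSolver

  height-area : ∀ {m a lam mu} (l : Le 0 lam mu) → Shape m a lam → Shape m a mu → height lam ≡ area l ℕ.+ height mu
  height-area {m} {a} {lam} {mu} l s s′ = ℕP.+-cancelʳ-≡ (inv T) _ _ (trans (height-inv lam s)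
      (trans (cong (ℕ._+ height T) (trans (sym (ℕP.+-identityʳ (inv lam))) (sym (area-inv l))))
      (trans (ℕP.+-assoc (area l) (inv mu) (height T)) (trans (cong (area l ℕ.+_) (sym (height-inv mu s′))) (sym (ℕP.+-assoc (area l) (height mu) (inv T)))))))
    where T = top (m ℕ.∸ a) a

  private
    sumTo-0 : ∀ B {g} → (∀ m → g m ≡ 0ℤ) → sumTo B g ≡ 0ℤ
    sumTo-0 zero h = h 0
    sumTo-0 (suc B) h = cong₂ _+_ (sumTo-0 B h) (h (suc B))

  le-or-zero : ∀ d lam mu → length lam ≡ length mu → nt lam ≡ nt mu ℕ.+ d →
    Le d lam mu ⊎ (¬ Le d lam mu × (∀ st φ → run d st lam mu φ ≡ 0ℤ))
  le-or-zero zero [] [] _ _ = inj₁ nil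
  le-or-zero (suc d) [] [] _ ()
  le-or-zero d (true ∷ lam) (true ∷ mu) l t with le-or-zero d lam mu (ℕP.suc-injective l) (ℕP.suc-injective t)
  ... | inj₁ x = inj₁ (same true x)
  ... | inj₂ (n , z) = inj₂ ((λ { (same _ x) → n x }) , λ st φ → z _ _)
  le-or-zero zero (true ∷ lam) (false ∷ mu) l t = inj₂ ((λ ()) , λ st φ → refl)
  le-or-zero (suc d) (true ∷ lam) (false ∷ mu) l t with le-or-zero d lam mu (ℕP.suc-injective l) (ℕP.suc-injective (trans t (ℕP.+-suc (nt mu) d)))
  ... | inj₁ x = inj₁ (dn x)
  ... | inj₂ (n , z) = inj₂ ((λ { (dn x) → n x }) , λ st φ → z _ _)
  le-or-zero d (false ∷ lam) (false ∷ mu) l t with le-or-zero d lam mu (ℕP.suc-injective l) t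
  ... | inj₁ x = inj₁ (same false x)
  ... | inj₂ (n , z) = inj₂ ((λ { (same _ x) → n x }) , λ { [] φ → z _ _ ; (B ∷ st) φ → sumTo-0 B (λ m → z _ _) })
  le-or-zero d (false ∷ lam) (true ∷ mu) l t with le-or-zero (suc d) lam mu (ℕP.suc-injective l) (trans t (sym (ℕP.+-suc (nt mu) d)))
  ... | inj₁ x = inj₁ (up x)
  ... | inj₂ (n , z) = inj₂ ((λ { (up x) → n x }) , λ { [] φ → z _ _ ; (B ∷ st) φ → sumTo-0 B (λ m → z _ _) })

  module LeafRun (Bd : ℕ) where

    bound : Bool → ℕ → ℕ → ℕ
    bound prev c B = if prev then c ⊓ B else B

    -- As run, but the gaps κ are tested only at the leaves "()"; prev tells whether the preceding symbol was "(".
    leafRun : (ℕ → ℕ) → Bool → List ℕ → Word → (ℤ → ℤ) → ℤ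
    leafRun κ prev st [] φ = φ 0ℤ
    leafRun κ prev st (true ∷ S) φ = leafRun (κ ∘ suc) true (Bd ∷ st) S φ
    leafRun κ prev [] (false ∷ S) φ = leafRun (κ ∘ suc) false [] S φ
    leafRun κ prev (B ∷ st) (false ∷ S) φ = sumTo (bound prev (κ 0) B) (λ m → leafRun (κ ∘ suc) false (meet m st) S (λ k → φ (+ (2 ℕ.* m) + k)))

    leafRun-cong : ∀ κ prev st S {φ ψ : ℤ → ℤ} → (∀ k → φ k ≡ ψ k) → leafRun κ prev st S φ ≡ leafRun κ prev st S ψ
    leafRun-cong κ prev st [] h = h 0ℤ
    leafRun-cong κ prev st (true ∷ S) h = leafRun-cong (κ ∘ suc) true (Bd ∷ st) S h
    leafRun-cong κ prev [] (false ∷ S) h = leafRun-cong (κ ∘ suc) false [] S h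
    leafRun-cong κ prev (B ∷ st) (false ∷ S) h = sumTo-cong (bound prev (κ 0) B) (λ m _ → leafRun-cong (κ ∘ suc) false (meet m st) S (λ k → h (+ (2 ℕ.* m) + k)))

    leafRun-≗ : ∀ {κ κ′} prev st S φ → (∀ k → κ k ≡ κ′ k) → leafRun κ prev st S φ ≡ leafRun κ′ prev st S φ
    leafRun-≗ prev st [] φ h = refl
    leafRun-≗ prev st (true ∷ S) φ h = leafRun-≗ true (Bd ∷ st) S φ (h ∘ suc)
    leafRun-≗ prev [] (false ∷ S) φ h = leafRun-≗ false [] S φ (h ∘ suc)
    leafRun-≗ {κ} {κ′} prev (B ∷ st) (false ∷ S) φ h = trans (cong (λ c → sumTo (bound prev c B) (λ m → leafRun (κ ∘ suc) false (meet m st) S (λ k → φ (+ (2 ℕ.* m) + k)))) (h 0))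
      (sumTo-cong (bound prev (κ′ 0) B) (λ m _ → leafRun-≗ false (meet m st) S _ (h ∘ suc)))

    private
      _▹_ : ℕ → (ℕ → ℕ) → ℕ → ℕ
      (d ▹ κ) zero = d
      (d ▹ κ) (suc k) = κ k

      neg-+ : ∀ (φ : ℤ → ℤ) d a k → φ (- + d + (- + a + k)) ≡ φ (- + (d ℕ.+ a) + k)
      neg-+ φ d a k = cong φ (trans (sym (ℤP.+-assoc (- + d) (- + a) k)) (cong (_+ k) (trans (sym (ℤP.neg-distrib-+ (+ d) (+ a))) (cong -_ (sym (ℤP.pos-+ d a))))))

      -- The stack of `run` expressed by that of `leafRun`: after a "(" every bound has been cut to
      -- the current gap, a cut that `leafRun` postpones to the next ")".
      loosen : Bool → ℕ → List ℕ → List ℕ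
      loosen prev d st = if prev then meet d st else st

    -- The gap only shrinks while reading "(", so testing it at the leaf covers all points enclosed since the last ")".
    mutual
      run-leafRun : ∀ {d lam mu} (l : Le d lam mu) prev st φ → (∀ k → gap l k ≤ Bd) →
        run d (loosen prev d st) lam mu φ ≡ leafRun (gap l) prev st lam (λ k → φ (- + area l + k))
      run-leafRun nil prev st φ h = refl
      run-leafRun (same {d} {lam} {mu} true l) prev st φ h = push l prev d ℕP.≤-refl st φ (h ∘ suc)
      run-leafRun (dn {d} l) prev st φ h = push l prev (suc d) (ℕP.n≤1+n d) st φ (h ∘ suc)
      run-leafRun (same {d} {lam} false l) prev st φ h = trans (pop-leafRun l prev d ℕP.≤-refl st φ (h ∘ suc))
        (leafRun-≗ prev st (false ∷ lam) _ (λ { zero → refl ; (suc k) → refl }))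
      run-leafRun (up {d} {lam} l) prev st φ h = trans (pop-leafRun l prev d (ℕP.n≤1+n d) st φ (h ∘ suc))
        (leafRun-≗ prev st (false ∷ lam) _ (λ { zero → refl ; (suc k) → refl }))

      push : ∀ {d lam mu} (l : Le d lam mu) prev d₀ → d ≤ d₀ → ∀ st φ → (∀ k → gap l k ≤ Bd) →
        run d (d ∷ meet d (loosen prev d₀ st)) lam mu (λ k → φ (- + d + k)) ≡
        leafRun (gap l) true (Bd ∷ st) lam (λ k → φ (- + (d ℕ.+ area l) + k))
      push {d} {lam} {mu} l prev d₀ le st φ h = trans (cong (λ s → run d s lam mu (λ k → φ (- + d + k))) (cong₂ _∷_ (sym (ℕP.m≤n⇒m⊓n≡m (h 0))) (eq prev)))
        (trans (run-leafRun l true (Bd ∷ st) (λ k → φ (- + d + k)) h) (leafRun-cong (gap l) true (Bd ∷ st) lam (neg-+ φ d (area l))))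
        where
        eq : ∀ prev → meet d (loosen prev d₀ st) ≡ meet d st
        eq true = meet-meet le st
        eq false = refl

      pop-leafRun : ∀ {d lam mu} (l : Le d lam mu) prev d₀ → d₀ ≤ d → ∀ st φ → (∀ k → gap l k ≤ Bd) →
        pop d (loosen prev d₀ st) lam mu (λ k → φ (- + d + k)) ≡
        leafRun (d₀ ▹ gap l) prev st (false ∷ lam) (λ k → φ (- + (d ℕ.+ area l) + k))
      pop-leafRun {d} {lam} {mu} l prev d₀ le [] φ h = trans (cong (λ s → pop d s lam mu (λ k → φ (- + d + k))) (nothing prev))
        (trans (run-leafRun l false [] (λ k → φ (- + d + k)) h) (leafRun-cong (gap l) false [] lam (neg-+ φ d (area l))))
        where
        nothing : ∀ prev → loosen prev d₀ [] ≡ []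
        nothing true = refl
        nothing false = refl
      pop-leafRun {d} {lam} {mu} l true d₀ le (B ∷ st) φ h = sumTo-cong (d₀ ⊓ B) (λ m mb →
        trans (cong (λ s → run d s lam mu (λ k → φ (- + d + (+ (2 ℕ.* m) + k)))) (meet-meet (ℕP.≤-trans mb (ℕP.m⊓n≤m d₀ B)) st))
        (one l (meet m st) φ m h))
      pop-leafRun {d} {lam} {mu} l false d₀ le (B ∷ st) φ h = sumTo-cong B (λ m mb → one l (meet m st) φ m h)

      one : ∀ {d lam mu} (l : Le d lam mu) st φ m → (∀ k → gap l k ≤ Bd) →
        run d st lam mu (λ k → φ (- + d + (+ (2 ℕ.* m) + k))) ≡ leafRun (gap l) false st lam (λ k → φ (- + (d ℕ.+ area l) + (+ (2 ℕ.* m) + k)))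
      one {d} {lam} {mu} l st φ m h = trans (run-leafRun l false st (λ k → φ (- + d + (+ (2 ℕ.* m) + k))) h)
        (leafRun-cong (gap l) false st lam (λ k → trans (cong (λ x → φ (- + d + x)) (solve 3 (λ a b c → a :+ (b :+ c) := b :+ (a :+ c)) refl (+ (2 ℕ.* m)) (- + area l) k))
          (neg-+ φ d (area l) (+ (2 ℕ.* m) + k))))
        where open +-*-Solver

    private
      meet-zeros : ∀ m st c → meet m (st ++ replicate c 0) ≡ meet m st ++ replicate c 0
      meet-zeros m st c = trans (LP.map-++ (m ⊓_) st (replicate c 0)) (cong (meet m st ++_) (trans (LP.map-replicate (m ⊓_) c 0) (cong (replicate c) (ℕP.⊓-zeroʳ m))))

      meet-0 : ∀ st → meet 0 st ≡ replicate (length st) 0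
      meet-0 [] = refl
      meet-0 (b ∷ st) = cong (0 ∷_) (meet-0 st)

      bound-0 : ∀ prev c → bound prev c 0 ≡ 0
      bound-0 true c = ℕP.⊓-zeroʳ c
      bound-0 false c = refl

      falses : ∀ κ prev c q φ → leafRun κ prev (replicate c 0) (replicate q false) φ ≡ φ 0ℤ
      falses κ prev c zero φ = refl
      falses κ prev zero (suc q) φ = falses (κ ∘ suc) false 0 q φ
      falses κ prev (suc c) (suc q) φ rewrite bound-0 prev (κ 0) = trans (cong (λ s → leafRun (κ ∘ suc) false s (replicate q false) _) (meet-zeros 0 [] c))
        (falses (κ ∘ suc) false c q (λ k → φ (0ℤ + k)))

    -- A leaf with gap 0 forces the label 0 on every pair enclosing it.
    leafRun-slice : ∀ κ prev st c S q φ → κ (suc (length S)) ≡ 0 →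
      leafRun κ prev (st ++ replicate c 0) (S ++ true ∷ replicate q false) φ ≡ leafRun κ prev st S φ
    leafRun-slice κ prev st c [] zero φ h = refl
    leafRun-slice κ prev st c [] (suc q) φ h rewrite h = trans (cong (λ s → leafRun (κ ∘ suc ∘ suc) false s (replicate q false) (λ k → φ (0ℤ + k))) (meet-0 (st ++ replicate c 0)))
      (falses (κ ∘ suc ∘ suc) false (length (st ++ replicate c 0)) q (λ k → φ (0ℤ + k)))
    leafRun-slice κ prev st c (true ∷ S) q φ h = leafRun-slice (κ ∘ suc) true (Bd ∷ st) c S q φ h
    leafRun-slice κ prev [] zero (false ∷ S) q φ h = leafRun-slice (κ ∘ suc) false [] 0 S q φ h
    leafRun-slice κ prev [] (suc c) (false ∷ S) q φ h rewrite bound-0 prev (κ 0) =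
      trans (cong (λ s → leafRun (κ ∘ suc) false s (S ++ true ∷ replicate q false) (λ k → φ (0ℤ + k))) (meet-zeros 0 [] c))
        (trans (leafRun-slice (κ ∘ suc) false [] c S q (λ k → φ (0ℤ + k)) h) (leafRun-cong (κ ∘ suc) false [] S (λ k → cong φ (ℤP.+-identityˡ k))))
    leafRun-slice κ prev (B ∷ st) c (false ∷ S) q φ h = sumTo-cong (bound prev (κ 0) B) (λ m _ →
      trans (cong (λ s → leafRun (κ ∘ suc) false s (S ++ true ∷ replicate q false) (λ k → φ (+ (2 ℕ.* m) + k))) (meet-zeros m st c))
        (leafRun-slice (κ ∘ suc) false (meet m st) c S q (λ k → φ (+ (2 ℕ.* m) + k)) h))

    -- The initial "(" of λ, left of the columns of v, enclose a leaf of gap 0. After it closes, all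
    -- that remain open have bound 0, and `leafRun-slice` can discard them.
    leafRun-prefix : ∀ κ p R φ → κ p ≡ 0 →
      ∃ λ c → leafRun κ false [] (replicate p true ++ false ∷ R) φ ≡ leafRun (λ k → κ (suc p ℕ.+ k)) false (replicate c 0) R φ
    leafRun-prefix κ zero R φ h = 0 , refl
    leafRun-prefix κ (suc p) R φ h = p , pushes (suc p) κ [] false h (λ ()) refl
      where
      pushes : ∀ q κ st prev → κ q ≡ 0 → (q ≡ 0 → prev ≡ true) → length st ℕ.+ q ≡ suc p →
        leafRun κ prev st (replicate q true ++ false ∷ R) φ ≡ leafRun (λ k → κ (suc q ℕ.+ k)) false (replicate p 0) R φ
      pushes zero κ [] prev h pr ()
      pushes zero κ (B ∷ st) prev h pr e rewrite pr refl | h =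
        trans (cong (λ s → leafRun (κ ∘ suc) false s R (λ k → φ (0ℤ + k))) (trans (meet-0 st) (cong (λ c → replicate c 0) (ℕP.suc-injective (trans (sym (ℕP.+-identityʳ _)) e)))))
          (leafRun-cong (κ ∘ suc) false (replicate p 0) R (λ k → cong φ (ℤP.+-identityˡ k)))
      pushes (suc q) κ st prev h pr e = pushes q (κ ∘ suc) (Bd ∷ st) true h (λ _ → refl) (trans (sym (ℕP.+-suc (length st) q)) e)

    leafRun-base : ∀ κ a q φ → κ a ≡ 0 → leafRun κ false [] (replicate a true ++ false ∷ replicate q false) φ ≡ φ 0ℤ
    leafRun-base κ a q φ h with c , e ← leafRun-prefix κ a (replicate q false) φ h = trans e (falses _ false c q φ)

    -- The condition for a family of labels to occur among the nested sums of `leafRun`. Labels are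
    -- listed in the order in which pairs close, as in `matchGo`.
    checks : (ℕ → ℕ) → Bool → List ℕ → Word → List ℕ → Bool
    checks κ prev st [] ts = true
    checks κ prev st (true ∷ S) ts = checks (κ ∘ suc) true (Bd ∷ st) S ts
    checks κ prev [] (false ∷ S) ts = checks (κ ∘ suc) false [] S ts
    checks κ prev (B ∷ st) (false ∷ S) [] = true
    checks κ prev (B ∷ st) (false ∷ S) (m ∷ ts) = (m ≤ᵇ bound prev (κ 0) B) ∧ checks (κ ∘ suc) false (meet m st) S ts

    private
      sumTo-upTo : ∀ B (g : ℕ → ℤ) → sumZ g (upTo (suc B)) ≡ sumTo B g
      sumTo-upTo zero g = ℤP.+-identityʳ (g 0)
      sumTo-upTo (suc B) g = trans (cong (sumZ g) (sym (LP.upTo-∷ʳ (suc B)))) (trans (sumZ-++ g (upTo (suc B)) (suc B ∷ []))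
        (cong₂ _+_ (sumTo-upTo B g) (ℤP.+-identityʳ _)))

      ≤ᵇ-f : ∀ {a b} → b < a → (a ≤ᵇ b) ≡ false
      ≤ᵇ-f {suc a} (s≤s le) = <ᵇ-f le

      sumTo-cut : ∀ b B (g : ℕ → ℤ) → b ≤ B → sumTo B (λ m → if m ≤ᵇ b then g m else 0ℤ) ≡ sumTo b g
      sumTo-cut b B g le with b ℕ.≟ B
      ... | yes refl = sumTo-cong b (λ m mb → cong (λ c → if c then g m else 0ℤ) (≤ᵇ-t mb))
      sumTo-cut zero zero g le | no ne = ⊥-elim (ne refl)
      sumTo-cut b (suc B) g le | no ne = trans (cong₂ _+_ (sumTo-cut b B g (ℕP.≤-pred (ℕP.≤∧≢⇒< le ne)))
          (cong (λ c → if c then g (suc B) else 0ℤ) (≤ᵇ-f (ℕP.≤∧≢⇒< le ne)))) (ℤP.+-identityʳ _)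

      if-∧ : ∀ a b (x : ℤ) → (if a ∧ b then x else 0ℤ) ≡ (if a then (if b then x else 0ℤ) else 0ℤ)
      if-∧ true b x = refl
      if-∧ false b x = refl

      sumZ-if : ∀ {A : Set} a (g : A → ℤ) xs → sumZ (λ x → if a then g x else 0ℤ) xs ≡ (if a then sumZ g xs else 0ℤ)
      sumZ-if true g xs = refl
      sumZ-if false g xs = sumZ-0 (λ _ → refl) xs

    -- The range of each nested sum depends on earlier labels. It is widened to the uniform range up
    -- to `Bd` used by `labelings`, and `checks` cuts the added terms away.
    leafRun-labelings : ∀ κ prev i ps st S φ → length ps ≡ length st → All (_≤ Bd) st →
      leafRun κ prev st S φ ≡ sumZ (λ ts → if checks κ prev st S ts then φ (+ (2 ℕ.* sum ts)) else 0ℤ) (labelings (length (matchGo i ps S)) Bd)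
    leafRun-labelings κ prev i ps st [] φ l a = sym (ℤP.+-identityʳ _)
    leafRun-labelings κ prev i ps st (true ∷ S) φ l a = leafRun-labelings (κ ∘ suc) true (suc i) (i ∷ ps) (Bd ∷ st) S φ (cong suc l) (ℕP.≤-refl ∷ a)
    leafRun-labelings κ prev i [] [] (false ∷ S) φ l a = leafRun-labelings (κ ∘ suc) false (suc i) [] [] S φ refl []
    leafRun-labelings κ prev i (j ∷ ps) (B ∷ st) (false ∷ S) φ l (b ∷ a) = sym (begin
      sumZ F (concatMap (λ m → map (m ∷_) L) (upTo (suc Bd)))
        ≡⟨ sumZ-concatMap F (λ m → map (m ∷_) L) (upTo (suc Bd)) ⟩
      sumZ (λ m → sumZ F (map (m ∷_) L)) (upTo (suc Bd))
        ≡⟨ sumTo-upTo Bd _ ⟩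
      sumTo Bd (λ m → sumZ F (map (m ∷_) L))
        ≡⟨ sumTo-cong Bd (λ m _ → trans (sumZ-map F (m ∷_) L) (trans (sumZ-cong (λ ts → if-∧ (m ≤ᵇ c) _ _) L) (sumZ-if (m ≤ᵇ c) _ L))) ⟩
      sumTo Bd (λ m → if m ≤ᵇ c then sumZ (λ ts → if checks (κ ∘ suc) false (meet m st) S ts then φ (+ (2 ℕ.* sum (m ∷ ts))) else 0ℤ) L else 0ℤ)
        ≡⟨ sumTo-cut c Bd _ c≤ ⟩
      sumTo c (λ m → sumZ (λ ts → if checks (κ ∘ suc) false (meet m st) S ts then φ (+ (2 ℕ.* sum (m ∷ ts))) else 0ℤ) L)
        ≡⟨ sumTo-cong c (λ m _ → trans (sumZ-cong (λ ts → cong (λ x → if checks (κ ∘ suc) false (meet m st) S ts then φ x else 0ℤ)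
              (trans (cong +_ (ℕP.*-distribˡ-+ 2 m (sum ts))) (ℤP.pos-+ (2 ℕ.* m) (2 ℕ.* sum ts)))) L)
            (sym (leafRun-labelings (κ ∘ suc) false (suc i) ps (meet m st) S (λ k → φ (+ (2 ℕ.* m) + k))
              (trans (ℕP.suc-injective l) (sym (LP.length-map _ st))) (meet-All m st a)))) ⟩
      sumTo c (λ m → leafRun (κ ∘ suc) false (meet m st) S (λ k → φ (+ (2 ℕ.* m) + k))) ∎)
      where
      open ≡-Reasoning
      L = labelings (length (matchGo (suc i) ps S)) Bd
      F = λ ts → if checks κ prev (B ∷ st) (false ∷ S) ts then φ (+ (2 ℕ.* sum ts)) else 0ℤ
      c = bound prev (κ 0) B
      bounded : ∀ prev → bound prev (κ 0) B ≤ Bd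
      bounded true = ℕP.≤-trans (ℕP.m⊓n≤n (κ 0) B) b
      bounded false = b
      c≤ : c ≤ Bd
      c≤ = bounded prev

-- Admissible labelings, and the parenthesis string inside λ

module Labelings where
  open import Data.Nat
  open Permutations
  open TensorPowers using (Word; nt; meet)
  open CosetPaths using (atB; atB-++; atB-++₂; applyUpTo-cong; applyUpTo-++)
  open BruhatOrder using (rank; bit)
  open Boxes
  open Words using (∧-true; ∈-concatMap-elim)
  open Runs

  zip-∈ˡ : {A B : Set} → ∀ (xs : List A) (ys : List B) {a b} → (a , b) ∈ zip xs ys → a ∈ xs
  zip-∈ˡ (x ∷ xs) (y ∷ ys) (here refl) = here refl
  zip-∈ˡ (x ∷ xs) (y ∷ ys) (there m) = there (zip-∈ˡ xs ys m)

  zip-∈ʳ : {A B : Set} → ∀ (xs : List A) (ys : List B) {a b} → (a , b) ∈ zip xs ys → b ∈ ys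
  zip-∈ʳ (x ∷ xs) (y ∷ ys) (here refl) = here refl
  zip-∈ʳ (x ∷ xs) (y ∷ ys) (there m) = there (zip-∈ʳ xs ys m)

  matchGo-∈ : ∀ i ps S {p} → p ∈ matchGo i ps S → (proj₁ p ∈ ps ⊎ i ≤ proj₁ p) × i ≤ proj₂ p
  matchGo-∈ i ps (true ∷ S) m with matchGo-∈ (suc i) (i ∷ ps) S m
  ... | inj₁ (here refl) , b = inj₂ ℕP.≤-refl , ℕP.<⇒≤ b
  ... | inj₁ (there a) , b = inj₁ a , ℕP.<⇒≤ b
  ... | inj₂ a , b = inj₂ (ℕP.<⇒≤ a) , ℕP.<⇒≤ b
  matchGo-∈ i [] (false ∷ S) m with matchGo-∈ (suc i) [] S m
  ... | inj₂ a , b = inj₂ (ℕP.<⇒≤ a) , ℕP.<⇒≤ b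
  matchGo-∈ i (j ∷ ps) (false ∷ S) (here refl) = inj₁ (here refl) , ℕP.≤-refl
  matchGo-∈ i (j ∷ ps) (false ∷ S) (there m) with matchGo-∈ (suc i) ps S m
  ... | inj₁ a , b = inj₁ (there a) , ℕP.<⇒≤ b
  ... | inj₂ a , b = inj₂ (ℕP.<⇒≤ a) , ℕP.<⇒≤ b

  -- The flag `prev` has to say whether the innermost open "(" immediately precedes `i`, because
  -- exactly then closing it produces a leaf.
  record OpenAt (prev : Bool) (i : ℕ) (ps : List ℕ) : Set where
    field
      decreasing : AllPairs (λ a b → b < a) ps
      below : All (_< i) ps
      adjacent : prev ≡ true → ∃₂ λ j ps′ → ps ≡ j ∷ ps′ × suc j ≡ i
      apart : prev ≡ false → ∀ {j} → j ∈ ps → suc j ≢ i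

  open OpenAt

  private
    open-push : ∀ {prev i ps} → OpenAt prev i ps → OpenAt true (suc i) (i ∷ ps)
    open-push o = record { decreasing = below o ∷ decreasing o ; below = ℕP.≤-refl ∷ All.map ℕP.m<n⇒m<1+n (below o)
      ; adjacent = λ _ → _ , _ , refl , refl ; apart = λ () }

    open-empty : ∀ {prev i} → OpenAt prev i [] → OpenAt false (suc i) []
    open-empty o = record { decreasing = [] ; below = [] ; adjacent = λ () ; apart = λ _ () }

    open-pop : ∀ {prev i j ps} → OpenAt prev i (j ∷ ps) → OpenAt false (suc i) ps
    open-pop {i = i} o with _ ∷ d ← decreasing o | _ ∷ b ← below o = record { decreasing = d ; below = All.map ℕP.m<n⇒m<1+n b
      ; adjacent = λ () ; apart = λ _ m e → ℕP.<⇒≢ (All.lookup b m) (ℕP.suc-injective e) }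

  module Checks (Bd : ℕ) where
    open LeafRun Bd

    -- The conditions on all pairs that close at `i` or later. `bounded` concerns those opened
    -- before `i`, whose stack entries remember the labels already read; columns are counted from
    -- `i`.
    record Good (κ : ℕ → ℕ) (i : ℕ) (ps st : List ℕ) (pt : List ((ℕ × ℕ) × ℕ)) : Set where
      field
        bounded : ∀ {p m B} → (p , m) ∈ pt → (proj₁ p , B) ∈ zip ps st → m ≤ B
        monotone : ∀ {p m p′ m′} → (p , m) ∈ pt → (p′ , m′) ∈ pt → encloses p p′ ≡ true → m ≤ m′
        leaves : ∀ {p m} → (p , m) ∈ pt → isValley p ≡ true → m ≤ κ (proj₂ p ∸ i)

    open Good

    private
      shift-index : ∀ {i q} → suc i ≤ q → suc (q ∸ suc i) ≡ q ∸ i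
      shift-index {i} {q} le = sym (ℕP.+-∸-assoc 1 le)

      unshift : ∀ (κ : ℕ → ℕ) {i q m} → suc i ≤ q → m ≤ κ (suc (q ∸ suc i)) → m ≤ κ (q ∸ i)
      unshift κ {i} {q} {m} le = subst (λ k → m ≤ κ k) (shift-index {i} {q} le)

      shift : ∀ (κ : ℕ → ℕ) {i q m} → suc i ≤ q → m ≤ κ (q ∸ i) → m ≤ κ (suc (q ∸ suc i))
      shift κ {i} {q} {m} le = subst (λ k → m ≤ κ k) (sym (shift-index {i} {q} le))

      in-zip : ∀ (ps st : List ℕ) → length ps ≡ length st → ∀ {j} → j ∈ ps → ∃ λ B → (j , B) ∈ zip ps st
      in-zip (p ∷ ps) (b ∷ st) l (here refl) = b , here refl
      in-zip (p ∷ ps) (b ∷ st) l (there q) with B , z ← in-zip ps st (ℕP.suc-injective l) q = B , there z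

      zip-meet : ∀ m (ps st : List ℕ) {j B} → (j , B) ∈ zip ps (meet m st) → ∃ λ B′ → B ≡ m ⊓ B′ × (j , B′) ∈ zip ps st
      zip-meet m (p ∷ ps) (b ∷ st) (here refl) = b , refl , here refl
      zip-meet m (p ∷ ps) (b ∷ st) (there x) with B′ , e , y ← zip-meet m ps st x = B′ , e , there y

      meet-zip : ∀ m (ps st : List ℕ) {j B} → (j , B) ∈ zip ps st → (j , m ⊓ B) ∈ zip ps (meet m st)
      meet-zip m (p ∷ ps) (b ∷ st) (here refl) = here refl
      meet-zip m (p ∷ ps) (b ∷ st) (there x) = there (meet-zip m ps st x)

    -- Pairs enclosing a pair that closes are those still open. Cutting their bounds by its label
    -- therefore replaces the comparison of every pair with all pairs inside it.
    checks-spec : ∀ κ prev i ps st S ts → OpenAt prev i ps → length ps ≡ length st → All (_≤ Bd) ts →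
      length ts ≡ length (matchGo i ps S) →
      (checks κ prev st S ts ≡ true → Good κ i ps st (zip (matchGo i ps S) ts)) ×
      (Good κ i ps st (zip (matchGo i ps S) ts) → checks κ prev st S ts ≡ true)
    checks-spec κ prev i ps st [] ts o l a lt = (λ _ → record { bounded = λ () ; monotone = λ () ; leaves = λ () }) , λ _ → refl
    checks-spec κ prev i ps st (true ∷ S) ts o l a lt with to , from ← checks-spec (κ ∘ suc) true (suc i) (i ∷ ps) (Bd ∷ st) S ts (open-push o) (cong suc l) a lt =
      (λ e → let g = to e in record
         { bounded = λ m x → bounded g m (there x) ; monotone = monotone g
         ; leaves = λ {p} m v → unshift κ (late m) (leaves g m v) }) ,
      λ g → from (record
         { bounded = λ { m (here refl) → All.lookup a (zip-∈ʳ M ts m) ; m (there x) → bounded g m x }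
         ; monotone = monotone g ; leaves = λ m v → shift κ (late m) (leaves g m v) })
      where
      M = matchGo (suc i) (i ∷ ps) S
      late : ∀ {p m} → (p , m) ∈ zip M ts → suc i ≤ proj₂ p
      late m = proj₂ (matchGo-∈ (suc i) (i ∷ ps) S (zip-∈ˡ M ts m))
    checks-spec κ prev i [] [] (false ∷ S) ts o l a lt with to , from ← checks-spec (κ ∘ suc) false (suc i) [] [] S ts (open-empty o) refl a lt =
      (λ e → let g = to e in record { bounded = λ m () ; monotone = monotone g ; leaves = λ m v → unshift κ (late m) (leaves g m v) }) ,
      λ g → from (record { bounded = λ m () ; monotone = monotone g ; leaves = λ m v → shift κ (late m) (leaves g m v) })
      where
      M = matchGo (suc i) [] S
      late : ∀ {p m} → (p , m) ∈ zip M ts → suc i ≤ proj₂ p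
      late m = proj₂ (matchGo-∈ (suc i) [] S (zip-∈ˡ M ts m))
    checks-spec κ prev i (j ∷ ps) (B ∷ st) (false ∷ S) [] o l a ()
    checks-spec κ prev i (j ∷ ps) (B ∷ st) (false ∷ S) (m ∷ ts) o l (_ ∷ a) lt
      with to , from ← checks-spec (κ ∘ suc) false (suc i) ps (meet m st) S ts (open-pop o) (trans (ℕP.suc-injective l) (sym (LP.length-map _ st))) a (ℕP.suc-injective lt)
      with jd ∷ _ ← decreasing o | ji ∷ psi ← below o = forward , backward
      where
      M = matchGo (suc i) ps S
      late : ∀ {p m} → (p , m) ∈ zip M ts → suc i ≤ proj₂ p
      late x = proj₂ (matchGo-∈ (suc i) ps S (zip-∈ˡ M ts x))
      origin : ∀ {p m} → (p , m) ∈ zip M ts → proj₁ p ∈ ps ⊎ suc i ≤ proj₁ p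
      origin x = proj₁ (matchGo-∈ (suc i) ps S (zip-∈ˡ M ts x))
      b = bound prev (κ 0) B
      b≤ : ∀ prev → bound prev (κ 0) B ≤ B
      b≤ true = ℕP.m⊓n≤n (κ 0) B
      b≤ false = ℕP.≤-refl
      forward : (m ≤ᵇ b) ∧ checks (κ ∘ suc) false (meet m st) S ts ≡ true → Good κ i (j ∷ ps) (B ∷ st) (((j , i) , m) ∷ zip M ts)
      forward e with mb , c ← ∧-true (m ≤ᵇ b) _ e = record { bounded = bd ; monotone = mn ; leaves = lv }
        where
        g = to c
        m≤b = ≤ᵇ-true m b mb
        bd : ∀ {p m′ B′} → (p , m′) ∈ ((j , i) , m) ∷ zip M ts → (proj₁ p , B′) ∈ (j , B) ∷ zip ps st → m′ ≤ B′
        bd (here refl) (here refl) = ℕP.≤-trans m≤b (b≤ prev)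
        bd (here refl) (there x) = ⊥-elim (ℕP.<-irrefl refl (All.lookup jd (zip-∈ˡ ps st x)))
        bd (there x) (here refl) with origin x
        ... | inj₁ j∈ = ⊥-elim (ℕP.<-irrefl refl (All.lookup jd j∈))
        ... | inj₂ i< = ⊥-elim (ℕP.<-asym ji i<)
        bd (there x) (there y) = ℕP.≤-trans (bounded g x (meet-zip m ps st y)) (ℕP.m⊓n≤n m _)
        mn : ∀ {p m₁ p′ m₂} → (p , m₁) ∈ ((j , i) , m) ∷ zip M ts → (p′ , m₂) ∈ ((j , i) , m) ∷ zip M ts → encloses p p′ ≡ true → m₁ ≤ m₂
        mn (here refl) (here refl) e = ⊥-elim (ℕP.<-irrefl refl (<ᵇ-true j j (proj₁ (∧-true (j <ᵇ j) _ e))))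
        mn {p′ = p′} (here refl) (there y) e = ⊥-elim (ℕP.<⇒≱ (<ᵇ-true (proj₂ p′) i (proj₂ (∧-true (j <ᵇ proj₁ p′) _ e))) (ℕP.<⇒≤ (late y)))
        mn {p = p} (there x) (here refl) e with origin x
        ... | inj₂ i< = ⊥-elim (ℕP.<-asym (ℕP.<-trans i< (<ᵇ-true (proj₁ p) j (proj₁ (∧-true (proj₁ p <ᵇ j) _ e)))) ji)
        -- The enclosing pair is still open, so its bound has just been cut to at most `m`.
        ... | inj₁ p∈ with B′ , y ← in-zip ps st (ℕP.suc-injective l) p∈ = ℕP.≤-trans (bounded g x (meet-zip m ps st y)) (ℕP.m⊓n≤m m B′)
        mn (there x) (there y) e = monotone g x y e
        lv : ∀ {p m′} → (p , m′) ∈ ((j , i) , m) ∷ zip M ts → isValley p ≡ true → m′ ≤ κ (proj₂ p ∸ i)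
        lv (here refl) v = go prev refl
          where
          go : ∀ pr → prev ≡ pr → m ≤ κ (i ∸ i)
          go false e = ⊥-elim (apart o e (here refl) (sym (≡ᵇ-true i (suc j) v)))
          go true refl = subst (λ k → m ≤ κ k) (sym (ℕP.n∸n≡0 i)) (ℕP.≤-trans m≤b (ℕP.m⊓n≤m (κ 0) B))
        lv (there x) v = unshift κ (late x) (leaves g x v)
      backward : Good κ i (j ∷ ps) (B ∷ st) (((j , i) , m) ∷ zip M ts) → (m ≤ᵇ b) ∧ checks (κ ∘ suc) false (meet m st) S ts ≡ true
      backward g = cong₂ _∧_ (≤ᵇ-t (m≤ prev refl)) (from (record { bounded = bd
          ; monotone = λ x y → monotone g (there x) (there y)
          ; leaves = λ x v → shift κ (late x) (leaves g (there x) v) }))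
        where
        m≤ : ∀ pr → prev ≡ pr → m ≤ bound pr (κ 0) B
        m≤ false _ = bounded g (here refl) (here refl)
        m≤ true e with j′ , ps′ , refl , refl ← adjacent o e =
          ℕP.⊓-glb (subst (λ k → m ≤ κ k) (ℕP.n∸n≡0 (suc j)) (leaves g (here refl) (≡ᵇ-refl (suc j)))) (bounded g (here refl) (here refl))
        bd : ∀ {p m′ B′} → (p , m′) ∈ zip M ts → (proj₁ p , B′) ∈ zip ps (meet m st) → m′ ≤ B′
        bd {p} x y with B″ , refl , y′ ← zip-meet m ps st y = ℕP.⊓-glb
          (monotone g (there x) (here refl) (cong₂ _∧_ (<ᵇ-t (All.lookup jd (zip-∈ˡ ps st y′))) (<ᵇ-t (late x))))
          (bounded g (there x) (there y′))

  labelings-∈ : ∀ k B {t} → t ∈ labelings k B → length t ≡ k × All (_≤ B) t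
  labelings-∈ zero B (here refl) = refl , []
  labelings-∈ (suc k) B m with x , mx , m′ ← ∈-concatMap-elim (λ m → map (m ∷_) (labelings k B)) (upTo (suc B)) m
    with t , mt , refl ← ∈-map⁻ (x ∷_) m′ with l , a ← labelings-∈ k B mt = cong suc l , ℕP.≤-pred (∈-upTo⁻ mx) ∷ a

  allᵇ-true : {A : Set} (p : A → Bool) → ∀ xs → allᵇ p xs ≡ true → ∀ {x} → x ∈ xs → p x ≡ true
  allᵇ-true p (x ∷ xs) e (here refl) = proj₁ (∧-true (p x) _ e)
  allᵇ-true p (x ∷ xs) e (there m) = allᵇ-true p xs (proj₂ (∧-true (p x) _ e)) m

  true-allᵇ : {A : Set} (p : A → Bool) → ∀ xs → (∀ {x} → x ∈ xs → p x ≡ true) → allᵇ p xs ≡ true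
  true-allᵇ p [] h = refl
  true-allᵇ p (x ∷ xs) h = cong₂ _∧_ (h (here refl)) (true-allᵇ p xs (h ∘ there))

  implies-true : ∀ a b → not a ∨ b ≡ true → a ≡ true → b ≡ true
  implies-true true b e _ = e

  true-implies : ∀ a b → (a ≡ true → b ≡ true) → not a ∨ b ≡ true
  true-implies true b h = h refl
  true-implies false b h = refl

  private
    rank-base′ : ∀ k a b → rank k (replicate a true ++ replicate b false) ≡ k ⊓ a
    rank-base′ zero a b = refl
    rank-base′ (suc k) zero zero = refl
    rank-base′ (suc k) zero (suc b) = trans (rank-base′ k zero b) (ℕP.⊓-zeroʳ k)
    rank-base′ (suc k) (suc a) b = cong suc (rank-base′ k a b)

  rank-base : ∀ n z k → rank k (base n z) ≡ k ⊓ z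
  rank-base n z k = rank-base′ k z (n ∸ z)

  rank-≤-base : ∀ {n z} β → nt β ≡ z → ∀ k → rank k β ≤ rank k (base n z)
  rank-≤-base {n} {z} β refl k = subst (rank k β ≤_) (sym (rank-base n z k)) (ℕP.⊓-glb (first k β) (total k β))
    where
    first : ∀ k β → rank k β ≤ k
    first zero β = z≤n
    first (suc k) [] = z≤n
    first (suc k) (true ∷ β) = s≤s (first k β)
    first (suc k) (false ∷ β) = ℕP.m≤n⇒m≤1+n (first k β)
    total : ∀ k β → rank k β ≤ nt β
    total zero β = z≤n
    total (suc k) [] = z≤n
    total (suc k) (true ∷ β) = s≤s (total k β)
    total (suc k) (false ∷ β) = total k β

  cn-∈ : ∀ k u → 0 < cn k u → k ∈ u
  cn-∈ k (x ∷ u) h with x ≟ k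
  ... | yes refl = here refl
  ... | no ne = there (cn-∈ k u (subst (0 <_) (trans (cn-∷ k x u) (cong (λ b → bit b + cn k u) (≡ᵇ-ne ne))) h))

  ∈-cn : ∀ k u → k ∈ u → 0 < cn k u
  ∈-cn k (x ∷ u) (here refl) rewrite ≡ᵇ-refl x = z<s
  ∈-cn k (x ∷ u) (there m) = ℕP.<-≤-trans (∈-cn k u m) (ℕP.≤-trans (ℕP.m≤n+m (cn k u) (bit (x ≡ᵇ k))) (ℕP.≤-reflexive (sym (cn-∷ k x u))))

  ∉-cn : ∀ k u → k ∉ u → cn k u ≡ 0
  ∉-cn k u ne with cn k u in e
  ... | zero = refl
  ... | suc _ = ⊥-elim (ne (cn-∈ k u (subst (0 <_) (sym e) z<s)))

  atB-other : ∀ p b c d e r k → k ≢ length p → k ≢ suc (length p) → atB (p ++ b ∷ c ∷ r) k ≡ atB (p ++ d ∷ e ∷ r) k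
  atB-other [] b c d e r zero x y = ⊥-elim (x refl)
  atB-other [] b c d e r (suc zero) x y = ⊥-elim (y refl)
  atB-other [] b c d e r (suc (suc k)) x y = refl
  atB-other (_ ∷ p) b c d e r zero x y = refl
  atB-other (_ ∷ p) b c d e r (suc k) x y = atB-other p b c d e r k (x ∘ cong suc) (y ∘ cong suc)

  firstIdx-here : ∀ k u → firstIdx k (k ∷ u) ≡ 0
  firstIdx-here k u rewrite ≡ᵇ-refl k = refl

  firstIdx-there : ∀ {x k} u → x ≢ k → firstIdx k (x ∷ u) ≡ suc (firstIdx k u)
  firstIdx-there u ne rewrite ≡ᵇ-ne ne = refl

  -- The later of two neighbouring columns to receive a box makes the path step down towards the other one.
  slope : ∀ {n z u mu} → Built n z u mu → ∀ k → k ∈ u ⊎ suc k ∈ u → (firstIdx k u <ᵇ firstIdx (suc k) u) ≡ atB mu k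
  slope empty k (inj₁ ())
  slope empty k (inj₂ ())
  slope {u = x ∷ u} (box p r b) k h with x ≟ k | x ≟ suc k
  ... | yes refl | _ = trans (cong₂ _<ᵇ_ (firstIdx-here x u) (firstIdx-there {x} {suc x} u (ℕP.<⇒≢ (ℕP.n<1+n _)))) (sym (atB-++₂ p false true r))
  ... | no ne | yes refl = trans (cong₂ _<ᵇ_ (firstIdx-there u ne) (firstIdx-here x u)) (sym (atB-++ p false (true ∷ r)))
  ... | no ne | no ne′ = trans (cong₂ _<ᵇ_ (firstIdx-there u ne) (firstIdx-there u ne′)) (trans (slope b k (tail h))
          (atB-other p true false false true r k (λ e → ne′ (cong suc (sym e))) (λ e → ne (sym e))))
    where
    tail : k ∈ x ∷ u ⊎ suc k ∈ x ∷ u → k ∈ u ⊎ suc k ∈ u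
    tail (inj₁ (here e)) = ⊥-elim (ne (sym e))
    tail (inj₁ (there m)) = inj₁ m
    tail (inj₂ (here e)) = ⊥-elim (ne′ (sym e))
    tail (inj₂ (there m)) = inj₂ m

  untouched : ∀ {n z u mu} → Built n z u mu → ∀ k → k ∉ u → suc k ∉ u → atB mu k ≡ atB (base n z) k
  untouched empty k _ _ = refl
  untouched (box p r b) k a c = trans (atB-other p false true true false r k (λ e → c (here (cong suc e))) (λ e → a (here e)))
    (untouched b k (a ∘ there) (c ∘ there))

  firstIdx-absent : ∀ k u → k ∉ u → firstIdx k u ≡ length u
  firstIdx-absent k [] _ = refl
  firstIdx-absent k (x ∷ u) ne rewrite ≡ᵇ-ne {x} {k} (λ e → ne (here (sym e))) = cong suc (firstIdx-absent k u (ne ∘ there))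

  firstIdx-present : ∀ k u → k ∈ u → firstIdx k u < length u
  firstIdx-present k (x ∷ u) m with x ≟ k
  ... | yes refl rewrite ≡ᵇ-refl x = z<s
  ... | no ne rewrite ≡ᵇ-ne ne with m
  ...   | here e = ⊥-elim (ne (sym e))
  ...   | there m′ = s≤s (firstIdx-present k u m′)

  private
    fold-min : ∀ x xs → let m = foldr (λ a b → if a <ᵇ b then a else b) x xs in (m ∈ x ∷ xs) × (∀ {k} → k ∈ x ∷ xs → m ≤ k)
    fold-min x [] = here refl , λ { (here refl) → ℕP.≤-refl }
    fold-min x (y ∷ xs) with ih , le ← fold-min x xs with y <ᵇ foldr (λ a b → if a <ᵇ b then a else b) x xs in e
    ... | true = there (here refl) , λ { (here refl) → ℕP.<⇒≤ (ℕP.<-≤-trans (<ᵇ-true y _ e) (le (here refl))) ; (there (here refl)) → ℕP.≤-refl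
          ; (there (there m)) → ℕP.<⇒≤ (ℕP.<-≤-trans (<ᵇ-true y _ e) (le (there m))) }
    ... | false = rot ih , λ { (here refl) → le (here refl) ; (there (here refl)) → <ᵇ-false y _ e ; (there (there m)) → le (there m) }
      where
      rot : ∀ {a} → a ∈ x ∷ xs → a ∈ x ∷ y ∷ xs
      rot (here e) = here e
      rot (there m) = there (there m)

    fold-max : ∀ x xs → let m = foldr (λ a b → if b <ᵇ a then a else b) x xs in (m ∈ x ∷ xs) × (∀ {k} → k ∈ x ∷ xs → k ≤ m)
    fold-max x [] = here refl , λ { (here refl) → ℕP.≤-refl }
    fold-max x (y ∷ xs) with ih , le ← fold-max x xs with foldr (λ a b → if b <ᵇ a then a else b) x xs <ᵇ y in e
    ... | true = there (here refl) , λ { (here refl) → ℕP.<⇒≤ (ℕP.≤-<-trans (le (here refl)) (<ᵇ-true _ y e)) ; (there (here refl)) → ℕP.≤-refl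
          ; (there (there m)) → ℕP.<⇒≤ (ℕP.≤-<-trans (le (there m)) (<ᵇ-true _ y e)) }
    ... | false = rot ih , λ { (here refl) → le (here refl) ; (there (here refl)) → <ᵇ-false _ y e ; (there (there m)) → le (there m) }
      where
      rot : ∀ {a} → a ∈ x ∷ xs → a ∈ x ∷ y ∷ xs
      rot (here e) = here e
      rot (there m) = there (there m)

    atB-base : ∀ k a b → (k < a → atB (replicate a true ++ replicate b false) k ≡ true) × (a ≤ k → atB (replicate a true ++ replicate b false) k ≡ false)
    atB-base k zero zero = (λ ()) , λ _ → refl
    atB-base zero zero (suc b) = (λ ()) , λ _ → refl
    atB-base (suc k) zero (suc b) = (λ ()) , λ _ → proj₂ (atB-base k zero b) z≤n
    atB-base zero (suc a) b = (λ _ → refl) , λ ()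
    atB-base (suc k) (suc a) b = (λ { (s≤s l) → proj₁ (atB-base k a b) l }) , λ { (s≤s l) → proj₂ (atB-base k a b) l }

    applyUpTo-atB : ∀ β → applyUpTo (atB β) (length β) ≡ β
    applyUpTo-atB [] = refl
    applyUpTo-atB (b ∷ β) = cong (b ∷_) (applyUpTo-atB β)

    applyUpTo-cong< : {A : Set} {f g : ℕ → A} → ∀ n → (∀ i → i < n → f i ≡ g i) → applyUpTo f n ≡ applyUpTo g n
    applyUpTo-cong< zero h = refl
    applyUpTo-cong< (suc n) h = cong₂ _∷_ (h 0 z<s) (applyUpTo-cong< n (λ i l → h (suc i) (s≤s l)))

    applyUpTo-const : {A : Set} (c : A) → ∀ n → applyUpTo (λ _ → c) n ≡ replicate n c
    applyUpTo-const c zero = refl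
    applyUpTo-const c (suc n) = cong (c ∷_) (applyUpTo-const c n)

  -- The string `parens u` is a factor of the path: outside the columns from `lo` to `hi` the path
  -- follows `base n z`, except for the ")" and the "(" that border these columns.
  module Slice {n z : ℕ} {mu : Word} {x : ℕ} {u′ : List ℕ} (le : z ≤ n) (b : Built n z (x ∷ u′) mu) where
    u = x ∷ u′
    lo = minL u
    hi = maxL u

    private
      lo∈ : lo ∈ u
      lo∈ = proj₁ (fold-min x u′)
      lo≤ : ∀ {k} → k ∈ u → lo ≤ k
      lo≤ = proj₂ (fold-min x u′)
      hi∈ : hi ∈ u
      hi∈ = proj₁ (fold-max x u′)
      ≤hi : ∀ {k} → k ∈ u → k ≤ hi
      ≤hi = proj₂ (fold-max x u′)
      letter : ∀ {k} → k ∈ u → 1 ≤ k × k < n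
      letter = All.lookup (built-valid le b)

      -- Boxes plus rank in column `k` make min(k, z), and the rank grows by at most one per column.
      -- Left of `z` the number of boxes therefore cannot decrease; `descend` is the mirror image,
      -- and together they show that the columns form an interval around `z`.
      climb : ∀ k → k < z → k ∈ u → suc k ∈ u
      climb k kz m = cn-∈ (suc k) u (ℕP.<-≤-trans (∈-cn k u m) (ℕP.+-cancelʳ-≤ (suc (rank k mu)) _ _ (begin
          cn k u + suc (rank k mu)                ≡⟨ ℕP.+-suc _ _ ⟩
          suc (cn k u + rank k mu)                ≡⟨ cong suc (trans (count-rank b k) (trans (rank-base n z k) (ℕP.m≤n⇒m⊓n≡m (ℕP.<⇒≤ kz)))) ⟩
          suc k                                   ≡⟨ trans (count-rank b (suc k)) (trans (rank-base n z (suc k)) (ℕP.m≤n⇒m⊓n≡m kz)) ⟨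
          cn (suc k) u + rank (suc k) mu          ≤⟨ ℕP.+-monoʳ-≤ (cn (suc k) u) (rank-suc-≤ k mu) ⟩
          cn (suc k) u + suc (rank k mu) ∎)))
        where open ℕP.≤-Reasoning

      descend : ∀ k → z ≤ k → suc k ∈ u → k ∈ u
      descend k zk m = cn-∈ k u (ℕP.<-≤-trans (∈-cn (suc k) u m) (ℕP.+-cancelʳ-≤ (rank k mu) _ _ (begin
          cn (suc k) u + rank k mu                ≤⟨ ℕP.+-monoʳ-≤ (cn (suc k) u) (rank-mono k mu) ⟩
          cn (suc k) u + rank (suc k) mu          ≡⟨ trans (count-rank b (suc k)) (trans (rank-base n z (suc k)) (ℕP.m≥n⇒m⊓n≡n (ℕP.m≤n⇒m≤1+n zk))) ⟩
          z                                       ≡⟨ trans (count-rank b k) (trans (rank-base n z k) (ℕP.m≥n⇒m⊓n≡n zk)) ⟨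
          cn k u + rank k mu ∎)))
        where open ℕP.≤-Reasoning

      lo≤z : lo ≤ z
      lo≤z with lo ≤? z
      ... | yes p = p
      ... | no np = ⊥-elim (go lo refl (ℕP.≰⇒> np))
        where
        go : ∀ a → lo ≡ a → z < a → ⊥
        go (suc a) e (s≤s za) = ℕP.<⇒≱ (subst (a <_) (sym e) (ℕP.n<1+n a)) (lo≤ (descend a za (subst (_∈ u) e lo∈)))

      z≤hi : z ≤ hi
      z≤hi with z ≤? hi
      ... | yes p = p
      ... | no np = ⊥-elim (ℕP.<⇒≱ (ℕP.n<1+n hi) (≤hi (climb hi (ℕP.≰⇒> np) hi∈)))

      up-to-z : ∀ i → lo + i ≤ z → lo + i ∈ u
      up-to-z zero h = subst (_∈ u) (sym (ℕP.+-identityʳ lo)) lo∈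
      up-to-z (suc i) h = subst (_∈ u) (sym (ℕP.+-suc lo i)) (climb (lo + i) (subst (_≤ z) (ℕP.+-suc lo i) h) (up-to-z i (ℕP.≤-trans (ℕP.+-monoʳ-≤ lo (ℕP.n≤1+n i)) h)))

      from-hi : ∀ i k → k + i ≡ hi → z ≤ k → k ∈ u
      from-hi zero k e h = subst (_∈ u) (sym (trans (sym (ℕP.+-identityʳ k)) e)) hi∈
      from-hi (suc i) k e h = descend k h (from-hi i (suc k) (trans (sym (ℕP.+-suc k i)) e) (ℕP.m≤n⇒m≤1+n h))

      present : ∀ k → lo ≤ k → k ≤ hi → k ∈ u
      present k a c with k ≤? z
      ... | yes p = subst (_∈ u) (ℕP.m+[n∸m]≡n a) (up-to-z (k ∸ lo) (subst (_≤ z) (sym (ℕP.m+[n∸m]≡n a)) p))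
      ... | no np = from-hi (hi ∸ k) k (ℕP.m+[n∸m]≡n c) (ℕP.<⇒≤ (ℕP.≰⇒> np))

    lo∸1∉ : lo ∸ 1 ∉ u
    lo∸1∉ m = go lo (proj₁ (letter lo∈)) (lo≤ m)
      where
      go : ∀ a → 1 ≤ a → ¬ (a ≤ a ∸ 1)
      go (suc a) _ h = ℕP.<-irrefl refl h

    suc-hi∉ : suc hi ∉ u
    suc-hi∉ m = ℕP.<-irrefl refl (≤hi m)

    private
      suc-pred : suc (lo ∸ 1) ≡ lo
      suc-pred = go lo (proj₁ (letter lo∈))
        where
        go : ∀ a → 1 ≤ a → suc (a ∸ 1) ≡ a
        go (suc a) _ = refl

      lo≤hi : lo ≤ hi
      lo≤hi = lo≤ hi∈

      p = lo ∸ 1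
      L = hi ∸ lo
      q = n ∸ suc hi

      total : p + suc (L + suc q) ≡ n
      total = begin
        p + suc (L + suc q)       ≡⟨ ℕP.+-suc p _ ⟩
        suc p + (L + suc q)       ≡⟨ cong (_+ (L + suc q)) suc-pred ⟩
        lo + (L + suc q)          ≡⟨ ℕP.+-assoc lo L (suc q) ⟨
        lo + L + suc q            ≡⟨ cong (_+ suc q) (ℕP.m+[n∸m]≡n lo≤hi) ⟩
        hi + suc q                ≡⟨ ℕP.+-suc hi q ⟩
        suc hi + q                ≡⟨ ℕP.m+[n∸m]≡n (proj₂ (letter hi∈)) ⟩
        n ∎
        where open ≡-Reasoning

      idx : ∀ i → p + suc i ≡ lo + i
      idx i = trans (ℕP.+-suc p i) (cong (_+ i) suc-pred)

      idx₂ : ∀ i → p + suc (L + i) ≡ hi + i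
      idx₂ i = trans (idx (L + i)) (trans (sym (ℕP.+-assoc lo L i)) (cong (_+ i) (ℕP.m+[n∸m]≡n lo≤hi)))

      before-lo : ∀ i → i < p → atB mu i ≡ true
      before-lo i l = trans (untouched b i (λ m → ℕP.<⇒≱ (ℕP.<-trans l p<lo) (lo≤ m)) (λ m → ℕP.<⇒≱ (ℕP.≤-<-trans l p<lo) (lo≤ m)))
          (proj₁ (atB-base i z (n ∸ z)) (ℕP.<-≤-trans (ℕP.<-trans l p<lo) lo≤z))
        where
        p<lo : p < lo
        p<lo = ℕP.≤-reflexive suc-pred

      -- Column `lo ∸ 1` has no letter, so `firstIdx` falls back to the length of the word there,
      -- and the comparison in `slope` comes out as ")".
      at-lo : atB mu p ≡ false
      at-lo = trans (sym (slope b p (inj₂ (subst (_∈ u) (sym suc-pred) lo∈)))) (<ᵇ-f (subst₂ _≤_ (cong (λ k → firstIdx k u) (sym suc-pred)) (sym (firstIdx-absent p u lo∸1∉))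
        (ℕP.<⇒≤ (firstIdx-present lo u lo∈))))

      middle : ∀ i → i < L → atB mu (lo + i) ≡ (firstIdx (lo + i) u <ᵇ firstIdx (suc (lo + i)) u)
      middle i l = sym (slope b (lo + i) (inj₁ (present (lo + i) (ℕP.m≤m+n lo i)
        (ℕP.≤-trans (ℕP.+-monoʳ-≤ lo (ℕP.<⇒≤ l)) (ℕP.≤-reflexive (ℕP.m+[n∸m]≡n lo≤hi))))))

      at-hi : atB mu hi ≡ true
      at-hi = trans (sym (slope b hi (inj₁ hi∈))) (<ᵇ-t (subst (firstIdx hi u <_) (sym (firstIdx-absent (suc hi) u suc-hi∉)) (firstIdx-present hi u hi∈)))

      after-hi : ∀ i → atB mu (hi + suc i) ≡ false
      after-hi i = trans (untouched b (hi + suc i) (λ m → ℕP.<⇒≱ (ℕP.m<m+n hi z<s) (≤hi m)) (λ m → ℕP.<⇒≱ (ℕP.m<n⇒m<1+n (ℕP.m<m+n hi z<s)) (≤hi m)))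
        (proj₂ (atB-base (hi + suc i) z (n ∸ z)) (ℕP.≤-trans z≤hi (ℕP.m≤m+n hi (suc i))))

      parens-eq : parens u ≡ applyUpTo (λ i → firstIdx (lo + i) u <ᵇ firstIdx (suc (lo + i)) u) L
      parens-eq = trans (sym (LP.map-∘ (upTo L))) (LP.map-upTo _ L)

    length-parens : lo + length (parens u) ≡ hi
    length-parens = trans (cong (lo +_) (trans (cong length parens-eq) (LP.length-applyUpTo _ L))) (ℕP.m+[n∸m]≡n lo≤hi)

    suc-lo∸1 : suc (lo ∸ 1) ≡ lo
    suc-lo∸1 = suc-pred

    slice : mu ≡ replicate (lo ∸ 1) true ++ false ∷ parens u ++ true ∷ replicate (n ∸ suc hi) false
    slice = begin
      mu                                                       ≡⟨ applyUpTo-atB mu ⟨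
      applyUpTo (atB mu) (length mu)                           ≡⟨ cong (applyUpTo (atB mu)) (trans (proj₁ (built-shape le b)) (sym total)) ⟩
      applyUpTo (atB mu) (p + suc (L + suc q))                 ≡⟨ applyUpTo-++ (atB mu) p (suc (L + suc q)) ⟩
      applyUpTo (atB mu) p ++ atB mu (p + 0) ∷ applyUpTo (λ i → atB mu (p + suc i)) (L + suc q)
        ≡⟨ cong₂ (λ X Y → X ++ atB mu (p + 0) ∷ Y) (trans (applyUpTo-cong< p before-lo) (applyUpTo-const true p)) (applyUpTo-++ _ L (suc q)) ⟩
      replicate p true ++ atB mu (p + 0) ∷ applyUpTo (λ i → atB mu (p + suc i)) L ++ atB mu (p + suc (L + 0)) ∷ applyUpTo (λ i → atB mu (p + suc (L + suc i))) q
        ≡⟨ cong (replicate p true ++_) (cong₂ _∷_ (trans (cong (atB mu) (ℕP.+-identityʳ p)) at-lo) (cong₂ _++_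
             (trans (applyUpTo-cong< L (λ i l → trans (cong (atB mu) (idx i)) (middle i l))) (sym parens-eq))
             (cong₂ _∷_ (trans (cong (atB mu) (trans (idx₂ 0) (ℕP.+-identityʳ hi))) at-hi)
               (trans (applyUpTo-cong (λ i → trans (cong (atB mu) (idx₂ (suc i))) (after-hi i)) q) (applyUpTo-const false q))))) ⟩
      replicate p true ++ false ∷ parens u ++ true ∷ replicate q false ∎
      where open ≡-Reasoning

-- Comparison of the two coefficient sums

open import Data.Nat as ℕ using (suc; z≤n; s≤s; _≤_; _<_; _≤ᵇ_; _≡ᵇ_; _∸_)
open import Data.Nat.ListAction using (sum)
open import Data.Integer using (+_; -_; 0ℤ; _+_; _-_)
open import Data.Integer.Solver using (module +-*-Solver)
open LaurentCoefficients
open Permutations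
open Words
open HeckeOperators using (desc; rmulʳ)
open CosetPaths
open TensorPowers
open KLVectors using (KL-vector)
open BruhatOrder using (Le; rank; Dom; dom⇒Le)
open Boxes
open Masks
open Runs
open Labelings

private
  sumZ-filterᵇ : {A : Set} (p : A → Bool) (g : A → ℤ) → ∀ xs → sumZ g (filterᵇ p xs) ≡ sumZ (λ x → if p x then g x else 0ℤ) xs
  sumZ-filterᵇ p g [] = refl
  sumZ-filterᵇ p g (x ∷ xs) with p x
  ... | true = cong (λ k → g x + k) (sumZ-filterᵇ p g xs)
  ... | false = trans (sumZ-filterᵇ p g xs) (sym (ℤP.+-identityˡ _))

-- The factor q^(ℓ(x(t))/2) cancels against the normalisation of B'_x(t). Up to the common power of
-- q, a labeling contributes the single monomial q^|t| at every y ≤ x(t).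
rhs-coefs : ∀ n z w vw y e → coefL (rhs n z w vw y) e ≡
  sumZ (λ t → if validLab vw t then (if bruhat y (xOf n z vw t) then δ (e + + len w) (+ (2 ℕ.* sum t)) else 0ℤ) else 0ℤ)
       (labelings (length (pairsT vw)) (length vw))
rhs-coefs n z w vw y e = begin
  coefL (rhs n z w vw y) e
    ≡⟨ coefL-mono* (- (+ len w)) (sumH (map term (Aw vw)) y) e ⟩
  coefL (sumH (map term (Aw vw)) y) (e - - (+ len w))
    ≡⟨ cong (λ k → coefL (sumH (map term (Aw vw)) y) (e + k)) (ℤP.neg-involutive (+ len w)) ⟩
  coefL (sumH (map term (Aw vw)) y) e′
    ≡⟨ trans (coefL-concatMap (λ h → h y) (map term (Aw vw)) e′) (sumZ-map _ term (Aw vw)) ⟩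
  sumZ (λ t → coefL (term t y) e′) (Aw vw)
    ≡⟨ sumZ-cong one (Aw vw) ⟩
  sumZ (λ t → if bruhat y (xOf n z vw t) then δ e′ (+ (2 ℕ.* sum t)) else 0ℤ) (Aw vw)
    ≡⟨ sumZ-filterᵇ (validLab vw) _ (labelings (length (pairsT vw)) (length vw)) ⟩
  sumZ (λ t → if validLab vw t then (if bruhat y (xOf n z vw t) then δ e′ (+ (2 ℕ.* sum t)) else 0ℤ) else 0ℤ) (labelings (length (pairsT vw)) (length vw)) ∎
  where
  open ≡-Reasoning
  e′ = e + + len w
  term : List ℕ → Hk
  term t = scaleH (monoL (+ (2 ℕ.* sum t ℕ.+ len (xOf n z vw t)))) (Bprime (xOf n z vw t))
  one : ∀ t → coefL (term t y) e′ ≡ (if bruhat y (xOf n z vw t) then δ e′ (+ (2 ℕ.* sum t)) else 0ℤ)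
  one t = trans (coefL-mono* (+ (2 ℕ.* sum t ℕ.+ len x)) (Bprime x y) e′) go
    where
    x = xOf n z vw t
    s = 2 ℕ.* sum t
    go : coefL (Bprime x y) (e′ - + (s ℕ.+ len x)) ≡ (if bruhat y x then δ e′ (+ s) else 0ℤ)
    go with bruhat y x
    ... | false = refl
    ... | true = trans (coefL-pairing (monoL (- (+ len x))) (e′ - + (s ℕ.+ len x))) (trans (pairing-mono (- (+ len x)) (δ (e′ - + (s ℕ.+ len x))))
          (δ-inj {e′ - + (s ℕ.+ len x)} { - (+ len x)} {e′} {+ s}
            (λ q → trans (solve 2 (λ a b → a := (a :- b) :+ b) refl e′ (+ (s ℕ.+ len x))) (trans (cong (_+ + (s ℕ.+ len x)) q)
               (trans (cong (λ k → - (+ len x) + k) (ℤP.pos-+ s (len x))) (solve 2 (λ s l → :- l :+ (s :+ l) := s) refl (+ s) (+ len x)))))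
            (λ q → trans (cong₂ _-_ q (ℤP.pos-+ s (len x))) (solve 2 (λ s l → s :- (s :+ l) := :- l) refl (+ s) (+ len x)))))
      where open +-*-Solver

module Assembly {n z : ℕ} (zn : z < n) {vw : List ℕ} {lam : Word} (b : Built n z vw lam) where

  private
    le : z ≤ n
    le = ℕP.<⇒≤ zn
    sλ = built-shape le b
    Bd = length vw
    PL : List ℕ → List ((ℕ × ℕ) × ℕ)
    PL t = zip (pairsT vw) t

  module _ {y : Perm} (py : IsPerm n y) where
    private
      β = path z n y
      sβ = path-shape {z} py le

      module _ (l : Le 0 lam β) where

        -- No path goes below `base n z`, so the gap is at most the number of boxes of λ in the
        -- column. This makes the capacity bound a consequence of the gap bound.
        gap-cn : ∀ k → gap l k ≤ cn k vw
        gap-cn k = ℕP.+-cancelʳ-≤ (rank k lam) _ _ (ℕP.≤-trans (ℕP.≤-reflexive (trans (gap-rank l k) (ℕP.+-identityʳ _)))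
          (ℕP.≤-trans (rank-≤-base β (proj₂ sβ) k) (ℕP.≤-reflexive (sym (count-rank b k)))))

        gap-0 : ∀ k → k ∉ vw → gap l k ≡ 0
        gap-0 k ne = ℕP.n≤0⇒n≡0 (subst (gap l k ≤_) (∉-cn k vw ne) (gap-cn k))

        gap-≤ : ∀ k → gap l k ≤ Bd
        gap-≤ k = ℕP.≤-trans (gap-cn k) (cn-≤ vw)
          where
          cn-≤ : ∀ u → cn k u ≤ length u
          cn-≤ [] = z≤n
          cn-≤ (x ∷ u) with x ≡ᵇ k
          ... | true = s≤s (cn-≤ u)
          ... | false = ℕP.m≤n⇒m≤1+n (cn-≤ u)

        open LeafRun Bd
        open Checks Bd

        κ : ℕ → ℕ
        κ k = gap l (minL vw ℕ.+ k)

        -- Pairs of λ outside the string `parens vw` are leaves or enclose leaves in columns without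
        -- letters. The gap is 0 there, so they carry the label 0 and drop out.
        to-slice : ∀ φ → leafRun (gap l) false [] lam φ ≡ leafRun κ false [] (parens vw) φ
        to-slice φ = go vw b refl gap-0
          where
          go : ∀ u → Built n z u lam → u ≡ vw → (∀ k → k ∉ u → gap l k ≡ 0) →
            leafRun (gap l) false [] lam φ ≡ leafRun (λ k → gap l (minL u ℕ.+ k)) false [] (parens u) φ
          -- For trivial v the path is `base n z`, with its only leaf in column `z`, where the gap
          -- is 0 as well.
          go [] empty _ g = trans (cong (λ q → leafRun (gap l) false [] (replicate z true ++ replicate q false) φ) n∸z)
              (leafRun-base (gap l) z (n ∸ suc z) φ (g z (λ ())))
            where
            n∸z : n ∸ z ≡ suc (n ∸ suc z)
            n∸z = trans (ℕP.+-∸-assoc 1 zn) refl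
          go u@(_ ∷ _) bu _ g with c , e ← leafRun-prefix (gap l) (minL u ∸ 1) (parens u ++ true ∷ replicate (n ∸ suc (maxL u)) false) φ (g _ (Slice.lo∸1∉ le bu)) =
              trans (cong (λ γ → leafRun (gap l) false [] γ φ) slice) (trans e
                (trans (leafRun-≗ false (replicate c 0) (parens u ++ true ∷ replicate (n ∸ suc (maxL u)) false) φ (λ k → cong (λ a → gap l (a ℕ.+ k)) suc-lo∸1))
                  (leafRun-slice (λ k → gap l (minL u ℕ.+ k)) false [] c (parens u) (n ∸ suc (maxL u)) φ
                    (trans (cong (gap l) (trans (ℕP.+-suc (minL u) _) (cong suc length-parens))) (g _ suc-hi∉)))))
            where open Slice le bu hiding (u)

        -- Admissibility and the Bruhat condition together demand monotone labels with every leaf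
        -- label at most the gap in its valley column; the capacity bound then follows from
        -- `gap-cn`.
        term-eq : ∀ t → t ∈ labelings (length (pairsT vw)) Bd → ∀ x →
          (if validLab vw t then (if bruhat y (xOf n z vw t) then x else 0ℤ) else 0ℤ) ≡
          (if checks κ false [] (parens vw) t then x else 0ℤ)
        term-eq t mt x with lt , at ← labelings-∈ (length (pairsT vw)) Bd mt = trans (sym (if-and (validLab vw t) (bruhat y (xOf n z vw t))))
            (cong (λ c → if c then x else 0ℤ) (iff-Bool to from))
          where
          if-and : ∀ a c → (if a ∧ c then x else 0ℤ) ≡ (if a then (if c then x else 0ℤ) else 0ℤ)
          if-and true c = refl
          if-and false c = refl
          spec = checks-spec κ false 0 [] [] (parens vw) t
            (record { decreasing = [] ; below = [] ; adjacent = λ () ; apart = λ _ () }) refl at lt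
          MonoTest LeafTest : (ℕ × ℕ) × ℕ → Bool
          MonoTest pm = allᵇ (λ pm′ → not (encloses (proj₁ pm) (proj₁ pm′)) ∨ (proj₂ pm ≤ᵇ proj₂ pm′)) (PL t)
          LeafTest pm = not (isValley (proj₁ pm)) ∨ (proj₂ pm ≤ᵇ capacity vw (proj₁ pm))
          column : ∀ p → isValley p ≡ true → minL vw ℕ.+ proj₂ p ≡ valleyCol vw p
          column p v = cong (minL vw ℕ.+_) (≡ᵇ-true (proj₂ p) (suc (proj₁ p)) v)
          to : validLab vw t ∧ bruhat y (xOf n z vw t) ≡ true → checks κ false [] (parens vw) t ≡ true
          to e with va , br ← ∧-true (validLab vw t) _ e with _ , va′ ← ∧-true (length t ≡ᵇ length (pairsT vw)) _ va
            with mo , lf ← ∧-true (allᵇ MonoTest (PL t)) (allᵇ LeafTest (PL t)) va′ = proj₂ spec (record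
              { bounded = λ _ ()
              ; monotone = λ {p} {m} {p′} {m′} i j en → ≤ᵇ-true m m′ (implies-true (encloses p p′) _ (allᵇ-true _ (PL t) (allᵇ-true MonoTest (PL t) mo i) j) en)
              ; leaves = λ {p} {m} i v → ℕP.+-cancelʳ-≤ (rank (valleyCol vw p) lam) _ _ (ℕP.≤-trans (proj₂ bx i v)
                  (ℕP.≤-reflexive (trans (sym (trans (gap-rank l (valleyCol vw p)) (ℕP.+-identityʳ _)))
                    (cong (λ k → gap l k ℕ.+ rank (valleyCol vw p) lam) (sym (column p v)))))) })
            where
            cap′ : ∀ {pm} → pm ∈ PL t → isValley (proj₁ pm) ≡ true → proj₂ pm ≤ capacity vw (proj₁ pm)
            cap′ {pm} i v = ≤ᵇ-true (proj₂ pm) _ (implies-true (isValley (proj₁ pm)) _ (allᵇ-true LeafTest (PL t) lf i) v)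
            bx = bruhat-xOf⇒ le b t cap′ {y} py br
          from : checks κ false [] (parens vw) t ≡ true → validLab vw t ∧ bruhat y (xOf n z vw t) ≡ true
          from c = cong₂ _∧_ (cong₂ _∧_ (trans (cong (_≡ᵇ length (pairsT vw)) lt) (≡ᵇ-refl (length (pairsT vw))))
              (cong₂ _∧_ (true-allᵇ MonoTest (PL t) (λ {pm} i → true-allᵇ _ (PL t) (λ {pm′} j → true-implies (encloses (proj₁ pm) (proj₁ pm′)) _ (λ en → ≤ᵇ-t (monotone i j en)))))
                (true-allᵇ LeafTest (PL t) (λ {pm} i → true-implies (isValley (proj₁ pm)) _ (λ v → ≤ᵇ-t (cap′ i v))))))
              (⇒bruhat-xOf le b t cap′ {y} py dom valley)
            where
            open Good (proj₁ spec c)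
            leaf : ∀ {pm} → pm ∈ PL t → isValley (proj₁ pm) ≡ true → proj₂ pm ≤ gap l (valleyCol vw (proj₁ pm))
            leaf {pm} i v = subst (λ k → proj₂ pm ≤ gap l k) (column (proj₁ pm) v) (leaves i v)
            cap′ : ∀ {pm} → pm ∈ PL t → isValley (proj₁ pm) ≡ true → proj₂ pm ≤ capacity vw (proj₁ pm)
            cap′ {pm} i v = ℕP.≤-trans (leaf i v) (gap-cn (valleyCol vw (proj₁ pm)))
            dom : Dom lam β
            dom k = ℕP.≤-trans (ℕP.m≤n+m (rank k lam) (gap l k)) (ℕP.≤-reflexive (trans (gap-rank l k) (ℕP.+-identityʳ _)))
            valley : ∀ {pm} → pm ∈ PL t → isValley (proj₁ pm) ≡ true → proj₂ pm ℕ.+ rank (valleyCol vw (proj₁ pm)) lam ≤ rank (valleyCol vw (proj₁ pm)) β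
            valley {pm} i v = ℕP.≤-trans (ℕP.+-monoˡ-≤ (rank (valleyCol vw (proj₁ pm)) lam) (leaf i v))
              (ℕP.≤-reflexive (trans (gap-rank l (valleyCol vw (proj₁ pm))) (ℕP.+-identityʳ _)))

        main-≤ : ∀ e → N lam β (e + + height β) ≡
          sumZ (λ t → if validLab vw t then (if bruhat y (xOf n z vw t) then δ (e + + height lam) (+ (2 ℕ.* sum t)) else 0ℤ) else 0ℤ)
            (labelings (length (pairsT vw)) Bd)
        main-≤ e = begin
          run 0 [] lam β (δ (e + + height β))
            ≡⟨ run-leafRun l false [] (δ (e + + height β)) gap-≤ ⟩
          leafRun (gap l) false [] lam (λ k → δ (e + + height β) (- + area l + k))
            ≡⟨ leafRun-cong (gap l) false [] lam shift ⟩
          leafRun (gap l) false [] lam (δ (e + + height lam))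
            ≡⟨ to-slice (δ (e + + height lam)) ⟩
          leafRun κ false [] (parens vw) (δ (e + + height lam))
            ≡⟨ leafRun-labelings κ false 0 [] [] (parens vw) (δ (e + + height lam)) refl [] ⟩
          sumZ (λ t → if checks κ false [] (parens vw) t then δ (e + + height lam) (+ (2 ℕ.* sum t)) else 0ℤ) (labelings (length (pairsT vw)) Bd)
            ≡⟨ sumZ-∈-cong (labelings (length (pairsT vw)) Bd) (λ t mt → sym (term-eq t mt (δ (e + + height lam) (+ (2 ℕ.* sum t))))) ⟩
          sumZ (λ t → if validLab vw t then (if bruhat y (xOf n z vw t) then δ (e + + height lam) (+ (2 ℕ.* sum t)) else 0ℤ) else 0ℤ)
            (labelings (length (pairsT vw)) Bd) ∎
          where
          open ≡-Reasoning
          open +-*-Solver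
          hl : + height lam ≡ + area l + + height β
          hl = trans (cong +_ (height-area l sλ sβ)) (ℤP.pos-+ (area l) (height β))
          -- The columns contribute minus the area, which is the difference of the heights. This
          -- replaces the rescaling at β by the one at λ, that is, by ℓ(w).
          shift : ∀ k → δ (e + + height β) (- + area l + k) ≡ δ (e + + height lam) k
          shift k = δ-inj {e + + height β} { - + area l + k} {e + + height lam} {k}
            (λ q → trans (cong (λ h → e + h) hl) (trans (solve 3 (λ e a h → e :+ (a :+ h) := a :+ (e :+ h)) refl e (+ area l) (+ height β))
               (trans (cong (λ x → + area l + x) q) (solve 2 (λ a k → a :+ (:- a :+ k) := k) refl (+ area l) k))))
            (λ q → trans (solve 3 (λ e a h → e :+ h := :- a :+ (e :+ (a :+ h))) refl e (+ area l) (+ height β))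
               (cong (λ x → - + area l + x) (trans (cong (λ h → e + h) (sym hl)) q)))

    -- If the path of `y` is not below λ, both sides are zero: the run breaks off, and every x(t)
    -- has its path below λ.
    tree-sum : ∀ e → N lam β (e + + height β) ≡
      sumZ (λ t → if validLab vw t then (if bruhat y (xOf n z vw t) then δ (e + + height lam) (+ (2 ℕ.* sum t)) else 0ℤ) else 0ℤ)
        (labelings (length (pairsT vw)) Bd)
    tree-sum e with le-or-zero 0 lam β (trans (proj₁ sλ) (sym (proj₁ sβ))) (trans (proj₂ sλ) (trans (sym (proj₂ sβ)) (sym (ℕP.+-identityʳ _))))
    ... | inj₁ l = main-≤ l e
    ... | inj₂ (nl , zero′) = trans (zero′ [] (δ (e + + height β))) (sym (sumZ-0 none (labelings (length (pairsT vw)) Bd)))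
      where
      none : ∀ t → (if validLab vw t then (if bruhat y (xOf n z vw t) then δ (e + + height lam) (+ (2 ℕ.* sum t)) else 0ℤ) else 0ℤ) ≡ 0ℤ
      none t with validLab vw t in va | bruhat y (xOf n z vw t) in br
      ... | false | _ = refl
      ... | true | false = refl
      ... | true | true = ⊥-elim (nl (dom⇒Le 0 lam β (trans (proj₁ sλ) (sym (proj₁ sβ))) (trans (proj₂ sλ) (trans (sym (proj₂ sβ)) (sym (ℕP.+-identityʳ _))))
            (λ k → ℕP.≤-trans (proj₁ (bruhat-xOf⇒ le b t cap′ {y} py br) k) (ℕP.≤-reflexive (sym (ℕP.+-identityʳ _))))))
        where
        LeafTest : (ℕ × ℕ) × ℕ → Bool
        LeafTest pm = not (isValley (proj₁ pm)) ∨ (proj₂ pm ≤ᵇ capacity vw (proj₁ pm))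
        lf : allᵇ LeafTest (PL t) ≡ true
        lf = proj₂ (∧-true (allᵇ (λ pm → allᵇ (λ pm′ → not (encloses (proj₁ pm) (proj₁ pm′)) ∨ (proj₂ pm ≤ᵇ proj₂ pm′)) (PL t)) (PL t)) _
          (proj₂ (∧-true (length t ≡ᵇ length (pairsT vw)) _ va)))
        cap′ : ∀ {pm} → pm ∈ PL t → isValley (proj₁ pm) ≡ true → proj₂ pm ≤ capacity vw (proj₁ pm)
        cap′ {pm} i v = ≤ᵇ-true (proj₂ pm) _ (implies-true (isValley (proj₁ pm)) _ (allᵇ-true LeafTest (PL t) lf i) v)

theorem4p2 : (n : ℕ) (w : Perm) (z : ℕ) → IsPerm n w → Cograssmannian n w z →
    (vw : List ℕ) → ReducedWordOf n vw (vOf n z w) →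
    (P : Perm → List ℤ) → IsKL n w P →
    HEq n (Cform w P) (rhs n z w vw)
theorem4p2 n w z pw (_ , zn , _ , only) vw (letters , ev , lenv) P kl y py e = begin
  coefL (Cform w P y) e                                  ≡⟨ KL-vector {P = P} le pw kl descents y py e ⟩
  N lam (path z n y) (e + + height (path z n y))         ≡⟨ Assembly.tree-sum zn built py e ⟩
  sumZ (λ t → if validLab vw t then (if bruhat y (xOf n z vw t) then δ (e + + height lam) (+ (2 ℕ.* sum t)) else 0ℤ) else 0ℤ) L
    ≡⟨ cong (λ h → sumZ (λ t → if validLab vw t then (if bruhat y (xOf n z vw t) then δ (e + + len h) (+ (2 ℕ.* sum t)) else 0ℤ) else 0ℤ) L) (sym w≡) ⟩
  sumZ (λ t → if validLab vw t then (if bruhat y (xOf n z vw t) then δ (e + + len w) (+ (2 ℕ.* sum t)) else 0ℤ) else 0ℤ) L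
    ≡⟨ rhs-coefs n z w vw y e ⟨
  coefL (rhs n z w vw y) e ∎
  where
  open ≡-Reasoning
  L = labelings (length (pairsT vw)) (length vw)
  le : z ≤ n
  le = ℕP.<⇒≤ zn
  lam = path z n w
  sλ = path-shape {z} pw le
  descents : ∀ j → suc j < n → suc j ≢ z → desc (rmulʳ (suc j)) w ≡ true
  descents j lt ne with dr-dec j pw lt
  ... | inj₁ (d , _) = d
  ... | inj₂ (_ , q) = ⊥-elim (only (suc j) (s≤s z≤n) lt ne (ℕP.≤-reflexive (sym q)))
  w≡ : w ≡ maxrep lam
  w≡ = no-ascent⇒maxrep {z} pw (λ j lt ne → <ᵇ-true _ _ (trans (sym (dr-at j pw lt)) (descents j lt ne)))
  v≡ : vOf n z w ≡ minrep lam
  v≡ = trans (cong (vOf n z) w≡) (vOf-minrep lam le sλ)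
  valid : Valid n vw
  valid = All.tabulate (λ {i} m → let a , c = ∧-true (1 ≤ᵇ i) _ (allᵇ-true _ vw letters m) in ≤ᵇ-true 1 i a , <ᵇ-true i n c)
  built : Built n z vw lam
  built = reduced⇒built vw lam le valid sλ (trans ev v≡) (trans lenv (cong len v≡))
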